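{- Let $n\ge 3$, let $A$ be the adjacency matrix of the cycle $C_n$, and let $k\in\mathbb N^+$. PST under $A^k$ between distinct vertices $a,b$ of $C_n$ occurs if and only if either $n=4$ and $a,b$ are antipodal (with $k\in\mathbb N^+$ arbitrary), or $n=8$, $a,b$ are antipodal, and $k$ is even. The minimum positive transfer times are $\pi/2^k$ for $C_4$, and $\pi/2^q$ for $C_8$ when $k=2q$.
   Context: $\mathbb N^+=\{1,2,3,\ldots\}$. $C_n$ is the cycle on $n$ vertices; for even $n$, two vertices are antipodal if they are at distance $n/2$. A real symmetric matrix $K$ indexed by a finite vertex set has perfect state transfer (PST) from vertex $a$ to vertex $b$ at time $\tau>0$ (a transfer time) if $\exp(-\mathrm i\tau K)e_a=\gamma e_b$ for some $\gamma\in\mathbb C$ with $|\gamma|=1$, where $e_v$ is the standard basis vector indexed by $v$; PST under $K$ between $a$ and $b$ occurs if this holds for some $\tau>0$. -}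

module Defs where

open import Algebra.Bundles.Raw using (RawRing)
open import Data.Bool.Base using (if_then_else_)
open import Data.Fin.Base using (Fin; toℕ)
open import Data.Fin.Properties using () renaming (_≟_ to _≟ᶠ_)
open import Data.Integer.Base using (+_)
open import Data.Nat.Base as ℕ using (ℕ; zero; suc; _!)
import Data.Nat.Properties as ℕ
open import Data.Product.Base using (∃; ∃-syntax; _×_; _,_)
open import Data.Rational.Base as ℚ
  using (ℚ; 0ℚ; 1ℚ; ½; _+_; _*_; _-_; -_; ∣_∣; _<_; _≤_; _/_)
open import Data.Rational.Properties as ℚ using (module ≤-Reasoning)
open import Data.Rational.Solver using (module +-*-Solver)
open import Data.Sum.Base using (_⊎_)
open import Data.Vec.Functional using (Vector)
open import Level using (0ℓ)
open import Relation.Binary.PropositionalEquality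
  using (_≡_; refl; sym; trans; cong; cong₂; subst)
open import Relation.Nullary.Decidable using (Dec; does; _⊎-dec_; _×-dec_)
open import Relation.Nullary.Negation using (¬_)
import Algebra.Definitions.RawSemiring as SemiringOps

-- Real numbers are Cauchy sequences of rationals, compared up to _≈ᴿ_; the
-- Cauchy condition and the strict order carry their witnesses.

Eventually : (ℕ → Set) → Set
Eventually P = ∃[ N ] (∀ m → N ℕ.≤ m → P m)

IsCauchy : (ℕ → ℚ) → Set
IsCauchy x = ∀ ε → 0ℚ < ε →
  ∃[ N ] (∀ m n → N ℕ.≤ m → N ℕ.≤ n → ∣ x m - x n ∣ < ε)

record ℝ : Set where
  constructor mkℝ
  field
    seq    : ℕ → ℚ
    cauchy : IsCauchy seq
open ℝ public

private
  +-lemma : ∀ a b c d → (a + b) - (c + d) ≡ (a - c) + (b - d)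
  +-lemma = solve 4 (λ a b c d → (a :+ b) :- (c :+ d) := (a :- c) :+ (b :- d)) refl
    where open +-*-Solver

  *-lemma : ∀ a b c d → a * b - c * d ≡ a * (b - d) + d * (a - c)
  *-lemma = solve 4 (λ a b c d → a :* b :- c :* d := a :* (b :- d) :+ d :* (a :- c)) refl
    where open +-*-Solver

  neg-lemma : ∀ a b → (- a) - (- b) ≡ - (a - b)
  neg-lemma = solve 2 (λ a b → (:- a) :- (:- b) := :- (a :- b)) refl
    where open +-*-Solver

  split-lemma : ∀ a b → a ≡ (a - b) + b
  split-lemma = solve 2 (λ a b → a := (a :- b) :+ b) refl
    where open +-*-Solver

  half+half : ∀ ε → ½ * ε + ½ * ε ≡ ε
  half+half ε = trans (sym (ℚ.*-distribʳ-+ ε ½ ½)) (ℚ.*-identityˡ ε)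

  half-pos : ∀ {ε} → 0ℚ < ε → 0ℚ < ½ * ε
  half-pos {ε} 0<ε = subst (_< ½ * ε) (ℚ.*-zeroʳ ½) (ℚ.*-monoʳ-<-pos ½ 0<ε)

  eventuallyBounded : ∀ {x} → IsCauchy x →
    ∃[ B ] (0ℚ < B × ∃[ N ] (∀ m → N ℕ.≤ m → ∣ x m ∣ ≤ B))
  eventuallyBounded {x} c with c 1ℚ (ℚ.positive⁻¹ 1ℚ)
  ... | N , h = 1ℚ + ∣ x N ∣
              , ℚ.+-mono-<-≤ (ℚ.positive⁻¹ 1ℚ) (ℚ.0≤∣p∣ (x N))
              , N , λ m N≤m → begin
      ∣ x m ∣                   ≡⟨ cong ∣_∣ (split-lemma (x m) (x N)) ⟩
      ∣ (x m - x N) + x N ∣     ≤⟨ ℚ.∣p+q∣≤∣p∣+∣q∣ (x m - x N) (x N) ⟩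
      ∣ x m - x N ∣ + ∣ x N ∣   ≤⟨ ℚ.+-monoˡ-≤ ∣ x N ∣ (ℚ.<⇒≤ (h m N N≤m ℕ.≤-refl)) ⟩
      1ℚ + ∣ x N ∣              ∎
    where open ≤-Reasoning

  scaleDown : ∀ B ε → 0ℚ < B → 0ℚ < ε → ∃[ δ ] (0ℚ < δ × B * δ ≡ ½ * ε)
  scaleDown B ε 0<B 0<ε = ℚ.1/ B * (½ * ε) , pos , eq
    where
    instance
      B-pos : ℚ.Positive B
      B-pos = ℚ.positive 0<B
      B-nonZero : ℚ.NonZero B
      B-nonZero = ℚ.pos⇒nonZero B
      1/B-pos : ℚ.Positive (ℚ.1/ B)
      1/B-pos = ℚ.1/pos⇒pos B
    pos : 0ℚ < ℚ.1/ B * (½ * ε)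
    pos = subst (_< ℚ.1/ B * (½ * ε)) (ℚ.*-zeroʳ (ℚ.1/ B))
            (ℚ.*-monoʳ-<-pos (ℚ.1/ B) (half-pos 0<ε))
    eq : B * (ℚ.1/ B * (½ * ε)) ≡ ½ * ε
    eq = trans (sym (ℚ.*-assoc B (ℚ.1/ B) (½ * ε)))
           (trans (cong (_* (½ * ε)) (ℚ.*-inverseʳ B)) (ℚ.*-identityˡ (½ * ε)))

  bound : ∀ {B δ} u v → 0ℚ < B → ∣ u ∣ ≤ B → ∣ v ∣ < δ → ∣ u * v ∣ < B * δ
  bound {B} {δ} u v 0<B u≤B v<δ = begin-strict
    ∣ u * v ∣         ≡⟨ ℚ.∣p*q∣≡∣p∣*∣q∣ u v ⟩
    ∣ u ∣ * ∣ v ∣     ≤⟨ ℚ.*-monoʳ-≤-nonNeg ∣ v ∣ {{ℚ.∣-∣-nonNeg v}} u≤B ⟩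
    B * ∣ v ∣         <⟨ ℚ.*-monoʳ-<-pos B {{ℚ.positive 0<B}} v<δ ⟩
    B * δ             ∎
    where open ≤-Reasoning

  product-close : ∀ {B C δ η ε} a b c d → 0ℚ < B → 0ℚ < C →
    B * δ ≡ ½ * ε → C * η ≡ ½ * ε →
    ∣ a ∣ ≤ B → ∣ b - d ∣ < δ → ∣ d ∣ ≤ C → ∣ a - c ∣ < η →
    ∣ a * b - c * d ∣ < ε
  product-close {B} {C} {δ} {η} {ε} a b c d 0<B 0<C Bδ Cη a≤B bd d≤C ac = begin-strict
    ∣ a * b - c * d ∣                   ≡⟨ cong ∣_∣ (*-lemma a b c d) ⟩
    ∣ a * (b - d) + d * (a - c) ∣       ≤⟨ ℚ.∣p+q∣≤∣p∣+∣q∣ (a * (b - d)) (d * (a - c)) ⟩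
    ∣ a * (b - d) ∣ + ∣ d * (a - c) ∣   <⟨ ℚ.+-mono-< (bound a (b - d) 0<B a≤B bd)
                                                     (bound d (a - c) 0<C d≤C ac) ⟩
    B * δ + C * η                       ≡⟨ cong₂ _+_ Bδ Cη ⟩
    ½ * ε + ½ * ε                       ≡⟨ half+half ε ⟩
    ε                                   ∎
    where open ≤-Reasoning

abstract
  const-cauchy : ∀ q → IsCauchy (λ _ → q)
  const-cauchy q ε 0<ε = 0 , λ _ _ _ _ →
    subst (_< ε) (sym (cong ∣_∣ (ℚ.+-inverseʳ q))) 0<ε

  neg-cauchy : ∀ {x} → IsCauchy x → IsCauchy (λ n → - x n)
  neg-cauchy {x} c ε 0<ε with c ε 0<ε
  ... | N , h = N , λ m n N≤m N≤n →
    subst (_< ε)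
      (sym (trans (cong ∣_∣ (neg-lemma (x m) (x n))) (ℚ.∣-p∣≡∣p∣ (x m - x n))))
      (h m n N≤m N≤n)

  +-cauchy : ∀ {x y} → IsCauchy x → IsCauchy y → IsCauchy (λ n → x n + y n)
  +-cauchy {x} {y} c d ε 0<ε with c (½ * ε) (half-pos 0<ε) | d (½ * ε) (half-pos 0<ε)
  ... | M , h | N , k = M ℕ.⊔ N , λ m n p q → begin-strict
      ∣ (x m + y m) - (x n + y n) ∣   ≡⟨ cong ∣_∣ (+-lemma (x m) (y m) (x n) (y n)) ⟩
      ∣ (x m - x n) + (y m - y n) ∣   ≤⟨ ℚ.∣p+q∣≤∣p∣+∣q∣ (x m - x n) (y m - y n) ⟩
      ∣ x m - x n ∣ + ∣ y m - y n ∣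
        <⟨ ℚ.+-mono-< (h m n (ℕ.m⊔n≤o⇒m≤o M N p) (ℕ.m⊔n≤o⇒m≤o M N q))
                      (k m n (ℕ.m⊔n≤o⇒n≤o M N p) (ℕ.m⊔n≤o⇒n≤o M N q)) ⟩
      ½ * ε + ½ * ε                   ≡⟨ half+half ε ⟩
      ε                               ∎
    where open ≤-Reasoning

  *-cauchy : ∀ {x y} → IsCauchy x → IsCauchy y → IsCauchy (λ n → x n * y n)
  *-cauchy {x} {y} c d ε 0<ε =
    let B , 0<B , M , b  = eventuallyBounded c
        C , 0<C , N , b′ = eventuallyBounded d
        δ , 0<δ , Bδ     = scaleDown B ε 0<B 0<ε
        η , 0<η , Cη     = scaleDown C ε 0<C 0<ε
        P , h            = d δ 0<δ
        Q , k            = c η 0<η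
    in (M ℕ.⊔ N) ℕ.⊔ (P ℕ.⊔ Q) , λ m n p q →
      let p₁ = ℕ.m⊔n≤o⇒m≤o (M ℕ.⊔ N) (P ℕ.⊔ Q) p
          p₂ = ℕ.m⊔n≤o⇒n≤o (M ℕ.⊔ N) (P ℕ.⊔ Q) p
          q₁ = ℕ.m⊔n≤o⇒m≤o (M ℕ.⊔ N) (P ℕ.⊔ Q) q
          q₂ = ℕ.m⊔n≤o⇒n≤o (M ℕ.⊔ N) (P ℕ.⊔ Q) q
      in product-close (x m) (y m) (x n) (y n) 0<B 0<C Bδ Cη
           (b m (ℕ.m⊔n≤o⇒m≤o M N p₁))
           (h m n (ℕ.m⊔n≤o⇒m≤o P Q p₂) (ℕ.m⊔n≤o⇒m≤o P Q q₂))
           (b′ n (ℕ.m⊔n≤o⇒n≤o M N q₁))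
           (k m n (ℕ.m⊔n≤o⇒n≤o P Q p₂) (ℕ.m⊔n≤o⇒n≤o P Q q₂))

fromℚ : ℚ → ℝ
fromℚ q = mkℝ (λ _ → q) (const-cauchy q)

0ᴿ 1ᴿ : ℝ
0ᴿ = fromℚ 0ℚ
1ᴿ = fromℚ 1ℚ

infix  8 -ᴿ_
infixl 7 _*ᴿ_
infixl 6 _+ᴿ_ _-ᴿ_
infix  4 _≈ᴿ_ _<ᴿ_ _≤ᴿ_

_+ᴿ_ _*ᴿ_ : ℝ → ℝ → ℝ
x +ᴿ y = mkℝ (λ n → seq x n + seq y n) (+-cauchy {seq x} {seq y} (cauchy x) (cauchy y))
x *ᴿ y = mkℝ (λ n → seq x n * seq y n) (*-cauchy {seq x} {seq y} (cauchy x) (cauchy y))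

-ᴿ_ : ℝ → ℝ
-ᴿ x = mkℝ (λ n → - seq x n) (neg-cauchy {seq x} (cauchy x))

_-ᴿ_ : ℝ → ℝ → ℝ
x -ᴿ y = x +ᴿ (-ᴿ y)

_≈ᴿ_ _<ᴿ_ _≤ᴿ_ : ℝ → ℝ → Set
x ≈ᴿ y = ∀ ε → 0ℚ < ε → Eventually (λ m → ∣ seq x m - seq y m ∣ < ε)
x <ᴿ y = ∃[ ε ] (0ℚ < ε × Eventually (λ m → seq x m + ε ≤ seq y m))
x ≤ᴿ y = ¬ (y <ᴿ x)

ℝ-rawRing : RawRing 0ℓ 0ℓ
ℝ-rawRing = record
  { Carrier = ℝ ; _≈_ = _≈ᴿ_ ; _+_ = _+ᴿ_ ; _*_ = _*ᴿ_ ; -_ = -ᴿ_ ; 0# = 0ᴿ ; 1# = 1ᴿ }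

open SemiringOps (RawRing.rawSemiring ℝ-rawRing) public
  using () renaming (_^_ to _^ᴿ_)

infix 4 _⟶ᴿ_

_⟶ᴿ_ : (ℕ → ℝ) → ℝ → Set
s ⟶ᴿ L = ∀ ε → 0ℚ < ε →
  Eventually (λ m → fromℚ (- ε) <ᴿ (s m -ᴿ L) × (s m -ᴿ L) <ᴿ fromℚ ε)

record ℂ : Set where
  constructor _+i_
  field
    re im : ℝ
open ℂ public

infix  8 -ᶜ_
infixl 7 _*ᶜ_
infixl 6 _+ᶜ_
infix  4 _≈ᶜ_ _⟶ᶜ_ _+i_

_+ᶜ_ _*ᶜ_ : ℂ → ℂ → ℂ
z +ᶜ w = (re z +ᴿ re w) +i (im z +ᴿ im w)
z *ᶜ w = (re z *ᴿ re w -ᴿ im z *ᴿ im w) +i (re z *ᴿ im w +ᴿ im z *ᴿ re w)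

-ᶜ_ : ℂ → ℂ
-ᶜ z = (-ᴿ re z) +i (-ᴿ im z)

fromℝ : ℝ → ℂ
fromℝ x = x +i 0ᴿ

iᶜ : ℂ
iᶜ = 0ᴿ +i 1ᴿ

_≈ᶜ_ : ℂ → ℂ → Set
z ≈ᶜ w = re z ≈ᴿ re w × im z ≈ᴿ im w

_⟶ᶜ_ : (ℕ → ℂ) → ℂ → Set
s ⟶ᶜ L = (λ m → re (s m)) ⟶ᴿ re L × (λ m → im (s m)) ⟶ᴿ im L

-- |z| = 1, written without the square root as |z|² = 1.
UnitModulus : ℂ → Set
UnitModulus z = re z *ᴿ re z +ᴿ im z *ᴿ im z ≈ᴿ 1ᴿ

ℂ-rawRing : RawRing 0ℓ 0ℓ
ℂ-rawRing = record
  { Carrier = ℂ ; _≈_ = _≈ᶜ_ ; _+_ = _+ᶜ_ ; _*_ = _*ᶜ_ ; -_ = -ᶜ_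
  ; 0# = fromℝ 0ᴿ ; 1# = fromℝ 1ᴿ }

Matrix : Set → ℕ → Set
Matrix A n = Vector (Vector A n) n

module MatrixOps (R : RawRing 0ℓ 0ℓ) where
  open RawRing R renaming (_+_ to _⊕_; _*_ to _⊗_) hiding (-_)
  open SemiringOps rawSemiring using (sum)

  infixr 8 _^ᴹ_
  infixl 7 _*ᴹ_ _·ᴹ_ _*ᵛ_
  infixl 6 _+ᴹ_

  basis : ∀ {n} → Fin n → Vector Carrier n
  basis a i = if does (a ≟ᶠ i) then 1# else 0#

  0ᴹ 1ᴹ : ∀ {n} → Matrix Carrier n
  0ᴹ _ _ = 0#
  1ᴹ     = basis

  _+ᴹ_ _*ᴹ_ : ∀ {n} → Matrix Carrier n → Matrix Carrier n → Matrix Carrier n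
  (M +ᴹ N) i j = M i j ⊕ N i j
  (M *ᴹ N) i j = sum (λ l → M i l ⊗ N l j)

  _·ᴹ_ : ∀ {n} → Carrier → Matrix Carrier n → Matrix Carrier n
  (c ·ᴹ M) i j = c ⊗ M i j

  _^ᴹ_ : ∀ {n} → Matrix Carrier n → ℕ → Matrix Carrier n
  M ^ᴹ zero  = 1ᴹ
  M ^ᴹ suc k = M *ᴹ (M ^ᴹ k)

  _*ᵛ_ : ∀ {n} → Matrix Carrier n → Vector Carrier n → Vector Carrier n
  (M *ᵛ v) i = sum (λ l → M i l ⊗ v l)

1/_! : ℕ → ℚ
1/ n ! = _/_ (+ 1) (n !) {{n ℕ.!≢0}}

module _ where
  open MatrixOps ℂ-rawRing

  -- ∑_{m < N} M^m / m!
  expPartial : ∀ {n} → Matrix ℂ n → ℕ → Matrix ℂ n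
  expPartial M zero    = 0ᴹ
  expPartial M (suc N) = expPartial M N +ᴹ fromℝ (fromℚ (1/ N !)) ·ᴹ (M ^ᴹ N)

  IsExp : ∀ {n} → Matrix ℂ n → Matrix ℂ n → Set
  IsExp M E = ∀ i j → (λ N → expPartial M N i j) ⟶ᶜ E i j

  -- U is exp(-iτK), which always exists and is unique up to _≈ᶜ_.
  PSTAt : ∀ {n} → Matrix ℝ n → Fin n → Fin n → ℝ → Set
  PSTAt {n} K a b τ =
    ∃[ U ] (IsExp ((-ᶜ (iᶜ *ᶜ fromℝ τ)) ·ᴹ (λ i j → fromℝ (K i j))) U ×
    ∃[ γ ] (UnitModulus γ ×
      (∀ v → (U *ᵛ basis a) v ≈ᶜ γ *ᶜ basis b v)))

PST : ∀ {n} → Matrix ℝ n → Fin n → Fin n → Set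
PST K a b = ∃[ τ ] (0ᴿ <ᴿ τ × PSTAt K a b τ)

IsMinTransferTime : ∀ {n} → Matrix ℝ n → Fin n → Fin n → ℝ → Set
IsMinTransferTime K a b τ =
  0ᴿ <ᴿ τ × PSTAt K a b τ × (∀ σ → 0ᴿ <ᴿ σ → PSTAt K a b σ → τ ≤ᴿ σ)

-- ∑_{j < N} (-1)^j x^(2j+1) / (2j+1)!
sinPartial : ℝ → ℕ → ℝ
sinPartial x zero    = 0ᴿ
sinPartial x (suc N) = sinPartial x N +ᴿ
  (-ᴿ 1ᴿ) ^ᴿ N *ᴿ fromℚ (1/ (suc (2 ℕ.* N)) !) *ᴿ x ^ᴿ suc (2 ℕ.* N)

SinZero : ℝ → Set
SinZero x = sinPartial x ⟶ᴿ 0ᴿ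

-- π as the least positive zero of the sine; this determines it up to _≈ᴿ_.
IsPi : ℝ → Set
IsPi p = 0ᴿ <ᴿ p × SinZero p × (∀ x → 0ᴿ <ᴿ x → x <ᴿ p → ¬ SinZero x)

Next : ∀ {n} → Fin n → Fin n → Set
Next {n} i j = suc (toℕ i) ≡ toℕ j ⊎ (suc (toℕ i) ≡ n × toℕ j ≡ 0)

CycleEdge : ∀ {n} → Fin n → Fin n → Set
CycleEdge i j = Next i j ⊎ Next j i

next? : ∀ {n} (i j : Fin n) → Dec (Next i j)
next? {n} i j = (suc (toℕ i) ℕ.≟ toℕ j) ⊎-dec ((suc (toℕ i) ℕ.≟ n) ×-dec (toℕ j ℕ.≟ 0))

cycleEdge? : ∀ {n} (i j : Fin n) → Dec (CycleEdge i j)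
cycleEdge? i j = next? i j ⊎-dec next? j i

cycleAdj : ∀ n → Matrix ℝ n
cycleAdj n i j = if does (cycleEdge? i j) then 1ᴿ else 0ᴿ

-- A walk of the given length.
data CycleWalk {n : ℕ} : ℕ → Fin n → Fin n → Set where
  here : ∀ {a} → CycleWalk 0 a a
  step : ∀ {ℓ a b c} → CycleEdge a b → CycleWalk ℓ b c → CycleWalk (suc ℓ) a c

AtDistance : ∀ {n} → ℕ → Fin n → Fin n → Set
AtDistance d a b = CycleWalk d a b × (∀ ℓ → CycleWalk ℓ a b → d ℕ.≤ ℓ)

Antipodal : ∀ {n} → Fin n → Fin n → Set
Antipodal {n} a b = ∃[ h ] (n ≡ 2 ℕ.* h × AtDistance h a b)

open MatrixOps ℝ-rawRing public using (_^ᴹ_)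

{-# OPTIONS --safe #-}
-- Write E x = e^{ix}. A left eigenvector v of K with eigenvalue κ turns transfer
-- from a to b into the scalar equation E(-τκ) v(a) = γ v(b). On the cycle the
-- vectors x ↦ ζˣ with ζⁿ = 1 have eigenvalue θ = ζ + ζ⁻¹. Taking ζ = e^{2πi/n} and
-- its conjugate gives Im ζ^(b-a) = 0, so n = 2h and a, b are antipodal; comparing
-- any ζ with ζ = 1 then gives E(τ(2ᵏ - θᵏ)) = ζʰ = ±1, that is,
-- τ(2ᵏ - θᵏ) = πm with m even or odd according to the sign.
--
-- Suppose one integer X satisfies τX = π · odd; suitable choices are
-- X = 2ᵏ - (-2)ᵏ for h odd, X = 2ᵏ for h ≡ 2 mod 4 (θ = 0), and X = 2ᵏ - 2^{k/2} for
-- h ≡ 4 mod 8 (θ = √2). If an odd m ≥ 3 divides h, eliminating τ shows that an odd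
-- multiple of θᵏ, ζ = e^{2πi/m}, is an even integer. But θ is a unit of ℤ[ζ], so
-- ℤ[ζ] would equal 2ℤ[ζ] up to odd factors, which elimination excludes for a
-- finitely generated group. For 8 ∣ n the eigenvalues 0 and √2 force k even, and for
-- 16 ∣ n the eigenvalue √(2 + √2) contradicts the irrationality of √2. This leaves
-- n = 4 and n = 8, where U is computed from rational eigenvectors of A and A².
--
-- The functions E and π are built on rational partial sums: E(x + y) = E x · E y is
-- the Cauchy product, π/2 is the limit of the contraction q ↦ q + cos q on
-- [3/2, 8/5], and sin t ≥ t/3 on [0, 2] shows that π is the first zero.
module Submission where

open import Defs
open import Algebra.Bundles using (CommutativeRing)
open import Algebra.Bundles.Raw using (RawRing)
import Algebra.Properties.CommutativeSemiring.Exp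
import Algebra.Properties.Semiring.Sum
import Algebra.Solver.Ring
open import Algebra.Solver.Ring.AlmostCommutativeRing using (fromCommutativeRing; _-Raw-AlmostCommutative⟶_)
import Algebra.Solver.Ring.Simple
open import Algebra.Structures using (IsCommutativeRing)
open import Data.Bool.Base using (Bool; true; false; if_then_else_)
open import Data.Empty using (⊥; ⊥-elim)
open import Data.Fin.Base as Fin using (Fin; toℕ)
open import Data.Fin.Patterns using (0F; 1F; 2F)
import Data.Fin.Properties as Fin
open import Data.Integer.Base as ℤ using (ℤ; +_; -[1+_])
import Data.Integer.DivMod as ℤDM
import Data.Integer.Properties as ℤ
open import Data.Maybe.Base as Maybe using (Maybe; just; nothing)
open import Data.Nat.Base as ℕ using (ℕ; zero; suc)
import Data.Nat.Coprimality as Coprime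
open import Data.Nat.Divisibility using (_∣_; divides)
open import Data.Nat.Induction using (<-rec)
import Data.Nat.Properties as ℕ
open import Data.Nat.Tactic.RingSolver using (solve-∀)
open import Data.Product.Base using (Σ; ∃-syntax; _×_; _,_; proj₁; proj₂)
open import Data.Rational.Base as ℚ using (ℚ; mkℚ; 0ℚ; 1ℚ; ½; _+_; _*_; _-_; -_; ∣_∣; _<_; _≤_; _/_)
import Data.Rational.Properties as ℚ
open import Data.Rational.Solver using (module +-*-Solver)
import Data.Rational.Unnormalised.Base as ℚᵘ
import Data.Rational.Unnormalised.Properties as ℚᵘ
open import Data.Sum.Base using (_⊎_; inj₁; inj₂)
open import Data.Unit.Base using (tt)
open import Function.Bundles using (_⇔_; mk⇔)
open import Level using (0ℓ)
open import Relation.Binary.Definitions using (DecidableEquality; tri<; tri≈; tri>)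
open import Relation.Binary.PropositionalEquality
  using (_≡_; _≢_; refl; sym; trans; cong; cong₂; subst; subst₂; module ≡-Reasoning)
import Relation.Binary.Reasoning.Setoid
open import Relation.Nullary.Decidable
  using (yes; no; does; dec-true; dec-false; from-yes; map′; _×-dec_; _→-dec_)
open import Relation.Nullary.Negation using (¬_; contradiction)

-- Rational numbers and null sequences

-- Equality and order of the reals are undecidable here, which shapes the analysis. Equality is
-- still stable: a number that is neither positive nor negative is zero (`¬pos⇒≋0`), so equations
-- are proved by refuting both signs, and case splits are made only between overlapping alternatives
-- (`pos-+⁻`). All estimates concern rational partial sums, are uniform on bounded sets, and pass to
-- the reals along the diagonal (`expSeq`). In the arithmetic part the powers of ζ form a spanning
-- family that may satisfy arbitrary relations. Odd factors act as units, so the elimination takes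
-- place over ℤ localised at 2, with denominators kept as explicit odd integers. The odd multiple τX
-- supplies the odd factor; conditions with m even alone say nothing modulo 2. Minimality of the
-- times on C₄ and C₈ rests on two eigenvectors: a kernel vector fixes γ, and against it an
-- eigenvector for μ of the opposite symmetry under exchange of a and b must have phase -1, so that
-- σμ is a zero of the sine.

ιℚ : ℤ → ℚ
ιℚ z = mkℚ z 0 (Coprime.sym (Coprime.1-coprimeTo ℤ.∣ z ∣))

ιℚ-+ : ∀ z w → ιℚ (z ℤ.+ w) ≡ ιℚ z + ιℚ w
ιℚ-+ z w = ℚ.toℚᵘ-injective (ℚᵘ.≃-sym (ℚᵘ.≃-trans (ℚ.toℚᵘ-homo-+ (ιℚ z) (ιℚ w))
  (ℚᵘ.*≡* (cong (ℤ._* + 1) (cong₂ ℤ._+_ (ℤ.*-identityʳ z) (ℤ.*-identityʳ w))))))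

ιℚ-* : ∀ z w → ιℚ (z ℤ.* w) ≡ ιℚ z * ιℚ w
ιℚ-* z w = ℚ.toℚᵘ-injective (ℚᵘ.≃-sym (ℚ.toℚᵘ-homo-* (ιℚ z) (ιℚ w)))

ιℚ-neg : ∀ z → ιℚ (ℤ.- z) ≡ - ιℚ z
ιℚ-neg z = ℚ.toℚᵘ-injective (ℚᵘ.≃-sym (ℚ.toℚᵘ-homo‿- (ιℚ z)))

ιℚ-mono-≤ : ∀ {z w} → z ℤ.≤ w → ιℚ z ≤ ιℚ w
ιℚ-mono-≤ z≤w = ℚ.*≤* (ℤ.*-monoʳ-≤-nonNeg (+ 1) z≤w)

ιℚ-mono-< : ∀ {z w} → z ℤ.< w → ιℚ z < ιℚ w
ιℚ-mono-< z<w = ℚ.*<* (ℤ.*-monoʳ-<-pos (+ 1) z<w)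

ιℚ-injective : ∀ {z w} → ιℚ z ≡ ιℚ w → z ≡ w
ιℚ-injective {z} {w} eq with ℤ.<-cmp z w
... | tri≈ _ z≡w _ = z≡w
... | tri< z<w _ _ = contradiction eq (ℚ.<⇒≢ (ιℚ-mono-< z<w))
... | tri> _ _ w<z = contradiction (sym eq) (ℚ.<⇒≢ (ιℚ-mono-< w<z))

ιℕ : ℕ → ℚ
ιℕ n = ιℚ (+ n)

p≤q⇒0≤q-p : ∀ {p q} → p ≤ q → 0ℚ ≤ q - p
p≤q⇒0≤q-p {p} {q} p≤q = subst (_≤ q - p) (ℚ.+-inverseʳ p) (ℚ.+-monoˡ-≤ (- p) p≤q)

0≤q-p⇒p≤q : ∀ {p q} → 0ℚ ≤ q - p → p ≤ q
0≤q-p⇒p≤q {p} {q} h = subst₂ _≤_ (ℚ.+-identityˡ p) (lemma q p) (ℚ.+-monoˡ-≤ p h)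
  where
  open +-*-Solver
  lemma : ∀ q p → (q - p) + p ≡ q
  lemma = solve 2 (λ q p → (q :- p) :+ p := q) refl

p<q⇒0<q-p : ∀ {p q} → p < q → 0ℚ < q - p
p<q⇒0<q-p {p} {q} p<q = subst (_< q - p) (ℚ.+-inverseʳ p) (ℚ.+-monoˡ-< (- p) p<q)

0<q-p⇒p<q : ∀ {p q} → 0ℚ < q - p → p < q
0<q-p⇒p<q {p} {q} h = subst₂ _<_ (ℚ.+-identityˡ p) (lemma q p) (ℚ.+-monoˡ-< p h)
  where
  open +-*-Solver
  lemma : ∀ q p → (q - p) + p ≡ q
  lemma = solve 2 (λ q p → (q :- p) :+ p := q) refl

*-nonNeg : ∀ {p q} → 0ℚ ≤ p → 0ℚ ≤ q → 0ℚ ≤ p * q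
*-nonNeg {p} {q} 0≤p 0≤q = subst (_≤ p * q) (ℚ.*-zeroʳ p)
  (ℚ.*-monoˡ-≤-nonNeg p {{ℚ.nonNegative 0≤p}} 0≤q)

*-pos : ∀ {p q} → 0ℚ < p → 0ℚ < q → 0ℚ < p * q
*-pos {p} {q} 0<p 0<q = subst (_< p * q) (ℚ.*-zeroʳ p)
  (ℚ.*-monoʳ-<-pos p {{ℚ.positive 0<p}} 0<q)

*-mono-≤ : ∀ {p q r s} → 0ℚ ≤ p → 0ℚ ≤ s → p ≤ q → r ≤ s → p * r ≤ q * s
*-mono-≤ {p} {q} {r} {s} 0≤p 0≤s p≤q r≤s = ℚ.≤-trans
  (ℚ.*-monoˡ-≤-nonNeg p {{ℚ.nonNegative 0≤p}} r≤s)
  (ℚ.*-monoʳ-≤-nonNeg s {{ℚ.nonNegative 0≤s}} p≤q)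

-- Linear estimates are proved by exhibiting q - p as a visibly non-negative d.
≤-by : ∀ {p q} d → 0ℚ ≤ d → q - p ≡ d → p ≤ q
≤-by d 0≤d eq = 0≤q-p⇒p≤q (subst (0ℚ ≤_) (sym eq) 0≤d)

<-by : ∀ {p q} d → 0ℚ < d → q - p ≡ d → p < q
<-by d 0<d eq = 0<q-p⇒p<q (subst (0ℚ <_) (sym eq) 0<d)

+-nonNeg : ∀ {p q} → 0ℚ ≤ p → 0ℚ ≤ q → 0ℚ ≤ p + q
+-nonNeg 0≤p 0≤q = ℚ.+-mono-≤ 0≤p 0≤q

p≤∣p∣ : ∀ p → p ≤ ∣ p ∣
p≤∣p∣ p with ℚ.≤-total 0ℚ p
... | inj₁ 0≤p = ℚ.≤-reflexive (sym (ℚ.0≤p⇒∣p∣≡p 0≤p))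
... | inj₂ p≤0 = ℚ.≤-trans p≤0 (ℚ.0≤∣p∣ p)

-p≤∣p∣ : ∀ p → - p ≤ ∣ p ∣
-p≤∣p∣ p = subst (- p ≤_) (ℚ.∣-p∣≡∣p∣ p) (p≤∣p∣ (- p))

∣p∣< : ∀ {p b} → p < b → - p < b → ∣ p ∣ < b
∣p∣< {p} {b} p<b -p<b with ℚ.∣p∣≡p∨∣p∣≡-p p
... | inj₁ eq = subst (_< b) (sym eq) p<b
... | inj₂ eq = subst (_< b) (sym eq) -p<b

∣p-q∣≡∣q-p∣ : ∀ p q → ∣ p - q ∣ ≡ ∣ q - p ∣
∣p-q∣≡∣q-p∣ p q = trans (cong ∣_∣ (lemma p q)) (ℚ.∣-p∣≡∣p∣ (q - p))
  where
  open +-*-Solver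
  lemma : ∀ p q → p - q ≡ - (q - p)
  lemma = solve 2 (λ p q → p :- q := :- (q :- p)) refl

0<½ : 0ℚ < ½
0<½ = ℚ.positive⁻¹ ½

0<1 : 0ℚ < 1ℚ
0<1 = ℚ.positive⁻¹ 1ℚ

0<½* : ∀ {ε} → 0ℚ < ε → 0ℚ < ½ * ε
0<½* = *-pos 0<½

½+½ : ∀ ε → ½ * ε + ½ * ε ≡ ε
½+½ = solve 1 (λ ε → con ½ :* ε :+ con ½ :* ε := ε) refl
  where open +-*-Solver

_÷⁺_ : ∀ ε {B} → 0ℚ < B → ℚ
_÷⁺_ ε {B} 0<B = ε * (ℚ.1/ B) {{ℚ.pos⇒nonZero B {{ℚ.positive 0<B}}}}

÷⁺-pos : ∀ {ε B} → 0ℚ < ε → (0<B : 0ℚ < B) → 0ℚ < ε ÷⁺ 0<B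
÷⁺-pos {ε} {B} 0<ε 0<B = *-pos 0<ε (ℚ.positive⁻¹ (ℚ.1/ B) {{ℚ.1/pos⇒pos B}})
  where
  instance
    B-pos : ℚ.Positive B
    B-pos = ℚ.positive 0<B
    B-nonZero : ℚ.NonZero B
    B-nonZero = ℚ.pos⇒nonZero B

*-÷⁺ : ∀ ε {B} (0<B : 0ℚ < B) → B * (ε ÷⁺ 0<B) ≡ ε
*-÷⁺ ε {B} 0<B = trans (ℚ.*-comm B _) (trans (ℚ.*-assoc ε _ B)
    (trans (cong (ε *_) (ℚ.*-inverseˡ B)) (ℚ.*-identityʳ ε)))
  where
  instance
    B-nonZero : ℚ.NonZero B
    B-nonZero = ℚ.pos⇒nonZero B {{ℚ.positive 0<B}}

module _ {P Q : ℕ → Set} where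

  ev-× : Eventually P → Eventually Q → Eventually (λ m → P m × Q m)
  ev-× (M , p) (N , q) = M ℕ.⊔ N , λ m h →
    p m (ℕ.m⊔n≤o⇒m≤o M N h) , q m (ℕ.m⊔n≤o⇒n≤o M N h)

  ev-map : (∀ {m} → P m → Q m) → Eventually P → Eventually Q
  ev-map f (N , p) = N , λ m h → f (p m h)

ev-all : ∀ {P : ℕ → Set} → (∀ m → P m) → Eventually P
ev-all p = 0 , λ m _ → p m

Null : (ℕ → ℚ) → Set
Null f = ∀ ε → 0ℚ < ε → Eventually (λ m → ∣ f m ∣ < ε)

Bounded : (ℕ → ℚ) → Set
Bounded f = ∃[ B ] (0ℚ < B × Eventually (λ m → ∣ f m ∣ ≤ B))

null-≤ : ∀ {f g} → Null g → Eventually (λ m → ∣ f m ∣ ≤ g m) → Null f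
null-≤ {g = g} g-null f≤g ε 0<ε = ev-map (λ {m} (g<ε , f≤) → ℚ.≤-<-trans f≤ (ℚ.≤-<-trans (p≤∣p∣ (g m)) g<ε))
  (ev-× (g-null ε 0<ε) f≤g)

null-≗ : ∀ {f g} → Null g → (∀ m → f m ≡ g m) → Null f
null-≗ g-null f≗g ε 0<ε = ev-map (λ {m} → subst (λ x → ∣ x ∣ < ε) (sym (f≗g m))) (g-null ε 0<ε)

null-0 : Null (λ _ → 0ℚ)
null-0 ε 0<ε = ev-all (λ _ → 0<ε)

null-+ : ∀ {f g} → Null f → Null g → Null (λ m → f m + g m)
null-+ {f} {g} f-null g-null ε 0<ε = ev-map
  (λ {m} (p , q) → ℚ.≤-<-trans (ℚ.∣p+q∣≤∣p∣+∣q∣ (f m) (g m))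
    (subst (∣ f m ∣ + ∣ g m ∣ <_) (½+½ ε) (ℚ.+-mono-< p q)))
  (ev-× (f-null _ (0<½* 0<ε)) (g-null _ (0<½* 0<ε)))

null-neg : ∀ {f} → Null f → Null (λ m → - f m)
null-neg {f} f-null ε 0<ε = ev-map (λ {m} → subst (_< ε) (sym (ℚ.∣-p∣≡∣p∣ (f m)))) (f-null ε 0<ε)

null-* : ∀ {f g} → Bounded f → Null g → Null (λ m → f m * g m)
null-* {f} {g} (B , 0<B , f≤B) g-null ε 0<ε = ev-map
  (λ {m} (p , q) → begin-strict
    ∣ f m * g m ∣        ≡⟨ ℚ.∣p*q∣≡∣p∣*∣q∣ (f m) (g m) ⟩
    ∣ f m ∣ * ∣ g m ∣    ≤⟨ *-mono-≤ (ℚ.0≤∣p∣ (f m)) (ℚ.0≤∣p∣ (g m)) p ℚ.≤-refl ⟩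
    B * ∣ g m ∣          <⟨ ℚ.*-monoʳ-<-pos B {{ℚ.positive 0<B}} q ⟩
    B * (ε ÷⁺ 0<B)       ≡⟨ *-÷⁺ ε 0<B ⟩
    ε                    ∎)
  (ev-× f≤B (g-null _ (÷⁺-pos 0<ε 0<B)))
  where open ℚ.≤-Reasoning

const-bounded : ∀ c → Bounded (λ _ → c)
const-bounded c = 1ℚ + ∣ c ∣ , ℚ.+-mono-<-≤ 0<1 (ℚ.0≤∣p∣ c) , ev-all (λ _ →
  subst (_≤ 1ℚ + ∣ c ∣) (ℚ.+-identityˡ ∣ c ∣) (ℚ.+-monoˡ-≤ ∣ c ∣ (ℚ.<⇒≤ 0<1)))

cauchy-bounded : ∀ {x} → IsCauchy x → Bounded x
cauchy-bounded {x} c with c 1ℚ 0<1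
... | N , h = 1ℚ + ∣ x N ∣ , ℚ.+-mono-<-≤ 0<1 (ℚ.0≤∣p∣ (x N)) , N , λ m N≤m → begin
    ∣ x m ∣                   ≡⟨ cong ∣_∣ (lemma (x m) (x N)) ⟩
    ∣ (x m - x N) + x N ∣     ≤⟨ ℚ.∣p+q∣≤∣p∣+∣q∣ (x m - x N) (x N) ⟩
    ∣ x m - x N ∣ + ∣ x N ∣   ≤⟨ ℚ.+-monoˡ-≤ ∣ x N ∣ (ℚ.<⇒≤ (h m N N≤m ℕ.≤-refl)) ⟩
    1ℚ + ∣ x N ∣              ∎
  where
  open ℚ.≤-Reasoning
  open +-*-Solver
  lemma : ∀ a b → a ≡ (a - b) + b
  lemma = solve 2 (λ a b → a := (a :- b) :+ b) refl

archimedeanℚ : ∀ q → ∃[ n ] (q ≤ ιℕ n)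
archimedeanℚ q@(mkℚ (+ k) d _)    = k , ℚ.*≤* (ℤ.*-monoˡ-≤-nonNeg (+ k) (ℤ.+≤+ (ℕ.s≤s ℕ.z≤n)))
archimedeanℚ q@(mkℚ -[1+ k ] d _) = 0 , ℚ.nonPositive⁻¹ q

-- The rings of real and complex numbers

-- _≈ᴿ_ unfolds to a function type, which blocks the inference of its
-- arguments; the record does not.
infix 4 _≋_ _≋ᶜ_

record _≋_ (x y : ℝ) : Set where
  constructor mk≋
  field un≋ : x ≈ᴿ y
open _≋_

≡⇒≋ : ∀ {x y} → (∀ m → seq x m ≡ seq y m) → x ≋ y
≡⇒≋ {x} {y} eq = mk≋ (null-≗ null-0 (λ m →
  trans (cong (_- seq y m) (eq m)) (ℚ.+-inverseʳ (seq y m))))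

≋-refl : ∀ {x} → x ≋ x
≋-refl = ≡⇒≋ (λ _ → refl)

≋-sym : ∀ {x y} → x ≋ y → y ≋ x
≋-sym {x} {y} (mk≋ p) = mk≋ (λ ε 0<ε →
  ev-map (λ {m} → subst (_< ε) (∣p-q∣≡∣q-p∣ (seq x m) (seq y m))) (p ε 0<ε))

≋-trans : ∀ {x y z} → x ≋ y → y ≋ z → x ≋ z
≋-trans {x} {y} {z} (mk≋ p) (mk≋ q) =
  mk≋ (null-≗ (null-+ p q) (λ m → lemma (seq x m) (seq y m) (seq z m)))
  where
  open +-*-Solver
  lemma : ∀ a b c → a - c ≡ (a - b) + (b - c)
  lemma = solve 3 (λ a b c → a :- c := (a :- b) :+ (b :- c)) refl

+-cong : ∀ {x x′ y y′} → x ≋ x′ → y ≋ y′ → x +ᴿ y ≋ x′ +ᴿ y′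
+-cong {x} {x′} {y} {y′} (mk≋ p) (mk≋ q) =
  mk≋ (null-≗ (null-+ p q) (λ m → lemma (seq x m) (seq y m) (seq x′ m) (seq y′ m)))
  where
  open +-*-Solver
  lemma : ∀ a b c d → (a + b) - (c + d) ≡ (a - c) + (b - d)
  lemma = solve 4 (λ a b c d → (a :+ b) :- (c :+ d) := (a :- c) :+ (b :- d)) refl

*-cong : ∀ {x x′ y y′} → x ≋ x′ → y ≋ y′ → x *ᴿ y ≋ x′ *ᴿ y′
*-cong {x} {x′} {y} {y′} (mk≋ p) (mk≋ q) = mk≋ (null-≗
  (null-+ (null-* {seq x} {λ m → seq y m - seq y′ m} (cauchy-bounded (cauchy x)) q)
          (null-* {seq y′} {λ m → seq x m - seq x′ m} (cauchy-bounded (cauchy y′)) p))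
  (λ m → lemma (seq x m) (seq y m) (seq x′ m) (seq y′ m)))
  where
  open +-*-Solver
  lemma : ∀ a b c d → a * b - c * d ≡ a * (b - d) + d * (a - c)
  lemma = solve 4 (λ a b c d → a :* b :- c :* d := a :* (b :- d) :+ d :* (a :- c)) refl

-‿cong : ∀ {x y} → x ≋ y → -ᴿ x ≋ -ᴿ y
-‿cong {x} {y} (mk≋ p) = mk≋ (null-≗ (null-neg p) (λ m → lemma (seq x m) (seq y m)))
  where
  open +-*-Solver
  lemma : ∀ a b → (- a) - (- b) ≡ - (a - b)
  lemma = solve 2 (λ a b → (:- a) :- (:- b) := :- (a :- b)) refl

ℝ-ring : CommutativeRing 0ℓ 0ℓ
ℝ-ring = record
  { Carrier = ℝ ; _≈_ = _≋_ ; _+_ = _+ᴿ_ ; _*_ = _*ᴿ_ ; -_ = -ᴿ_ ; 0# = 0ᴿ ; 1# = 1ᴿ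
  ; isCommutativeRing = record
    { isRing = record
      { +-isAbelianGroup = record
        { isGroup = record
          { isMonoid = record
            { isSemigroup = record
              { isMagma = record
                { isEquivalence = record { refl = ≋-refl ; sym = ≋-sym ; trans = ≋-trans }
                ; ∙-cong = +-cong }
              ; assoc = λ x y z → ≡⇒≋ (λ m → ℚ.+-assoc (seq x m) (seq y m) (seq z m)) }
            ; identity = (λ x → ≡⇒≋ (λ m → ℚ.+-identityˡ (seq x m)))
                       , (λ x → ≡⇒≋ (λ m → ℚ.+-identityʳ (seq x m))) }
          ; inverse = (λ x → ≡⇒≋ (λ m → ℚ.+-inverseˡ (seq x m)))
                    , (λ x → ≡⇒≋ (λ m → ℚ.+-inverseʳ (seq x m)))
          ; ⁻¹-cong = -‿cong }
        ; comm = λ x y → ≡⇒≋ (λ m → ℚ.+-comm (seq x m) (seq y m)) }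
      ; *-cong = *-cong
      ; *-assoc = λ x y z → ≡⇒≋ (λ m → ℚ.*-assoc (seq x m) (seq y m) (seq z m))
      ; *-identity = (λ x → ≡⇒≋ (λ m → ℚ.*-identityˡ (seq x m)))
                   , (λ x → ≡⇒≋ (λ m → ℚ.*-identityʳ (seq x m)))
      ; distrib = (λ x y z → ≡⇒≋ (λ m → ℚ.*-distribˡ-+ (seq x m) (seq y m) (seq z m)))
                , (λ x y z → ≡⇒≋ (λ m → ℚ.*-distribʳ-+ (seq x m) (seq y m) (seq z m))) }
    ; *-comm = λ x y → ≡⇒≋ (λ m → ℚ.*-comm (seq x m) (seq y m)) } }

ι : ℤ → ℝ
ι z = fromℚ (ιℚ z)

ι-+ : ∀ z w → ι (z ℤ.+ w) ≋ ι z +ᴿ ι w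
ι-+ z w = ≡⇒≋ (λ _ → ιℚ-+ z w)

ι-* : ∀ z w → ι (z ℤ.* w) ≋ ι z *ᴿ ι w
ι-* z w = ≡⇒≋ (λ _ → ιℚ-* z w)

ι-neg : ∀ z → ι (ℤ.- z) ≋ -ᴿ ι z
ι-neg z = ≡⇒≋ (λ _ → ιℚ-neg z)

-- Coefficients of a ring solver have to be compared, which is impossible in `ℝ`; integers are
-- decidable and embed into it.
ℤ-coeffs : ℤ.+-*-rawRing -Raw-AlmostCommutative⟶ fromCommutativeRing ℝ-ring
ℤ-coeffs = record
  { ⟦_⟧ = ι ; +-homo = ι-+ ; *-homo = ι-* ; -‿homo = ι-neg ; 0-homo = ≋-refl ; 1-homo = ≋-refl }

ι-≟ : ∀ z w → Maybe (ι z ≋ ι w)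
ι-≟ z w with z ℤ.≟ w
... | yes refl = just ≋-refl
... | no _     = nothing

module ℝ-Solver = Algebra.Solver.Ring ℤ.+-*-rawRing (fromCommutativeRing ℝ-ring) ℤ-coeffs ι-≟

record _≋ᶜ_ (z w : ℂ) : Set where
  constructor mk≋ᶜ
  field
    re≋ : re z ≋ re w
    im≋ : im z ≋ im w
open _≋ᶜ_

≈ᶜ⇒≋ᶜ : ∀ {z w} → z ≈ᶜ w → z ≋ᶜ w
≈ᶜ⇒≋ᶜ (p , q) = mk≋ᶜ (mk≋ p) (mk≋ q)

≋ᶜ⇒≈ᶜ : ∀ {z w} → z ≋ᶜ w → z ≈ᶜ w
≋ᶜ⇒≈ᶜ (mk≋ᶜ (mk≋ p) (mk≋ q)) = p , q

module R where
  open CommutativeRing ℝ-ring public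
  open ℝ-Solver public

ℂ-ring : CommutativeRing 0ℓ 0ℓ
ℂ-ring = record
  { Carrier = ℂ ; _≈_ = _≋ᶜ_ ; _+_ = _+ᶜ_ ; _*_ = _*ᶜ_ ; -_ = -ᶜ_
  ; 0# = fromℝ 0ᴿ ; 1# = fromℝ 1ᴿ
  ; isCommutativeRing = record
    { isRing = record
      { +-isAbelianGroup = record
        { isGroup = record
          { isMonoid = record
            { isSemigroup = record
              { isMagma = record
                { isEquivalence = record
                  { refl = mk≋ᶜ ≋-refl ≋-refl
                  ; sym = λ (mk≋ᶜ p q) → mk≋ᶜ (≋-sym p) (≋-sym q)
                  ; trans = λ (mk≋ᶜ p q) (mk≋ᶜ p′ q′) → mk≋ᶜ (≋-trans p p′) (≋-trans q q′) }
                ; ∙-cong = λ (mk≋ᶜ p q) (mk≋ᶜ p′ q′) → mk≋ᶜ (+-cong p p′) (+-cong q q′) }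
              ; assoc = λ z w v → mk≋ᶜ (R.+-assoc (re z) (re w) (re v)) (R.+-assoc (im z) (im w) (im v)) }
            ; identity = (λ z → mk≋ᶜ (R.+-identityˡ (re z)) (R.+-identityˡ (im z)))
                       , (λ z → mk≋ᶜ (R.+-identityʳ (re z)) (R.+-identityʳ (im z))) }
          ; inverse = (λ z → mk≋ᶜ (R.-‿inverseˡ (re z)) (R.-‿inverseˡ (im z)))
                    , (λ z → mk≋ᶜ (R.-‿inverseʳ (re z)) (R.-‿inverseʳ (im z)))
          ; ⁻¹-cong = λ (mk≋ᶜ p q) → mk≋ᶜ (-‿cong p) (-‿cong q) }
        ; comm = λ z w → mk≋ᶜ (R.+-comm (re z) (re w)) (R.+-comm (im z) (im w)) }
      ; *-cong = λ (mk≋ᶜ p q) (mk≋ᶜ p′ q′) →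
          mk≋ᶜ (+-cong (*-cong p p′) (-‿cong (*-cong q q′))) (+-cong (*-cong p q′) (*-cong q p′))
      ; *-assoc = λ z w v → mk≋ᶜ (assoc-re (re z) (im z) (re w) (im w) (re v) (im v))
                                 (assoc-im (re z) (im z) (re w) (im w) (re v) (im v))
      ; *-identity = (λ z → mk≋ᶜ (idˡ-re (re z) (im z)) (idˡ-im (re z) (im z)))
                   , (λ z → mk≋ᶜ (idʳ-re (re z) (im z)) (idʳ-im (re z) (im z)))
      ; distrib = (λ z w v → mk≋ᶜ (distˡ-re (re z) (im z) (re w) (im w) (re v) (im v))
                                  (distˡ-im (re z) (im z) (re w) (im w) (re v) (im v)))
                , (λ z w v → mk≋ᶜ (distʳ-re (re z) (im z) (re w) (im w) (re v) (im v))
                                  (distʳ-im (re z) (im z) (re w) (im w) (re v) (im v))) }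
    ; *-comm = λ z w → mk≋ᶜ (comm-re (re z) (im z) (re w) (im w)) (comm-im (re z) (im z) (re w) (im w)) } }
  where
  open R using (solve; _:=_; _:+_; _:*_; _:-_; con)
  assoc-re = solve 6 (λ a b c d e f →
    (a :* c :- b :* d) :* e :- (a :* d :+ b :* c) :* f :=
    a :* (c :* e :- d :* f) :- b :* (c :* f :+ d :* e)) ≋-refl
  assoc-im = solve 6 (λ a b c d e f →
    (a :* c :- b :* d) :* f :+ (a :* d :+ b :* c) :* e :=
    a :* (c :* f :+ d :* e) :+ b :* (c :* e :- d :* f)) ≋-refl
  idˡ-re = solve 2 (λ a b → con (+ 1) :* a :- con (+ 0) :* b := a) ≋-refl
  idˡ-im = solve 2 (λ a b → con (+ 1) :* b :+ con (+ 0) :* a := b) ≋-refl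
  idʳ-re = solve 2 (λ a b → a :* con (+ 1) :- b :* con (+ 0) := a) ≋-refl
  idʳ-im = solve 2 (λ a b → a :* con (+ 0) :+ b :* con (+ 1) := b) ≋-refl
  distˡ-re = solve 6 (λ a b c d e f →
    a :* (c :+ e) :- b :* (d :+ f) := (a :* c :- b :* d) :+ (a :* e :- b :* f)) ≋-refl
  distˡ-im = solve 6 (λ a b c d e f →
    a :* (d :+ f) :+ b :* (c :+ e) := (a :* d :+ b :* c) :+ (a :* f :+ b :* e)) ≋-refl
  distʳ-re = solve 6 (λ a b c d e f →
    (c :+ e) :* a :- (d :+ f) :* b := (c :* a :- d :* b) :+ (e :* a :- f :* b)) ≋-refl
  distʳ-im = solve 6 (λ a b c d e f →
    (c :+ e) :* b :+ (d :+ f) :* a := (c :* b :+ d :* a) :+ (e :* b :+ f :* a)) ≋-refl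
  comm-re = solve 4 (λ a b c d → a :* c :- b :* d := c :* a :- d :* b) ≋-refl
  comm-im = solve 4 (λ a b c d → a :* d :+ b :* c := c :* b :+ d :* a) ≋-refl

fromℝ-cong : ∀ {x y} → x ≋ y → fromℝ x ≋ᶜ fromℝ y
fromℝ-cong p = mk≋ᶜ p ≋-refl

fromℝ-+ : ∀ x y → fromℝ (x +ᴿ y) ≋ᶜ fromℝ x +ᶜ fromℝ y
fromℝ-+ x y = mk≋ᶜ ≋-refl (≋-sym (R.+-identityˡ 0ᴿ))

fromℝ-neg : ∀ x → fromℝ (-ᴿ x) ≋ᶜ -ᶜ fromℝ x
fromℝ-neg x = mk≋ᶜ ≋-refl (R.solve 0 (R.con (+ 0) R.:= R.:- R.con (+ 0)) ≋-refl)

fromℝ-* : ∀ x y → fromℝ (x *ᴿ y) ≋ᶜ fromℝ x *ᶜ fromℝ y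
fromℝ-* x y = mk≋ᶜ
  (R.solve 2 (λ x y → x R.:* y R.:= x R.:* y R.:- R.con (+ 0) R.:* R.con (+ 0)) ≋-refl x y)
  (R.solve 2 (λ x y → R.con (+ 0) R.:= x R.:* R.con (+ 0) R.:+ R.con (+ 0) R.:* y) ≋-refl x y)

ιᶜ : ℤ → ℂ
ιᶜ z = fromℝ (ι z)

ℤ-coeffsᶜ : ℤ.+-*-rawRing -Raw-AlmostCommutative⟶ fromCommutativeRing ℂ-ring
ℤ-coeffsᶜ = record
  { ⟦_⟧ = ιᶜ
  ; +-homo = λ z w → CommutativeRing.trans ℂ-ring (fromℝ-cong (ι-+ z w)) (fromℝ-+ (ι z) (ι w))
  ; *-homo = λ z w → CommutativeRing.trans ℂ-ring (fromℝ-cong (ι-* z w)) (fromℝ-* (ι z) (ι w))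
  ; -‿homo = λ z → CommutativeRing.trans ℂ-ring (fromℝ-cong (ι-neg z)) (fromℝ-neg (ι z))
  ; 0-homo = CommutativeRing.refl ℂ-ring ; 1-homo = CommutativeRing.refl ℂ-ring }

module ℂ-Solver = Algebra.Solver.Ring ℤ.+-*-rawRing (fromCommutativeRing ℂ-ring) ℤ-coeffsᶜ
  (λ z w → Maybe.map fromℝ-cong (ι-≟ z w))

module C where
  open CommutativeRing ℂ-ring public
  open ℂ-Solver public

-- Limits

infix 4 _⇝_ _⇝ᶜ_

-- Convergence read off the rational approximations. The strict inequalities of `_⟶ᴿ_` each hide a
-- further gap; a pointwise bound for all large `m` turns the algebra of limits into estimates of
-- rationals.
record _⇝_ (s : ℕ → ℝ) (L : ℝ) : Set where
  constructor mk⇝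
  field close : ∀ ε → 0ℚ < ε → Eventually (λ N → Eventually (λ m → ∣ seq (s N) m - seq L m ∣ < ε))
open _⇝_

⟶⇒⇝ : ∀ {s L} → s ⟶ᴿ L → s ⇝ L
⟶⇒⇝ {s} {L} lim = mk⇝ λ ε 0<ε → ev-map
  (λ {N} ((δ , 0<δ , lo) , (δ′ , 0<δ′ , hi)) → ev-map
    (λ {m} (l , h) → ∣p∣<
      (ℚ.<-≤-trans (<-by δ′ 0<δ′ (lemma₁ (seq (s N) m - seq L m) δ′)) h)
      (ℚ.≤-<-trans (≤-by (seq (s N) m - seq L m - (- ε + δ)) (p≤q⇒0≤q-p l)
          (lemma₂ (seq (s N) m - seq L m) ε δ))
        (<-by δ 0<δ (lemma₃ ε δ))))
    (ev-× lo hi))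
  (lim ε 0<ε)
  where
  open +-*-Solver
  lemma₁ : ∀ x δ → (x + δ) - x ≡ δ
  lemma₁ = solve 2 (λ x δ → (x :+ δ) :- x := δ) refl
  lemma₂ : ∀ x ε δ → (ε - δ) - (- x) ≡ x - (- ε + δ)
  lemma₂ = solve 3 (λ x ε δ → (ε :- δ) :- (:- x) := x :- (:- ε :+ δ)) refl
  lemma₃ : ∀ ε δ → ε - (ε - δ) ≡ δ
  lemma₃ = solve 2 (λ ε δ → ε :- (ε :- δ) := δ) refl

⇝⇒⟶ : ∀ {s L} → s ⇝ L → s ⟶ᴿ L
⇝⇒⟶ {s} {L} (mk⇝ lim) ε 0<ε = ev-map
  (λ {N} c →
    (½ * ε , 0<½* 0<ε , ev-map (λ {m} h → ≤-by ((½ * ε) - (- (seq (s N) m - seq L m)))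
        (p≤q⇒0≤q-p (ℚ.≤-trans (-p≤∣p∣ (seq (s N) m - seq L m)) (ℚ.<⇒≤ h)))
        (lemma₁ (seq (s N) m - seq L m) ε)) c)
    , (½ * ε , 0<½* 0<ε , ev-map (λ {m} h → ≤-by ((½ * ε) - (seq (s N) m - seq L m))
        (p≤q⇒0≤q-p (ℚ.≤-trans (p≤∣p∣ (seq (s N) m - seq L m)) (ℚ.<⇒≤ h)))
        (lemma₂ (seq (s N) m - seq L m) ε)) c))
  (lim (½ * ε) (0<½* 0<ε))
  where
  open +-*-Solver
  lemma₁ : ∀ x ε → x - (- ε + ½ * ε) ≡ (½ * ε) - (- x)
  lemma₁ = solve 2 (λ x ε → x :- (:- ε :+ con ½ :* ε) := (con ½ :* ε) :- (:- x)) refl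
  lemma₂ : ∀ x ε → ε - (x + ½ * ε) ≡ ½ * ε - x
  lemma₂ = solve 2 (λ x ε → ε :- (x :+ con ½ :* ε) := (con ½ :* ε) :- x) refl

private
  <½⇒< : ∀ {x y z ε} → z ≡ x + y → ∣ x ∣ < ½ * ε → ∣ y ∣ < ½ * ε → ∣ z ∣ < ε
  <½⇒< {x} {y} {z} {ε} refl p q =
    ℚ.≤-<-trans (ℚ.∣p+q∣≤∣p∣+∣q∣ x y) (subst (∣ x ∣ + ∣ y ∣ <_) (½+½ ε) (ℚ.+-mono-< p q))

lim-unique : ∀ {s L L′} → s ⇝ L → s ⇝ L′ → L ≋ L′
lim-unique {s} {L} {L′} (mk⇝ p) (mk⇝ q) = mk≋ λ ε 0<ε →
  let N , h = ev-× (p (½ * ε) (0<½* 0<ε)) (q (½ * ε) (0<½* 0<ε))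
      c , d = h N ℕ.≤-refl
  in ev-map (λ {m} (x , y) → <½⇒< (lemma (seq L m) (seq L′ m) (seq (s N) m))
       (subst (_< ½ * ε) (∣p-q∣≡∣q-p∣ (seq (s N) m) (seq L m)) x) y) (ev-× c d)
  where
  open +-*-Solver
  lemma : ∀ a b c → a - b ≡ (a - c) + (c - b)
  lemma = solve 3 (λ a b c → a :- b := (a :- c) :+ (c :- b)) refl

lim-const : ∀ {L} → (λ _ → L) ⇝ L
lim-const {L} = mk⇝ λ ε 0<ε → ev-all (λ _ → un≋ (≋-refl {L}) ε 0<ε)

lim-+ : ∀ {s t K L} → s ⇝ K → t ⇝ L → (λ N → s N +ᴿ t N) ⇝ K +ᴿ L
lim-+ {s} {t} {K} {L} (mk⇝ p) (mk⇝ q) = mk⇝ λ ε 0<ε → ev-map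
  (λ {N} (c , d) → ev-map
    (λ {m} (x , y) → <½⇒< (lemma (seq (s N) m) (seq (t N) m) (seq K m) (seq L m)) x y) (ev-× c d))
  (ev-× (p (½ * ε) (0<½* 0<ε)) (q (½ * ε) (0<½* 0<ε)))
  where
  open +-*-Solver
  lemma : ∀ a b c d → (a + b) - (c + d) ≡ (a - c) + (b - d)
  lemma = solve 4 (λ a b c d → (a :+ b) :- (c :+ d) := (a :- c) :+ (b :- d)) refl

lim-cong : ∀ {s t K L} → (∀ N → s N ≋ t N) → K ≋ L → s ⇝ K → t ⇝ L
lim-cong {s} {t} {K} {L} s≋t K≋L (mk⇝ p) = mk⇝ λ ε 0<ε →
  let ε₁ = ½ * ε ; 0<ε₁ = 0<½* 0<ε ; ε₂ = ½ * ε₁ ; 0<ε₂ = 0<½* 0<ε₁ in ev-map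
  (λ {N} c → ev-map
    (λ {m} (x , y , z) → <½⇒< (lemma (seq (t N) m) (seq (s N) m) (seq K m) (seq L m)) x
      (<½⇒< refl y z))
    (ev-× (un≋ (≋-sym (s≋t N)) ε₁ 0<ε₁) (ev-× c (un≋ K≋L ε₂ 0<ε₂))))
  (p ε₂ 0<ε₂)
  where
  open +-*-Solver
  lemma : ∀ a b c d → a - d ≡ (a - b) + ((b - c) + (c - d))
  lemma = solve 4 (λ a b c d → a :- d := (a :- b) :+ ((b :- c) :+ (c :- d))) refl

lim-* : ∀ {s L} c → s ⇝ L → (λ N → c *ᴿ s N) ⇝ c *ᴿ L
lim-* {s} {L} c (mk⇝ p) = mk⇝ λ ε 0<ε → let B , 0<B , c≤B = cauchy-bounded (cauchy c) in ev-map
  (λ {N} h → ev-map (λ {m} (x , y) → bound B ε 0<B (seq c m) (seq (s N) m) (seq L m) x y)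
    (ev-× c≤B h))
  (p (ε ÷⁺ 0<B) (÷⁺-pos 0<ε 0<B))
  where
  open ℚ.≤-Reasoning
  open +-*-Solver
  lemma : ∀ c x y → c * x - c * y ≡ c * (x - y)
  lemma = solve 3 (λ c x y → c :* x :- c :* y := c :* (x :- y)) refl
  bound : ∀ B ε (0<B : 0ℚ < B) c x y → ∣ c ∣ ≤ B → ∣ x - y ∣ < ε ÷⁺ 0<B → ∣ c * x - c * y ∣ < ε
  bound B ε 0<B c x y c≤B h = begin-strict
      ∣ c * x - c * y ∣       ≡⟨ cong ∣_∣ (lemma c x y) ⟩
      ∣ c * (x - y) ∣         ≡⟨ ℚ.∣p*q∣≡∣p∣*∣q∣ c _ ⟩
      ∣ c ∣ * ∣ x - y ∣       ≤⟨ *-mono-≤ (ℚ.0≤∣p∣ c) (ℚ.0≤∣p∣ (x - y)) c≤B ℚ.≤-refl ⟩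
      B * ∣ x - y ∣           <⟨ ℚ.*-monoʳ-<-pos B {{ℚ.positive 0<B}} h ⟩
      B * (ε ÷⁺ 0<B)          ≡⟨ *-÷⁺ ε 0<B ⟩
      ε                       ∎

lim-sub : ∀ {s L} (f : ℕ → ℕ) → (∀ N → N ℕ.≤ f N) → s ⇝ L → (λ N → s (f N)) ⇝ L
lim-sub f N≤fN (mk⇝ p) = mk⇝ λ ε 0<ε → let M , h = p ε 0<ε in
  M , λ N M≤N → h (f N) (ℕ.≤-trans M≤N (N≤fN N))

record _⇝ᶜ_ (s : ℕ → ℂ) (L : ℂ) : Set where
  constructor mk⇝ᶜ
  field
    re⇝ : (λ N → re (s N)) ⇝ re L
    im⇝ : (λ N → im (s N)) ⇝ im L
open _⇝ᶜ_

⟶ᶜ⇒⇝ᶜ : ∀ {s L} → s ⟶ᶜ L → s ⇝ᶜ L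
⟶ᶜ⇒⇝ᶜ (p , q) = mk⇝ᶜ (⟶⇒⇝ p) (⟶⇒⇝ q)

⇝ᶜ⇒⟶ᶜ : ∀ {s L} → s ⇝ᶜ L → s ⟶ᶜ L
⇝ᶜ⇒⟶ᶜ (mk⇝ᶜ p q) = ⇝⇒⟶ p , ⇝⇒⟶ q

limᶜ-unique : ∀ {s L L′} → s ⇝ᶜ L → s ⇝ᶜ L′ → L ≋ᶜ L′
limᶜ-unique (mk⇝ᶜ p q) (mk⇝ᶜ p′ q′) = mk≋ᶜ (lim-unique p p′) (lim-unique q q′)

limᶜ-const : ∀ {L} → (λ _ → L) ⇝ᶜ L
limᶜ-const = mk⇝ᶜ lim-const lim-const

limᶜ-+ : ∀ {s t K L} → s ⇝ᶜ K → t ⇝ᶜ L → (λ N → s N +ᶜ t N) ⇝ᶜ K +ᶜ L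
limᶜ-+ (mk⇝ᶜ p q) (mk⇝ᶜ p′ q′) = mk⇝ᶜ (lim-+ p p′) (lim-+ q q′)

limᶜ-cong : ∀ {s t K L} → (∀ N → s N ≋ᶜ t N) → K ≋ᶜ L → s ⇝ᶜ K → t ⇝ᶜ L
limᶜ-cong s≋t K≋L (mk⇝ᶜ p q) =
  mk⇝ᶜ (lim-cong (λ N → re≋ (s≋t N)) (re≋ K≋L) p) (lim-cong (λ N → im≋ (s≋t N)) (im≋ K≋L) q)

limᶜ-* : ∀ {s L} c → s ⇝ᶜ L → (λ N → c *ᶜ s N) ⇝ᶜ c *ᶜ L
limᶜ-* {s} {L} c (mk⇝ᶜ p q) = mk⇝ᶜ
  (lim-cong (λ N → lemma (re c) (im c) (re (s N)) (im (s N))) (lemma (re c) (im c) (re L) (im L))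
    (lim-+ (lim-* (re c) p) (lim-* (-ᴿ im c) q)))
  (lim-+ (lim-* (re c) q) (lim-* (im c) p))
  where
  open R
  lemma = solve 4 (λ a b c d → a :* c :+ (:- b) :* d := a :* c :- b :* d) ≋-refl

-- Order

record Pos (x : ℝ) : Set where
  constructor mkPos
  field
    gap     : ℚ
    gap-pos : 0ℚ < gap
    gap≤    : Eventually (λ m → gap ≤ seq x m)
open Pos

<⇒pos : ∀ {x y} → x <ᴿ y → Pos (y -ᴿ x)
<⇒pos {x} {y} (ε , 0<ε , h) = mkPos ε 0<ε (ev-map (λ {m} p →
    ≤-by (seq y m - (seq x m + ε)) (p≤q⇒0≤q-p p) (lemma (seq x m) (seq y m) ε)) h)
  where
  open +-*-Solver
  lemma : ∀ x y ε → (y - x) - ε ≡ y - (x + ε)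
  lemma = solve 3 (λ x y ε → (y :- x) :- ε := y :- (x :+ ε)) refl

pos⇒< : ∀ {x y} → Pos (y -ᴿ x) → x <ᴿ y
pos⇒< {x} {y} (mkPos ε 0<ε h) = ε , 0<ε , ev-map (λ {m} p →
    ≤-by ((seq y m - seq x m) - ε) (p≤q⇒0≤q-p p) (lemma (seq x m) (seq y m) ε)) h
  where
  open +-*-Solver
  lemma : ∀ x y ε → y - (x + ε) ≡ (y - x) - ε
  lemma = solve 3 (λ x y ε → y :- (x :+ ε) := (y :- x) :- ε) refl

pos-cong : ∀ {x y} → x ≋ y → Pos x → Pos y
pos-cong {x} {y} x≋y (mkPos ε 0<ε h) = mkPos (½ * ε) (0<½* 0<ε) (ev-map (λ {m} (p , q) →
    ≤-by ((seq x m - ε) + (½ * ε - (seq x m - seq y m)))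
      (+-nonNeg (p≤q⇒0≤q-p p) (p≤q⇒0≤q-p (ℚ.≤-trans (p≤∣p∣ _) (ℚ.<⇒≤ q))))
      (lemma (seq x m) (seq y m) ε))
    (ev-× h (un≋ x≋y _ (0<½* 0<ε))))
  where
  open +-*-Solver
  lemma : ∀ x y ε → y - ½ * ε ≡ (x - ε) + (½ * ε - (x - y))
  lemma = solve 3 (λ x y ε → y :- con ½ :* ε := (x :- ε) :+ (con ½ :* ε :- (x :- y))) refl

0<⇒pos : ∀ {x} → 0ᴿ <ᴿ x → Pos x
0<⇒pos {x} h = pos-cong (R.solve 1 (λ x → x R.:- R.con (+ 0) R.:= x) ≋-refl x) (<⇒pos h)

pos⇒0< : ∀ {x} → Pos x → 0ᴿ <ᴿ x
pos⇒0< {x} h = pos⇒< (pos-cong (R.solve 1 (λ x → x R.:= x R.:- R.con (+ 0)) ≋-refl x) h)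

pos-fromℚ : ∀ {q} → 0ℚ < q → Pos (fromℚ q)
pos-fromℚ {q} 0<q = mkPos q 0<q (ev-all (λ _ → ℚ.≤-refl))

pos-+ : ∀ {x y} → Pos x → Pos y → Pos (x +ᴿ y)
pos-+ (mkPos ε 0<ε h) (mkPos δ 0<δ k) =
  mkPos (ε + δ) (ℚ.+-mono-< 0<ε 0<δ) (ev-map (λ (p , q) → ℚ.+-mono-≤ p q) (ev-× h k))

pos-* : ∀ {x y} → Pos x → Pos y → Pos (x *ᴿ y)
pos-* (mkPos ε 0<ε h) (mkPos δ 0<δ k) = mkPos (ε * δ) (*-pos 0<ε 0<δ) (ev-map
  (λ (p , q) → *-mono-≤ (ℚ.<⇒≤ 0<ε) (ℚ.≤-trans (ℚ.<⇒≤ 0<δ) q) p q) (ev-× h k))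

¬pos-0 : ¬ Pos 0ᴿ
¬pos-0 (mkPos ε 0<ε (N , h)) = ℚ.<-irrefl refl (ℚ.<-≤-trans 0<ε (h N ℕ.≤-refl))

-- A rational approximation of a + b decides which summand is bounded below.
pos-+⁻ : ∀ {x y} → Pos (x +ᴿ y) → Pos x ⊎ Pos y
pos-+⁻ {x} {y} (mkPos ε 0<ε h) = split (ev-× h (ev-× (K , cx) (L , cy)))
  where
  δ = ½ * (½ * ε)
  0<δ : 0ℚ < δ
  0<δ = 0<½* (0<½* 0<ε)
  K = proj₁ (cauchy x δ 0<δ)
  L = proj₁ (cauchy y δ 0<δ)
  cx : ∀ m → K ℕ.≤ m → ∀ n → K ℕ.≤ n → ∣ seq x m - seq x n ∣ < δ
  cx m p n q = proj₂ (cauchy x δ 0<δ) m n p q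
  cy : ∀ m → L ℕ.≤ m → ∀ n → L ℕ.≤ n → ∣ seq y m - seq y n ∣ < δ
  cy m p n q = proj₂ (cauchy y δ 0<δ) m n p q
  open +-*-Solver
  lemma₁ : ∀ a b e → b - ½ * (½ * e) ≡ (a - ½ * e) + (½ * (½ * e) - (a - b))
  lemma₁ = solve 3 (λ a b e → b :- con ½ :* (con ½ :* e) :=
    (a :- con ½ :* e) :+ (con ½ :* (con ½ :* e) :- (a :- b))) refl
  lemma₂ : ∀ a c e → c - ½ * e ≡ (½ * e - a) + ((a + c) - e)
  lemma₂ = solve 3 (λ a c e → c :- con ½ :* e := (con ½ :* e :- a) :+ ((a :+ c) :- e)) refl
  from : ∀ a b → ½ * ε ≤ a → ∣ a - b ∣ < δ → δ ≤ b
  from a b p q = ≤-by ((a - ½ * ε) + (δ - (a - b)))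
    (+-nonNeg (p≤q⇒0≤q-p p) (p≤q⇒0≤q-p (ℚ.≤-trans (p≤∣p∣ (a - b)) (ℚ.<⇒≤ q)))) (lemma₁ a b ε)
  split : Eventually (λ m → ε ≤ seq x m + seq y m
            × (∀ n → K ℕ.≤ n → ∣ seq x m - seq x n ∣ < δ) × (∀ n → L ℕ.≤ n → ∣ seq y m - seq y n ∣ < δ))
          → Pos x ⊎ Pos y
  split (N , k) = decide (k N ℕ.≤-refl) (ℚ.≤-total (½ * ε) (seq x N))
    where
    decide : _ → _ → _
    decide (s , p , q) (inj₁ le) = inj₁ (mkPos δ 0<δ (K , λ m K≤m → from (seq x N) (seq x m) le (p m K≤m)))
    decide (s , p , q) (inj₂ ge) = inj₂ (mkPos δ 0<δ (L , λ m L≤m → from (seq y N) (seq y m)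
      (≤-by ((½ * ε - seq x N) + ((seq x N + seq y N) - ε))
        (+-nonNeg (p≤q⇒0≤q-p ge) (p≤q⇒0≤q-p s)) (lemma₂ (seq x N) (seq y N) ε))
      (q m L≤m)))

-- If some approximation beyond the Cauchy index for ε/2 had absolute value at least ε, all later
-- ones would keep the same sign with absolute value at least ε/2, and x or -x would be positive.
¬pos⇒≋0 : ∀ {x} → ¬ Pos x → ¬ Pos (-ᴿ x) → x ≋ 0ᴿ
¬pos⇒≋0 {x} ¬p ¬n = mk≋ λ ε 0<ε →
  let δ = ½ * ε ; 0<δ = 0<½* 0<ε ; N , c = cauchy x δ 0<δ in
  N , λ m N≤m → subst (λ q → ∣ q ∣ < ε) (lemma₀ (seq x m)) (small (seq x m) ε 0<ε
    (λ ε≤ → ¬p (mkPos δ 0<δ (N , λ n N≤n → from (seq x m) (seq x n) ε ε≤ (c m n N≤m N≤n))))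
    (λ ε≤ → ¬n (mkPos δ 0<δ (N , λ n N≤n → from (- seq x m) (- seq x n) ε ε≤
      (subst (_< δ) (trans (sym (ℚ.∣-p∣≡∣p∣ _)) (cong ∣_∣ (lemma₃ (seq x m) (seq x n)))) (c m n N≤m N≤n))))))
  where
  open +-*-Solver
  lemma₀ : ∀ a → a ≡ a - 0ℚ
  lemma₀ = solve 1 (λ a → a := a :- con 0ℚ) refl
  lemma₁ : ∀ a b e → b - ½ * e ≡ (a - e) + (½ * e - (a - b))
  lemma₁ = solve 3 (λ a b e → b :- con ½ :* e := (a :- e) :+ (con ½ :* e :- (a :- b))) refl
  lemma₃ : ∀ a b → - (a - b) ≡ - a - - b
  lemma₃ = solve 2 (λ a b → :- (a :- b) := :- a :- :- b) refl
  from : ∀ a b ε → ε ≤ a → ∣ a - b ∣ < ½ * ε → ½ * ε ≤ b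
  from a b ε p q = ≤-by ((a - ε) + (½ * ε - (a - b)))
    (+-nonNeg (p≤q⇒0≤q-p p) (p≤q⇒0≤q-p (ℚ.≤-trans (p≤∣p∣ (a - b)) (ℚ.<⇒≤ q)))) (lemma₁ a b ε)
  small : ∀ a ε → 0ℚ < ε → ¬ (ε ≤ a) → ¬ (ε ≤ - a) → ∣ a ∣ < ε
  small a ε 0<ε p q = ∣p∣< (ℚ.≰⇒> p) (ℚ.≰⇒> q)

archimedean : ∀ {p} x → Pos p → ∃[ n ] Pos (ι (+ n) *ᴿ p -ᴿ x)
archimedean {p} x (mkPos ε 0<ε h) =
  let B , 0<B , b = cauchy-bounded (cauchy x)
      n , B<n = archimedeanℚ ((B + 1ℚ) ÷⁺ 0<ε)
  in n , mkPos 1ℚ 0<1 (ev-map (λ {m} (u , v) → bound (ιℕ n) B (seq p m) (seq x m)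
       (ιℚ-mono-≤ {+ 0} {+ n} (ℤ.+≤+ ℕ.z≤n)) B<n u v) (ev-× h b))
  where
  open +-*-Solver
  lemma : ∀ n B e p x → (n * p - x) - 1ℚ ≡ n * (p - e) + ((n * e - (B + 1ℚ)) + (B - x))
  lemma = solve 5 (λ n B e p x → (n :* p :- x) :- con 1ℚ :=
    n :* (p :- e) :+ ((n :* e :- (B :+ con 1ℚ)) :+ (B :- x))) refl
  bound : ∀ n B p x → 0ℚ ≤ n → (B + 1ℚ) ÷⁺ 0<ε ≤ n → ε ≤ p → ∣ x ∣ ≤ B → 1ℚ ≤ n * p - x
  bound n B p x 0≤n q≤n ε≤p x≤B = ≤-by (n * (p - ε) + ((n * ε - (B + 1ℚ)) + (B - x)))
    (+-nonNeg (*-nonNeg 0≤n (p≤q⇒0≤q-p ε≤p)) (+-nonNeg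
      (p≤q⇒0≤q-p (subst (_≤ n * ε) (trans (ℚ.*-comm _ ε) (*-÷⁺ (B + 1ℚ) 0<ε))
        (ℚ.*-monoʳ-≤-nonNeg ε {{ℚ.nonNegative (ℚ.<⇒≤ 0<ε)}} q≤n)))
      (p≤q⇒0≤q-p (ℚ.≤-trans (p≤∣p∣ x) x≤B))))
    (lemma n B ε p x)

-- The exponential series over the Gaussian rationals

-- Without eta the operations stay folded on neutral arguments.
record 𝔾 : Set where
  no-eta-equality
  pattern
  constructor _+𝕚_
  field
    reᴳ imᴳ : ℚ
open 𝔾

infix  4 _+𝕚_
infixl 6 _+ᴳ_ _-ᴳ_
infixl 7 _*ᴳ_
infix  8 -ᴳ_

_+ᴳ_ _*ᴳ_ : 𝔾 → 𝔾 → 𝔾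
(a +𝕚 b) +ᴳ (c +𝕚 d) = a + c +𝕚 b + d
(a +𝕚 b) *ᴳ (c +𝕚 d) = a * c - b * d +𝕚 a * d + b * c

-ᴳ_ : 𝔾 → 𝔾
-ᴳ (a +𝕚 b) = - a +𝕚 - b

_-ᴳ_ : 𝔾 → 𝔾 → 𝔾
g -ᴳ h = g +ᴳ (-ᴳ h)

0ᴳ 1ᴳ : 𝔾
0ᴳ = 0ℚ +𝕚 0ℚ
1ᴳ = 1ℚ +𝕚 0ℚ

𝔾-ring : CommutativeRing 0ℓ 0ℓ
𝔾-ring = record
  { Carrier = 𝔾 ; _≈_ = _≡_ ; _+_ = _+ᴳ_ ; _*_ = _*ᴳ_ ; -_ = -ᴳ_ ; 0# = 0ᴳ ; 1# = 1ᴳ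
  ; isCommutativeRing = record
    { isRing = record
      { +-isAbelianGroup = record
        { isGroup = record
          { isMonoid = record
            { isSemigroup = record
              { isMagma = record
                { isEquivalence = record { refl = refl ; sym = sym ; trans = trans }
                ; ∙-cong = cong₂ _+ᴳ_ }
              ; assoc = λ { (a +𝕚 b) (c +𝕚 d) (e +𝕚 f) → cong₂ _+𝕚_ (ℚ.+-assoc a c e) (ℚ.+-assoc b d f) } }
            ; identity = (λ { (a +𝕚 b) → cong₂ _+𝕚_ (ℚ.+-identityˡ a) (ℚ.+-identityˡ b) })
                       , (λ { (a +𝕚 b) → cong₂ _+𝕚_ (ℚ.+-identityʳ a) (ℚ.+-identityʳ b) }) }
          ; inverse = (λ { (a +𝕚 b) → cong₂ _+𝕚_ (ℚ.+-inverseˡ a) (ℚ.+-inverseˡ b) })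
                    , (λ { (a +𝕚 b) → cong₂ _+𝕚_ (ℚ.+-inverseʳ a) (ℚ.+-inverseʳ b) })
          ; ⁻¹-cong = cong (λ g → -ᴳ g) }
        ; comm = λ { (a +𝕚 b) (c +𝕚 d) → cong₂ _+𝕚_ (ℚ.+-comm a c) (ℚ.+-comm b d) } }
      ; *-cong = cong₂ _*ᴳ_
      ; *-assoc = λ { (a +𝕚 b) (c +𝕚 d) (e +𝕚 f) → cong₂ _+𝕚_ (assoc-re a b c d e f) (assoc-im a b c d e f) }
      ; *-identity = (λ { (a +𝕚 b) → cong₂ _+𝕚_ (idˡ-re a b) (idˡ-im a b) })
                   , (λ { (a +𝕚 b) → cong₂ _+𝕚_ (idʳ-re a b) (idʳ-im a b) })
      ; distrib = (λ { (a +𝕚 b) (c +𝕚 d) (e +𝕚 f) → cong₂ _+𝕚_ (distˡ-re a b c d e f) (distˡ-im a b c d e f) })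
                , (λ { (a +𝕚 b) (c +𝕚 d) (e +𝕚 f) → cong₂ _+𝕚_ (distʳ-re a b c d e f) (distʳ-im a b c d e f) }) }
    ; *-comm = λ { (a +𝕚 b) (c +𝕚 d) → cong₂ _+𝕚_ (comm-re a b c d) (comm-im a b c d) } } }
  where
  open +-*-Solver
  assoc-re = solve 6 (λ a b c d e f →
    (a :* c :- b :* d) :* e :- (a :* d :+ b :* c) :* f :=
    a :* (c :* e :- d :* f) :- b :* (c :* f :+ d :* e)) refl
  assoc-im = solve 6 (λ a b c d e f →
    (a :* c :- b :* d) :* f :+ (a :* d :+ b :* c) :* e :=
    a :* (c :* f :+ d :* e) :+ b :* (c :* e :- d :* f)) refl
  idˡ-re = solve 2 (λ a b → con 1ℚ :* a :- con 0ℚ :* b := a) refl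
  idˡ-im = solve 2 (λ a b → con 1ℚ :* b :+ con 0ℚ :* a := b) refl
  idʳ-re = solve 2 (λ a b → a :* con 1ℚ :- b :* con 0ℚ := a) refl
  idʳ-im = solve 2 (λ a b → a :* con 0ℚ :+ b :* con 1ℚ := b) refl
  distˡ-re = solve 6 (λ a b c d e f →
    a :* (c :+ e) :- b :* (d :+ f) := (a :* c :- b :* d) :+ (a :* e :- b :* f)) refl
  distˡ-im = solve 6 (λ a b c d e f →
    a :* (d :+ f) :+ b :* (c :+ e) := (a :* d :+ b :* c) :+ (a :* f :+ b :* e)) refl
  distʳ-re = solve 6 (λ a b c d e f →
    (c :+ e) :* a :- (d :+ f) :* b := (c :* a :- d :* b) :+ (e :* a :- f :* b)) refl
  distʳ-im = solve 6 (λ a b c d e f →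
    (c :+ e) :* b :+ (d :+ f) :* a := (c :* b :+ d :* a) :+ (e :* b :+ f :* a)) refl
  comm-re = solve 4 (λ a b c d → a :* c :- b :* d := c :* a :- d :* b) refl
  comm-im = solve 4 (λ a b c d → a :* d :+ b :* c := c :* b :+ d :* a) refl

_≟ᴳ_ : DecidableEquality 𝔾
(a +𝕚 b) ≟ᴳ (c +𝕚 d) = map′ (λ (p , q) → cong₂ _+𝕚_ p q) (λ { refl → refl , refl }) ((a ℚ.≟ c) ×-dec (b ℚ.≟ d))

module 𝔾-Solver = Algebra.Solver.Ring.Simple (fromCommutativeRing 𝔾-ring) _≟ᴳ_
module G where
  open CommutativeRing 𝔾-ring public
  open 𝔾-Solver public

-- The sum norm: unlike the modulus it stays rational, yet it is submultiplicative and dominates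
-- both parts.
‖_‖ : 𝔾 → ℚ
‖ a +𝕚 b ‖ = ∣ a ∣ + ∣ b ∣

0≤‖‖ : ∀ g → 0ℚ ≤ ‖ g ‖
0≤‖‖ (a +𝕚 b) = +-nonNeg (ℚ.0≤∣p∣ a) (ℚ.0≤∣p∣ b)

∣re∣≤‖‖ : ∀ g → ∣ reᴳ g ∣ ≤ ‖ g ‖
∣re∣≤‖‖ (a +𝕚 b) = subst (_≤ ∣ a ∣ + ∣ b ∣) (ℚ.+-identityʳ ∣ a ∣) (ℚ.+-monoʳ-≤ ∣ a ∣ (ℚ.0≤∣p∣ b))

∣im∣≤‖‖ : ∀ g → ∣ imᴳ g ∣ ≤ ‖ g ‖
∣im∣≤‖‖ (a +𝕚 b) = subst (_≤ ∣ a ∣ + ∣ b ∣) (ℚ.+-identityˡ ∣ b ∣) (ℚ.+-monoˡ-≤ ∣ b ∣ (ℚ.0≤∣p∣ a))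

‖-‖-neg : ∀ g → ‖ -ᴳ g ‖ ≡ ‖ g ‖
‖-‖-neg (a +𝕚 b) = cong₂ _+_ (ℚ.∣-p∣≡∣p∣ a) (ℚ.∣-p∣≡∣p∣ b)

‖‖-+ : ∀ g h → ‖ g +ᴳ h ‖ ≤ ‖ g ‖ + ‖ h ‖
‖‖-+ (a +𝕚 b) (c +𝕚 d) = ℚ.≤-trans (ℚ.+-mono-≤ (ℚ.∣p+q∣≤∣p∣+∣q∣ a c) (ℚ.∣p+q∣≤∣p∣+∣q∣ b d))
  (ℚ.≤-reflexive (lemma (∣ a ∣) (∣ b ∣) (∣ c ∣) (∣ d ∣)))
  where
  open +-*-Solver
  lemma : ∀ a b c d → (a + c) + (b + d) ≡ (a + b) + (c + d)
  lemma = solve 4 (λ a b c d → (a :+ c) :+ (b :+ d) := (a :+ b) :+ (c :+ d)) refl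

‖‖-* : ∀ g h → ‖ g *ᴳ h ‖ ≤ ‖ g ‖ * ‖ h ‖
‖‖-* (a +𝕚 b) (c +𝕚 d) = begin
    ∣ a * c - b * d ∣ + ∣ a * d + b * c ∣
      ≤⟨ ℚ.+-mono-≤ (ℚ.∣p-q∣≤∣p∣+∣q∣ (a * c) (b * d)) (ℚ.∣p+q∣≤∣p∣+∣q∣ (a * d) (b * c)) ⟩
    (∣ a * c ∣ + ∣ b * d ∣) + (∣ a * d ∣ + ∣ b * c ∣)
      ≡⟨ cong₂ _+_ (cong₂ _+_ (ℚ.∣p*q∣≡∣p∣*∣q∣ a c) (ℚ.∣p*q∣≡∣p∣*∣q∣ b d))
                   (cong₂ _+_ (ℚ.∣p*q∣≡∣p∣*∣q∣ a d) (ℚ.∣p*q∣≡∣p∣*∣q∣ b c)) ⟩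
    (∣ a ∣ * ∣ c ∣ + ∣ b ∣ * ∣ d ∣) + (∣ a ∣ * ∣ d ∣ + ∣ b ∣ * ∣ c ∣)
      ≡⟨ lemma (∣ a ∣) (∣ b ∣) (∣ c ∣) (∣ d ∣) ⟩
    (∣ a ∣ + ∣ b ∣) * (∣ c ∣ + ∣ d ∣) ∎
  where
  open ℚ.≤-Reasoning
  open +-*-Solver
  lemma : ∀ a b c d → (a * c + b * d) + (a * d + b * c) ≡ (a + b) * (c + d)
  lemma = solve 4 (λ a b c d → (a :* c :+ b :* d) :+ (a :* d :+ b :* c) := (a :+ b) :* (c :+ d)) refl

‖‖-scale : ∀ q b → ‖ (0ℚ +𝕚 q) *ᴳ b ‖ ≤ ∣ q ∣ * ‖ b ‖
‖‖-scale q b = ℚ.≤-trans (‖‖-* (0ℚ +𝕚 q) b) (ℚ.≤-reflexive (cong (_* ‖ b ‖) (ℚ.+-identityˡ ∣ q ∣)))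

‖‖-real : ∀ q b → ‖ (q +𝕚 0ℚ) *ᴳ b ‖ ≤ ∣ q ∣ * ‖ b ‖
‖‖-real q b = ℚ.≤-trans (‖‖-* (q +𝕚 0ℚ) b) (ℚ.≤-reflexive (cong (_* ‖ b ‖) (ℚ.+-identityʳ ∣ q ∣)))

ν : ℕ → 𝔾
ν n = ιℕ n +𝕚 0ℚ

ν-suc : ∀ n → ν (suc n) ≡ 1ᴳ +ᴳ ν n
ν-suc n = cong₂ _+𝕚_ (ιℚ-+ (+ 1) (+ n)) refl

recip : ℕ → ℚ
recip n = (+ 1) / suc n

recip-inverse : ∀ n → ιℕ (suc n) * recip n ≡ 1ℚ
recip-inverse n = ℚ.toℚᵘ-injective (ℚᵘ.≃-trans (ℚ.toℚᵘ-homo-* (ιℕ (suc n)) (recip n))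
  (ℚᵘ.≃-trans (ℚᵘ.*-congˡ {ℚ.toℚᵘ (ιℕ (suc n))} (ℚ.toℚᵘ-fromℚᵘ (ℚᵘ.mkℚᵘ (+ 1) n)))
    (ℚᵘ.*≡* (trans (ℤ.*-identityʳ _) (trans (ℤ.*-identityʳ (+ suc n))
      (sym (trans (ℤ.*-identityˡ _) (ℤ.*-identityˡ (+ suc n)))))))))

recip-pos : ∀ n → 0ℚ < recip n
recip-pos n = ℚ.positive⁻¹ (recip n) {{ℚ.normalize-pos 1 (suc n)}}

-- term q m is (iq)ᵐ / m!.
term : ℚ → ℕ → 𝔾
term q zero    = 1ᴳ
term q (suc m) = (recip m +𝕚 0ℚ) *ᴳ ((0ℚ +𝕚 q) *ᴳ term q m)

expᴳ : ℚ → ℕ → 𝔾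
expᴳ q zero    = 0ᴳ
expᴳ q (suc N) = expᴳ q N +ᴳ term q N

-- majorant B m is Bᵐ / m!.
majorant : ℚ → ℕ → ℚ
majorant B zero    = 1ℚ
majorant B (suc m) = recip m * (B * majorant B m)

majorant-nonNeg : ∀ {B} → 0ℚ ≤ B → ∀ m → 0ℚ ≤ majorant B m
majorant-nonNeg 0≤B zero    = ℚ.<⇒≤ 0<1
majorant-nonNeg 0≤B (suc m) = *-nonNeg (ℚ.<⇒≤ (recip-pos m)) (*-nonNeg 0≤B (majorant-nonNeg 0≤B m))

∣q∣≤B⇒0≤B : ∀ q {B} → ∣ q ∣ ≤ B → 0ℚ ≤ B
∣q∣≤B⇒0≤B q = ℚ.≤-trans (ℚ.0≤∣p∣ q)

∣recip∣ : ∀ m → ∣ recip m ∣ ≡ recip m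
∣recip∣ m = ℚ.0≤p⇒∣p∣≡p (ℚ.<⇒≤ (recip-pos m))

term-bound : ∀ {q B} → ∣ q ∣ ≤ B → ∀ m → ‖ term q m ‖ ≤ majorant B m
term-bound {q} {B} q≤B zero    = ℚ.≤-refl
term-bound {q} {B} q≤B (suc m) = begin
    ‖ (recip m +𝕚 0ℚ) *ᴳ ((0ℚ +𝕚 q) *ᴳ term q m) ‖   ≤⟨ ‖‖-real (recip m) ((0ℚ +𝕚 q) *ᴳ term q m) ⟩
    ∣ recip m ∣ * ‖ (0ℚ +𝕚 q) *ᴳ term q m ‖          ≤⟨ *-mono-≤ (ℚ.0≤∣p∣ (recip m))
      (*-nonNeg (∣q∣≤B⇒0≤B q q≤B) (majorant-nonNeg (∣q∣≤B⇒0≤B q q≤B) m)) (ℚ.≤-reflexive (∣recip∣ m))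
      (ℚ.≤-trans (‖‖-scale q (term q m))
        (*-mono-≤ (ℚ.0≤∣p∣ q) (majorant-nonNeg (∣q∣≤B⇒0≤B q q≤B) m) q≤B (term-bound q≤B m))) ⟩
    recip m * (B * majorant B m)                      ∎
  where open ℚ.≤-Reasoning

B*majorant : ∀ B m → B * majorant B m ≡ ιℕ (suc m) * majorant B (suc m)
B*majorant B m = sym (trans (sym (ℚ.*-assoc (ιℕ (suc m)) (recip m) (B * majorant B m)))
  (trans (cong (_* (B * majorant B m)) (recip-inverse m)) (ℚ.*-identityˡ _)))

-- The derivative of z^(m+1)/(m+1)! is z^m/m!. A product rule takes the place of differentiation:
-- the induction hypothesis contributes m copies of the bound, the new factor one more, and together
-- they cancel 1/(m+1).
term-lipschitz : ∀ {p q B} → ∣ p ∣ ≤ B → ∣ q ∣ ≤ B → ∀ m →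
  ‖ term p (suc m) -ᴳ term q (suc m) ‖ ≤ ∣ p - q ∣ * majorant B m
term-lipschitz {p} {q} {B} p≤B q≤B m = begin
    ‖ term p (suc m) -ᴳ term q (suc m) ‖
      ≡⟨ cong ‖_‖ (expand (recip m +𝕚 0ℚ) p q (term p m) (term q m)) ⟩
    ‖ (recip m +𝕚 0ℚ) *ᴳ ((0ℚ +𝕚 p) *ᴳ (term p m -ᴳ term q m) +ᴳ (0ℚ +𝕚 p - q) *ᴳ term q m) ‖
      ≤⟨ ‖‖-real (recip m) ((0ℚ +𝕚 p) *ᴳ Δ +ᴳ (0ℚ +𝕚 p - q) *ᴳ term q m) ⟩
    ∣ recip m ∣ * ‖ (0ℚ +𝕚 p) *ᴳ (term p m -ᴳ term q m) +ᴳ (0ℚ +𝕚 p - q) *ᴳ term q m ‖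
      ≤⟨ *-mono-≤ (ℚ.0≤∣p∣ (recip m)) (+-nonNeg (*-nonNeg 0≤B (0≤‖‖ Δ)) (*-nonNeg (ℚ.0≤∣p∣ (p - q)) (majorant-nonNeg 0≤B m)))
           (ℚ.≤-reflexive (∣recip∣ m))
           (ℚ.≤-trans (‖‖-+ ((0ℚ +𝕚 p) *ᴳ Δ) ((0ℚ +𝕚 p - q) *ᴳ term q m)) (ℚ.+-mono-≤
             (ℚ.≤-trans (‖‖-scale p Δ) (*-mono-≤ (ℚ.0≤∣p∣ p) (0≤‖‖ Δ) p≤B ℚ.≤-refl))
             (ℚ.≤-trans (‖‖-scale (p - q) (term q m))
               (*-mono-≤ (ℚ.0≤∣p∣ (p - q)) (majorant-nonNeg 0≤B m) ℚ.≤-refl (term-bound q≤B m))))) ⟩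
    recip m * (B * ‖ term p m -ᴳ term q m ‖ + ∣ p - q ∣ * majorant B m)
      ≤⟨ *-mono-≤ (ℚ.<⇒≤ (recip-pos m))
           (+-nonNeg (*-nonNeg (ℚ.0≤∣p∣ (p - q)) (*-nonNeg (ιℚ-mono-≤ {+ 0} {+ m} (ℤ.+≤+ ℕ.z≤n)) (majorant-nonNeg 0≤B m)))
             (*-nonNeg (ℚ.0≤∣p∣ (p - q)) (majorant-nonNeg 0≤B m)))
           ℚ.≤-refl (ℚ.+-monoˡ-≤ _ (previous m)) ⟩
    recip m * (∣ p - q ∣ * (ιℕ m * majorant B m) + ∣ p - q ∣ * majorant B m)
      ≡⟨ collect (recip m) (∣ p - q ∣) (ιℕ m) (majorant B m) ⟩
    ((1ℚ + ιℕ m) * recip m) * (∣ p - q ∣ * majorant B m)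
      ≡⟨ cong (_* (∣ p - q ∣ * majorant B m)) (trans (cong (_* recip m) (sym (ιℚ-+ (+ 1) (+ m)))) (recip-inverse m)) ⟩
    1ℚ * (∣ p - q ∣ * majorant B m)
      ≡⟨ ℚ.*-identityˡ _ ⟩
    ∣ p - q ∣ * majorant B m ∎
  where
  open ℚ.≤-Reasoning
  Δ : 𝔾
  Δ = term p m -ᴳ term q m
  0≤B : 0ℚ ≤ B
  0≤B = ∣q∣≤B⇒0≤B q q≤B
  expand : ∀ r p q s t → r *ᴳ ((0ℚ +𝕚 p) *ᴳ s) -ᴳ r *ᴳ ((0ℚ +𝕚 q) *ᴳ t) ≡
    r *ᴳ ((0ℚ +𝕚 p) *ᴳ (s -ᴳ t) +ᴳ (0ℚ +𝕚 p - q) *ᴳ t)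
  expand r p q s t = G.solve 5 (λ r p q s t → r G.:* (p G.:* s) G.:- r G.:* (q G.:* t) G.:=
      r G.:* (p G.:* (s G.:- t) G.:+ (p G.:- q) G.:* t)) refl r (0ℚ +𝕚 p) (0ℚ +𝕚 q) s t
  collect : ∀ r d n b → r * (d * (n * b) + d * b) ≡ ((1ℚ + n) * r) * (d * b)
  collect = solve 4 (λ r d n b → r :* (d :* (n :* b) :+ d :* b) := ((con 1ℚ :+ n) :* r) :* (d :* b)) refl
    where open +-*-Solver
  previous : ∀ m → B * ‖ term p m -ᴳ term q m ‖ ≤ ∣ p - q ∣ * (ιℕ m * majorant B m)
  previous zero = ℚ.≤-reflexive (trans (ℚ.*-zeroʳ B) (sym (trans (cong (∣ p - q ∣ *_) (ℚ.*-zeroˡ 1ℚ)) (ℚ.*-zeroʳ ∣ p - q ∣))))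
  previous (suc m) = ℚ.≤-trans (*-mono-≤ 0≤B (*-nonNeg (ℚ.0≤∣p∣ (p - q)) (majorant-nonNeg 0≤B m)) ℚ.≤-refl
    (term-lipschitz p≤B q≤B m))
    (ℚ.≤-reflexive (trans (swap B (∣ p - q ∣) (majorant B m)) (cong (∣ p - q ∣ *_) (B*majorant B m))))
    where
    swap : ∀ b d m → b * (d * m) ≡ d * (b * m)
    swap = solve 3 (λ b d m → b :* (d :* m) := d :* (b :* m)) refl
      where open +-*-Solver

infixr 8 _^ℚ_

_^ℚ_ : ℚ → ℕ → ℚ
r ^ℚ zero  = 1ℚ
r ^ℚ suc m = r * r ^ℚ m

¼ : ℚ
¼ = ½ * ½

^ℚ-nonNeg : ∀ {r} → 0ℚ ≤ r → ∀ m → 0ℚ ≤ r ^ℚ m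
^ℚ-nonNeg 0≤r zero    = ℚ.<⇒≤ 0<1
^ℚ-nonNeg 0≤r (suc m) = *-nonNeg 0≤r (^ℚ-nonNeg 0≤r m)

0≤½ : 0ℚ ≤ ½
0≤½ = ℚ.<⇒≤ 0<½

0≤¼ : 0ℚ ≤ ¼
0≤¼ = ℚ.nonNegative⁻¹ ¼

-- Since (m + 1) / 2ᵐ ≤ 1.
½^≤recip : ∀ m → ½ ^ℚ m ≤ recip m
½^≤recip m = ≤-by ((1ℚ - ιℕ (suc m) * ½ ^ℚ m) * recip m)
    (*-nonNeg (p≤q⇒0≤q-p (bound m)) (ℚ.<⇒≤ (recip-pos m))) (eq (recip m) (ιℕ (suc m)) (½ ^ℚ m) (recip-inverse m))
  where
  open +-*-Solver
  lem : ∀ r n x → r - x ≡ (1ℚ - n * x) * r + x * (n * r - 1ℚ)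
  lem = solve 3 (λ r n x → r :- x := (con 1ℚ :- n :* x) :* r :+ x :* (n :* r :- con 1ℚ)) refl
  eq : ∀ r n x → n * r ≡ 1ℚ → r - x ≡ (1ℚ - n * x) * r
  eq r n x nr = trans (lem r n x) (trans (cong (λ u → (1ℚ - n * x) * r + x * (u - 1ℚ)) nr)
    (trans (cong (_+_ ((1ℚ - n * x) * r)) (ℚ.*-zeroʳ x)) (ℚ.+-identityʳ _)))
  lem₂ : ∀ n x → 1ℚ - (1ℚ + n) * (½ * x) ≡ (1ℚ - n * x) * ½ + ½ * (1ℚ - x)
  lem₂ = solve 2 (λ n x → con 1ℚ :- (con 1ℚ :+ n) :* (con ½ :* x) :=
    (con 1ℚ :- n :* x) :* con ½ :+ con ½ :* (con 1ℚ :- x)) refl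
  lem₃ : ∀ x → 1ℚ - ½ * x ≡ ½ * (1ℚ - x) + ½
  lem₃ = solve 1 (λ x → con 1ℚ :- con ½ :* x := con ½ :* (con 1ℚ :- x) :+ con ½) refl
  ≤1 : ∀ m → ½ ^ℚ m ≤ 1ℚ
  ≤1 zero    = ℚ.≤-refl
  ≤1 (suc m) = ≤-by _ (+-nonNeg (*-nonNeg 0≤½ (p≤q⇒0≤q-p (≤1 m))) 0≤½) (lem₃ (½ ^ℚ m))
  bound : ∀ m → ιℕ (suc m) * ½ ^ℚ m ≤ 1ℚ
  bound zero    = ℚ.≤-refl
  bound (suc m) = subst (λ n → n * (½ * ½ ^ℚ m) ≤ 1ℚ) (sym (ιℚ-+ (+ 1) (+ suc m)))
    (≤-by _ (+-nonNeg (*-nonNeg (p≤q⇒0≤q-p (bound m)) 0≤½) (*-nonNeg 0≤½ (p≤q⇒0≤q-p (≤1 m))))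
      (lem₂ (ιℕ (suc m)) (½ ^ℚ m)))

null-recip : Null recip
null-recip ε 0<ε = let n , h = archimedeanℚ (1ℚ ÷⁺ 0<ε) in
  n , λ m n≤m → subst (_< ε) (sym (∣recip∣ m)) (ℚ.*-cancelˡ-<-nonNeg (ιℕ (suc m))
    {{ℚ.nonNegative (ιℚ-mono-≤ {+ 0} {+ suc m} (ℤ.+≤+ ℕ.z≤n))}}
    (subst₂ _<_ (sym (recip-inverse m)) (ℚ.*-comm ε (ιℕ (suc m)))
      (subst (_< ε * ιℕ (suc m)) (*-÷⁺ 1ℚ 0<ε) (ℚ.*-monoʳ-<-pos ε {{ℚ.positive 0<ε}}
        (ℚ.≤-<-trans h (ιℚ-mono-< {+ n} {+ suc m} (ℤ.+<+ (ℕ.s≤s n≤m))))))))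

null-½^ : ∀ C → Null (λ m → C * ½ ^ℚ m)
null-½^ C = null-* {λ _ → C} {½ ^ℚ_} (const-bounded C) (null-≤ null-recip (ev-all λ m →
  subst (_≤ recip m) (sym (ℚ.0≤p⇒∣p∣≡p (^ℚ-nonNeg 0≤½ m))) (½^≤recip m)))

¼^≤½^ : ∀ m → ¼ ^ℚ m ≤ ½ ^ℚ m
¼^≤½^ zero    = ℚ.≤-refl
¼^≤½^ (suc m) = *-mono-≤ {¼} {½} 0≤¼ (^ℚ-nonNeg 0≤½ m) (ℚ.*≤* (ℤ.+≤+ (ℕ.s≤s (ℕ.s≤s ℕ.z≤n)))) (¼^≤½^ m)

-- The induction proves the sharper bound 2 b(N) - 2 b(d+N): since b at least halves at every step,
-- the next term is paid for by the decrease of the subtracted part.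
tail-bound : ∀ {S f : ℕ → 𝔾} {b : ℕ → ℚ} N → (∀ m → S (suc m) ≡ S m +ᴳ f m) →
  (∀ d → ‖ f (d ℕ.+ N) ‖ ≤ b (d ℕ.+ N)) →
  (∀ d → b (suc d ℕ.+ N) + b (suc d ℕ.+ N) ≤ b (d ℕ.+ N)) → (∀ d → 0ℚ ≤ b (d ℕ.+ N)) →
  ∀ d → ‖ S (d ℕ.+ N) -ᴳ S N ‖ ≤ b N + b N
tail-bound {S} {f} {b} N S-suc f≤b halves 0≤b d =
  ℚ.≤-trans (go d) (≤-by _ (+-nonNeg (0≤b d) (0≤b d)) (lemma₀ (b N) (b (d ℕ.+ N))))
  where
  open +-*-Solver
  lemma₀ : ∀ a c → (a + a) - ((a + a) - (c + c)) ≡ c + c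
  lemma₀ = solve 2 (λ a c → (a :+ a) :- ((a :+ a) :- (c :+ c)) := c :+ c) refl
  lemma₁ : ∀ a c e → ((a + a) - (e + e)) - (((a + a) - (c + c)) + c) ≡ c - (e + e)
  lemma₁ = solve 3 (λ a c e → ((a :+ a) :- (e :+ e)) :- (((a :+ a) :- (c :+ c)) :+ c) := c :- (e :+ e)) refl
  lemma₂ : ∀ x y z → (x +ᴳ y) -ᴳ z ≡ (x -ᴳ z) +ᴳ y
  lemma₂ = G.solve 3 (λ x y z → (x G.:+ y) G.:- z G.:= (x G.:- z) G.:+ y) refl
  go : ∀ d → ‖ S (d ℕ.+ N) -ᴳ S N ‖ ≤ (b N + b N) - (b (d ℕ.+ N) + b (d ℕ.+ N))
  go zero    = ℚ.≤-reflexive (trans (cong ‖_‖ (G.-‿inverseʳ (S N))) (sym (ℚ.+-inverseʳ (b N + b N))))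
  go (suc d) = begin
    ‖ S (suc d ℕ.+ N) -ᴳ S N ‖                        ≡⟨ cong (λ g → ‖ g -ᴳ S N ‖) (S-suc (d ℕ.+ N)) ⟩
    ‖ (S (d ℕ.+ N) +ᴳ f (d ℕ.+ N)) -ᴳ S N ‖           ≡⟨ cong ‖_‖ (lemma₂ (S (d ℕ.+ N)) (f (d ℕ.+ N)) (S N)) ⟩
    ‖ (S (d ℕ.+ N) -ᴳ S N) +ᴳ f (d ℕ.+ N) ‖           ≤⟨ ‖‖-+ (S (d ℕ.+ N) -ᴳ S N) (f (d ℕ.+ N)) ⟩
    ‖ S (d ℕ.+ N) -ᴳ S N ‖ + ‖ f (d ℕ.+ N) ‖          ≤⟨ ℚ.+-mono-≤ (go d) (f≤b d) ⟩
    ((b N + b N) - (b (d ℕ.+ N) + b (d ℕ.+ N))) + b (d ℕ.+ N)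
      ≤⟨ ≤-by _ (p≤q⇒0≤q-p (halves d)) (lemma₁ (b N) (b (d ℕ.+ N)) (b (suc d ℕ.+ N))) ⟩
    (b N + b N) - (b (suc d ℕ.+ N) + b (suc d ℕ.+ N)) ∎
    where open ℚ.≤-Reasoning

-- The first s values are unconstrained. Each of them is absorbed into the constant, and shifting
-- the index by one costs a factor 4.
geometric-bound : ∀ s (b : ℕ → ℚ) → (∀ m → 0ℚ ≤ b m) → (∀ m → s ℕ.≤ m → b (suc m) ≤ ¼ * b m) →
  ∃[ K ] (0ℚ < K × (∀ m → b m ≤ K * ¼ ^ℚ m))
geometric-bound zero b 0≤b h = 1ℚ + b 0 , ℚ.+-mono-<-≤ 0<1 (0≤b 0) , go
  where
  open +-*-Solver
  lemma₀ : ∀ x → (1ℚ + x) * 1ℚ - x ≡ 1ℚ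
  lemma₀ = solve 1 (λ x → (con 1ℚ :+ x) :* con 1ℚ :- x := con 1ℚ) refl
  lemma₁ : ∀ q k x → q * (k * x) ≡ k * (q * x)
  lemma₁ = solve 3 (λ q k x → q :* (k :* x) := k :* (q :* x)) refl
  go : ∀ m → b m ≤ (1ℚ + b 0) * ¼ ^ℚ m
  go zero    = ≤-by 1ℚ (ℚ.<⇒≤ 0<1) (lemma₀ (b 0))
  go (suc m) = ℚ.≤-trans (h m ℕ.z≤n) (ℚ.≤-trans (ℚ.*-monoˡ-≤-nonNeg ¼ (go m))
    (ℚ.≤-reflexive (lemma₁ ¼ (1ℚ + b 0) (¼ ^ℚ m))))
geometric-bound (suc s) b 0≤b h =
  let K , 0<K , g = geometric-bound s (λ m → b (suc m)) (λ m → 0≤b (suc m)) (λ m s≤m → h (suc m) (ℕ.s≤s s≤m)) in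
  b 0 + ιℕ 4 * K , ℚ.+-mono-≤-< (0≤b 0) (*-pos (ℚ.positive⁻¹ (ιℕ 4)) 0<K) , λ
    { zero    → ≤-by _ (*-nonNeg (ℚ.nonNegative⁻¹ (ιℕ 4)) (ℚ.<⇒≤ 0<K)) (lemma₀ (b 0) K)
    ; (suc m) → ℚ.≤-trans (g m) (≤-by _ (*-nonNeg (0≤b 0) (*-nonNeg 0≤¼ (^ℚ-nonNeg 0≤¼ m))) (lemma₁ (b 0) K (¼ ^ℚ m))) }
  where
  open +-*-Solver
  lemma₀ : ∀ b K → (b + ιℕ 4 * K) * 1ℚ - b ≡ ιℕ 4 * K
  lemma₀ = solve 2 (λ b K → (b :+ con (ιℕ 4) :* K) :* con 1ℚ :- b := con (ιℕ 4) :* K) refl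
  lemma₁ : ∀ b K x → (b + ιℕ 4 * K) * (¼ * x) - K * x ≡ b * (¼ * x)
  lemma₁ = solve 3 (λ b K x → (b :+ con (ιℕ 4) :* K) :* (con ¼ :* x) :- K :* x := b :* (con ¼ :* x)) refl

-- The ratio B/(m+1) is at most 1/4 once m + 1 ≥ 4B. The ratio 1/4 leaves room for products: the
-- error of a Cauchy product of two such sequences still decays like 1/2^m.
majorant-geometric : ∀ {B} → 0ℚ ≤ B → ∃[ K ] (0ℚ < K × (∀ m → majorant B m ≤ K * ¼ ^ℚ m))
majorant-geometric {B} 0≤B = let n , h = archimedeanℚ (ιℕ 4 * B) in
  geometric-bound n (majorant B) (majorant-nonNeg 0≤B) (λ m n≤m →
    ≤-by (((ιℕ (suc m) - ιℕ 4 * B) * ¼) * (recip m * majorant B m))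
      (*-nonNeg (*-nonNeg (p≤q⇒0≤q-p (ℚ.≤-trans h (ιℚ-mono-≤ {+ n} {+ suc m} (ℤ.+≤+ (ℕ.m≤n⇒m≤1+n n≤m))))) 0≤¼)
        (*-nonNeg (ℚ.<⇒≤ (recip-pos m)) (majorant-nonNeg 0≤B m)))
      (eq (ιℕ (suc m)) B (recip m) (majorant B m) (recip-inverse m)))
  where
  open +-*-Solver
  lemma : ∀ n B r x → ¼ * x - r * (B * x) ≡ ((n - ιℕ 4 * B) * ¼) * (r * x) + (1ℚ - n * r) * (¼ * x)
  lemma = solve 4 (λ n B r x → con ¼ :* x :- r :* (B :* x) :=
    ((n :- con (ιℕ 4) :* B) :* con ¼) :* (r :* x) :+ (con 1ℚ :- n :* r) :* (con ¼ :* x)) refl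
  eq : ∀ n B r x → n * r ≡ 1ℚ → ¼ * x - r * (B * x) ≡ ((n - ιℕ 4 * B) * ¼) * (r * x)
  eq n B r x nr = trans (lemma n B r x) (trans
    (cong (λ u → ((n - ιℕ 4 * B) * ¼) * (r * x) + (1ℚ - u) * (¼ * x)) nr)
    (trans (cong (_+_ (((n - ιℕ 4 * B) * ¼) * (r * x))) (ℚ.*-zeroˡ (¼ * x))) (ℚ.+-identityʳ _)))

¼^-halves : ∀ {C} → 0ℚ ≤ C → ∀ m → C * ¼ ^ℚ suc m + C * ¼ ^ℚ suc m ≤ C * ¼ ^ℚ m
¼^-halves {C} 0≤C m = ≤-by _ (*-nonNeg 0≤½ (*-nonNeg 0≤C (^ℚ-nonNeg 0≤¼ m))) (lemma C (¼ ^ℚ m))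
  where
  open +-*-Solver
  lemma : ∀ c x → c * x - (c * (¼ * x) + c * (¼ * x)) ≡ ½ * (c * x)
  lemma = solve 2 (λ c x → c :* x :- (c :* (con ¼ :* x) :+ c :* (con ¼ :* x)) := con ½ :* (c :* x)) refl

-- Uniformity in q is the point: q will run through the approximations of a real number, which are
-- eventually bounded by one B.
record Bounds (B : ℚ) : Set where
  field
    K      : ℚ
    0<K    : 0ℚ < K
    term≤  : ∀ {q} → ∣ q ∣ ≤ B → ∀ m → ‖ term q m ‖ ≤ K * ¼ ^ℚ m
    tail≤  : ∀ {q} → ∣ q ∣ ≤ B → ∀ N d → ‖ expᴳ q (d ℕ.+ N) -ᴳ expᴳ q N ‖ ≤ K * ¼ ^ℚ N + K * ¼ ^ℚ N
    lip≤   : ∀ {p q} → ∣ p ∣ ≤ B → ∣ q ∣ ≤ B → ∀ N → ‖ expᴳ p N -ᴳ expᴳ q N ‖ ≤ (ιℕ 8 * K) * ∣ p - q ∣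

computed-bounds : ∀ {B} → 0ℚ ≤ B → Bounds B
computed-bounds {B} 0≤B = record { K = K ; 0<K = 0<K ; term≤ = term≤ ; tail≤ = tail≤ ; lip≤ = lip≤ }
  where
  K = proj₁ (majorant-geometric 0≤B)
  0<K = proj₁ (proj₂ (majorant-geometric 0≤B))
  0≤K = ℚ.<⇒≤ 0<K
  maj = proj₂ (proj₂ (majorant-geometric 0≤B))
  term≤ : ∀ {q} → ∣ q ∣ ≤ B → ∀ m → ‖ term q m ‖ ≤ K * ¼ ^ℚ m
  term≤ q≤B m = ℚ.≤-trans (term-bound q≤B m) (maj m)
  tail≤ : ∀ {q} → ∣ q ∣ ≤ B → ∀ N d → ‖ expᴳ q (d ℕ.+ N) -ᴳ expᴳ q N ‖ ≤ K * ¼ ^ℚ N + K * ¼ ^ℚ N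
  tail≤ {q} q≤B N = tail-bound {expᴳ q} {term q} {λ m → K * ¼ ^ℚ m} N (λ _ → refl)
    (λ d → term≤ q≤B (d ℕ.+ N)) (λ d → ¼^-halves 0≤K (d ℕ.+ N)) (λ d → *-nonNeg 0≤K (^ℚ-nonNeg 0≤¼ (d ℕ.+ N)))
  lip≤ : ∀ {p q} → ∣ p ∣ ≤ B → ∣ q ∣ ≤ B → ∀ N → ‖ expᴳ p N -ᴳ expᴳ q N ‖ ≤ (ιℕ 8 * K) * ∣ p - q ∣
  lip≤ {p} {q} p≤B q≤B N = subst₂ _≤_
    (trans (cong (λ n → ‖ S n -ᴳ S 0 ‖) (ℕ.+-identityʳ N)) (cong ‖_‖ (lemma₀ (S N)))) (lemma₁ K (∣ p - q ∣))
    (tail-bound {S} {f} {λ m → C * ¼ ^ℚ m} 0 (λ m → lemma₂ (expᴳ p m) (term p m) (expᴳ q m) (term q m))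
      (λ d → f≤ (d ℕ.+ 0)) (λ d → ¼^-halves 0≤C (d ℕ.+ 0)) (λ d → *-nonNeg 0≤C (^ℚ-nonNeg 0≤¼ (d ℕ.+ 0))) N)
    where
    S f : ℕ → 𝔾
    S m = expᴳ p m -ᴳ expᴳ q m
    f m = term p m -ᴳ term q m
    -- The difference of the terms of index m + 1 is bounded by the majorant of index m. The 4
    -- undoes this shift, and `tail-bound` doubles it to 8.
    C : ℚ
    C = (ιℕ 4 * K) * ∣ p - q ∣
    0≤C : 0ℚ ≤ C
    0≤C = *-nonNeg (*-nonNeg (ℚ.nonNegative⁻¹ (ιℕ 4)) 0≤K) (ℚ.0≤∣p∣ (p - q))
    lemma₀ : ∀ s → s -ᴳ 0ᴳ ≡ s
    lemma₀ = G.solve 1 (λ s → s G.:- G.con 0ᴳ G.:= s) refl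
    lemma₂ : ∀ a b c d → (a +ᴳ b) -ᴳ (c +ᴳ d) ≡ (a -ᴳ c) +ᴳ (b -ᴳ d)
    lemma₂ = G.solve 4 (λ a b c d → (a G.:+ b) G.:- (c G.:+ d) G.:= (a G.:- c) G.:+ (b G.:- d)) refl
    open +-*-Solver
    lemma₁ : ∀ K d → ((ιℕ 4 * K) * d) * 1ℚ + ((ιℕ 4 * K) * d) * 1ℚ ≡ (ιℕ 8 * K) * d
    lemma₁ = solve 2 (λ K d → ((con (ιℕ 4) :* K) :* d) :* con 1ℚ :+ ((con (ιℕ 4) :* K) :* d) :* con 1ℚ := (con
      (ιℕ 8) :* K) :* d) refl
    lemma₃ : ∀ K d x → d * (K * x) ≡ ((ιℕ 4 * K) * d) * (¼ * x)
    lemma₃ = solve 3 (λ K d x → d :* (K :* x) := ((con (ιℕ 4) :* K) :* d) :* (con ¼ :* x)) refl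
    f≤ : ∀ m → ‖ f m ‖ ≤ C * ¼ ^ℚ m
    f≤ zero    = *-nonNeg 0≤C (ℚ.<⇒≤ 0<1)
    f≤ (suc m) = ℚ.≤-trans (term-lipschitz p≤B q≤B m)
      (ℚ.≤-trans (ℚ.*-monoˡ-≤-nonNeg (∣ p - q ∣) {{ℚ.∣-∣-nonNeg (p - q)}} (maj m))
        (ℚ.≤-reflexive (lemma₃ K (∣ p - q ∣) (¼ ^ℚ m))))

-- The constants are never evaluated; at concrete B they would be huge.
abstract
  bounds : ∀ {B} → 0ℚ ≤ B → Bounds B
  bounds = computed-bounds

-- Cauchy products and the addition formula

infixl 7 _⋆_

-- (u ⋆ v) n = ∑_{i ≤ n} u i · v (n - i)
_⋆_ : (ℕ → 𝔾) → (ℕ → 𝔾) → ℕ → 𝔾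
(u ⋆ v) zero    = u 0 *ᴳ v 0
(u ⋆ v) (suc n) = u 0 *ᴳ v (suc n) +ᴳ ((λ i → u (suc i)) ⋆ v) n

⋆-congˡ : ∀ {u u′} v → (∀ i → u i ≡ u′ i) → ∀ n → (u ⋆ v) n ≡ (u′ ⋆ v) n
⋆-congˡ v eq zero    = cong (_*ᴳ v 0) (eq 0)
⋆-congˡ v eq (suc n) = cong₂ _+ᴳ_ (cong (_*ᴳ v (suc n)) (eq 0)) (⋆-congˡ v (λ i → eq (suc i)) n)

⋆-congʳ : ∀ u {v v′} → (∀ i → v i ≡ v′ i) → ∀ n → (u ⋆ v) n ≡ (u ⋆ v′) n
⋆-congʳ u eq zero    = cong (u 0 *ᴳ_) (eq 0)
⋆-congʳ u eq (suc n) = cong₂ _+ᴳ_ (cong (u 0 *ᴳ_) (eq (suc n))) (⋆-congʳ (λ i → u (suc i)) eq n)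

⋆-scaleˡ : ∀ c u v n → ((λ i → c *ᴳ u i) ⋆ v) n ≡ c *ᴳ (u ⋆ v) n
⋆-scaleˡ c u v zero    = G.*-assoc c (u 0) (v 0)
⋆-scaleˡ c u v (suc n) = trans (cong₂ _+ᴳ_ (G.*-assoc c (u 0) (v (suc n))) (⋆-scaleˡ c (λ i → u (suc i)) v n))
  (sym (G.distribˡ c _ _))

⋆-scaleʳ : ∀ c u v n → (u ⋆ (λ i → c *ᴳ v i)) n ≡ c *ᴳ (u ⋆ v) n
⋆-scaleʳ c u v zero    = lemma c (u 0) (v 0)
  where
  lemma : ∀ c u v → u *ᴳ (c *ᴳ v) ≡ c *ᴳ (u *ᴳ v)
  lemma = G.solve 3 (λ c u v → u G.:* (c G.:* v) G.:= c G.:* (u G.:* v)) refl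
⋆-scaleʳ c u v (suc n) = trans (cong (u 0 *ᴳ (c *ᴳ v (suc n)) +ᴳ_) (⋆-scaleʳ c (λ i → u (suc i)) v n))
  (lemma c (u 0) (v (suc n)) (((λ i → u (suc i)) ⋆ v) n))
  where
  lemma : ∀ c u v w → u *ᴳ (c *ᴳ v) +ᴳ c *ᴳ w ≡ c *ᴳ (u *ᴳ v +ᴳ w)
  lemma = G.solve 4 (λ c u v w → u G.:* (c G.:* v) G.:+ c G.:* w G.:= c G.:* (u G.:* v G.:+ w)) refl

⋆-+ˡ : ∀ u u′ v n → ((λ i → u i +ᴳ u′ i) ⋆ v) n ≡ (u ⋆ v) n +ᴳ (u′ ⋆ v) n
⋆-+ˡ u u′ v zero    = G.distribʳ (v 0) (u 0) (u′ 0)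
⋆-+ˡ u u′ v (suc n) = trans (cong ((u 0 +ᴳ u′ 0) *ᴳ v (suc n) +ᴳ_) (⋆-+ˡ (λ i → u (suc i)) (λ i → u′ (suc i)) v n))
  (lemma (u 0) (u′ 0) (v (suc n)) _ _)
  where
  lemma : ∀ a b c x y → (a +ᴳ b) *ᴳ c +ᴳ (x +ᴳ y) ≡ (a *ᴳ c +ᴳ x) +ᴳ (b *ᴳ c +ᴳ y)
  lemma = G.solve 5 (λ a b c x y → (a G.:+ b) G.:* c G.:+ (x G.:+ y) G.:= (a G.:* c G.:+ x) G.:+ (b G.:* c G.:+ y)) refl

⋆-shiftʳ : ∀ u v → v 0 ≡ 0ᴳ → ∀ n → (u ⋆ v) (suc n) ≡ (u ⋆ (λ i → v (suc i))) n
⋆-shiftʳ u v v₀ zero    = trans (cong (λ x → u 0 *ᴳ v 1 +ᴳ u 1 *ᴳ x) v₀) (lemma (u 0 *ᴳ v 1) (u 1))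
  where
  lemma : ∀ a b → a +ᴳ b *ᴳ 0ᴳ ≡ a
  lemma = G.solve 2 (λ a b → a G.:+ b G.:* G.con 0ᴳ G.:= a) refl
⋆-shiftʳ u v v₀ (suc n) = cong (u 0 *ᴳ v (suc (suc n)) +ᴳ_) (⋆-shiftʳ (λ i → u (suc i)) v v₀ n)

-- The operator x d/dx on coefficient sequences.
D : (ℕ → 𝔾) → ℕ → 𝔾
D u i = ν i *ᴳ u i

-- In each summand n splits as i + (n - i). This derivation property carries the binomial theorem,
-- in the form of `term-+`.
leibniz : ∀ u v n → ν n *ᴳ (u ⋆ v) n ≡ (D u ⋆ v) n +ᴳ (u ⋆ D v) n
leibniz u v zero    = lemma (ν 0) (u 0) (v 0) refl
  where
  lemma : ∀ z a b → z ≡ 0ᴳ → z *ᴳ (a *ᴳ b) ≡ (z *ᴳ a) *ᴳ b +ᴳ a *ᴳ (z *ᴳ b)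
  lemma z a b refl = G.solve 2 (λ a b → G.con 0ᴳ G.:* (a G.:* b) G.:= (G.con 0ᴳ G.:* a) G.:* b G.:+ a G.:*
    (G.con 0ᴳ G.:* b)) refl a b
leibniz u v (suc n) = begin
    ν (suc n) *ᴳ (u 0 *ᴳ v (suc n) +ᴳ (u′ ⋆ v) n)
      ≡⟨ split (ν (suc n)) (ν n) (u 0) (v (suc n)) ((u′ ⋆ v) n) (ν-suc n) ⟩
    u 0 *ᴳ D v (suc n) +ᴳ (ν n *ᴳ (u′ ⋆ v) n +ᴳ (u′ ⋆ v) n)
      ≡⟨ cong (λ x → u 0 *ᴳ D v (suc n) +ᴳ (x +ᴳ (u′ ⋆ v) n)) (leibniz u′ v n) ⟩
    u 0 *ᴳ D v (suc n) +ᴳ (((D u′ ⋆ v) n +ᴳ (u′ ⋆ D v) n) +ᴳ (u′ ⋆ v) n)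
      ≡⟨ regroup (u 0 *ᴳ D v (suc n)) ((D u′ ⋆ v) n) ((u′ ⋆ D v) n) ((u′ ⋆ v) n) (u 0) (v (suc n)) (ν 0) refl ⟩
    (D u 0 *ᴳ v (suc n) +ᴳ ((D u′ ⋆ v) n +ᴳ (u′ ⋆ v) n)) +ᴳ (u 0 *ᴳ D v (suc n) +ᴳ (u′ ⋆ D v) n)
      ≡⟨ cong (λ x → (D u 0 *ᴳ v (suc n) +ᴳ x) +ᴳ (u 0 *ᴳ D v (suc n) +ᴳ (u′ ⋆ D v) n))
           (trans (sym (⋆-+ˡ (D u′) u′ v n)) (⋆-congˡ v shift-D n)) ⟩
    (D u ⋆ v) (suc n) +ᴳ (u ⋆ D v) (suc n) ∎
  where
  open ≡-Reasoning
  u′ : ℕ → 𝔾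
  u′ i = u (suc i)
  split : ∀ s n a b w → s ≡ 1ᴳ +ᴳ n → s *ᴳ (a *ᴳ b +ᴳ w) ≡ a *ᴳ (s *ᴳ b) +ᴳ (n *ᴳ w +ᴳ w)
  split s n a b w refl = G.solve 4 (λ n a b w → (G.con 1ᴳ G.:+ n) G.:* (a G.:* b G.:+ w) G.:=
    a G.:* ((G.con 1ᴳ G.:+ n) G.:* b) G.:+ (n G.:* w G.:+ w)) refl n a b w
  regroup : ∀ x a b c d e z → z ≡ 0ᴳ → x +ᴳ ((a +ᴳ b) +ᴳ c) ≡ ((z *ᴳ d) *ᴳ e +ᴳ (a +ᴳ c)) +ᴳ (x +ᴳ b)
  regroup x a b c d e z refl = G.solve 6 (λ x a b c d e → x G.:+ ((a G.:+ b) G.:+ c) G.:=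
    ((G.con 0ᴳ G.:* d) G.:* e G.:+ (a G.:+ c)) G.:+ (x G.:+ b)) refl x a b c d e
  shift-D : ∀ i → D u′ i +ᴳ u′ i ≡ D u (suc i)
  shift-D i = trans (lemma (ν i) (u (suc i))) (cong (_*ᴳ u (suc i)) (sym (ν-suc i)))
    where
    lemma : ∀ n a → n *ᴳ a +ᴳ a ≡ (1ᴳ +ᴳ n) *ᴳ a
    lemma = G.solve 2 (λ n a → n G.:* a G.:+ a G.:= (G.con 1ᴳ G.:+ n) G.:* a) refl

ν*recip : ∀ n → ν (suc n) *ᴳ (recip n +𝕚 0ℚ) ≡ 1ᴳ
ν*recip n = cong₂ _+𝕚_ (trans (lemma₁ (ιℕ (suc n)) (recip n)) (recip-inverse n)) (lemma₂ (ιℕ (suc n)) (recip n))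
  where
  open +-*-Solver
  lemma₁ : ∀ a b → a * b - 0ℚ * 0ℚ ≡ a * b
  lemma₁ = solve 2 (λ a b → a :* b :- con 0ℚ :* con 0ℚ := a :* b) refl
  lemma₂ : ∀ a b → a * 0ℚ + 0ℚ * b ≡ 0ℚ
  lemma₂ = solve 2 (λ a b → a :* con 0ℚ :+ con 0ℚ :* b := con 0ℚ) refl

D-term : ∀ q n → D (term q) (suc n) ≡ (0ℚ +𝕚 q) *ᴳ term q n
D-term q n = trans (sym (G.*-assoc (ν (suc n)) (recip n +𝕚 0ℚ) _))
  (trans (cong (_*ᴳ ((0ℚ +𝕚 q) *ᴳ term q n)) (ν*recip n)) (G.*-identityˡ _))

-- Both sides satisfy (n+1) c(n+1) = i(p+q) c(n): the left one by definition, the right one by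
-- `leibniz` and the recursion `D-term` of each factor.
term-+ : ∀ p q n → term (p + q) n ≡ (term p ⋆ term q) n
term-+ p q zero    = refl
term-+ p q (suc n) = begin
    r *ᴳ ((0ℚ +𝕚 p + q) *ᴳ term (p + q) n)              ≡⟨ cong (λ x → r *ᴳ ((0ℚ +𝕚 p + q) *ᴳ x)) (term-+ p q n) ⟩
    r *ᴳ ((0ℚ +𝕚 p + q) *ᴳ c n)                         ≡⟨ cong (r *ᴳ_) (G.distribʳ (c n) (0ℚ +𝕚 p) (0ℚ +𝕚 q)) ⟩
    r *ᴳ ((0ℚ +𝕚 p) *ᴳ c n +ᴳ (0ℚ +𝕚 q) *ᴳ c n)         ≡⟨ cong (r *ᴳ_) (cong₂ _+ᴳ_ left right) ⟨
    r *ᴳ ((D (term p) ⋆ term q) (suc n) +ᴳ (term p ⋆ D (term q)) (suc n))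
                                                        ≡⟨ cong (r *ᴳ_) (leibniz (term p) (term q) (suc n)) ⟨
    r *ᴳ (ν (suc n) *ᴳ c (suc n))                       ≡⟨ lemma r (ν (suc n)) (c (suc n)) (ν*recip n) ⟩
    c (suc n)                                           ∎
  where
  open ≡-Reasoning
  r : 𝔾
  r = recip n +𝕚 0ℚ
  c : ℕ → 𝔾
  c = term p ⋆ term q
  lemma : ∀ r n c → n *ᴳ r ≡ 1ᴳ → r *ᴳ (n *ᴳ c) ≡ c
  lemma r n c nr = trans (G.solve 3 (λ r n c → r G.:* (n G.:* c) G.:= (n G.:* r) G.:* c) refl r n c)
    (trans (cong (_*ᴳ c) nr) (G.*-identityˡ c))
  left : (D (term p) ⋆ term q) (suc n) ≡ (0ℚ +𝕚 p) *ᴳ c n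
  left = trans (cong₂ _+ᴳ_ (lemma₀ (term q (suc n)))
      (trans (⋆-congˡ (term q) (D-term p) n) (⋆-scaleˡ (0ℚ +𝕚 p) (term p) (term q) n)))
    (G.+-identityˡ _)
    where
    lemma₀ : ∀ x → (ν 0 *ᴳ 1ᴳ) *ᴳ x ≡ 0ᴳ
    lemma₀ = G.solve 1 (λ x → (G.con 0ᴳ G.:* G.con 1ᴳ) G.:* x G.:= G.con 0ᴳ) refl
  right : (term p ⋆ D (term q)) (suc n) ≡ (0ℚ +𝕚 q) *ᴳ c n
  right = trans (⋆-shiftʳ (term p) (D (term q)) refl n)
    (trans (⋆-congʳ (term p) (D-term q) n) (⋆-scaleʳ (0ℚ +𝕚 q) (term p) (term q) n))

⋆-partial : ∀ u {S v} → S 0 ≡ 0ᴳ → (∀ n → S (suc n) ≡ S n +ᴳ v n) → ∀ n → (u ⋆ S) (suc n) ≡ (u ⋆ S) n +ᴳ (u ⋆ v) n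
⋆-partial u {S} {v} S₀ S-suc zero =
  trans (cong₂ _+ᴳ_ (cong (u 0 *ᴳ_) (S-suc 0)) (cong (u 1 *ᴳ_) S₀)) (lemma (u 0) (u 1) (S 0) (v 0))
  where
  lemma : ∀ a b s v → a *ᴳ (s +ᴳ v) +ᴳ b *ᴳ 0ᴳ ≡ a *ᴳ s +ᴳ a *ᴳ v
  lemma = G.solve 4 (λ a b s v → a G.:* (s G.:+ v) G.:+ b G.:* G.con 0ᴳ G.:= a G.:* s G.:+ a G.:* v) refl
⋆-partial u {S} {v} S₀ S-suc (suc n) =
  trans (cong₂ _+ᴳ_ (cong (u 0 *ᴳ_) (S-suc (suc n))) (⋆-partial (λ i → u (suc i)) S₀ S-suc n))
    (lemma (u 0) (S (suc n)) (v (suc n)) _ _)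
  where
  lemma : ∀ a s v x y → a *ᴳ (s +ᴳ v) +ᴳ (x +ᴳ y) ≡ (a *ᴳ s +ᴳ x) +ᴳ (a *ᴳ v +ᴳ y)
  lemma = G.solve 5 (λ a s v x y → a G.:* (s G.:+ v) G.:+ (x G.:+ y) G.:= (a G.:* s G.:+ x) G.:+ (a G.:* v G.:+ y)) refl

expᴳ-+ : ∀ p q N → expᴳ (p + q) N ≡ (term p ⋆ expᴳ q) N
expᴳ-+ p q zero    = sym (G.zeroʳ 1ᴳ)
expᴳ-+ p q (suc N) = trans (cong₂ _+ᴳ_ (expᴳ-+ p q N) (term-+ p q N))
  (sym (⋆-partial (term p) {expᴳ q} refl (λ _ → refl) N))

-- Summed from the front, in step with the recursion of `_⋆_`, whereas `expᴳ` adds new terms at the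
-- end.
frontSum : (ℕ → 𝔾) → ℕ → 𝔾
frontSum u zero    = 0ᴳ
frontSum u (suc n) = u 0 +ᴳ frontSum (λ i → u (suc i)) n

frontSum-suc : ∀ u n → frontSum u (suc n) ≡ frontSum u n +ᴳ u n
frontSum-suc u zero    = G.+-comm (u 0) 0ᴳ
frontSum-suc u (suc n) = trans (cong (u 0 +ᴳ_) (frontSum-suc (λ i → u (suc i)) n)) (sym (G.+-assoc (u 0) _ _))

expᴳ≡frontSum : ∀ q N → expᴳ q N ≡ frontSum (term q) N
expᴳ≡frontSum q zero    = refl
expᴳ≡frontSum q (suc N) = trans (cong (_+ᴳ term q N) (expᴳ≡frontSum q N)) (sym (frontSum-suc (term q) N))

-- The error of the Cauchy product: frontSum u j · L - (u ⋆ S) j = ∑_{i < j} u i (L - S (j - i)).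
product-error : ∀ {T} L (S : ℕ → 𝔾) j → S 0 ≡ 0ᴳ → 0ℚ ≤ T → (∀ i → i ℕ.≤ j → ‖ L -ᴳ S i ‖ ≤ T * ¼ ^ℚ i) →
  ∀ u C → 0ℚ ≤ C → (∀ i → ‖ u i ‖ ≤ C * ¼ ^ℚ i) → ‖ frontSum u j *ᴳ L -ᴳ (u ⋆ S) j ‖ ≤ (C * T) * ½ ^ℚ j
product-error {T} L S zero S₀ 0≤T L≤ u C 0≤C u≤ = subst (_≤ (C * T) * 1ℚ)
  (sym (cong ‖_‖ (trans (cong (λ s → 0ᴳ *ᴳ L -ᴳ u 0 *ᴳ s) S₀) (lemma L (u 0)))))
  (*-nonNeg (*-nonNeg 0≤C 0≤T) (ℚ.<⇒≤ 0<1))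
  where
  lemma : ∀ l u → 0ᴳ *ᴳ l -ᴳ u *ᴳ 0ᴳ ≡ 0ᴳ
  lemma = G.solve 2 (λ l u → G.con 0ᴳ G.:* l G.:- u G.:* G.con 0ᴳ G.:= G.con 0ᴳ) refl
product-error {T} L S (suc j) S₀ 0≤T L≤ u C 0≤C u≤ = begin
    ‖ (u 0 +ᴳ F) *ᴳ L -ᴳ (u 0 *ᴳ S (suc j) +ᴳ P) ‖      ≡⟨ cong ‖_‖ (lemma (u 0) F L (S (suc j)) P) ⟩
    ‖ u 0 *ᴳ (L -ᴳ S (suc j)) +ᴳ (F *ᴳ L -ᴳ P) ‖        ≤⟨ ‖‖-+ (u 0 *ᴳ (L -ᴳ S (suc j))) (F *ᴳ L -ᴳ P) ⟩
    ‖ u 0 *ᴳ (L -ᴳ S (suc j)) ‖ + ‖ F *ᴳ L -ᴳ P ‖       ≤⟨ ℚ.+-mono-≤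
      (ℚ.≤-trans (‖‖-* (u 0) (L -ᴳ S (suc j))) (*-mono-≤ (0≤‖‖ (u 0)) (*-nonNeg 0≤T (^ℚ-nonNeg 0≤¼ (suc j)))
        (u≤ 0) (L≤ (suc j) ℕ.≤-refl)))
      -- Dropping the first entry of `u` improves its constant from C to C/4; this gain lets the
      -- error halve at each step.
      (product-error {T} L S j S₀ 0≤T (λ i i≤j → L≤ i (ℕ.m≤n⇒m≤1+n i≤j)) (λ i → u (suc i)) (C * ¼) (*-nonNeg 0≤C 0≤¼)
        (λ i → ℚ.≤-trans (u≤ (suc i)) (ℚ.≤-reflexive (sym (ℚ.*-assoc C ¼ (¼ ^ℚ i)))))) ⟩
    (C * 1ℚ) * (T * (¼ * ¼ ^ℚ j)) + ((C * ¼) * T) * ½ ^ℚ j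
      ≤⟨ ≤-by ((C * T) * (¼ * (½ ^ℚ j - ¼ ^ℚ j))) (*-nonNeg (*-nonNeg 0≤C 0≤T) (*-nonNeg 0≤¼ (p≤q⇒0≤q-p (¼^≤½^ j))))
        (arith C T (¼ ^ℚ j) (½ ^ℚ j)) ⟩
    (C * T) * (½ * ½ ^ℚ j)                               ∎
  where
  open ℚ.≤-Reasoning
  F = frontSum (λ i → u (suc i)) j
  P = ((λ i → u (suc i)) ⋆ S) j
  lemma : ∀ u f l s p → (u +ᴳ f) *ᴳ l -ᴳ (u *ᴳ s +ᴳ p) ≡ u *ᴳ (l -ᴳ s) +ᴳ (f *ᴳ l -ᴳ p)
  lemma = G.solve 5 (λ u f l s p → (u G.:+ f) G.:* l G.:- (u G.:* s G.:+ p) G.:= u G.:* (l G.:- s) G.:+ (f G.:* l G.:- p)) refl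
  arith : ∀ C T x y → (C * T) * (½ * y) - ((C * 1ℚ) * (T * (¼ * x)) + ((C * ¼) * T) * y) ≡ (C * T) * (¼ * (y - x))
  arith = solve 4 (λ C T x y → (C :* T) :* (con ½ :* y) :- ((C :* con 1ℚ) :* (T :* (con ¼ :* x)) :+ ((C :* con ¼) :* T) :* y)
    := (C :* T) :* (con ¼ :* (y :- x))) refl
    where open +-*-Solver

expᴳ-+-error : ∀ {B} (bd : Bounds B) → let open Bounds bd in ∀ {p q} → ∣ p ∣ ≤ B → ∣ q ∣ ≤ B → ∀ N →
  ‖ expᴳ p N *ᴳ expᴳ q N -ᴳ expᴳ (p + q) N ‖ ≤ (K * (K + K)) * ½ ^ℚ N
expᴳ-+-error bd {p} {q} p≤B q≤B N = subst (_≤ (K * (K + K)) * ½ ^ℚ N)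
  (cong₂ (λ x y → ‖ x *ᴳ expᴳ q N -ᴳ y ‖) (sym (expᴳ≡frontSum p N)) (sym (expᴳ-+ p q N)))
  (product-error {K + K} (expᴳ q N) (expᴳ q) N refl (+-nonNeg 0≤K 0≤K) near (term p) K 0≤K (term≤ p≤B))
  where
  open Bounds bd
  0≤K = ℚ.<⇒≤ 0<K
  near : ∀ i → i ℕ.≤ N → ‖ expᴳ q N -ᴳ expᴳ q i ‖ ≤ (K + K) * ¼ ^ℚ i
  near i i≤N = subst₂ (λ n b → ‖ expᴳ q n -ᴳ expᴳ q i ‖ ≤ b) (ℕ.m∸n+n≡m i≤N) (sym (ℚ.*-distribʳ-+ (¼ ^ℚ i) K K)) (tail≤ q≤B i
    (N ℕ.∸ i))

-- The function E

module C^ = Algebra.Properties.CommutativeSemiring.Exp C.commutativeSemiring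
open C^ using () renaming (_^_ to _^ᶜ_) public

toᴳ : ℂ → ℕ → 𝔾
toᴳ z m = seq (re z) m +𝕚 seq (im z) m

𝔾-η : ∀ g → (reᴳ g +𝕚 imᴳ g) ≡ g
𝔾-η (a +𝕚 b) = refl

private
  re-sub : ∀ g h → reᴳ g - reᴳ h ≡ reᴳ (g -ᴳ h)
  re-sub (a +𝕚 b) (c +𝕚 d) = refl

  im-sub : ∀ g h → imᴳ g - imᴳ h ≡ imᴳ (g -ᴳ h)
  im-sub (a +𝕚 b) (c +𝕚 d) = refl

  ‖‖-triangle : ∀ x y z → ‖ x -ᴳ z ‖ ≤ ‖ x -ᴳ y ‖ + ‖ y -ᴳ z ‖
  ‖‖-triangle x y z = subst (λ g → ‖ g ‖ ≤ ‖ x -ᴳ y ‖ + ‖ y -ᴳ z ‖) (lemma x y z) (‖‖-+ (x -ᴳ y) (y -ᴳ z))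
    where
    lemma : ∀ x y z → (x -ᴳ y) +ᴳ (y -ᴳ z) ≡ x -ᴳ z
    lemma = G.solve 3 (λ x y z → (x G.:- y) G.:+ (y G.:- z) G.:= x G.:- z) refl

  ‖‖-sym : ∀ x y → ‖ x -ᴳ y ‖ ≡ ‖ y -ᴳ x ‖
  ‖‖-sym x y = trans (cong ‖_‖ (lemma x y)) (‖-‖-neg (y -ᴳ x))
    where
    lemma : ∀ x y → x -ᴳ y ≡ -ᴳ (y -ᴳ x)
    lemma = G.solve 2 (λ x y → x G.:- y G.:= G.:- (y G.:- x)) refl

null⇒≋ᶜ : ∀ {z w f} → Null f → Eventually (λ m → ‖ toᴳ z m -ᴳ toᴳ w m ‖ ≤ f m) → z ≋ᶜ w
null⇒≋ᶜ {z} {w} h b = mk≋ᶜ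
  (mk≋ (null-≤ h (ev-map (λ {m} → ℚ.≤-trans (∣re∣≤‖‖ (toᴳ z m -ᴳ toᴳ w m))) b)))
  (mk≋ (null-≤ h (ev-map (λ {m} → ℚ.≤-trans (∣im∣≤‖‖ (toᴳ z m -ᴳ toᴳ w m))) b)))

≡⇒≋ᶜ : ∀ {z w} → (∀ m → toᴳ z m ≡ toᴳ w m) → z ≋ᶜ w
≡⇒≋ᶜ eq = mk≋ᶜ (≡⇒≋ (λ m → cong reᴳ (eq m))) (≡⇒≋ (λ m → cong imᴳ (eq m)))

-- The diagonal: the approximation of x and the length of the partial sum advance together, so an
-- identity for `E` becomes an estimate of a single partial sum at a single rational point.
expSeq : ℝ → ℕ → 𝔾
expSeq x m = expᴳ (seq x m) m

bound-of : ∀ x → ∃[ B ] (0ℚ < B × Eventually (λ m → ∣ seq x m ∣ ≤ B))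
bound-of x = cauchy-bounded (cauchy x)

tail-null : ∀ {B} (bd : Bounds B) → let open Bounds bd in Null (λ N → K * ¼ ^ℚ N + K * ¼ ^ℚ N)
tail-null bd = null-+ small small
  where
  open Bounds bd
  small : Null (λ N → K * ¼ ^ℚ N)
  small = null-≤ (null-½^ K) (ev-all (λ N → ℚ.≤-trans
    (ℚ.≤-reflexive (ℚ.0≤p⇒∣p∣≡p (*-nonNeg (ℚ.<⇒≤ 0<K) (^ℚ-nonNeg 0≤¼ N))))
    (ℚ.*-monoˡ-≤-nonNeg K {{ℚ.nonNegative (ℚ.<⇒≤ 0<K)}} (¼^≤½^ N))))

near : ∀ {B} (bd : Bounds B) → let open Bounds bd in ∀ {q} → ∣ q ∣ ≤ B → ∀ {N m} → N ℕ.≤ m →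
  ‖ expᴳ q m -ᴳ expᴳ q N ‖ ≤ K * ¼ ^ℚ N + K * ¼ ^ℚ N
near bd {q} q≤B {N} {m} N≤m = subst (λ n → ‖ expᴳ q n -ᴳ expᴳ q N ‖ ≤ K * ¼ ^ℚ N + K * ¼ ^ℚ N)
  (ℕ.m∸n+n≡m N≤m) (tail≤ q≤B N (m ℕ.∸ N))
  where open Bounds bd

-- Both entries are first cut back to length N, at their own rational points. The two tails take ε/4
-- each, and the Lipschitz bound between the points takes ε/2.
expSeq-cauchy : ∀ x ε → 0ℚ < ε → ∃[ N ] (∀ m n → N ℕ.≤ m → N ℕ.≤ n → ‖ expSeq x m -ᴳ expSeq x n ‖ < ε)
expSeq-cauchy x ε 0<ε = N , λ m n N≤m N≤n → begin-strict
    ‖ expSeq x m -ᴳ expSeq x n ‖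
      ≤⟨ ‖‖-triangle (expSeq x m) (expᴳ (seq x m) N) (expSeq x n) ⟩
    ‖ expSeq x m -ᴳ expᴳ (seq x m) N ‖ + ‖ expᴳ (seq x m) N -ᴳ expSeq x n ‖
      ≤⟨ ℚ.+-mono-≤ (near bd (x≤B m (N₁≤ N≤m)) N≤m) (‖‖-triangle (expᴳ (seq x m) N) (expᴳ (seq x n) N) (expSeq x n)) ⟩
    T + (‖ expᴳ (seq x m) N -ᴳ expᴳ (seq x n) N ‖ + ‖ expᴳ (seq x n) N -ᴳ expSeq x n ‖)
      ≤⟨ ℚ.+-monoʳ-≤ T (ℚ.+-mono-≤ (lip≤ (x≤B m (N₁≤ N≤m)) (x≤B n (N₁≤ N≤n)) N)
           (subst (_≤ T) (‖‖-sym (expSeq x n) (expᴳ (seq x n) N)) (near bd (x≤B n (N₁≤ N≤n)) N≤n))) ⟩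
    T + ((ιℕ 8 * K) * ∣ seq x m - seq x n ∣ + T)
      <⟨ ℚ.+-mono-< T<δ (ℚ.+-mono-< (ℚ.*-monoʳ-<-pos (ιℕ 8 * K) {{ℚ.positive 0<8K}}
           (proj₂ xc m n (N₂≤ N≤m) (N₂≤ N≤n))) T<δ) ⟩
    δ + ((ιℕ 8 * K) * (δ′ ÷⁺ 0<8K) + δ)
      ≡⟨ cong (λ y → δ + (y + δ)) (*-÷⁺ δ′ 0<8K) ⟩
    δ + (δ′ + δ)  ≡⟨ lemma ε ⟩
    ε ∎
  where
  open ℚ.≤-Reasoning
  bd = bounds (ℚ.<⇒≤ (proj₁ (proj₂ (bound-of x))))
  open Bounds bd
  N₁ = proj₁ (proj₂ (proj₂ (bound-of x)))
  x≤B = proj₂ (proj₂ (proj₂ (bound-of x)))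
  δ δ′ : ℚ
  δ′ = ½ * ε
  δ = ½ * δ′
  0<8K : 0ℚ < ιℕ 8 * K
  0<8K = *-pos (ℚ.positive⁻¹ (ιℕ 8)) 0<K
  xc = cauchy x (δ′ ÷⁺ 0<8K) (÷⁺-pos (0<½* 0<ε) 0<8K)
  N₂ = proj₁ xc
  tn = tail-null bd δ (0<½* (0<½* 0<ε))
  N = (N₁ ℕ.⊔ N₂) ℕ.⊔ proj₁ tn
  T = K * ¼ ^ℚ N + K * ¼ ^ℚ N
  T<δ : T < δ
  T<δ = ℚ.≤-<-trans (p≤∣p∣ T) (proj₂ tn N (ℕ.m≤n⊔m (N₁ ℕ.⊔ N₂) (proj₁ tn)))
  N₁≤ : ∀ {m} → N ℕ.≤ m → N₁ ℕ.≤ m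
  N₁≤ h = ℕ.m⊔n≤o⇒m≤o N₁ N₂ (ℕ.m⊔n≤o⇒m≤o (N₁ ℕ.⊔ N₂) (proj₁ tn) h)
  N₂≤ : ∀ {m} → N ℕ.≤ m → N₂ ℕ.≤ m
  N₂≤ h = ℕ.m⊔n≤o⇒n≤o N₁ N₂ (ℕ.m⊔n≤o⇒m≤o (N₁ ℕ.⊔ N₂) (proj₁ tn) h)
  lemma : ∀ e → ½ * (½ * e) + (½ * e + ½ * (½ * e)) ≡ e
  lemma = solve 1 (λ e → con ½ :* (con ½ :* e) :+ (con ½ :* e :+ con ½ :* (con ½ :* e)) := e) refl
    where open +-*-Solver

abstract
  expSeq-re-cauchy : ∀ x → IsCauchy (λ m → reᴳ (expSeq x m))
  expSeq-re-cauchy x ε 0<ε = let N , h = expSeq-cauchy x ε 0<ε in N , λ m n p q → ℚ.≤-<-trans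
    (subst (λ y → ∣ y ∣ ≤ ‖ expSeq x m -ᴳ expSeq x n ‖) (sym (re-sub (expSeq x m) (expSeq x n)))
      (∣re∣≤‖‖ (expSeq x m -ᴳ expSeq x n))) (h m n p q)

  expSeq-im-cauchy : ∀ x → IsCauchy (λ m → imᴳ (expSeq x m))
  expSeq-im-cauchy x ε 0<ε = let N , h = expSeq-cauchy x ε 0<ε in N , λ m n p q → ℚ.≤-<-trans
    (subst (λ y → ∣ y ∣ ≤ ‖ expSeq x m -ᴳ expSeq x n ‖) (sym (im-sub (expSeq x m) (expSeq x n)))
      (∣im∣≤‖‖ (expSeq x m -ᴳ expSeq x n))) (h m n p q)

-- E x is e^{ix}.
E : ℝ → ℂ
E x = mkℝ (λ m → reᴳ (expSeq x m)) (expSeq-re-cauchy x) +i mkℝ (λ m → imᴳ (expSeq x m)) (expSeq-im-cauchy x)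

toᴳ-E : ∀ x m → toᴳ (E x) m ≡ expSeq x m
toᴳ-E x m = 𝔾-η (expSeq x m)

common-bound : ∀ x y → ∃[ B ] (0ℚ ≤ B × Eventually (λ m → ∣ seq x m ∣ ≤ B × ∣ seq y m ∣ ≤ B))
common-bound x y = let Bx , 0<Bx , hx = bound-of x ; By , 0<By , hy = bound-of y in
  Bx + By , +-nonNeg (ℚ.<⇒≤ 0<Bx) (ℚ.<⇒≤ 0<By) , ev-map (λ (p , q) →
      ℚ.≤-trans p (subst (_≤ Bx + By) (ℚ.+-identityʳ Bx) (ℚ.+-monoʳ-≤ Bx (ℚ.<⇒≤ 0<By)))
    , ℚ.≤-trans q (subst (_≤ Bx + By) (ℚ.+-identityˡ By) (ℚ.+-monoˡ-≤ By (ℚ.<⇒≤ 0<Bx))))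
    (ev-× hx hy)

E-cong : ∀ {x y} → x ≋ y → E x ≋ᶜ E y
E-cong {x} {y} (mk≋ x≈y) = null⇒≋ᶜ
  (null-* {λ _ → ιℕ 8 * K} {λ m → ∣ seq x m - seq y m ∣} (const-bounded (ιℕ 8 * K))
    (λ ε 0<ε → ev-map (λ {m} → subst (_< ε) (sym (ℚ.∣∣p∣∣≡∣p∣ (seq x m - seq y m)))) (x≈y ε 0<ε)))
  (ev-map (λ {m} (p , q) → subst (_≤ (ιℕ 8 * K) * ∣ seq x m - seq y m ∣)
      (cong₂ (λ g h → ‖ g -ᴳ h ‖) (sym (toᴳ-E x m)) (sym (toᴳ-E y m))) (lip≤ p q m))
    (proj₂ (proj₂ (common-bound x y))))
  where open Bounds (bounds (proj₁ (proj₂ (common-bound x y))))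

E-+ : ∀ x y → E (x +ᴿ y) ≋ᶜ E x *ᶜ E y
E-+ x y = null⇒≋ᶜ (null-½^ (K * (K + K)))
  (ev-map (λ {m} (p , q) → subst (_≤ (K * (K + K)) * ½ ^ℚ m)
      (trans (‖‖-sym (expSeq x m *ᴳ expSeq y m) (expSeq (x +ᴿ y) m))
        (cong₂ (λ g h → ‖ g -ᴳ h ‖) (sym (toᴳ-E (x +ᴿ y) m)) (sym (cong₂ _*ᴳ_ (toᴳ-E x m) (toᴳ-E y m)))))
      (expᴳ-+-error bd p q m))
    (proj₂ (proj₂ (common-bound x y))))
  where
  bd = bounds (proj₁ (proj₂ (common-bound x y)))
  open Bounds bd

conj : ℂ → ℂ
conj z = re z +i (-ᴿ im z)

conjᴳ : 𝔾 → 𝔾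
conjᴳ (a +𝕚 b) = a +𝕚 - b

expᴳ-neg : ∀ q N → expᴳ (- q) N ≡ conjᴳ (expᴳ q N)
expᴳ-neg q zero    = refl
expᴳ-neg q (suc N) = trans (cong₂ _+ᴳ_ (expᴳ-neg q N) (go N)) (conj-+ (expᴳ q N) (term q N))
  where
  open +-*-Solver
  conj-+ : ∀ g h → conjᴳ g +ᴳ conjᴳ h ≡ conjᴳ (g +ᴳ h)
  conj-+ (a +𝕚 b) (c +𝕚 d) = cong₂ _+𝕚_ refl (sym (ℚ.neg-distrib-+ b d))
  conj-* : ∀ r q g → (r +𝕚 0ℚ) *ᴳ ((0ℚ +𝕚 - q) *ᴳ conjᴳ g) ≡ conjᴳ ((r +𝕚 0ℚ) *ᴳ ((0ℚ +𝕚 q) *ᴳ g))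
  conj-* r q (a +𝕚 b) = cong₂ _+𝕚_
    (solve 4 (λ r q a b → r :* (con 0ℚ :* a :- (:- q) :* (:- b)) :- con 0ℚ :* (con 0ℚ :* (:- b) :+ (:- q) :* a) :=
      r :* (con 0ℚ :* a :- q :* b) :- con 0ℚ :* (con 0ℚ :* b :+ q :* a)) refl r q a b)
    (solve 4 (λ r q a b → r :* (con 0ℚ :* (:- b) :+ (:- q) :* a) :+ con 0ℚ :* (con 0ℚ :* a :- (:- q) :* (:- b)) :=
      :- (r :* (con 0ℚ :* b :+ q :* a) :+ con 0ℚ :* (con 0ℚ :* a :- q :* b))) refl r q a b)
  go : ∀ m → term (- q) m ≡ conjᴳ (term q m)
  go zero    = refl
  go (suc m) = trans (cong (λ g → (recip m +𝕚 0ℚ) *ᴳ ((0ℚ +𝕚 - q) *ᴳ g)) (go m)) (conj-* (recip m) q (term q m))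

E-neg : ∀ x → E (-ᴿ x) ≋ᶜ conj (E x)
E-neg x = ≡⇒≋ᶜ (λ m → trans (toᴳ-E (-ᴿ x) m) (trans (expᴳ-neg (seq x m) m) (conj-proj (expSeq x m))))
  where
  conj-proj : ∀ g → conjᴳ g ≡ (reᴳ g +𝕚 - imᴳ g)
  conj-proj (a +𝕚 b) = refl

expᴳ-0 : ∀ N → expᴳ 0ℚ (suc N) ≡ 1ᴳ
expᴳ-0 zero    = refl
expᴳ-0 (suc N) = trans (cong (_+ᴳ term 0ℚ (suc N)) (expᴳ-0 N))
  (lemma (recip N +𝕚 0ℚ) (term 0ℚ N))
  where
  lemma : ∀ r t → 1ᴳ +ᴳ r *ᴳ ((0ℚ +𝕚 0ℚ) *ᴳ t) ≡ 1ᴳ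
  lemma = G.solve 2 (λ r t → G.con 1ᴳ G.:+ r G.:* (G.con 0ᴳ G.:* t) G.:= G.con 1ᴳ) refl

E-0 : E 0ᴿ ≋ᶜ fromℝ 1ᴿ
E-0 = null⇒≋ᶜ {E 0ᴿ} {fromℝ 1ᴿ} {λ _ → 0ℚ} null-0 (1 , λ { (suc m) _ → ℚ.≤-reflexive
  (cong (λ g → ‖ g -ᴳ 1ᴳ ‖) (trans (toᴳ-E 0ᴿ (suc m)) (expᴳ-0 m))) })

recip-! : ∀ N → 1/ suc N ! ≡ recip N * 1/ N !
recip-! N = begin
    1/ suc N !                                        ≡⟨ ℚ.*-identityʳ (1/ suc N !) ⟨
    1/ suc N ! * 1ℚ                                   ≡⟨ cong (1/ suc N ! *_) eq ⟨
    1/ suc N ! * (ιℕ (suc N ℕ.!) * (recip N * 1/ N !)) ≡⟨ ℚ.*-assoc (1/ suc N !) (ιℕ (suc N ℕ.!)) (recip N * 1/ N !) ⟨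
    1/ suc N ! * ιℕ (suc N ℕ.!) * (recip N * 1/ N !)  ≡⟨ cong (_* (recip N * 1/ N !)) (unit (suc N ℕ.!) {{suc N ℕ.!≢0}}) ⟩
    1ℚ * (recip N * 1/ N !)                           ≡⟨ ℚ.*-identityˡ _ ⟩
    recip N * 1/ N !                                  ∎
  where
  open ≡-Reasoning
  unit : ∀ d .{{_ : ℕ.NonZero d}} → ((+ 1) / d) * ιℕ d ≡ 1ℚ
  unit (suc d) = trans (ℚ.*-comm (recip d) (ιℕ (suc d))) (recip-inverse d)
  eq : ιℕ (suc N ℕ.!) * (recip N * 1/ N !) ≡ 1ℚ
  eq = trans (cong (_* (recip N * 1/ N !)) (trans (cong ιℚ (ℤ.pos-* (suc N) (N ℕ.!))) (ιℚ-* (+ suc N) (+ (N ℕ.!)))))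
    (trans (lemma (ιℕ (suc N)) (ιℕ (N ℕ.!)) (recip N) (1/ N !))
      (trans (cong₂ _*_ (recip-inverse N) (unit (N ℕ.!) {{N ℕ.!≢0}})) (ℚ.*-identityˡ 1ℚ)))
    where
    open +-*-Solver
    lemma : ∀ a b r s → (a * b) * (r * s) ≡ (a * r) * (s * b)
    lemma = solve 4 (λ a b r s → (a :* b) :* (r :* s) := (a :* r) :* (s :* b)) refl

cexp : ℂ → ℕ → ℂ
cexp z zero    = fromℝ 0ᴿ
cexp z (suc N) = cexp z N +ᶜ fromℝ (fromℚ (1/ N !)) *ᶜ z ^ᶜ N

toᴳ-term : ∀ x m N → toᴳ (fromℝ (fromℚ (1/ N !)) *ᶜ (iᶜ *ᶜ fromℝ x) ^ᶜ N) m ≡ term (seq x m) N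
toᴳ-term x m zero    = refl
toᴳ-term x m (suc N) = trans (cong₂ (λ r z → (r +𝕚 0ℚ) *ᴳ (z *ᴳ P)) (recip-! N) iq) (trans
    (cong (_*ᴳ ((0ℚ +𝕚 seq x m) *ᴳ P)) (real-* (recip N) (1/ N !)))
    (trans (lemma (recip N +𝕚 0ℚ) (1/ N ! +𝕚 0ℚ) (0ℚ +𝕚 seq x m) P)
      (cong (λ t → (recip N +𝕚 0ℚ) *ᴳ ((0ℚ +𝕚 seq x m) *ᴳ t)) (toᴳ-term x m N))))
  where
  P : 𝔾
  P = toᴳ ((iᶜ *ᶜ fromℝ x) ^ᶜ N) m
  open +-*-Solver
  iq : (0ℚ * seq x m - 1ℚ * 0ℚ +𝕚 0ℚ * 0ℚ + 1ℚ * seq x m) ≡ (0ℚ +𝕚 seq x m)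
  iq = cong₂ _+𝕚_ (solve 1 (λ q → con 0ℚ :* q :- con 1ℚ :* con 0ℚ := con 0ℚ) refl (seq x m))
    (solve 1 (λ q → con 0ℚ :* con 0ℚ :+ con 1ℚ :* q := q) refl (seq x m))
  real-* : ∀ a b → (a * b +𝕚 0ℚ) ≡ (a +𝕚 0ℚ) *ᴳ (b +𝕚 0ℚ)
  real-* a b = cong₂ _+𝕚_ (solve 2 (λ a b → a :* b := a :* b :- con 0ℚ :* con 0ℚ) refl a b)
    (solve 2 (λ a b → con 0ℚ := a :* con 0ℚ :+ con 0ℚ :* b) refl a b)
  lemma : ∀ a b z p → (a *ᴳ b) *ᴳ (z *ᴳ p) ≡ a *ᴳ (z *ᴳ (b *ᴳ p))
  lemma = G.solve 4 (λ a b z p → (a G.:* b) G.:* (z G.:* p) G.:= a G.:* (z G.:* (b G.:* p))) refl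

toᴳ-cexp : ∀ x m N → toᴳ (cexp (iᶜ *ᶜ fromℝ x) N) m ≡ expᴳ (seq x m) N
toᴳ-cexp x m zero    = refl
toᴳ-cexp x m (suc N) = cong₂ _+ᴳ_ (toᴳ-cexp x m N) (toᴳ-term x m N)

null⇒⇝ᶜ : ∀ {s L f} → Null f → Eventually (λ N → Eventually (λ m → ‖ toᴳ (s N) m -ᴳ toᴳ L m ‖ ≤ f N)) → s ⇝ᶜ L
null⇒⇝ᶜ {s} {L} {f} h b = mk⇝ᶜ
  (mk⇝ λ ε 0<ε → ev-map (λ {N} (p , q) → ev-map (λ {m} r → ℚ.≤-<-trans (∣re∣≤‖‖ (toᴳ (s N) m -ᴳ toᴳ L m))
    (ℚ.≤-<-trans r (ℚ.≤-<-trans (p≤∣p∣ (f N)) p))) q) (ev-× (h ε 0<ε) b))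
  (mk⇝ λ ε 0<ε → ev-map (λ {N} (p , q) → ev-map (λ {m} r → ℚ.≤-<-trans (∣im∣≤‖‖ (toᴳ (s N) m -ᴳ toᴳ L m))
    (ℚ.≤-<-trans r (ℚ.≤-<-trans (p≤∣p∣ (f N)) p))) q) (ev-× (h ε 0<ε) b))

-- Once m ≥ N, the diagonal entry and the N-th partial sum are taken at the same rational point, so
-- they differ by a tail.
E-lim : ∀ x → cexp (iᶜ *ᶜ fromℝ x) ⇝ᶜ E x
E-lim x = null⇒⇝ᶜ (tail-null bd) (ev-all λ N → ev-map
    (λ {m} (q≤B , N≤m) → subst (_≤ K * ¼ ^ℚ N + K * ¼ ^ℚ N)
      (trans (‖‖-sym (expSeq x m) (expᴳ (seq x m) N))
        (cong₂ (λ g h → ‖ g -ᴳ h ‖) (sym (toᴳ-cexp x m N)) (sym (toᴳ-E x m))))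
      (near bd q≤B N≤m))
    (ev-× (proj₂ (proj₂ (bound-of x))) (N , λ m h → h)))
  where
  bd = bounds (ℚ.<⇒≤ (proj₁ (proj₂ (bound-of x))))
  open Bounds bd

-- Sine

-- Doubling by recursion: series and powers of squares then advance two steps at a time by
-- computation, which `2 ℕ.* n` does not give.
dbl : ℕ → ℕ
dbl zero    = zero
dbl (suc n) = suc (suc (dbl n))

dbl≡2* : ∀ n → dbl n ≡ 2 ℕ.* n
dbl≡2* zero    = refl
dbl≡2* (suc n) = cong suc (trans (cong suc (dbl≡2* n)) (sym (ℕ.+-suc n (n ℕ.+ 0))))

n≤dbl : ∀ n → n ℕ.≤ dbl n
n≤dbl zero    = ℕ.z≤n
n≤dbl (suc n) = ℕ.s≤s (ℕ.m≤n⇒m≤1+n (n≤dbl n))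

term-suc-real : ∀ q m {a} → term q m ≡ (a +𝕚 0ℚ) → term q (suc m) ≡ (0ℚ +𝕚 recip m * (q * a))
term-suc-real q m {a} eq = trans (cong (λ t → (recip m +𝕚 0ℚ) *ᴳ ((0ℚ +𝕚 q) *ᴳ t)) eq) (cong₂ _+𝕚_
  (solve 3 (λ r q a → r :* (con 0ℚ :* a :- q :* con 0ℚ) :- con 0ℚ :* (con 0ℚ :* con 0ℚ :+ q :* a) := con 0ℚ) refl (recip m) q a)
  (solve 3 (λ r q a → r :* (con 0ℚ :* con 0ℚ :+ q :* a) :+ con 0ℚ :* (con 0ℚ :* a :- q :* con 0ℚ) := r :* (q :* a)) refl
    (recip m) q a))
  where open +-*-Solver

term-suc-imag : ∀ q m {b} → term q m ≡ (0ℚ +𝕚 b) → term q (suc m) ≡ (- (recip m * (q * b)) +𝕚 0ℚ)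
term-suc-imag q m {b} eq = trans (cong (λ t → (recip m +𝕚 0ℚ) *ᴳ ((0ℚ +𝕚 q) *ᴳ t)) eq) (cong₂ _+𝕚_
  (solve 3 (λ r q b → r :* (con 0ℚ :* con 0ℚ :- q :* b) :- con 0ℚ :* (con 0ℚ :* b :+ q :* con 0ℚ) := :- (r :* (q :* b))) refl
    (recip m) q b)
  (solve 3 (λ r q b → r :* (con 0ℚ :* b :+ q :* con 0ℚ) :+ con 0ℚ :* (con 0ℚ :* con 0ℚ :- q :* b) := con 0ℚ) refl (recip m) q b))
  where open +-*-Solver

private
  sinTerm : ℚ → ℕ → ℚ
  sinTerm q N = ((- 1ℚ) ^ℚ N * 1/ suc (dbl N) !) * q ^ℚ suc (dbl N)

  term-even : ∀ q N → term q (dbl N) ≡ (((- 1ℚ) ^ℚ N * 1/ dbl N !) * q ^ℚ dbl N +𝕚 0ℚ)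
  term-odd  : ∀ q N → term q (suc (dbl N)) ≡ (0ℚ +𝕚 sinTerm q N)
  term-even q zero    = refl
  term-even q (suc N) = trans (term-suc-imag q (suc (dbl N)) (term-odd q N)) (cong (_+𝕚 0ℚ)
    (trans (lemma (recip (suc (dbl N))) q ((- 1ℚ) ^ℚ N) (1/ suc (dbl N) !) (q ^ℚ suc (dbl N)))
      (cong (λ r → (((- 1ℚ) * (- 1ℚ) ^ℚ N) * r) * q ^ℚ dbl (suc N)) (sym (recip-! (suc (dbl N)))))))
    where
    open +-*-Solver
    lemma : ∀ r q s t x → - (r * (q * ((s * t) * x))) ≡ ((- 1ℚ * s) * (r * t)) * (q * x)
    lemma = solve 5 (λ r q s t x → :- (r :* (q :* ((s :* t) :* x))) := ((con (- 1ℚ) :* s) :* (r :* t)) :* (q :* x)) refl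
  term-odd q N = trans (term-suc-real q (dbl N) (term-even q N)) (cong (0ℚ +𝕚_)
    (trans (lemma (recip (dbl N)) q ((- 1ℚ) ^ℚ N) (1/ dbl N !) (q ^ℚ dbl N))
      (cong (λ r → ((- 1ℚ) ^ℚ N * r) * q ^ℚ suc (dbl N)) (sym (recip-! (dbl N))))))
    where
    open +-*-Solver
    lemma : ∀ r q s t x → r * (q * ((s * t) * x)) ≡ (s * (r * t)) * (q * x)
    lemma = solve 5 (λ r q s t x → r :* (q :* ((s :* t) :* x)) := (s :* (r :* t)) :* (q :* x)) refl

  seq-^ᴿ : ∀ x n m → seq (x ^ᴿ n) m ≡ seq x m ^ℚ n
  seq-^ᴿ x zero    m = refl
  seq-^ᴿ x (suc n) m = cong (seq x m *_) (seq-^ᴿ x n m)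

  im-+ : ∀ g h → imᴳ (g +ᴳ h) ≡ imᴳ g + imᴳ h
  im-+ (a +𝕚 b) (c +𝕚 d) = refl

  seq-sinPartial : ∀ x N m → seq (sinPartial x N) m ≡ imᴳ (expᴳ (seq x m) (dbl N))
  seq-sinPartial x zero    m = refl
  seq-sinPartial x (suc N) m = trans (cong₂ _+_ (seq-sinPartial x N m)
      (cong₂ _*_ (cong₂ _*_ (seq-^ᴿ (-ᴿ 1ᴿ) N m) (cong (λ k → 1/ suc k !) (sym (dbl≡2* N))))
        (trans (seq-^ᴿ x (suc (2 ℕ.* N)) m) (cong (λ k → seq x m ^ℚ suc k) (sym (dbl≡2* N))))))
    (sym (trans (im-+ (S +ᴳ term q (dbl N)) (term q (suc (dbl N))))
      (trans (cong₂ _+_ (trans (im-+ S (term q (dbl N))) (cong (λ t → imᴳ S + imᴳ t) (term-even q N))) (cong imᴳ (term-odd q N)))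
        (cong (_+ sinTerm q N) (ℚ.+-identityʳ (imᴳ S))))))
    where
    q = seq x m
    S = expᴳ q (dbl N)

sinPartial-lim : ∀ x → sinPartial x ⇝ im (E x)
sinPartial-lim x = lim-cong (λ N → ≡⇒≋ (λ m → trans (cong imᴳ (toᴳ-cexp x m (dbl N))) (sym (seq-sinPartial x N m)))) ≋-refl
  (lim-sub {λ N → im (cexp (iᶜ *ᶜ fromℝ x) N)} dbl n≤dbl (im⇝ (E-lim x)))

SinZero⇒ : ∀ {x} → SinZero x → im (E x) ≋ 0ᴿ
SinZero⇒ {x} h = lim-unique (sinPartial-lim x) (⟶⇒⇝ h)

⇒SinZero : ∀ {x} → im (E x) ≋ 0ᴿ → SinZero x
⇒SinZero {x} h = ⇝⇒⟶ (lim-cong (λ _ → ≋-refl) h (sinPartial-lim x))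

private
  recip≤½ : ∀ n → recip (suc n) ≤ ½
  recip≤½ n = ≤-by (½ * (ιℕ n * recip (suc n)))
    (*-nonNeg 0≤½ (*-nonNeg (ιℚ-mono-≤ {+ 0} {+ n} (ℤ.+≤+ ℕ.z≤n)) (ℚ.<⇒≤ (recip-pos (suc n)))))
    (eq (ιℕ n) (recip (suc n)) (trans (cong (_* recip (suc n)) (sym (ιℚ-+ (+ 2) (+ n)))) (recip-inverse (suc n))))
    where
    open +-*-Solver
    lemma : ∀ n r → ½ - r ≡ ½ * (n * r) + ½ * (1ℚ - (ιℕ 2 + n) * r)
    lemma = solve 2 (λ n r → con ½ :- r := con ½ :* (n :* r) :+ con ½ :* (con 1ℚ :- (con (ιℕ 2) :+ n) :* r)) refl
    eq : ∀ n r → (ιℕ 2 + n) * r ≡ 1ℚ → ½ - r ≡ ½ * (n * r)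
    eq n r h = trans (lemma n r) (trans (cong (λ u → ½ * (n * r) + ½ * (1ℚ - u)) h) (ℚ.+-identityʳ (½ * (n * r))))

  -- The terms (iq)^m/m! return to a non-negative real after four steps when q ≥ 0, so the sine
  -- series is advanced in blocks of four.
  quad : ℕ → ℕ
  quad zero    = zero
  quad (suc j) = suc (suc (suc (suc (quad j))))

  n≤quad : ∀ n → n ℕ.≤ quad n
  n≤quad zero    = ℕ.z≤n
  n≤quad (suc n) = ℕ.s≤s (ℕ.m≤n⇒m≤1+n (ℕ.m≤n⇒m≤1+n (ℕ.m≤n⇒m≤1+n (n≤quad n))))

  q²≤4 : ∀ {q} → 0ℚ ≤ q → q ≤ ιℕ 2 → q * q ≤ ιℕ 4
  q²≤4 0≤q q≤2 = *-mono-≤ {_} {ιℕ 2} {_} {ιℕ 2} 0≤q (ℚ.nonNegative⁻¹ (ιℕ 2)) q≤2 q≤2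

  module Block (q : ℚ) (N : ℕ) (a : ℚ) (eq : term q N ≡ (a +𝕚 0ℚ)) where
    b₁ = recip N * (q * a)
    a₂ = - (recip (suc N) * (q * b₁))
    b₃ = recip (suc (suc N)) * (q * a₂)
    a₄ = - (recip (suc (suc (suc N))) * (q * b₃))
    t₁ : term q (suc N) ≡ (0ℚ +𝕚 b₁)
    t₁ = term-suc-real q N eq
    t₂ : term q (suc (suc N)) ≡ (a₂ +𝕚 0ℚ)
    t₂ = term-suc-imag q (suc N) t₁
    t₃ : term q (suc (suc (suc N))) ≡ (0ℚ +𝕚 b₃)
    t₃ = term-suc-real q (suc (suc N)) t₂
    t₄ : term q (suc (suc (suc (suc N)))) ≡ (a₄ +𝕚 0ℚ)
    t₄ = term-suc-imag q (suc (suc (suc N))) t₃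
    open +-*-Solver
    im-sum : imᴳ (expᴳ q (suc (suc (suc (suc N))))) ≡ imᴳ (expᴳ q N) + (b₁ + b₃)
    im-sum = trans (im-+ (expᴳ q (suc (suc (suc N)))) (term q (suc (suc (suc N)))))
      (trans (cong₂ _+_ (trans (im-+ (expᴳ q (suc (suc N))) (term q (suc (suc N))))
        (cong₂ _+_ (trans (im-+ (expᴳ q (suc N)) (term q (suc N)))
          (cong₂ _+_ (trans (im-+ (expᴳ q N) (term q N)) (cong (λ t → imᴳ (expᴳ q N) + imᴳ t) eq)) (cong imᴳ t₁)))
          (cong imᴳ t₂))) (cong imᴳ t₃))
        (lemma (imᴳ (expᴳ q N)) b₁ b₃))
      where
      lemma : ∀ s b c → (((s + 0ℚ) + b) + 0ℚ) + c ≡ s + (b + c)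
      lemma = solve 3 (λ s b c → (((s :+ con 0ℚ) :+ b) :+ con 0ℚ) :+ c := s :+ (b :+ c)) refl
    a₄-nonNeg : 0ℚ ≤ q → 0ℚ ≤ a → 0ℚ ≤ a₄
    a₄-nonNeg 0≤q 0≤a = subst (0ℚ ≤_) (sym (lemma (recip (suc (suc (suc N)))) (recip (suc (suc N))) (recip (suc N)) q b₁))
      (*-nonNeg (r≥0 (suc (suc (suc N)))) (*-nonNeg 0≤q (*-nonNeg (r≥0 (suc (suc N))) (*-nonNeg 0≤q (*-nonNeg (r≥0 (suc N))
        (*-nonNeg 0≤q b₁≥0))))))
      where
      r≥0 : ∀ n → 0ℚ ≤ recip n
      r≥0 n = ℚ.<⇒≤ (recip-pos n)
      b₁≥0 : 0ℚ ≤ b₁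
      b₁≥0 = *-nonNeg (r≥0 N) (*-nonNeg 0≤q 0≤a)
      lemma : ∀ r s t q b → - (r * (q * (s * (q * (- (t * (q * b))))))) ≡ r * (q * (s * (q * (t * (q * b)))))
      lemma = solve 5 (λ r s t q b → :- (r :* (q :* (s :* (q :* (:- (t :* (q :* b))))))) := r :* (q :* (s :* (q :* (t :*
        (q :* b)))))) refl
    -- The second sine term of a block is q²/((N+2)(N+3)) times the first in absolute value, at most
    -- 4 · 1/2 · 1/2 = 1. This is the origin of the range [0, 2].
    b₁+b₃≥0 : 0ℚ ≤ q → q ≤ ιℕ 2 → 0ℚ ≤ a → 0ℚ ≤ b₁ + b₃
    b₁+b₃≥0 0≤q q≤2 0≤a = subst (0ℚ ≤_) (sym (lemma (recip (suc N)) (recip (suc (suc N))) q b₁))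
      (*-nonNeg (*-nonNeg (ℚ.<⇒≤ (recip-pos N)) (*-nonNeg 0≤q 0≤a)) (p≤q⇒0≤q-p
        (*-mono-≤ {q = ιℕ 4} {s = ¼} (*-nonNeg 0≤q 0≤q) 0≤¼ (q²≤4 0≤q q≤2)
          (*-mono-≤ {q = ½} {s = ½} (ℚ.<⇒≤ (recip-pos (suc N))) 0≤½ (recip≤½ N) (recip≤½ (suc N))))))
      where
      lemma : ∀ r s q b → b + s * (q * (- (r * (q * b)))) ≡ b * (1ℚ - (q * q) * (r * s))
      lemma = solve 4 (λ r s q b → b :+ s :* (q :* (:- (r :* (q :* b)))) := b :* (con 1ℚ :- (q :* q) :* (r :* s))) refl

  ⅓ : ℚ
  ⅓ = (+ 1) / 3

  -- The first block gives q - q³/6, which is at least q/3 because q² ≤ 4; every later block adds a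
  -- non-negative amount.
  block : ∀ {q} → 0ℚ ≤ q → q ≤ ιℕ 2 → ∀ j →
    ∃[ a ] (0ℚ ≤ a × term q (quad j) ≡ (a +𝕚 0ℚ) × ⅓ * q ≤ imᴳ (expᴳ q (quad (suc j))))
  block {q} 0≤q q≤2 zero = 1ℚ , ℚ.<⇒≤ 0<1 , refl ,
    ≤-by (⅓ * ½ * (q * (ιℕ 4 - q * q))) (*-nonNeg (ℚ.nonNegative⁻¹ (⅓ * ½)) (*-nonNeg 0≤q (p≤q⇒0≤q-p (q²≤4 0≤q q≤2))))
      (trans (cong (_- ⅓ * q) (im-sum)) (lemma q))
    where
    open Block q 0 1ℚ refl
    open +-*-Solver
    lemma : ∀ q → (0ℚ + (recip 0 * (q * 1ℚ) + recip 2 * (q * - (recip 1 * (q * (recip 0 * (q * 1ℚ))))))) - ⅓ * q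
      ≡ ⅓ * ½ * (q * (ιℕ 4 - q * q))
    lemma = solve 1 (λ q → (con 0ℚ :+ (con (recip 0) :* (q :* con 1ℚ) :+ con (recip 2) :* (q :* :- (con (recip 1) :* (q :*
      (con (recip 0) :* (q :* con 1ℚ))))))) :- con ⅓ :* q
      := con ⅓ :* con ½ :* (q :* (con (ιℕ 4) :- q :* q))) refl
  block {q} 0≤q q≤2 (suc j) = extend (block 0≤q q≤2 j)
    where
    extend : _ → ∃[ a ] (0ℚ ≤ a × term q (quad (suc j)) ≡ (a +𝕚 0ℚ) × ⅓ * q ≤ imᴳ (expᴳ q (quad (suc (suc j)))))
    extend (a , 0≤a , eq , h) = a₄ , a₄≥0 , t₄ , ℚ.≤-trans h (subst (S ≤_) (sym next.im-sum)
        (subst (_≤ S + (next.b₁ + next.b₃)) (ℚ.+-identityʳ S) (ℚ.+-monoʳ-≤ S (next.b₁+b₃≥0 0≤q q≤2 a₄≥0))))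
      where
      open Block q (quad j) a eq
      S = imᴳ (expᴳ q (quad (suc j)))
      a₄≥0 = a₄-nonNeg 0≤q 0≤a
      module next = Block q (quad (suc j)) a₄ t₄

sin-lower : ∀ {q} → 0ℚ ≤ q → q ≤ ιℕ 2 → ∀ j → ⅓ * q ≤ imᴳ (expᴳ q (quad (suc j)))
sin-lower 0≤q q≤2 j = proj₂ (proj₂ (proj₂ (block 0≤q q≤2 j)))

-- The rational lower bound is available only at the indices `quad (suc j)`; the Cauchy property
-- carries it, halved, to all large indices.
sin-pos : ∀ {x} → Pos x → Pos (ι (+ 2) -ᴿ x) → Pos (im (E x))
sin-pos {x} (mkPos ε 0<ε hx) (mkPos _ 0<δ h2) = mkPos η 0<η (N , bound)
  where
  η : ℚ
  η = ½ * (⅓ * ε)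
  0<⅓ε : 0ℚ < ⅓ * ε
  0<⅓ε = *-pos (ℚ.positive⁻¹ ⅓) 0<ε
  0<η : 0ℚ < η
  0<η = 0<½* 0<⅓ε
  N = proj₁ (cauchy (im (E x)) η 0<η)
  close-to : ∀ m n → N ℕ.≤ m → N ℕ.≤ n → ∣ seq (im (E x)) m - seq (im (E x)) n ∣ < η
  close-to = proj₂ (cauchy (im (E x)) η 0<η)
  range = ev-× hx h2
  j = N ℕ.⊔ proj₁ range
  n = quad (suc j)
  j≤n : j ℕ.≤ n
  j≤n = ℕ.≤-trans (ℕ.n≤1+n j) (n≤quad (suc j))
  at : ε ≤ seq x n × _ ≤ ιℕ 2 - seq x n
  at = proj₂ range n (ℕ.m⊔n≤o⇒n≤o N (proj₁ range) j≤n)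
  low : ⅓ * ε ≤ seq (im (E x)) n
  low = ℚ.≤-trans (ℚ.*-monoˡ-≤-nonNeg ⅓ (proj₁ at))
    (sin-lower (ℚ.≤-trans (ℚ.<⇒≤ 0<ε) (proj₁ at)) (0≤q-p⇒p≤q (ℚ.≤-trans (ℚ.<⇒≤ 0<δ) (proj₂ at))) j)
  open +-*-Solver
  lemma : ∀ a b e → b - ½ * e ≡ (a - e) + (½ * e - (a - b))
  lemma = solve 3 (λ a b e → b :- con ½ :* e := (a :- e) :+ (con ½ :* e :- (a :- b))) refl
  from : ∀ a b e → e ≤ a → ∣ a - b ∣ < ½ * e → ½ * e ≤ b
  from a b e p q = ≤-by ((a - e) + (½ * e - (a - b)))
    (+-nonNeg (p≤q⇒0≤q-p p) (p≤q⇒0≤q-p (ℚ.≤-trans (p≤∣p∣ (a - b)) (ℚ.<⇒≤ q)))) (lemma a b e)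
  bound : ∀ m → N ℕ.≤ m → η ≤ seq (im (E x)) m
  bound m N≤m = from (seq (im (E x)) n) (seq (im (E x)) m) (⅓ * ε) low (close-to n m (ℕ.m⊔n≤o⇒m≤o N (proj₁ range) j≤n) N≤m)

-- The number π

private
  -- Centre and right end of [3/2, 8/5], an interval around π/2 ≈ 1.5708.
  mid top : ℚ
  mid = (+ 31) / 20
  top = (+ 8) / 5

  re-+ : ∀ g h → reᴳ (g +ᴳ h) ≡ reᴳ g + reᴳ h
  re-+ (a +𝕚 b) (c +𝕚 d) = refl

  re-- : ∀ g h → reᴳ (g -ᴳ h) ≡ reᴳ g - reᴳ h
  re-- (a +𝕚 b) (c +𝕚 d) = refl

  record InI (q : ℚ) : Set where
    constructor inI
    field offset : ∣ q - mid ∣ ≤ (+ 1) / 20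
  open InI

  lower : ∀ {q} → InI q → (+ 3) / 2 ≤ q
  lower {q} h = ≤-by ((+ 1) / 20 - (- (q - mid))) (p≤q⇒0≤q-p (ℚ.≤-trans (-p≤∣p∣ (q - mid)) (offset h)))
    (solve 1 (λ q → q :- con ((+ 3) / 2) := con ((+ 1) / 20) :- (:- (q :- con mid))) refl q)
    where open +-*-Solver

  upper : ∀ {q} → InI q → q ≤ top
  upper {q} h = ≤-by ((+ 1) / 20 - (q - mid)) (p≤q⇒0≤q-p (ℚ.≤-trans (p≤∣p∣ (q - mid)) (offset h)))
    (solve 1 (λ q → con top :- q := con ((+ 1) / 20) :- (q :- con mid)) refl q)
    where open +-*-Solver

  0≤top : 0ℚ ≤ top
  0≤top = ℚ.≤ᵇ⇒≤ tt

  0≤I : ∀ {q} → InI q → 0ℚ ≤ q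
  0≤I h = ℚ.≤-trans (ℚ.≤ᵇ⇒≤ tt) (lower h)

  ∣I∣≤top : ∀ {q} → InI q → ∣ q ∣ ≤ top
  ∣I∣≤top h = subst (_≤ top) (sym (ℚ.0≤p⇒∣p∣≡p (0≤I h))) (upper h)

  -- The ratio of consecutive majorants is (8/5)/(k+1), at most 2/5 for k ≥ 3.
  majorant-halves : ∀ k → 3 ℕ.≤ k → majorant top (suc k) + majorant top (suc k) ≤ majorant top k
  majorant-halves k 3≤k = ≤-by ((ιℕ (suc k) - (top + top)) * (recip k * majorant top k))
    (*-nonNeg (p≤q⇒0≤q-p (ℚ.≤-trans {top + top} {ιℕ 4} (ℚ.≤ᵇ⇒≤ tt) (ιℚ-mono-≤ {+ 4} {+ suc k} (ℤ.+≤+ (ℕ.s≤s 3≤k)))))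
      (*-nonNeg (ℚ.<⇒≤ (recip-pos k)) (majorant-nonNeg 0≤top k)))
    (eq (ιℕ (suc k)) (recip k) (majorant top k) (recip-inverse k))
    where
    open +-*-Solver
    lemma : ∀ n r m → m - (r * (top * m) + r * (top * m)) ≡ (n - (top + top)) * (r * m) + (1ℚ - n * r) * m
    lemma = solve 3 (λ n r m → m :- (r :* (con top :* m) :+ r :* (con top :* m)) :=
      (n :- (con top :+ con top)) :* (r :* m) :+ (con 1ℚ :- n :* r) :* m) refl
    eq : ∀ n r m → n * r ≡ 1ℚ → m - (r * (top * m) + r * (top * m)) ≡ (n - (top + top)) * (r * m)
    eq n r m h = trans (lemma n r m) (trans (cong (λ u → (n - (top + top)) * (r * m) + (1ℚ - u) * m) h)
      (trans (cong (_+_ ((n - (top + top)) * (r * m))) (ℚ.*-zeroˡ m)) (ℚ.+-identityʳ _)))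

  cos₆ : ∀ q → reᴳ (expᴳ q 6) ≡ 1ℚ - ½ * (q * q) + (+ 1) / 24 * ((q * q) * (q * q))
  cos₆ q = trans (sum (expᴳ q 0) (term q 0) (term q 1) (term q 2) (term q 3) (term q 4) (term q 5))
    (trans (cong₂ (λ x y → ((((0ℚ + 1ℚ) + x) + reᴳ (term q 2)) + y) + reᴳ (term q 4) + reᴳ (term q 5)) (cong reᴳ t₁)
      (cong reᴳ t₃))
    (trans (cong₂ (λ x y → ((((0ℚ + 1ℚ) + 0ℚ) + x) + 0ℚ) + y + reᴳ (term q 5)) (cong reᴳ t₂) (cong reᴳ t₄))
    (trans (cong (λ x → ((((0ℚ + 1ℚ) + 0ℚ) + (- (recip 1 * (q * (recip 0 * (q * 1ℚ)))))) + 0ℚ)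
        + (- (recip 3 * (q * (recip 2 * (q * (- (recip 1 * (q * (recip 0 * (q * 1ℚ)))))))))) + x) (cong reᴳ t₅)) (cosine q))))
    where
    open +-*-Solver
    t₁ = term-suc-real q 0 {1ℚ} refl
    t₂ = term-suc-imag q 1 t₁
    t₃ = term-suc-real q 2 t₂
    t₄ = term-suc-imag q 3 t₃
    t₅ = term-suc-real q 4 t₄
    sum : ∀ z a b c d e f → reᴳ (((((((z +ᴳ a) +ᴳ b) +ᴳ c) +ᴳ d) +ᴳ e) +ᴳ f)) ≡
      ((((((reᴳ z + reᴳ a) + reᴳ b) + reᴳ c) + reᴳ d) + reᴳ e) + reᴳ f)
    sum (_ +𝕚 _) (_ +𝕚 _) (_ +𝕚 _) (_ +𝕚 _) (_ +𝕚 _) (_ +𝕚 _) (_ +𝕚 _) = refl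
    cosine : ∀ q → ((((((0ℚ + 1ℚ) + 0ℚ) + (- (recip 1 * (q * (recip 0 * (q * 1ℚ)))))) + 0ℚ)
        + (- (recip 3 * (q * (recip 2 * (q * (- (recip 1 * (q * (recip 0 * (q * 1ℚ))))))))))) + 0ℚ)
      ≡ 1ℚ - ½ * (q * q) + (+ 1) / 24 * ((q * q) * (q * q))
    cosine = solve 1 (λ q → (((((con 0ℚ :+ con 1ℚ) :+ con 0ℚ) :+ (:- (con (recip 1) :* (q :* (con (recip 0) :*
      (q :* con 1ℚ)))))) :+ con 0ℚ)
        :+ (:- (con (recip 3) :* (q :* (con (recip 2) :* (q :* (:- (con (recip 1) :* (q :* (con (recip 0) :*
          (q :* con 1ℚ))))))))))) :+ con 0ℚ
      := con 1ℚ :- con ½ :* (q :* q) :+ con ((+ 1) / 24) :* ((q :* q) :* (q :* q))) refl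

  -- The divided difference of q + 1 - q²/2 + q⁴/24 is 1 - s w. On the interval 3/2 ≤ s ≤ 8/5 and
  -- 1/2 ≤ w ≤ 5/8, hence 3/4 ≤ s w ≤ 1.
  main-part : ∀ {x y} → InI x → InI y →
    ∣ (x + reᴳ (expᴳ x 6)) - (y + reᴳ (expᴳ y 6)) ∣ ≤ ∣ x - y ∣ * ¼
  main-part {x} {y} hx hy = begin
    ∣ (x + reᴳ (expᴳ x 6)) - (y + reᴳ (expᴳ y 6)) ∣   ≡⟨ cong₂ (λ u v → ∣ (x + u) - (y + v) ∣) (cos₆ x) (cos₆ y) ⟩
    ∣ (x + P x) - (y + P y) ∣                         ≡⟨ cong ∣_∣ (factor x y) ⟩
    ∣ (x - y) * (1ℚ - s * w) ∣                        ≡⟨ ℚ.∣p*q∣≡∣p∣*∣q∣ (x - y) (1ℚ - s * w) ⟩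
    ∣ x - y ∣ * ∣ 1ℚ - s * w ∣                        ≤⟨ ℚ.*-monoˡ-≤-nonNeg (∣ x - y ∣) {{ℚ.∣-∣-nonNeg (x - y)}}
      (subst (_≤ ¼) (sym (ℚ.0≤p⇒∣p∣≡p (p≤q⇒0≤q-p sw≤1))) (≤-by (s * w - (+ 3) / 4) (p≤q⇒0≤q-p sw≥) (lemma (s * w)))) ⟩
    ∣ x - y ∣ * ¼                                     ∎
    where
    open ℚ.≤-Reasoning
    open +-*-Solver
    P : ℚ → ℚ
    P q = 1ℚ - ½ * (q * q) + (+ 1) / 24 * ((q * q) * (q * q))
    s w : ℚ
    s = ½ * (x + y)
    w = 1ℚ - (+ 1) / 12 * (x * x + y * y)
    factor : ∀ x y → (x + P x) - (y + P y) ≡ (x - y) * (1ℚ - (½ * (x + y)) * (1ℚ - (+ 1) / 12 * (x * x + y * y)))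
    factor = solve 2 (λ x y → (x :+ (con 1ℚ :- con ½ :* (x :* x) :+ con ((+ 1) / 24) :* ((x :* x) :* (x :* x))))
      :- (y :+ (con 1ℚ :- con ½ :* (y :* y) :+ con ((+ 1) / 24) :* ((y :* y) :* (y :* y))))
      := (x :- y) :* (con 1ℚ :- (con ½ :* (x :+ y)) :* (con 1ℚ :- con ((+ 1) / 12) :* (x :* x :+ y :* y)))) refl
    lemma : ∀ u → ¼ - (1ℚ - u) ≡ u - (+ 3) / 4
    lemma = solve 1 (λ u → con ¼ :- (con 1ℚ :- u) := u :- con ((+ 3) / 4)) refl
    sq-lower : ∀ {q} → InI q → (+ 9) / 4 ≤ q * q
    sq-lower {q} h = *-mono-≤ {(+ 3) / 2} {q} {(+ 3) / 2} {q} (ℚ.≤ᵇ⇒≤ tt) (0≤I h) (lower h) (lower h)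
    sq-upper : ∀ {q} → InI q → q * q ≤ ιℕ 3
    sq-upper {q} h = ℚ.≤-trans (*-mono-≤ {q} {top} {q} {top} (0≤I h) 0≤top (upper h) (upper h)) (ℚ.≤ᵇ⇒≤ tt)
    s≤ : s ≤ top
    s≤ = ≤-by (½ * ((top - x) + (top - y))) (*-nonNeg 0≤½ (+-nonNeg (p≤q⇒0≤q-p (upper hx)) (p≤q⇒0≤q-p (upper hy))))
      (solve 2 (λ x y → con top :- con ½ :* (x :+ y) := con ½ :* ((con top :- x) :+ (con top :- y))) refl x y)
    s≥ : (+ 3) / 2 ≤ s
    s≥ = ≤-by (½ * ((x - (+ 3) / 2) + (y - (+ 3) / 2))) (*-nonNeg 0≤½ (+-nonNeg (p≤q⇒0≤q-p (lower hx)) (p≤q⇒0≤q-p (lower hy))))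
      (solve 2 (λ x y → con ½ :* (x :+ y) :- con ((+ 3) / 2) := con ½ :* ((x :- con ((+ 3) / 2)) :+ (y :- con
        ((+ 3) / 2)))) refl x y)
    w≤ : w ≤ (+ 5) / 8
    w≤ = ≤-by ((+ 1) / 12 * ((x * x - (+ 9) / 4) + (y * y - (+ 9) / 4)))
      (*-nonNeg {(+ 1) / 12} (ℚ.≤ᵇ⇒≤ tt) (+-nonNeg (p≤q⇒0≤q-p (sq-lower hx)) (p≤q⇒0≤q-p (sq-lower hy))))
      (solve 2 (λ x y → con ((+ 5) / 8) :- (con 1ℚ :- con ((+ 1) / 12) :* (x :+ y)) :=
        con ((+ 1) / 12) :* ((x :- con ((+ 9) / 4)) :+ (y :- con ((+ 9) / 4)))) refl (x * x) (y * y))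
    w≥ : ½ ≤ w
    w≥ = ≤-by ((+ 1) / 12 * ((ιℕ 3 - x * x) + (ιℕ 3 - y * y)))
      (*-nonNeg {(+ 1) / 12} (ℚ.≤ᵇ⇒≤ tt) (+-nonNeg (p≤q⇒0≤q-p (sq-upper hx)) (p≤q⇒0≤q-p (sq-upper hy))))
      (solve 2 (λ x y → (con 1ℚ :- con ((+ 1) / 12) :* (x :+ y)) :- con ½ :=
        con ((+ 1) / 12) :* ((con (ιℕ 3) :- x) :+ (con (ιℕ 3) :- y))) refl (x * x) (y * y))
    0≤s : 0ℚ ≤ s
    0≤s = ℚ.≤-trans (ℚ.≤ᵇ⇒≤ tt) s≥
    sw≤1 : s * w ≤ 1ℚ
    sw≤1 = *-mono-≤ {s} {top} {w} {(+ 5) / 8} 0≤s (ℚ.≤ᵇ⇒≤ tt) s≤ w≤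
    sw≥ : (+ 3) / 4 ≤ s * w
    sw≥ = *-mono-≤ {(+ 3) / 2} {s} {½} {w} (ℚ.≤ᵇ⇒≤ tt) (ℚ.≤-trans 0≤½ w≥) s≥ w≥

  -- The first six terms contract by 1/4. The remaining ones add at most twice (8/5)^5/5! ≈ 0.087,
  -- which fits into another 1/4.
  contraction : ∀ {x y} → InI x → InI y → ∀ d →
    ∣ (x + reᴳ (expᴳ x (d ℕ.+ 6))) - (y + reᴳ (expᴳ y (d ℕ.+ 6))) ∣ ≤ ½ * ∣ x - y ∣
  contraction {x} {y} hx hy d = begin
    ∣ (x + reᴳ (expᴳ x (d ℕ.+ 6))) - (y + reᴳ (expᴳ y (d ℕ.+ 6))) ∣
      ≡⟨ cong ∣_∣ (trans (split x y (reᴳ (expᴳ x (d ℕ.+ 6))) (reᴳ (expᴳ y (d ℕ.+ 6))) (reᴳ (expᴳ x 6)) (reᴳ (expᴳ y 6)))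
           (cong (_+_ ((x + reᴳ (expᴳ x 6)) - (y + reᴳ (expᴳ y 6))))
             (sym (trans (re-- (S (d ℕ.+ 6)) (S 6)) (cong₂ _-_ (re-- (expᴳ x (d ℕ.+ 6)) (expᴳ y (d ℕ.+ 6))) (re-- (expᴳ x 6)
               (expᴳ y 6))))))) ⟩
    ∣ ((x + reᴳ (expᴳ x 6)) - (y + reᴳ (expᴳ y 6))) + reᴳ (S (d ℕ.+ 6) -ᴳ S 6) ∣
      ≤⟨ ℚ.∣p+q∣≤∣p∣+∣q∣ ((x + reᴳ (expᴳ x 6)) - (y + reᴳ (expᴳ y 6))) (reᴳ (S (d ℕ.+ 6) -ᴳ S 6)) ⟩
    ∣ (x + reᴳ (expᴳ x 6)) - (y + reᴳ (expᴳ y 6)) ∣ + ∣ reᴳ (S (d ℕ.+ 6) -ᴳ S 6) ∣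
      ≤⟨ ℚ.+-mono-≤ (main-part hx hy) (ℚ.≤-trans (∣re∣≤‖‖ (S (d ℕ.+ 6) -ᴳ S 6)) tail) ⟩
    ∣ x - y ∣ * ¼ + (∣ x - y ∣ * majorant top 5 + ∣ x - y ∣ * majorant top 5)
      ≤⟨ ≤-by (∣ x - y ∣ * (¼ - (majorant top 5 + majorant top 5)))
           (*-nonNeg (ℚ.0≤∣p∣ (x - y)) (ℚ.≤ᵇ⇒≤ tt)) (collect (∣ x - y ∣) (majorant top 5)) ⟩
    ½ * ∣ x - y ∣ ∎
    where
    open ℚ.≤-Reasoning
    open +-*-Solver
    S f : ℕ → 𝔾
    S m = expᴳ x m -ᴳ expᴳ y m
    f m = term x m -ᴳ term y m
    split : ∀ x y a b c e → (x + a) - (y + b) ≡ ((x + c) - (y + e)) + ((a - b) - (c - e))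
    split = solve 6 (λ x y a b c e → (x :+ a) :- (y :+ b) := ((x :+ c) :- (y :+ e)) :+ ((a :- b) :- (c :- e))) refl
    collect : ∀ u m → ½ * u - (u * ¼ + (u * m + u * m)) ≡ u * (¼ - (m + m))
    collect = solve 2 (λ u m → con ½ :* u :- (u :* con ¼ :+ (u :* m :+ u :* m)) := u :* (con ¼ :- (m :+ m))) refl
    lemma₂ : ∀ a b c d → (a +ᴳ b) -ᴳ (c +ᴳ d) ≡ (a -ᴳ c) +ᴳ (b -ᴳ d)
    lemma₂ = G.solve 4 (λ a b c d → (a G.:+ b) G.:- (c G.:+ d) G.:= (a G.:- c) G.:+ (b G.:- d)) refl
    b : ℕ → ℚ
    b m = ∣ x - y ∣ * majorant top (ℕ.pred m)
    tail : ‖ S (d ℕ.+ 6) -ᴳ S 6 ‖ ≤ b 6 + b 6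
    tail = tail-bound {S} {f} {b} 6 (λ m → lemma₂ (expᴳ x m) (term x m) (expᴳ y m) (term y m))
      (λ e → subst (λ k → ‖ f k ‖ ≤ b k) (ℕ.+-comm 6 e) (term-lipschitz (∣I∣≤top hx) (∣I∣≤top hy) (5 ℕ.+ e)))
      (λ e → subst (λ k → b (suc k) + b (suc k) ≤ b k) (ℕ.+-comm 6 e)
        (subst (_≤ ∣ x - y ∣ * majorant top (5 ℕ.+ e)) (ℚ.*-distribˡ-+ (∣ x - y ∣) (majorant top (6 ℕ.+ e)) (majorant top
          (6 ℕ.+ e)))
          (ℚ.*-monoˡ-≤-nonNeg (∣ x - y ∣) {{ℚ.∣-∣-nonNeg (x - y)}} (majorant-halves (5 ℕ.+ e) (ℕ.s≤s (ℕ.s≤s (ℕ.s≤s ℕ.z≤n)))))))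
      (λ e → *-nonNeg (ℚ.0≤∣p∣ (x - y)) (majorant-nonNeg 0≤top (ℕ.pred (e ℕ.+ 6)))) d

  -- Eight terms at 1.55 give about 0.021, and the tail is at most twice (8/5)^8/8! ≈ 0.0011. The
  -- bound 1/40 is half the radius of the interval, just what an iteration contracting by 1/2 may
  -- add at the centre without leaving it.
  centre : ∀ d → ∣ reᴳ (expᴳ mid (d ℕ.+ 8)) ∣ ≤ (+ 1) / 40
  centre d = begin
    ∣ reᴳ (expᴳ mid (d ℕ.+ 8)) ∣
      ≡⟨ cong ∣_∣ (trans (split (reᴳ (expᴳ mid (d ℕ.+ 8))) (reᴳ (expᴳ mid 8)))
           (cong (_+_ (reᴳ (expᴳ mid 8))) (sym (re-- (expᴳ mid (d ℕ.+ 8)) (expᴳ mid 8))))) ⟩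
    ∣ reᴳ (expᴳ mid 8) + reᴳ (expᴳ mid (d ℕ.+ 8) -ᴳ expᴳ mid 8) ∣
      ≤⟨ ℚ.∣p+q∣≤∣p∣+∣q∣ (reᴳ (expᴳ mid 8)) (reᴳ (expᴳ mid (d ℕ.+ 8) -ᴳ expᴳ mid 8)) ⟩
    ∣ reᴳ (expᴳ mid 8) ∣ + ∣ reᴳ (expᴳ mid (d ℕ.+ 8) -ᴳ expᴳ mid 8) ∣
      ≤⟨ ℚ.+-mono-≤ {∣ reᴳ (expᴳ mid 8) ∣} {(+ 22) / 1000} (ℚ.≤ᵇ⇒≤ tt)
           (ℚ.≤-trans (∣re∣≤‖‖ (expᴳ mid (d ℕ.+ 8) -ᴳ expᴳ mid 8)) tail) ⟩
    (+ 22) / 1000 + (majorant top 8 + majorant top 8)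
      ≤⟨ ℚ.≤ᵇ⇒≤ tt ⟩
    (+ 1) / 40 ∎
    where
    open ℚ.≤-Reasoning
    open +-*-Solver
    split : ∀ a b → a ≡ b + (a - b)
    split = solve 2 (λ a b → a := b :+ (a :- b)) refl
    tail : ‖ expᴳ mid (d ℕ.+ 8) -ᴳ expᴳ mid 8 ‖ ≤ majorant top 8 + majorant top 8
    tail = tail-bound {expᴳ mid} {term mid} {majorant top} 8 (λ _ → refl)
      (λ e → term-bound {mid} {top} (ℚ.≤ᵇ⇒≤ tt) (e ℕ.+ 8))
      (λ e → majorant-halves (e ℕ.+ 8) (ℕ.≤-trans (ℕ.s≤s (ℕ.s≤s (ℕ.s≤s ℕ.z≤n))) (ℕ.m≤n+m 8 e)))
      (λ e → majorant-nonNeg 0≤top (e ℕ.+ 8)) d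

-- Fixed-point iteration of q ↦ q + cos q, with ever longer partial sums of
-- the cosine; it contracts the interval [3/2, 8/5] to π/2.
halfπ-seq : ℕ → ℚ
halfπ-seq zero    = mid
halfπ-seq (suc n) = halfπ-seq n + reᴳ (expᴳ (halfπ-seq n) (n ℕ.+ 8))

private
  InI-seq : ∀ n → InI (halfπ-seq n)
  InI-seq zero    = inI (ℚ.≤ᵇ⇒≤ tt)
  InI-seq (suc n) = inI (begin
      ∣ (p + C p) - mid ∣                               ≡⟨ cong ∣_∣ (split (p + C p) mid (C mid)) ⟩
      ∣ ((p + C p) - (mid + C mid)) + C mid ∣             ≤⟨ ℚ.∣p+q∣≤∣p∣+∣q∣ ((p + C p) - (mid + C mid)) (C mid) ⟩
      ∣ (p + C p) - (mid + C mid) ∣ + ∣ C mid ∣           ≤⟨ ℚ.+-mono-≤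
        (subst (λ k → ∣ (p + reᴳ (expᴳ p k)) - (mid + reᴳ (expᴳ mid k)) ∣ ≤ ½ * ∣ p - mid ∣)
          (ℕ.+-assoc n 2 6) (contraction (InI-seq n) (InI-seq 0) (n ℕ.+ 2)))
        (centre n) ⟩
      ½ * ∣ p - mid ∣ + (+ 1) / 40                      ≤⟨ ℚ.+-monoˡ-≤ ((+ 1) / 40) (ℚ.*-monoˡ-≤-nonNeg ½ (offset (InI-seq n))) ⟩
      ½ * ((+ 1) / 20) + (+ 1) / 40                    ≡⟨⟩
      (+ 1) / 20                                       ∎)
    where
    open ℚ.≤-Reasoning
    open +-*-Solver
    p : ℚ
    p = halfπ-seq n
    C : ℚ → ℚ
    C q = reᴳ (expᴳ q (n ℕ.+ 8))
    split : ∀ a c e → a - c ≡ (a - (c + e)) + e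
    split = solve 3 (λ a c e → a :- c := (a :- (c :+ e)) :+ e) refl

  bd₀ : Bounds top
  bd₀ = bounds 0≤top

  open Bounds bd₀

  ¼^≡½^½^ : ∀ n → ¼ ^ℚ n ≡ ½ ^ℚ n * ½ ^ℚ n
  ¼^≡½^½^ zero    = refl
  ¼^≡½^½^ (suc n) = trans (cong (¼ *_) (¼^≡½^½^ n))
    (solve 1 (λ x → con ¼ :* (x :* x) := (con ½ :* x) :* (con ½ :* x)) refl (½ ^ℚ n))
    where open +-*-Solver

  step-size : ℕ → ℚ
  step-size n = reᴳ (expᴳ (halfπ-seq n) (n ℕ.+ 8))

  C₀ : ℚ
  C₀ = ∣ step-size 0 ∣ + ιℕ 4 * K

  -- Since each iterate is its predecessor plus the step, the cosine at the new point is the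
  -- difference of two images of the iteration, at most half the old step, plus the one term by
  -- which the partial sum grows, at most K/4^n. The correction -4K/2^n is chosen so that this
  -- recursion holds with equality.
  step-bound′ : ∀ n → ∣ step-size n ∣ ≤ (C₀ - ιℕ 4 * K * ½ ^ℚ n) * ½ ^ℚ n
  step-bound′ zero    = ℚ.≤-reflexive (lemma (∣ step-size 0 ∣) K)
    where
    open +-*-Solver
    lemma : ∀ s k → s ≡ ((s + ιℕ 4 * k) - ιℕ 4 * k * 1ℚ) * 1ℚ
    lemma = solve 2 (λ s k → s := ((s :+ con (ιℕ 4) :* k) :- con (ιℕ 4) :* k :* con 1ℚ) :* con 1ℚ) refl
  step-bound′ (suc n) = begin
      ∣ step-size (suc n) ∣ ≡⟨ cong ∣_∣ (trans (re-+ (expᴳ p′ (n ℕ.+ 8)) (term p′ (n ℕ.+ 8))) (cong (_+ t) (split p (C p)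
        (C p′)))) ⟩
      ∣ ((p + C p) + C p′ - (p + C p)) + t ∣ ≤⟨ ℚ.∣p+q∣≤∣p∣+∣q∣ ((p + C p) + C p′ - (p + C p)) t ⟩
      ∣ (p + C p) + C p′ - (p + C p) ∣ + ∣ t ∣ ≤⟨ ℚ.+-mono-≤
        (ℚ.≤-trans (subst (λ k → ∣ (p′ + reᴳ (expᴳ p′ k)) - (p + reᴳ (expᴳ p k)) ∣ ≤ ½ * ∣ p′ - p ∣)
          (ℕ.+-assoc n 2 6) (contraction (InI-seq (suc n)) (InI-seq n) (n ℕ.+ 2)))
          (ℚ.*-monoˡ-≤-nonNeg ½ (subst (λ u → ∣ u ∣ ≤ (C₀ - ιℕ 4 * K * x) * x) (sym (cancel p (C p))) (step-bound′ n))))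
        (ℚ.≤-trans (∣re∣≤‖‖ (term p′ (n ℕ.+ 8))) (ℚ.≤-trans (term≤ (∣I∣≤top (InI-seq (suc n))) (n ℕ.+ 8))
          (ℚ.*-monoˡ-≤-nonNeg K {{ℚ.nonNegative (ℚ.<⇒≤ 0<K)}} (decreasing 8)))) ⟩
      ½ * ((C₀ - ιℕ 4 * K * x) * x) + K * ¼ ^ℚ n ≡⟨ trans (cong (λ y → ½ * ((C₀ - ιℕ 4 * K * x) * x) + K * y) (¼^≡½^½^ n))
        (arith C₀ K x) ⟩
      (C₀ - ιℕ 4 * K * (½ * x)) * (½ * x) ∎
    where
    open ℚ.≤-Reasoning
    open +-*-Solver
    p p′ x t : ℚ
    p = halfπ-seq n
    p′ = halfπ-seq (suc n)
    x = ½ ^ℚ n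
    t = reᴳ (term p′ (n ℕ.+ 8))
    C : ℚ → ℚ
    C q = reᴳ (expᴳ q (n ℕ.+ 8))
    split : ∀ p c d → d ≡ (p + c) + d - (p + c)
    split = solve 3 (λ p c d → d := (p :+ c) :+ d :- (p :+ c)) refl
    cancel : ∀ p c → (p + c) - p ≡ c
    cancel = solve 2 (λ p c → (p :+ c) :- p := c) refl
    arith : ∀ c k x → ½ * ((c - ιℕ 4 * k * x) * x) + k * (x * x) ≡ (c - ιℕ 4 * k * (½ * x)) * (½ * x)
    arith = solve 3 (λ c k x → con ½ :* ((c :- con (ιℕ 4) :* k :* x) :* x) :+ k :* (x :* x) :=
      (c :- con (ιℕ 4) :* k :* (con ½ :* x)) :* (con ½ :* x)) refl
    decreasing : ∀ d → ¼ ^ℚ (n ℕ.+ d) ≤ ¼ ^ℚ n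
    decreasing zero    = ℚ.≤-reflexive (cong (¼ ^ℚ_) (ℕ.+-identityʳ n))
    decreasing (suc d) = ℚ.≤-trans (ℚ.≤-reflexive (cong (¼ ^ℚ_) (ℕ.+-suc n d)))
      (ℚ.≤-trans (≤-by _ (*-nonNeg {(+ 3) / 4} (ℚ.≤ᵇ⇒≤ tt) (^ℚ-nonNeg 0≤¼ (n ℕ.+ d)))
        (solve 1 (λ y → y :- con ¼ :* y := con ((+ 3) / 4) :* y) refl (¼ ^ℚ (n ℕ.+ d)))) (decreasing d))

  ½^-halves : ∀ {C} m → C * ½ ^ℚ suc m + C * ½ ^ℚ suc m ≡ C * ½ ^ℚ m
  ½^-halves {C} m = solve 2 (λ c x → c :* (con ½ :* x) :+ c :* (con ½ :* x) := c :* x) refl C (½ ^ℚ m)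
    where open +-*-Solver

0≤C₀ : 0ℚ ≤ C₀
0≤C₀ = +-nonNeg (ℚ.0≤∣p∣ (step-size 0)) (*-nonNeg (ℚ.nonNegative⁻¹ (ιℕ 4)) (ℚ.<⇒≤ 0<K))

step-bound : ∀ n → ∣ step-size n ∣ ≤ C₀ * ½ ^ℚ n
step-bound n = ℚ.≤-trans (step-bound′ n) (≤-by (ιℕ 4 * K * ½ ^ℚ n * ½ ^ℚ n)
  (*-nonNeg (*-nonNeg (*-nonNeg (ℚ.nonNegative⁻¹ (ιℕ 4)) (ℚ.<⇒≤ 0<K)) (^ℚ-nonNeg 0≤½ n)) (^ℚ-nonNeg 0≤½ n))
  (solve 3 (λ c k x → c :* x :- (c :- k :* x) :* x := k :* x :* x) refl C₀ (ιℕ 4 * K) (½ ^ℚ n)))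
  where open +-*-Solver

null-step : Null step-size
null-step = null-≤ (null-½^ C₀) (ev-all step-bound)

private
  halfπ-near : ∀ {N m} → N ℕ.≤ m → ∣ halfπ-seq m - halfπ-seq N ∣ ≤ (C₀ + C₀) * ½ ^ℚ N
  halfπ-near {N} {m} N≤m =
    subst₂ (λ k b → ∣ halfπ-seq k - halfπ-seq N ∣ ≤ b) (ℕ.m∸n+n≡m N≤m) (sym (ℚ.*-distribʳ-+ (½ ^ℚ N) C₀ C₀))
      (ℚ.≤-trans (∣re∣≤‖‖ (S (m ℕ.∸ N ℕ.+ N) -ᴳ S N))
        (tail-bound {S} {f} {λ k → C₀ * ½ ^ℚ k} N (λ _ → refl) (λ d → f≤ (d ℕ.+ N))
          (λ d → ℚ.≤-reflexive (½^-halves {C₀} (d ℕ.+ N))) (λ d → *-nonNeg 0≤C₀ (^ℚ-nonNeg 0≤½ (d ℕ.+ N))) (m ℕ.∸ N)))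
    where
    -- The real sequence is viewed among the Gaussian rationals so that `tail-bound` applies.
    S f : ℕ → 𝔾
    S m = halfπ-seq m +𝕚 0ℚ
    f m = step-size m +𝕚 0ℚ
    f≤ : ∀ m → ‖ f m ‖ ≤ C₀ * ½ ^ℚ m
    f≤ m = ℚ.≤-trans (ℚ.≤-reflexive (ℚ.+-identityʳ (∣ step-size m ∣))) (step-bound m)

  cauchy-by : ∀ {x b : ℕ → ℚ} → Null b → (∀ {N m} → N ℕ.≤ m → ∣ x m - x N ∣ ≤ b N) → IsCauchy x
  cauchy-by {x} {b} b-null h ε 0<ε = let N , small = b-null (½ * ε) (0<½* 0<ε) in
    N , λ m n N≤m N≤n → bound {N} m n (small N ℕ.≤-refl) N≤m N≤n
    where
    open ℚ.≤-Reasoning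
    open +-*-Solver
    split : ∀ a b c → a - b ≡ (a - c) - (b - c)
    split = solve 3 (λ a b c → a :- b := (a :- c) :- (b :- c)) refl
    bound : ∀ {N} m n → ∣ b N ∣ < ½ * ε → N ℕ.≤ m → N ℕ.≤ n → ∣ x m - x n ∣ < ε
    bound {N} m n small N≤m N≤n = begin-strict
      ∣ x m - x n ∣                 ≡⟨ cong ∣_∣ (split (x m) (x n) (x N)) ⟩
      ∣ (x m - x N) - (x n - x N) ∣ ≤⟨ ℚ.∣p-q∣≤∣p∣+∣q∣ (x m - x N) (x n - x N) ⟩
      ∣ x m - x N ∣ + ∣ x n - x N ∣ ≤⟨ ℚ.+-mono-≤ (ℚ.≤-trans (h N≤m) (p≤∣p∣ (b N))) (ℚ.≤-trans (h N≤n) (p≤∣p∣ (b N))) ⟩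
      ∣ b N ∣ + ∣ b N ∣             <⟨ ℚ.+-mono-< small small ⟩
      ½ * ε + ½ * ε                 ≡⟨ ½+½ ε ⟩
      ε                             ∎

abstract
  halfπ-cauchy : IsCauchy halfπ-seq
  halfπ-cauchy = cauchy-by {halfπ-seq} (null-½^ (C₀ + C₀)) halfπ-near

halfπ : ℝ
halfπ = mkℝ halfπ-seq halfπ-cauchy

halfπ-pos : Pos halfπ
halfπ-pos = mkPos ((+ 3) / 2) (ℚ.positive⁻¹ ((+ 3) / 2)) (ev-all (λ n → lower (InI-seq n)))

halfπ<2 : Pos (ι (+ 2) -ᴿ halfπ)
halfπ<2 = mkPos ((+ 2) / 5) (ℚ.positive⁻¹ ((+ 2) / 5)) (ev-all (λ n → ≤-by (top - halfπ-seq n) (p≤q⇒0≤q-p (upper (InI-seq n)))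
  (solve 1 (λ p → (con (ιℕ 2) :- p) :- con ((+ 2) / 5) := con top :- p) refl (halfπ-seq n))))
  where open +-*-Solver

-- The n-th step is the cosine of the n-th iterate up to eight further terms, and the steps tend to
-- zero.
cos-halfπ : re (E halfπ) ≋ 0ᴿ
cos-halfπ = mk≋ (null-≗ {λ n → reᴳ (expᴳ (halfπ-seq n) n) - 0ℚ} {λ n → step-size n + (reᴳ (expᴳ (halfπ-seq n) n) - step-size n)}
  (null-+ null-step (null-≤ (tail-null bd₀) (ev-all tail)))
  (λ n → split (reᴳ (expᴳ (halfπ-seq n) n)) (step-size n)))
  where
  open +-*-Solver
  split : ∀ a b → a - 0ℚ ≡ b + (a - b)
  split = solve 2 (λ a b → a :- con 0ℚ := b :+ (a :- b)) refl
  tail : ∀ n → ∣ reᴳ (expᴳ (halfπ-seq n) n) - step-size n ∣ ≤ K * ¼ ^ℚ n + K * ¼ ^ℚ n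
  tail n = subst (_≤ K * ¼ ^ℚ n + K * ¼ ^ℚ n)
    (∣p-q∣≡∣q-p∣ (step-size n) (reᴳ (expᴳ (halfπ-seq n) n)))
    (ℚ.≤-trans (subst (λ u → ∣ u ∣ ≤ ‖ expᴳ (halfπ-seq n) (n ℕ.+ 8) -ᴳ expᴳ (halfπ-seq n) n ‖)
        (re-- (expᴳ (halfπ-seq n) (n ℕ.+ 8)) (expᴳ (halfπ-seq n) n)) (∣re∣≤‖‖ (expᴳ (halfπ-seq n) (n ℕ.+ 8) -ᴳ expᴳ
          (halfπ-seq n) n)))
      (near bd₀ (∣I∣≤top (InI-seq n)) (ℕ.m≤m+n n 8)))

*-cancel-pos : ∀ {x y} → Pos x → x *ᴿ y ≋ 0ᴿ → y ≋ 0ᴿ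
*-cancel-pos {x} {y} 0<x xy≋0 = ¬pos⇒≋0
  (λ 0<y → ¬pos-0 (pos-cong xy≋0 (pos-* 0<x 0<y)))
  (λ 0<-y → ¬pos-0 (pos-cong (R.trans (R.solve 2 (λ x y → x R.:* (R.:- y) R.:= R.:- (x R.:* y)) ≋-refl x y)
     (R.trans (-‿cong xy≋0) (R.solve 0 (R.:- R.con (+ 0) R.:= R.con (+ 0)) ≋-refl))) (pos-* 0<x 0<-y)))

conj-cong : ∀ {z w} → z ≋ᶜ w → conj z ≋ᶜ conj w
conj-cong (mk≋ᶜ p q) = mk≋ᶜ p (-‿cong q)

conj-* : ∀ z w → conj (z *ᶜ w) ≋ᶜ conj z *ᶜ conj w
conj-* z w = mk≋ᶜ
  (R.solve 4 (λ a b c d → a R.:* c R.:- b R.:* d R.:= a R.:* c R.:- (R.:- b) R.:* (R.:- d)) ≋-refl (re z) (im z) (re w) (im w))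
  (R.solve 4 (λ a b c d → R.:- (a R.:* d R.:+ b R.:* c) R.:= a R.:* (R.:- d) R.:+ (R.:- b) R.:* c) ≋-refl (re z) (im z) (re w)
    (im w))

E-conj : ∀ x → E x *ᶜ conj (E x) ≋ᶜ fromℝ 1ᴿ
E-conj x = C.trans (C.*-congˡ (C.sym (E-neg x))) (C.trans (C.sym (E-+ x (-ᴿ x))) (C.trans (E-cong (R.-‿inverseʳ x)) E-0))

E-unit : ∀ x → UnitModulus (E x)
E-unit x = un≋ (R.trans (R.solve 2 (λ a b → a R.:* a R.:+ b R.:* b R.:= a R.:* a R.:- b R.:* (R.:- b)) ≋-refl (re (E x)) (im
  (E x)))
  (re≋ (E-conj x)))

-- As the cosine vanishes, (s + 1)(s - 1) = 0, and s + 1 is positive.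
sin-halfπ : im (E halfπ) ≋ 1ᴿ
sin-halfπ = R.trans (R.solve 1 (λ s → s R.:= (s R.:- R.con (+ 1)) R.:+ R.con (+ 1)) ≋-refl s)
  (R.trans (R.+-congʳ (*-cancel-pos {s +ᴿ 1ᴿ} (pos-+ (sin-pos halfπ-pos halfπ<2) (pos-fromℚ 0<1))
    (R.trans (R.solve 2 (λ s c → (s R.:+ R.con (+ 1)) R.:* (s R.:- R.con (+ 1)) R.:=
        ((c R.:* c R.:+ s R.:* s) R.:- R.con (+ 1)) R.:- c R.:* c) ≋-refl s c)
      (R.trans (R.+-cong (R.+-congʳ (mk≋ (E-unit halfπ))) (R.-‿cong (R.*-cong cos-halfπ cos-halfπ)))
        (R.solve 0 ((R.con (+ 1) R.:- R.con (+ 1)) R.:- R.con (+ 0) R.:* R.con (+ 0) R.:= R.con (+ 0)) ≋-refl)))))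
    (R.+-identityˡ 1ᴿ))
  where
  s = im (E halfπ)
  c = re (E halfπ)

E-halfπ : E halfπ ≋ᶜ iᶜ
E-halfπ = mk≋ᶜ cos-halfπ sin-halfπ

π : ℝ
π = halfπ +ᴿ halfπ

iᶜ*iᶜ : iᶜ *ᶜ iᶜ ≋ᶜ ιᶜ (ℤ.- (+ 1))
iᶜ*iᶜ = mk≋ᶜ (R.solve 0 (R.con (+ 0) R.:* R.con (+ 0) R.:- R.con (+ 1) R.:* R.con (+ 1) R.:= R.con (ℤ.- (+ 1))) ≋-refl)
  (R.solve 0 (R.con (+ 0) R.:* R.con (+ 1) R.:+ R.con (+ 1) R.:* R.con (+ 0) R.:= R.con (+ 0)) ≋-refl)

E-π : E π ≋ᶜ ιᶜ (ℤ.- (+ 1))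
E-π = C.trans (E-+ halfπ halfπ) (C.trans (C.*-cong E-halfπ E-halfπ) iᶜ*iᶜ)

π-pos : Pos π
π-pos = pos-+ halfπ-pos halfπ-pos

-- Positivity is extended from (0, 2) to (0, π) by sin x = 2 sin(π/2 - x/2) sin(x/2), where both
-- arguments lie between 0 and π/2 < 2.
sin-pos-π : ∀ {x} → Pos x → Pos (π -ᴿ x) → Pos (im (E x))
sin-pos-π {x} 0<x x<π = pos-cong
  (R.trans (R.*-congˡ (R.*-congʳ cos-t)) (R.trans (R.solve 2 (λ c s → R.con (+ 2) R.:*
    (c R.:* s) R.:= c R.:* s R.:+ s R.:* c) ≋-refl (re (E t)) (im (E t)))
    (R.sym (im≋ (C.trans (E-cong x≋t+t) (E-+ t t))))))
  (pos-* (pos-fromℚ (ℚ.positive⁻¹ (ιℕ 2))) (pos-* (sin-pos u-pos u<2) (sin-pos t-pos t<2)))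
  where
  t u : ℝ
  t = fromℚ ½ *ᴿ x
  u = halfπ -ᴿ t
  x≋t+t : x ≋ t +ᴿ t
  x≋t+t = ≡⇒≋ (λ m → sym (½+½ (seq x m)))
  t-pos : Pos t
  t-pos = pos-* (pos-fromℚ 0<½) 0<x
  u-pos : Pos u
  u-pos = pos-cong (≡⇒≋ (λ m → lemma (seq halfπ m) (seq x m))) (pos-* (pos-fromℚ 0<½) x<π)
    where
    open +-*-Solver
    lemma : ∀ h x → ½ * ((h + h) - x) ≡ h - ½ * x
    lemma = solve 2 (λ h x → con ½ :* ((h :+ h) :- x) := h :- con ½ :* x) refl
  t<2 : Pos (ι (+ 2) -ᴿ t)
  t<2 = pos-cong (R.solve 2 (λ h t → (R.con (+ 2) R.:- h) R.:+ (h R.:- t) R.:= R.con (+ 2) R.:- t) ≋-refl halfπ t)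
    (pos-+ halfπ<2 u-pos)
  u<2 : Pos (ι (+ 2) -ᴿ u)
  u<2 = pos-cong (R.solve 2 (λ h t → (R.con (+ 2) R.:- h) R.:+ t R.:= R.con (+ 2) R.:- (h R.:- t)) ≋-refl halfπ t)
    (pos-+ halfπ<2 t-pos)
  cos-t : im (E u) ≋ re (E t)
  cos-t = R.trans (im≋ (C.trans (E-+ halfπ (-ᴿ t)) (C.*-cong E-halfπ (E-neg t))))
    (R.solve 2 (λ c s → R.con (+ 0) R.:* (R.:- s) R.:+ R.con (+ 1) R.:* c R.:= c) ≋-refl (re (E t)) (im (E t)))

sin≢0 : ∀ {x} → Pos x → Pos (π -ᴿ x) → ¬ (im (E x) ≋ 0ᴿ)
sin≢0 0<x x<π eq = ¬pos-0 (pos-cong eq (sin-pos-π 0<x x<π))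

π-isPi : IsPi π
π-isPi = pos⇒0< π-pos , ⇒SinZero (im≋ E-π) , λ x 0<x x<π h → sin≢0 (0<⇒pos 0<x) (<⇒pos x<π) (SinZero⇒ h)

-- Zeros of the sine

1≢-1 : ¬ (fromℝ 1ᴿ ≋ᶜ ιᶜ (ℤ.- (+ 1)))
1≢-1 h = ¬pos-0 (pos-cong (R.trans (R.+-congʳ (re≋ h)) (R.solve 0 (R.con (ℤ.- (+ 1)) R.:+ R.con (+ 1) R.:= R.con (+ 0)) ≋-refl))
  (pos-+ {1ᴿ} {1ᴿ} (pos-fromℚ 0<1) (pos-fromℚ 0<1)))

ℤ-parity : ∀ z → ∃[ c ] (z ≡ + 2 ℤ.* c ⊎ z ≡ + 2 ℤ.* c ℤ.+ + 1)
ℤ-parity z = z ℤDM./ (+ 2) , decide (z ℤDM.% (+ 2)) (ℤDM.n%d<d z (+ 2)) (ℤDM.a≡a%n+[a/n]*n z (+ 2))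
  where
  c = z ℤDM./ (+ 2)
  decide : ∀ r → r ℕ.< 2 → z ≡ + r ℤ.+ c ℤ.* + 2 → z ≡ + 2 ℤ.* c ⊎ z ≡ + 2 ℤ.* c ℤ.+ + 1
  decide 0 _ eq = inj₁ (trans eq (trans (ℤ.+-identityˡ (c ℤ.* + 2)) (ℤ.*-comm c (+ 2))))
  decide 1 _ eq = inj₂ (trans eq (trans (ℤ.+-comm (+ 1) (c ℤ.* + 2)) (cong (ℤ._+ + 1) (ℤ.*-comm c (+ 2)))))
  decide (suc (suc _)) (ℕ.s≤s (ℕ.s≤s ())) _

E-2π : E (π +ᴿ π) ≋ᶜ fromℝ 1ᴿ
E-2π = C.trans (E-+ π π) (C.trans (C.*-cong E-π E-π) (C.solve 0 (C.con (ℤ.- (+ 1)) C.:* C.con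
  (ℤ.- (+ 1)) C.:= C.con (+ 1)) C.refl))

E-2πn : ∀ n → E (π *ᴿ ι (+ 2 ℤ.* + n)) ≋ᶜ fromℝ 1ᴿ
E-2πn zero    = C.trans (E-cong (R.solve 1 (λ p → p R.:* R.con (+ 0) R.:= R.con (+ 0)) ≋-refl π)) E-0
E-2πn (suc n) = C.trans (E-cong (R.trans (R.*-congˡ (R.trans (ι-* (+ 2) (+ suc n)) (R.*-congˡ (ι-+ (+ 1) (+ n)))))
    (R.trans (R.solve 2 (λ p n → p R.:* (R.con (+ 2) R.:* (R.con (+ 1) R.:+ n)) R.:= p R.:* (R.con (+ 2) R.:* n) R.:+
      (p R.:+ p)) ≋-refl π (ι (+ n)))
      (R.+-congʳ (R.*-congˡ (R.sym (ι-* (+ 2) (+ n))))))))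
  (C.trans (E-+ (π *ᴿ ι (+ 2 ℤ.* + n)) (π +ᴿ π)) (C.trans (C.*-cong (E-2πn n) E-2π) (C.*-identityˡ (fromℝ 1ᴿ))))

E-2πz : ∀ z → E (π *ᴿ ι (+ 2 ℤ.* z)) ≋ᶜ fromℝ 1ᴿ
E-2πz (+ n)    = E-2πn n
E-2πz -[1+ n ] = C.trans (E-cong (R.trans (R.*-congˡ (ι-neg (+ 2 ℤ.* + suc n)))
    (R.solve 2 (λ p n → p R.:* (R.:- n) R.:= R.:- (p R.:* n)) ≋-refl π (ι (+ 2 ℤ.* + suc n)))))
  (C.trans (E-neg (π *ᴿ ι (+ 2 ℤ.* + suc n))) (C.trans (conj-cong (E-2πn (suc n)))
    (mk≋ᶜ ≋-refl (R.solve 0 (R.:- R.con (+ 0) R.:= R.con (+ 0)) ≋-refl))))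

private
  -- The open intervals of radius π about the multiples of π overlap, so a real number can be placed
  -- in one of them without deciding an equality.
  Located : ℝ → Set
  Located x = ∃[ z ] (Pos ((x -ᴿ π *ᴿ ι z) +ᴿ π) × Pos (π -ᴿ (x -ᴿ π *ᴿ ι z)))

  here-located : ∀ {x} → Pos (x +ᴿ π) → Pos (π -ᴿ x) → Located x
  here-located {x} p q = + 0
    , pos-cong (R.solve 2 (λ x π → x R.:+ π R.:= (x R.:- π R.:* R.con (+ 0)) R.:+ π) ≋-refl x π) p
    , pos-cong (R.solve 2 (λ x π → π R.:- x R.:= π R.:- (x R.:- π R.:* R.con (+ 0))) ≋-refl x π) q

  -- Induction on an upper bound of x in units of π/2. The alternatives x < π and x > π/2 overlap,
  -- hence are decidable; in the second, x - π is still above -π and has a bound lower by at least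
  -- one unit.
  locate-above : ∀ n x → Pos (x +ᴿ π) → Pos (ι (+ n) *ᴿ halfπ -ᴿ x) → Located x
  locate-above zero x p q = here-located p
    (pos-cong (R.solve 3 (λ x h p → p R.:+ (R.con (+ 0) R.:* h R.:- x) R.:= p R.:- x) ≋-refl x halfπ π) (pos-+ π-pos q))
  locate-above (suc n) x p q = decide (pos-+⁻ (pos-cong
      (R.solve 2 (λ x h → h R.:= ((h R.:+ h) R.:- x) R.:+ (x R.:- h)) ≋-refl x halfπ) halfπ-pos))
    where
    shift : Located (x -ᴿ π) → Located x
    shift (z , p , q) = z ℤ.+ + 1 , pos-cong (R.+-congʳ eq) p , pos-cong (R.+-congˡ (-‿cong eq)) q
      where
      eq : (x -ᴿ π) -ᴿ π *ᴿ ι z ≋ x -ᴿ π *ᴿ ι (z ℤ.+ + 1)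
      eq = R.trans (R.solve 3 (λ x p z → (x R.:- p) R.:- p R.:* z R.:= x R.:- p R.:* (z R.:+ R.con (+ 1))) ≋-refl x π (ι z))
        (R.+-congˡ (-‿cong (R.*-congˡ (R.sym (ι-+ z (+ 1))))))
    decide : Pos (π -ᴿ x) ⊎ Pos (x -ᴿ halfπ) → Located x
    decide (inj₁ x<π) = here-located p x<π
    decide (inj₂ h<x) = shift (locate-above n (x -ᴿ π)
      (pos-cong (R.solve 2 (λ x h → (x R.:- h) R.:+ h R.:= (x R.:- (h R.:+ h)) R.:+ (h R.:+ h)) ≋-refl x halfπ)
        (pos-+ h<x halfπ-pos))
      (pos-cong (R.trans (R.+-congʳ (R.+-congʳ (R.*-congʳ (ι-+ (+ 1) (+ n)))))
        (R.solve 3 (λ x h n → ((R.con (+ 1) R.:+ n) R.:* h R.:- x) R.:+ h R.:= n R.:* h R.:- (x R.:-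
          (h R.:+ h))) ≋-refl x halfπ (ι (+ n))))
        (pos-+ q halfπ-pos)))

  locate : ∀ x → Located x
  locate x = decide (pos-+⁻ (pos-cong (R.solve 2 (λ x p → p R.:= (x R.:+ p) R.:+ (R.:- x)) ≋-refl x π) π-pos))
    where
    reflect : Located (-ᴿ x) → Located x
    reflect (z , p , q) = ℤ.- z
      , pos-cong (R.trans (R.solve 3 (λ x p z → p R.:- ((R.:- x) R.:- p R.:* z) R.:= (x R.:- p R.:*
        (R.:- z)) R.:+ p) ≋-refl x π (ι z))
          (R.+-congʳ (R.+-congˡ (-‿cong (R.*-congˡ (R.sym (ι-neg z))))))) q
      , pos-cong (R.trans (R.solve 3 (λ x p z → ((R.:- x) R.:- p R.:* z) R.:+ p R.:= p R.:- (x R.:- p R.:*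
        (R.:- z))) ≋-refl x π (ι z))
          (R.+-congˡ (-‿cong (R.+-congˡ (-‿cong (R.*-congˡ (R.sym (ι-neg z)))))))) p
    decide : Pos (x +ᴿ π) ⊎ Pos (-ᴿ x) → Located x
    decide (inj₁ p) = let n , q = archimedean x halfπ-pos in locate-above n x p q
    decide (inj₂ p) = let n , q = archimedean (-ᴿ x) halfπ-pos in reflect (locate-above n (-ᴿ x) (pos-+ p π-pos) q)

  sin-zero-near-0 : ∀ {y} → im (E y) ≋ 0ᴿ → Pos (y +ᴿ π) → Pos (π -ᴿ y) → y ≋ 0ᴿ
  sin-zero-near-0 {y} eq p q = ¬pos⇒≋0 (λ 0<y → sin≢0 0<y q eq)
    (λ 0<-y → sin≢0 0<-y (pos-cong (R.solve 2 (λ y p → y R.:+ p R.:= p R.:- (R.:- y)) ≋-refl y π) p)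
      (R.trans (im≋ (E-neg y)) (R.trans (-‿cong eq) (R.solve 0 (R.:- R.con (+ 0) R.:= R.con (+ 0)) ≋-refl))))

E-π*-odd : ∀ c → E (π *ᴿ ι (+ 2 ℤ.* c ℤ.+ + 1)) ≋ᶜ ιᶜ (ℤ.- (+ 1))
E-π*-odd c = C.trans (E-cong (R.trans (R.*-congˡ (ι-+ (+ 2 ℤ.* c) (+ 1)))
    (R.solve 2 (λ p z → p R.:* (z R.:+ R.con (+ 1)) R.:= p R.:* z R.:+ p) ≋-refl π (ι (+ 2 ℤ.* c)))))
  (C.trans (E-+ _ π) (C.trans (C.*-cong (E-2πz c) E-π) (C.*-identityˡ (ιᶜ (ℤ.- (+ 1))))))

-- With im (E (x - πz)) = ± im (E x), the zero of the sine is moved into (-π, π).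
sin-zero : ∀ {x} → im (E x) ≋ 0ᴿ → ∃[ z ] (x ≋ π *ᴿ ι z)
sin-zero {x} sx≋0 = let z , p , q = locate x in z ,
    R.trans (R.solve 2 (λ x w → x R.:= (x R.:- w) R.:+ w) ≋-refl x (π *ᴿ ι z))
      (R.trans (R.+-congʳ (sin-zero-near-0 (shifted z (ℤ-parity z)) p q)) (R.+-identityˡ (π *ᴿ ι z)))
  where
  move : ∀ z e → E (π *ᴿ ι z) ≋ᶜ ιᶜ e → im (E (x -ᴿ π *ᴿ ι z)) ≋ 0ᴿ
  move z e h = R.trans (im≋ (C.trans (E-+ x (-ᴿ (π *ᴿ ι z))) (C.*-congˡ (C.trans (E-neg (π *ᴿ ι z)) (conj-cong h)))))
    (R.trans (R.+-congˡ (R.*-congʳ sx≋0))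
      (R.solve 2 (λ a e → a R.:* (R.:- R.con (+ 0)) R.:+ R.con (+ 0) R.:* e R.:= R.con (+ 0)) ≋-refl (re (E x)) (ι e)))
  shifted : ∀ z → ∃[ c ] (z ≡ + 2 ℤ.* c ⊎ z ≡ + 2 ℤ.* c ℤ.+ + 1) → im (E (x -ᴿ π *ᴿ ι z)) ≋ 0ᴿ
  shifted z (c , inj₁ refl) = move (+ 2 ℤ.* c) (+ 1) (E-2πz c)
  shifted z (c , inj₂ refl) = move (+ 2 ℤ.* c ℤ.+ + 1) (ℤ.- (+ 1)) (E-π*-odd c)

E≋1⇒even : ∀ {x} → E x ≋ᶜ fromℝ 1ᴿ → ∃[ c ] (x ≋ π *ᴿ ι (+ 2 ℤ.* c))
E≋1⇒even {x} h = let z , eq = sin-zero (im≋ h) in decide z eq (ℤ-parity z)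
  where
  decide : ∀ z → x ≋ π *ᴿ ι z → ∃[ c ] (z ≡ + 2 ℤ.* c ⊎ z ≡ + 2 ℤ.* c ℤ.+ + 1) → ∃[ c ] (x ≋ π *ᴿ ι (+ 2 ℤ.* c))
  decide z eq (c , inj₁ refl) = c , eq
  decide z eq (c , inj₂ refl) = ⊥-elim (1≢-1 (C.trans (C.sym h) (C.trans (E-cong eq) (E-π*-odd c))))

E≋-1⇒odd : ∀ {x} → E x ≋ᶜ ιᶜ (ℤ.- (+ 1)) → ∃[ c ] (x ≋ π *ᴿ ι (+ 2 ℤ.* c ℤ.+ + 1))
E≋-1⇒odd {x} h = let z , eq = sin-zero (im≋ h) in decide z eq (ℤ-parity z)
  where
  decide : ∀ z → x ≋ π *ᴿ ι z → ∃[ c ] (z ≡ + 2 ℤ.* c ⊎ z ≡ + 2 ℤ.* c ℤ.+ + 1) → ∃[ c ] (x ≋ π *ᴿ ι (+ 2 ℤ.* c ℤ.+ + 1))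
  decide z eq (c , inj₁ refl) = ⊥-elim (1≢-1 (C.trans (C.sym (E-2πz c)) (C.trans (E-cong (R.sym eq)) h)))
  decide z eq (c , inj₂ refl) = c , eq

-- Integral spans and roots of unity of odd order

ι-pos : ∀ n → Pos (ι (+ suc n))
ι-pos n = pos-fromℚ (ιℚ-mono-< {+ 0} {+ suc n} (ℤ.+<+ (ℕ.s≤s ℕ.z≤n)))

*-cancel-ι : ∀ {z x} → z ≢ + 0 → ι z *ᴿ x ≋ 0ᴿ → x ≋ 0ᴿ
*-cancel-ι {+ zero}  z≢0 _ = ⊥-elim (z≢0 refl)
*-cancel-ι {+ suc n} _ h   = *-cancel-pos (ι-pos n) h
*-cancel-ι { -[1+ n ]} {x} _ h = *-cancel-pos (ι-pos n) (R.trans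
  (R.solve 2 (λ z x → z R.:* x R.:= R.:- ((R.:- z) R.:* x)) ≋-refl (ι (+ suc n)) x)
  (R.trans (-‿cong (R.trans (R.*-congʳ (R.sym (ι-neg (+ suc n)))) h)) (R.solve 0 (R.:- R.con (+ 0) R.:= R.con (+ 0)) ≋-refl)))

*-cancel-ιᶜ : ∀ {z x} → z ≢ + 0 → ιᶜ z *ᶜ x ≋ᶜ fromℝ 0ᴿ → x ≋ᶜ fromℝ 0ᴿ
*-cancel-ιᶜ {z} {x} z≢0 (mk≋ᶜ p q) = mk≋ᶜ
  (*-cancel-ι z≢0 (R.trans (R.solve 3 (λ z a b → z R.:* a R.:= z R.:* a R.:- R.con (+ 0) R.:* b) ≋-refl (ι z) (re x) (im x)) p))
  (*-cancel-ι z≢0 (R.trans (R.solve 3 (λ z a b → z R.:* b R.:= z R.:* b R.:+ R.con (+ 0) R.:* a) ≋-refl (ι z) (re x) (im x)) q))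

odd : ℤ → ℤ
odd e = + 1 ℤ.+ + 2 ℤ.* e

odd≢0 : ∀ e → odd e ≢ + 0
odd≢0 e eq = even≢1 ℤ.∣ e ∣ (trans (sym (ℤ.abs-* (+ 2) e)) (cong ℤ.∣_∣ 2e≡-1))
  where
  2e≡-1 : + 2 ℤ.* e ≡ -[1+ 0 ]
  2e≡-1 = trans (sym (ℤ.+-identityˡ (+ 2 ℤ.* e))) (trans (ℤ.+-assoc -[1+ 0 ] (+ 1) (+ 2 ℤ.* e)) (cong (ℤ._+_ -[1+ 0 ]) eq))
  even≢1 : ∀ n → 2 ℕ.* n ≢ 1
  even≢1 (suc n) h = ℕ.1+n≢0 (trans (sym (ℕ.+-suc n (n ℕ.+ 0))) (ℕ.suc-injective h))

-- What ℂ contributes to the argument modulo 2 is torsion-freeness and 1 ≠ 0.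
module IntegerSpan (R : CommutativeRing 0ℓ 0ℓ)
  (hom : ℤ.+-*-rawRing -Raw-AlmostCommutative⟶ fromCommutativeRing R)
  (torsion-free : ∀ {z x} → z ≢ + 0 → CommutativeRing._≈_ R (CommutativeRing._*_ R (_-Raw-AlmostCommutative⟶_.⟦_⟧ hom z) x)
    (CommutativeRing.0# R) →
    CommutativeRing._≈_ R x (CommutativeRing.0# R))
  (nontrivial : ¬ CommutativeRing._≈_ R (CommutativeRing.1# R) (CommutativeRing.0# R)) where

  open CommutativeRing R using (0#; 1#; _≈_) renaming (Carrier to A; _+_ to _⊕_; _*_ to _⊗_; -_ to ⊖_)
  private
    module H = _-Raw-AlmostCommutative⟶_ hom
    module R′ = CommutativeRing R

  -- Agrees with the given homomorphism, but is 0# and 1# definitionally at 0 and 1.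
  φ : ℤ → A
  φ (+ 0)           = 0#
  φ (+ 1)           = 1#
  φ (+ suc (suc n)) = H.⟦ + suc (suc n) ⟧
  φ -[1+ n ]        = H.⟦ -[1+ n ] ⟧

  φ≈ : ∀ z → φ z ≈ H.⟦ z ⟧
  φ≈ (+ 0)           = R′.sym H.0-homo
  φ≈ (+ 1)           = R′.sym H.1-homo
  φ≈ (+ suc (suc n)) = R′.refl
  φ≈ -[1+ n ]        = R′.refl

  φ-+ : ∀ z w → φ (z ℤ.+ w) ≈ φ z ⊕ φ w
  φ-+ z w = R′.trans (φ≈ (z ℤ.+ w)) (R′.trans (H.+-homo z w) (R′.sym (R′.+-cong (φ≈ z) (φ≈ w))))

  φ-* : ∀ z w → φ (z ℤ.* w) ≈ φ z ⊗ φ w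
  φ-* z w = R′.trans (φ≈ (z ℤ.* w)) (R′.trans (H.*-homo z w) (R′.sym (R′.*-cong (φ≈ z) (φ≈ w))))

  φ-neg : ∀ z → φ (ℤ.- z) ≈ ⊖ φ z
  φ-neg z = R′.trans (φ≈ (ℤ.- z)) (R′.trans (H.-‿homo z) (R′.sym (R′.-‿cong (φ≈ z))))

  private
    φ-≟ : ∀ z w → Maybe (φ z ≈ φ w)
    φ-≟ z w with z ℤ.≟ w
    ... | yes refl = just (CommutativeRing.refl R)
    ... | no _     = nothing

    coeffs : ℤ.+-*-rawRing -Raw-AlmostCommutative⟶ fromCommutativeRing R
    coeffs = record { ⟦_⟧ = φ ; +-homo = φ-+ ; *-homo = φ-* ; -‿homo = φ-neg ; 0-homo = R′.refl ; 1-homo = R′.refl }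

  module Q where
    open CommutativeRing R public
    open Algebra.Solver.Ring ℤ.+-*-rawRing (fromCommutativeRing R)
      coeffs φ-≟ public
  module Q^ = Algebra.Properties.CommutativeSemiring.Exp Q.commutativeSemiring
  open Q^ using (_^_)

  ∑ : ℕ → (ℕ → A) → A
  ∑ zero    f = 0#
  ∑ (suc n) f = f 0 ⊕ ∑ n (λ i → f (suc i))

  ∑-cong : ∀ n {f g} → (∀ i → i ℕ.< n → f i ≈ g i) → ∑ n f ≈ ∑ n g
  ∑-cong zero    h = Q.refl
  ∑-cong (suc n) h = Q.+-cong (h 0 (ℕ.s≤s ℕ.z≤n)) (∑-cong n (λ i i<n → h (suc i) (ℕ.s≤s i<n)))

  ∑-+ : ∀ n f g → ∑ n (λ i → f i ⊕ g i) ≈ ∑ n f ⊕ ∑ n g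
  ∑-+ zero    f g = Q.sym (Q.+-identityˡ _)
  ∑-+ (suc n) f g = Q.trans (Q.+-congˡ (∑-+ n (λ i → f (suc i)) (λ i → g (suc i))))
    (Q.solve 4 (λ a b x y → (a Q.:+ b) Q.:+ (x Q.:+ y) Q.:= (a Q.:+ x) Q.:+ (b Q.:+ y)) Q.refl (f 0) (g 0) _ _)

  ∑-* : ∀ n c f → ∑ n (λ i → c ⊗ f i) ≈ c ⊗ ∑ n f
  ∑-* zero    c f = Q.sym (Q.zeroʳ c)
  ∑-* (suc n) c f = Q.trans (Q.+-congˡ (∑-* n c (λ i → f (suc i)))) (Q.sym (Q.distribˡ c (f 0) _))

  ∑-last : ∀ n f → ∑ (suc n) f ≈ ∑ n f ⊕ f n
  ∑-last zero    f = Q.+-comm (f 0) _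
  ∑-last (suc n) f = Q.trans (Q.+-congˡ (∑-last n (λ i → f (suc i)))) (Q.sym (Q.+-assoc (f 0) _ _))

  φ-odd : ∀ e → φ (odd e) ≈ φ (+ 1) ⊕ φ (+ 2) ⊗ φ e
  φ-odd e = Q.trans (φ-+ (+ 1) (+ 2 ℤ.* e)) (Q.+-congˡ (φ-* (+ 2) e))

  -- Membership in twice the span over the localisation of ℤ at 2, with the denominator cleared by
  -- `odd e`.
  InTwiceSpan : ∀ n (v : ℕ → A) → A → Set
  InTwiceSpan n v x = Σ ℤ λ e → Σ (ℕ → ℤ) λ c → φ (odd e) ⊗ x ≈ φ (+ 2) ⊗ ∑ n (λ j → φ (c j) ⊗ v j)

  -- Gaussian elimination over the local ring of integers at 2: a family lying
  -- in twice its own ℤ-span, up to odd factors, vanishes.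
  2-divisible⇒0 : ∀ n (v : ℕ → A) →
    (∀ i → i ℕ.< n → InTwiceSpan n v (v i)) →
    ∀ i → i ℕ.< n → v i ≈ 0#
  2-divisible⇒0 zero    v h i ()
  2-divisible⇒0 (suc n) v h = all
    where
    row₀ = h 0 (ℕ.s≤s ℕ.z≤n)
    e₀ = proj₁ row₀
    c₀ = proj₁ (proj₂ row₀)
    -- Moving the diagonal coefficient to the left leaves (1 + 2e₀) - 2 c₀(0) = 1 + 2d, again odd:
    -- the pivot is always a unit at 2, so the first vector can be eliminated.
    d : ℤ
    d = e₀ ℤ.+ ℤ.- c₀ 0
    T : A
    T = ∑ n (λ j → φ (c₀ (suc j)) ⊗ v (suc j))
    ιd : φ (odd d) ≈ φ (+ 1) ⊕ φ (+ 2) ⊗ (φ e₀ ⊕ ⊖ φ (c₀ 0))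
    ιd = Q.trans (φ-odd d) (Q.+-congˡ (Q.*-congˡ (Q.trans (φ-+ e₀ (ℤ.- c₀ 0)) (Q.+-congˡ (φ-neg (c₀ 0))))))
    first : φ (odd d) ⊗ v 0 ≈ φ (+ 2) ⊗ T
    first = Q.trans (Q.*-congʳ ιd) (Q.trans
      (Q.solve 3 (λ e c x → (Q.con (+ 1) Q.:+ Q.con (+ 2) Q.:* (e Q.:+ Q.:- c)) Q.:* x Q.:=
        (Q.con (+ 1) Q.:+ Q.con (+ 2) Q.:* e) Q.:* x Q.:+ Q.:- (Q.con (+ 2) Q.:* (c Q.:* x))) Q.refl (φ e₀) (φ (c₀ 0)) (v 0))
      (Q.trans (Q.+-congʳ (Q.trans (Q.*-congʳ (Q.sym (φ-odd e₀))) (proj₂ (proj₂ row₀))))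
        (Q.solve 2 (λ x t → Q.con (+ 2) Q.:* (x Q.:+ t) Q.:+ Q.:- (Q.con (+ 2) Q.:* x) Q.:= Q.con (+ 2) Q.:* t) Q.refl (φ
          (c₀ 0) ⊗ v 0) T)))
    reduce : ∀ i → i ℕ.< n → InTwiceSpan n (λ j → v (suc j)) (v (suc i))
    reduce i i<n = e′ , c′ , (begin
        φ (odd e′) ⊗ v (suc i)
          ≈⟨ Q.*-congʳ ιe′ ⟩
        (φ (odd d) ⊗ φ (odd e)) ⊗ v (suc i)
          ≈⟨ Q.*-assoc _ _ _ ⟩
        φ (odd d) ⊗ (φ (odd e) ⊗ v (suc i))
          ≈⟨ Q.*-congˡ (proj₂ (proj₂ row)) ⟩
        φ (odd d) ⊗ (φ (+ 2) ⊗ (φ (a 0) ⊗ v 0 ⊕ S))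
          ≈⟨ Q.solve 4 (λ d a x s → d Q.:* (Q.con (+ 2) Q.:* (a Q.:* x Q.:+ s)) Q.:=
               Q.con (+ 2) Q.:* (a Q.:* (d Q.:* x) Q.:+ d Q.:* s)) Q.refl (φ (odd d)) (φ (a 0)) (v 0) S ⟩
        φ (+ 2) ⊗ (φ (a 0) ⊗ (φ (odd d) ⊗ v 0) ⊕ φ (odd d) ⊗ S)
          ≈⟨ Q.*-congˡ (Q.+-cong (Q.trans (Q.*-congˡ first) (Q.trans (Q.sym (Q.*-assoc _ _ _)) (Q.sym (∑-* n _ _)))) (Q.sym
            (∑-* n _ _))) ⟩
        φ (+ 2) ⊗ (∑ n (λ j → (φ (a 0) ⊗ φ (+ 2)) ⊗ (φ (c₀ (suc j)) ⊗ v (suc j))) ⊕ ∑ n (λ j → φ (odd d) ⊗ (φ (a (suc j)) ⊗ v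
          (suc j))))
          ≈⟨ Q.*-congˡ (Q.trans (Q.sym (∑-+ n _ _)) (∑-cong n (λ j _ → collect j))) ⟩
        φ (+ 2) ⊗ ∑ n (λ j → φ (c′ j) ⊗ v (suc j)) ∎)
      where
      open Relation.Binary.Reasoning.Setoid Q.setoid
      row = h (suc i) (ℕ.s≤s i<n)
      e = proj₁ row
      a = proj₁ (proj₂ row)
      S : A
      S = ∑ n (λ j → φ (a (suc j)) ⊗ v (suc j))
      e′ : ℤ
      e′ = (d ℤ.+ e) ℤ.+ + 2 ℤ.* (d ℤ.* e)
      c′ : ℕ → ℤ
      c′ j = (a 0 ℤ.* + 2) ℤ.* c₀ (suc j) ℤ.+ odd d ℤ.* a (suc j)
      ιe′ : φ (odd e′) ≈ φ (odd d) ⊗ φ (odd e)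
      ιe′ = Q.trans (φ-odd e′) (Q.trans (Q.+-congˡ (Q.*-congˡ (Q.trans (φ-+ (d ℤ.+ e) (+ 2 ℤ.* (d ℤ.* e)))
          (Q.+-cong (φ-+ d e) (Q.trans (φ-* (+ 2) (d ℤ.* e)) (Q.*-congˡ (φ-* d e)))))))
        (Q.trans (Q.solve 2 (λ d e → Q.con (+ 1) Q.:+ Q.con (+ 2) Q.:* ((d Q.:+ e) Q.:+ Q.con (+ 2) Q.:* (d Q.:* e)) Q.:=
            (Q.con (+ 1) Q.:+ Q.con (+ 2) Q.:* d) Q.:* (Q.con (+ 1) Q.:+ Q.con (+ 2) Q.:* e)) Q.refl (φ d) (φ e))
          (Q.sym (Q.*-cong (φ-odd d) (φ-odd e)))))
      collect : ∀ j → (φ (a 0) ⊗ φ (+ 2)) ⊗ (φ (c₀ (suc j)) ⊗ v (suc j)) ⊕ φ (odd d) ⊗ (φ (a (suc j)) ⊗ v (suc j))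
        ≈ φ (c′ j) ⊗ v (suc j)
      collect j = Q.trans (Q.solve 5 (λ p q r s x → p Q.:* (q Q.:* x) Q.:+ r Q.:* (s Q.:* x) Q.:=
        (p Q.:* q Q.:+ r Q.:* s) Q.:* x) Q.refl
          (φ (a 0) ⊗ φ (+ 2)) (φ (c₀ (suc j))) (φ (odd d)) (φ (a (suc j))) (v (suc j)))
        (Q.*-congʳ (Q.sym (Q.trans (φ-+ ((a 0 ℤ.* + 2) ℤ.* c₀ (suc j)) (odd d ℤ.* a (suc j)))
          (Q.+-cong (Q.trans (φ-* (a 0 ℤ.* + 2) (c₀ (suc j))) (Q.*-congʳ (φ-* (a 0) (+ 2)))) (φ-* (odd d) (a (suc j)))))))
    rest : ∀ i → i ℕ.< n → v (suc i) ≈ 0#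
    rest = 2-divisible⇒0 n (λ i → v (suc i)) reduce
    all : ∀ i → i ℕ.< suc n → v i ≈ 0#
    all zero    _ = torsion-free (odd≢0 d) (Q.trans (Q.*-congʳ (Q.sym (φ≈ (odd d)))) (Q.trans first (Q.trans (Q.*-congˡ
        (Q.trans (∑-cong n (λ j j<n → Q.trans (Q.*-congˡ (rest j j<n)) (Q.trans (Q.zeroʳ _) (Q.sym (Q.zeroʳ 0#))))) (Q.trans
          (∑-* n 0# (λ _ → 0#)) (Q.zeroˡ _))))
      (Q.zeroʳ _))))
    all (suc i) (ℕ.s≤s i<n) = rest i i<n


  geo : A → ℕ → A
  geo z zero    = 0#
  geo z (suc n) = geo z n ⊕ z ^ n

  geo-telescope : ∀ z n → (z ⊕ ⊖ 1#) ⊗ geo z n ≈ z ^ n ⊕ ⊖ 1#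
  geo-telescope z zero    = Q.solve 1 (λ z →
    (z Q.:+ Q.:- Q.con (+ 1)) Q.:* Q.con (+ 0) Q.:= Q.con (+ 1) Q.:+ Q.:- Q.con (+ 1)) Q.refl z
  geo-telescope z (suc n) = Q.trans (Q.distribˡ _ (geo z n) (z ^ n)) (Q.trans (Q.+-congʳ (geo-telescope z n))
    (Q.solve 2 (λ z p → (p Q.:+ Q.:- Q.con (+ 1)) Q.:+
      (z Q.:+ Q.:- Q.con (+ 1)) Q.:* p Q.:= z Q.:* p Q.:+ Q.:- Q.con (+ 1)) Q.refl z (z ^ n)))

  sq-^ : ∀ z u → (z ⊗ z) ^ u ≈ z ^ dbl u
  sq-^ z zero    = Q.refl
  sq-^ z (suc u) = Q.trans (Q.*-congˡ (sq-^ z u)) (Q.*-assoc z z (z ^ dbl u))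

  geo-square : ∀ z u → (z ⊕ 1#) ⊗ geo (z ⊗ z) u ≈ geo z (dbl u)
  geo-square z zero    = Q.zeroʳ _
  geo-square z (suc u) = Q.trans (Q.distribˡ _ (geo (z ⊗ z) u) ((z ⊗ z) ^ u))
    (Q.trans (Q.+-cong (geo-square z u) (Q.*-congˡ (sq-^ z u)))
      (Q.solve 3 (λ g z p → g Q.:+ (z Q.:+ Q.con (+ 1)) Q.:* p Q.:= (g Q.:+ p) Q.:+ z Q.:* p) Q.refl (geo z (dbl u)) z
        (z ^ dbl u)))

  -- `cancel` says that ζ - ζ⁻¹ is not a zero divisor; it expresses that ζ is neither 1 nor -1 in a
  -- form that can be divided out.
  module OddRoot (u : ℕ) (ζ ζ̄ : A) (inv : ζ ⊗ ζ̄ ≈ 1#) (root : ζ ^ suc (dbl u) ≈ 1#)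
    (cancel : ∀ x → (ζ ⊕ ⊖ ζ̄) ⊗ x ≈ 0# → x ≈ 0#) where

    private
      m : ℕ
      m = suc (dbl u)
      z₂ θ κ : A
      z₂ = ζ ⊗ ζ
      θ = ζ ⊕ ζ̄
      -- The inverse of θ = ζ⁻¹(1 + ζ²). Multiplying θ by `geo (z₂ ⊗ z₂) u` gives ζ⁻¹ times the sum
      -- of ζ^(2i) over i < 2u, and that sum is -ζ^(4u) because the one over i < m vanishes. The
      -- factor -ζ³ then yields ζ^(4u+2) = 1.
      κ = ⊖ ((z₂ ⊗ ζ) ⊗ geo (z₂ ⊗ z₂) u)

      geo-zero : geo z₂ m ≈ 0#
      geo-zero = cancel (geo z₂ m) (Q.trans
        (Q.trans (Q.*-congʳ (Q.trans (Q.sym (Q.*-identityʳ _)) (Q.trans (Q.*-congˡ (Q.sym inv))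
          (Q.trans (Q.solve 2 (λ z w → (z Q.:+ Q.:- w) Q.:* (z Q.:* w) Q.:= w Q.:* (z Q.:* z Q.:+ Q.:- (z Q.:* w))) Q.refl ζ ζ̄)
            (Q.*-congˡ (Q.+-congˡ (Q.-‿cong inv)))))))
          (Q.*-assoc ζ̄ _ (geo z₂ m)))
        (Q.trans (Q.*-congˡ (Q.trans (geo-telescope z₂ m) (Q.trans (Q.+-congʳ (Q.trans (Q^.^-distrib-* ζ ζ m) (Q.trans
          (Q.*-cong root root) (Q.*-identityˡ _))))
          (Q.-‿inverseʳ _)))) (Q.zeroʳ ζ̄)))

      θκ : θ ⊗ κ ≈ 1#
      θκ = begin
        θ ⊗ κ
          ≈⟨ Q.solve 3 (λ z w g → (z Q.:+ w) Q.:* (Q.:- ((z Q.:* z Q.:* z) Q.:* g)) Q.:=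
               Q.:- ((z Q.:* z) Q.:* ((z Q.:* z Q.:+ z Q.:* w) Q.:* g))) Q.refl ζ ζ̄ (geo (z₂ ⊗ z₂) u) ⟩
        ⊖ (z₂ ⊗ ((z₂ ⊕ ζ ⊗ ζ̄) ⊗ geo (z₂ ⊗ z₂) u))
          ≈⟨ Q.-‿cong (Q.*-congˡ (Q.trans (Q.*-congʳ (Q.+-congˡ inv)) (geo-square z₂ u))) ⟩
        ⊖ (z₂ ⊗ geo z₂ (dbl u))
          ≈⟨ Q.solve 3 (λ z g p → Q.:- (z Q.:* g) Q.:= Q.:- (z Q.:* (g Q.:+ p)) Q.:+ z Q.:* p) Q.refl z₂ (geo z₂ (dbl u))
            (z₂ ^ dbl u) ⟩
        ⊖ (z₂ ⊗ geo z₂ m) ⊕ z₂ ^ m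
          ≈⟨ Q.+-cong (Q.-‿cong (Q.trans (Q.*-congˡ geo-zero) (Q.zeroʳ z₂))) (Q.trans (Q^.^-distrib-* ζ ζ m)
            (Q.*-cong root root)) ⟩
        ⊖ 0# ⊕ 1# ⊗ 1#
          ≈⟨ Q.solve 0 (Q.:- Q.con (+ 0) Q.:+ Q.con (+ 1) Q.:* Q.con (+ 1) Q.:= Q.con (+ 1)) Q.refl ⟩
        1# ∎
        where open Relation.Binary.Reasoning.Setoid Q.setoid

      comb : (ℕ → ℤ) → ℕ → A
      comb c i = φ (c i) ⊗ ζ ^ i

      -- Elements of ℤ[ζ] are represented by their action on the span of the powers of ζ. Preserving
      -- the span is visibly closed under sums and products, so coefficient sequences never have to
      -- be multiplied.
      InSpan Multiplier : A → Set
      InSpan z = Σ (ℕ → ℤ) λ c → z ≈ ∑ m (comb c)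
      Multiplier a = ∀ {z} → InSpan z → InSpan (a ⊗ z)

      span-cong : ∀ {z w} → z ≈ w → InSpan z → InSpan w
      span-cong eq (c , h) = c , Q.trans (Q.sym eq) h

      span-+ : ∀ {z w} → InSpan z → InSpan w → InSpan (z ⊕ w)
      span-+ (c , h) (d , k) = (λ i → c i ℤ.+ d i) , Q.trans (Q.+-cong h k) (Q.trans (Q.sym (∑-+ m (comb c) (comb d)))
        (∑-cong m (λ i _ → Q.trans (Q.sym (Q.distribʳ (ζ ^ i) (φ (c i)) (φ (d i)))) (Q.*-congʳ (Q.sym (φ-+ (c i) (d i)))))))

      mul-φ : ∀ n → Multiplier (φ n)
      mul-φ n (c , h) = (λ i → n ℤ.* c i) , Q.trans (Q.*-congˡ h) (Q.trans (Q.sym (∑-* m (φ n) (comb c)))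
        (∑-cong m (λ i _ → Q.trans (Q.sym (Q.*-assoc (φ n) (φ (c i)) (ζ ^ i))) (Q.*-congʳ (Q.sym (φ-* n (c i)))))))

      mul-ζ : Multiplier ζ
      mul-ζ {z} (c , h) = c′ , Q.trans (Q.*-congˡ h) (Q.trans (Q.sym (∑-* m ζ (comb c)))
        (Q.trans (∑-last (dbl u) (λ i → ζ ⊗ comb c i))
        (Q.trans (Q.+-comm _ _) (Q.+-cong
          (Q.trans (swap (c (dbl u)) (ζ ^ dbl u)) (Q.*-congˡ root))
          (∑-cong (dbl u) (λ i _ → swap (c i) (ζ ^ i)))))))
        where
        c′ : ℕ → ℤ
        -- A cyclic shift: ζ^m = 1 brings the top coefficient to the front.
        c′ zero    = c (dbl u)
        c′ (suc i) = c i
        swap : ∀ a p → ζ ⊗ (φ a ⊗ p) ≈ φ a ⊗ (ζ ⊗ p)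
        swap a p = Q.solve 3 (λ z a p → z Q.:* (a Q.:* p) Q.:= a Q.:* (z Q.:* p)) Q.refl ζ (φ a) p

      mul-cong : ∀ {a b} → a ≈ b → Multiplier a → Multiplier b
      mul-cong eq ma s = span-cong (Q.*-congʳ eq) (ma s)

      mul-* : ∀ {a b} → Multiplier a → Multiplier b → Multiplier (a ⊗ b)
      mul-* {a} {b} ma mb {z} s = span-cong (Q.sym (Q.*-assoc a b z)) (ma (mb s))

      mul-+ : ∀ {a b} → Multiplier a → Multiplier b → Multiplier (a ⊕ b)
      mul-+ {a} {b} ma mb {z} s = span-cong (Q.sym (Q.distribʳ z a b)) (span-+ (ma s) (mb s))

      mul-^ : ∀ {a} → Multiplier a → ∀ n → Multiplier (a ^ n)
      mul-^ ma zero    = mul-φ (+ 1)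
      mul-^ ma (suc n) = mul-* ma (mul-^ ma n)

      mul-geo : ∀ {a} → Multiplier a → ∀ n → Multiplier (geo a n)
      mul-geo ma zero    = mul-φ (+ 0)
      mul-geo ma (suc n) = mul-+ (mul-geo ma n) (mul-^ ma n)

      mul-κ : Multiplier κ
      mul-κ = mul-cong (Q.solve 1 (λ x → Q.con (ℤ.- (+ 1)) Q.:* x Q.:= Q.:- x) Q.refl _)
        (mul-* (mul-φ (ℤ.- (+ 1))) (mul-* (mul-* (mul-* mul-ζ mul-ζ) mul-ζ) (mul-geo (mul-* (mul-* mul-ζ mul-ζ)
          (mul-* mul-ζ mul-ζ)) u)))

      span-1 : InSpan (1#)
      span-1 = δ , Q.trans (Q.sym (Q.+-identityʳ _)) (Q.+-cong (Q.sym (Q.*-identityˡ _))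
        (Q.sym (Q.trans (∑-cong (dbl u) (λ i _ → Q.trans (Q.zeroˡ _) (Q.sym (Q.zeroʳ 0#))))
          (Q.trans (∑-* (dbl u) 0# (λ _ → 0#)) (Q.zeroˡ _)))))
        where
        δ : ℕ → ℤ
        δ zero    = + 1
        δ (suc _) = + 0

    -- θ is invertible in ℤ[ζ], so an odd multiple of a power of θ is not an even integer.
    θ^k-not-even : ∀ k e w → ¬ (φ (odd e) ⊗ θ ^ k ≈ φ (+ 2 ℤ.* w))
    θ^k-not-even k e w eq = nontrivial (2-divisible⇒0 m (ζ ^_) halve 0 (ℕ.s≤s ℕ.z≤n))
      where
      θκ^ : ∀ k → θ ^ k ⊗ κ ^ k ≈ 1#
      θκ^ zero    = Q.*-identityˡ _
      θκ^ (suc k) = Q.trans (Q.solve 4 (λ a b c d → (a Q.:* b) Q.:* (c Q.:* d) Q.:= (a Q.:* c) Q.:* (b Q.:* d)) Q.refl θ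
        (θ ^ k) κ (κ ^ k))
        (Q.trans (Q.*-cong θκ (θκ^ k)) (Q.*-identityˡ _))
      -- Multiplying the assumed equation by κ^k shows that the odd integer `odd e` is 2wκ^k. Hence
      -- `odd e` times any power of ζ is twice an element of ℤ[ζ], and the elimination makes all
      -- powers vanish, including ζ^0 = 1.
      halve : ∀ i → i ℕ.< m → InTwiceSpan m (ζ ^_) (ζ ^ i)
      halve i _ = e , proj₁ y , (begin
        φ (odd e) ⊗ ζ ^ i
          ≈⟨ Q.*-congʳ (Q.trans (Q.sym (Q.*-identityʳ _)) (Q.*-congˡ (Q.sym (θκ^ k)))) ⟩
        (φ (odd e) ⊗ (θ ^ k ⊗ κ ^ k)) ⊗ ζ ^ i
          ≈⟨ Q.*-congʳ (Q.trans (Q.sym (Q.*-assoc (φ (odd e)) _ _)) (Q.*-congʳ (Q.trans eq (φ-* (+ 2) w)))) ⟩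
        ((φ (+ 2) ⊗ φ w) ⊗ κ ^ k) ⊗ ζ ^ i
          ≈⟨ Q.solve 4 (λ t w p z → ((t Q.:* w) Q.:* p) Q.:* z Q.:= t Q.:* ((w Q.:* p) Q.:* (z Q.:* Q.con (+ 1)))) Q.refl
            (φ (+ 2)) (φ w) (κ ^ k) (ζ ^ i) ⟩
        φ (+ 2) ⊗ ((φ w ⊗ κ ^ k) ⊗ (ζ ^ i ⊗ 1#))
          ≈⟨ Q.*-congˡ (proj₂ y) ⟩
        φ (+ 2) ⊗ ∑ m (λ j → φ (proj₁ y j) ⊗ ζ ^ j) ∎)
        where
        open Relation.Binary.Reasoning.Setoid Q.setoid
        y : InSpan ((φ w ⊗ κ ^ k) ⊗ (ζ ^ i ⊗ 1#))
        y = mul-* (mul-φ w) (mul-^ mul-κ k) (mul-^ mul-ζ i span-1)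

-- Left eigenvectors

-- Operations and equality are separate parameters: the raw rings behind the matrices of the
-- statement carry `_≈ᴿ_` and `_≈ᶜ_`, while the proofs run on `_≋_` and `_≋ᶜ_`.
module Rows (raw : RawRing 0ℓ 0ℓ) (Eq : RawRing.Carrier raw → RawRing.Carrier raw → Set)
  (isCR : IsCommutativeRing Eq (RawRing._+_ raw) (RawRing._*_ raw) (RawRing.-_ raw) (RawRing.0# raw) (RawRing.1# raw)) where

  ring : CommutativeRing 0ℓ 0ℓ
  ring = record { isCommutativeRing = isCR }

  module Q = CommutativeRing ring
  open Q using (_≈_)
  open RawRing raw using (0#; 1#) renaming (Carrier to A; _+_ to _⊕_; _*_ to _⊗_)
  open MatrixOps raw public renaming (_^ᴹ_ to _^ᴹ′_)
  open Algebra.Properties.Semiring.Sum Q.semiring public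
    using (sum; sum-cong-≋; ∑-distrib-+; ∑-comm; *-distribˡ-sum; *-distribʳ-sum; sum-replicate-zero)
  open Algebra.Properties.CommutativeSemiring.Exp Q.commutativeSemiring using (_^_)
  open Relation.Binary.Reasoning.Setoid Q.setoid

  sum-zero : ∀ {n} {f : Fin n → A} → (∀ j → f j ≈ 0#) → sum f ≈ 0#
  sum-zero {n} h = Q.trans (sum-cong-≋ h) (sum-replicate-zero n)

  sum-single : ∀ {n} (f : Fin n → A) i → (∀ j → j ≢ i → f j ≈ 0#) → sum f ≈ f i
  sum-single f Fin.zero    h = Q.trans (Q.+-congˡ (sum-zero (λ j → h (Fin.suc j) (λ ())))) (Q.+-identityʳ (f Fin.zero))
  sum-single f (Fin.suc i) h = Q.trans (Q.+-cong (h Fin.zero (λ ())) (sum-single (λ j → f (Fin.suc j)) i (λ j j≢i → h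
    (Fin.suc j) (λ eq → j≢i (Fin.suc-injective eq)))))
    (Q.+-identityˡ _)

  basis-same : ∀ {n} (a : Fin n) → basis a a ≈ 1#
  basis-same a with a Fin.≟ a
  ... | yes _  = Q.refl
  ... | no a≢a = ⊥-elim (a≢a refl)

  basis-diff : ∀ {n} {a b : Fin n} → a ≢ b → basis a b ≈ 0#
  basis-diff {a = a} {b} a≢b with a Fin.≟ b
  ... | yes a≡b = ⊥-elim (a≢b a≡b)
  ... | no _    = Q.refl

  basis-sym : ∀ {n} (a b : Fin n) → basis a b ≈ basis b a
  basis-sym a b = decide (a Fin.≟ b)
    where
    decide : _ → basis a b ≈ basis b a
    decide (yes refl) = Q.refl
    decide (no a≢b)   = Q.trans (basis-diff a≢b) (Q.sym (basis-diff (λ b≡a → a≢b (sym b≡a))))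

  sum-basis : ∀ {n} (f : Fin n → A) a → sum (λ i → f i ⊗ basis a i) ≈ f a
  sum-basis f a = Q.trans (sum-single (λ i → f i ⊗ basis a i) a (λ j j≢a → Q.trans (Q.*-congˡ (basis-diff (λ a≡j → j≢a
    (sym a≡j)))) (Q.zeroʳ (f j))))
    (Q.trans (Q.*-congˡ (basis-same a)) (Q.*-identityʳ (f a)))

  infixl 7 _◁_

  _◁_ : ∀ {n} → (Fin n → A) → Matrix A n → Fin n → A
  (v ◁ M) y = sum (λ x → v x ⊗ M x y)

  ◁-congˡ : ∀ {n} {v w : Fin n → A} (M : Matrix A n) → (∀ x → v x ≈ w x) → ∀ y → (v ◁ M) y ≈ (w ◁ M) y
  ◁-congˡ M h y = sum-cong-≋ (λ x → Q.*-congʳ (h x))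

  ◁-congʳ : ∀ {n} (v : Fin n → A) {M N : Matrix A n} → (∀ x y → M x y ≈ N x y) → ∀ y → (v ◁ M) y ≈ (v ◁ N) y
  ◁-congʳ v h y = sum-cong-≋ (λ x → Q.*-congˡ (h x y))

  ◁-scale : ∀ {n} c (v : Fin n → A) (M : Matrix A n) y → ((λ x → c ⊗ v x) ◁ M) y ≈ c ⊗ (v ◁ M) y
  ◁-scale c v M y = Q.trans (sum-cong-≋ (λ x → Q.*-assoc c (v x) (M x y))) (Q.sym (*-distribˡ-sum c (λ x → v x ⊗ M x y)))

  ◁-·ᴹ : ∀ {n} c (v : Fin n → A) (M : Matrix A n) y → (v ◁ (c ·ᴹ M)) y ≈ c ⊗ (v ◁ M) y
  ◁-·ᴹ c v M y = Q.trans (sum-cong-≋ (λ x → Q.trans (Q.sym (Q.*-assoc (v x) c (M x y))) (Q.trans (Q.*-congʳ (Q.*-comm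
    (v x) c)) (Q.*-assoc c (v x) (M x y)))))
    (Q.sym (*-distribˡ-sum c (λ x → v x ⊗ M x y)))

  ◁-+ᴹ : ∀ {n} (v : Fin n → A) (M N : Matrix A n) y → (v ◁ (M +ᴹ N)) y ≈ (v ◁ M) y ⊕ (v ◁ N) y
  ◁-+ᴹ v M N y = Q.trans (sum-cong-≋ (λ x → Q.distribˡ (v x) (M x y) (N x y)))
    (∑-distrib-+ (λ x → v x ⊗ M x y) (λ x → v x ⊗ N x y))

  ◁-1ᴹ : ∀ {n} (v : Fin n → A) y → (v ◁ 1ᴹ) y ≈ v y
  ◁-1ᴹ v y = Q.trans (sum-cong-≋ (λ x → Q.*-congˡ (basis-sym x y))) (sum-basis v y)

  ◁-*ᴹ : ∀ {n} (v : Fin n → A) (M N : Matrix A n) y → (v ◁ (M *ᴹ N)) y ≈ ((v ◁ M) ◁ N) y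
  ◁-*ᴹ v M N y = begin
    sum (λ x → v x ⊗ sum (λ l → M x l ⊗ N l y))     ≈⟨ sum-cong-≋ (λ x → *-distribˡ-sum (v x) (λ l → M x l ⊗ N l y)) ⟩
    sum (λ x → sum (λ l → v x ⊗ (M x l ⊗ N l y)))   ≈⟨ ∑-comm (λ x l → v x ⊗ (M x l ⊗ N l y)) ⟩
    sum (λ l → sum (λ x → v x ⊗ (M x l ⊗ N l y)))   ≈⟨ sum-cong-≋ (λ l → Q.trans (sum-cong-≋ (λ x → Q.sym (Q.*-assoc (v x)
      (M x l) (N l y)))) (Q.sym (*-distribʳ-sum (N l y) (λ x → v x ⊗ M x l)))) ⟩
    sum (λ l → sum (λ x → v x ⊗ M x l) ⊗ N l y)     ∎

  basis-◁ : ∀ {n} (M : Matrix A n) x y → (basis x ◁ M) y ≈ M x y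
  basis-◁ M x y = Q.trans (sum-cong-≋ (λ i → Q.*-comm (basis x i) (M i y))) (sum-basis (λ i → M i y) x)

  sum-◁ : ∀ {r n} (u : Fin r → Fin n → A) (M : Matrix A n) y → ((λ x → sum (λ j → u j x)) ◁ M) y ≈ sum (λ j → (u j ◁ M) y)
  sum-◁ u M y = Q.trans (sum-cong-≋ (λ x → *-distribʳ-sum (M x y) (λ j → u j x))) (∑-comm (λ x j → u j x ⊗ M x y))

  LeftEigen : ∀ {n} → Matrix A n → A → (Fin n → A) → Set
  LeftEigen M λ′ v = ∀ y → (v ◁ M) y ≈ λ′ ⊗ v y

  eigen-*ᴹ : ∀ {n} {M N : Matrix A n} {κ λ′} {v} → LeftEigen M κ v → LeftEigen N λ′ v → LeftEigen (M *ᴹ N) (κ ⊗ λ′) v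
  eigen-*ᴹ {M = M} {N} {κ} {λ′} {v} hM hN y = Q.trans (◁-*ᴹ v M N y) (Q.trans (◁-congˡ N hM y) (Q.trans (◁-scale κ v N y)
    (Q.trans (Q.*-congˡ (hN y)) (Q.sym (Q.*-assoc κ λ′ (v y))))))

  eigen-^ᴹ : ∀ {n} {M : Matrix A n} {κ v} → LeftEigen M κ v → ∀ k → LeftEigen (M ^ᴹ′ k) (κ ^ k) v
  eigen-^ᴹ {v = v} h zero y = Q.trans (◁-1ᴹ v y) (Q.sym (Q.*-identityˡ (v y)))
  eigen-^ᴹ h (suc k)        = eigen-*ᴹ h (eigen-^ᴹ h k)

  -- Serves C₈, where the rational decomposition is one for A²; factors of M are therefore consumed
  -- in pairs.
  eigen-^ᴹ-dbl : ∀ {n} {M : Matrix A n} {κ v} → LeftEigen (M *ᴹ M) κ v → ∀ k → LeftEigen (M ^ᴹ′ dbl k) (κ ^ k) v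
  eigen-^ᴹ-dbl {v = v} h zero y = Q.trans (◁-1ᴹ v y) (Q.sym (Q.*-identityˡ (v y)))
  eigen-^ᴹ-dbl {M = M} {κ} {v} h (suc k) y =
    Q.trans (◁-*ᴹ v M (M *ᴹ (M ^ᴹ′ dbl k)) y) (Q.trans (◁-*ᴹ (v ◁ M) M (M ^ᴹ′ dbl k) y)
      (Q.trans (◁-congˡ (M ^ᴹ′ dbl k) (λ x → Q.trans (Q.sym (◁-*ᴹ v M M x)) (h x)) y)
        (Q.trans (◁-scale κ v (M ^ᴹ′ dbl k) y) (Q.trans (Q.*-congˡ (eigen-^ᴹ-dbl {M = M} h k y)) (Q.sym (Q.*-assoc κ (κ ^ k)
          (v y)))))))

module ℝM = Rows ℝ-rawRing _≋_ (CommutativeRing.isCommutativeRing ℝ-ring)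
module ℂM = Rows ℂ-rawRing _≋ᶜ_ (CommutativeRing.isCommutativeRing ℂ-ring)

embed : ∀ {n} → Matrix ℝ n → Matrix ℂ n
embed M i j = fromℝ (M i j)

fromℝ-sum : ∀ {n} (f : Fin n → ℝ) → fromℝ (ℝM.sum f) ≋ᶜ ℂM.sum (λ i → fromℝ (f i))
fromℝ-sum {zero}  f = C.refl
fromℝ-sum {suc n} f = C.trans (fromℝ-+ (f Fin.zero) (ℝM.sum (λ i → f (Fin.suc i)))) (C.+-congˡ {fromℝ (f Fin.zero)} (fromℝ-sum
  (λ i → f (Fin.suc i))))

embed-^ᴹ : ∀ {n} (M : Matrix ℝ n) k i j → embed (M ^ᴹ k) i j ≋ᶜ (embed M ℂM.^ᴹ′ k) i j
embed-^ᴹ M zero i j = decide (i Fin.≟ j)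
  where

  decide : _ → embed (M ^ᴹ 0) i j ≋ᶜ ℂM.basis i j
  decide (yes refl) = C.trans (fromℝ-cong (ℝM.basis-same i)) (C.sym (ℂM.basis-same i))
  decide (no i≢j)   = C.trans (fromℝ-cong (ℝM.basis-diff i≢j)) (C.sym (ℂM.basis-diff i≢j))
embed-^ᴹ M (suc k) i j = C.trans (fromℝ-sum (λ l → M i l *ᴿ (M ^ᴹ k) l j))
  (ℂM.sum-cong-≋ (λ l → C.trans (fromℝ-* (M i l) ((M ^ᴹ k) l j)) (C.*-congˡ {fromℝ (M i l)} (embed-^ᴹ M k l j))))

fromℝ-^ : ∀ x k → fromℝ (x ^ᴿ k) ≋ᶜ fromℝ x ^ᶜ k
fromℝ-^ x zero    = C.refl
fromℝ-^ x (suc k) = C.trans (fromℝ-* x (x ^ᴿ k)) (C.*-congˡ {fromℝ x} (fromℝ-^ x k))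

cexp-cong : ∀ {z w} → z ≋ᶜ w → ∀ N → cexp z N ≋ᶜ cexp w N
cexp-cong eq zero    = C.refl
cexp-cong eq (suc N) = C.+-cong (cexp-cong eq N) (C.*-congˡ {fromℝ (fromℚ (1/ N !))} (C^.^-congˡ N eq))

◁-expPartial : ∀ {n} {M : Matrix ℂ n} {κ v} → ℂM.LeftEigen M κ v →
  ∀ N y → (v ℂM.◁ expPartial M N) y ≋ᶜ cexp κ N *ᶜ v y
◁-expPartial {M = M} {κ} {v} h zero y = C.trans (ℂM.sum-zero (λ x → C.zeroʳ (v x))) (C.sym (C.zeroˡ (v y)))
◁-expPartial {M = M} {κ} {v} h (suc N) y = C.trans
  (ℂM.◁-+ᴹ v (expPartial M N) (fromℝ (fromℚ (1/ N !)) ℂM.·ᴹ (M ℂM.^ᴹ′ N)) y)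
  (C.trans (C.+-cong (◁-expPartial h N y) (C.trans (ℂM.◁-·ᴹ (fromℝ (fromℚ (1/ N !))) v (M ℂM.^ᴹ′ N) y)
      (C.trans (C.*-congˡ {fromℝ (fromℚ (1/ N !))} (ℂM.eigen-^ᴹ h N y)) (C.sym (C.*-assoc (fromℝ (fromℚ (1/ N !))) (κ ^ᶜ N)
        (v y))))))
    (C.sym (C.distribʳ (v y) (cexp κ N) (fromℝ (fromℚ (1/ N !)) *ᶜ κ ^ᶜ N))))

limᶜ-sum : ∀ {n} {s : ℕ → Fin n → ℂ} {L : Fin n → ℂ} → (∀ i → (λ N → s N i) ⇝ᶜ L i) → (λ N → ℂM.sum (s N)) ⇝ᶜ ℂM.sum L
limᶜ-sum {zero}  h = limᶜ-const
limᶜ-sum {suc n} h = limᶜ-+ (h Fin.zero) (limᶜ-sum (λ i → h (Fin.suc i)))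

evolution : ∀ {n} → Matrix ℝ n → ℝ → Matrix ℂ n
evolution K τ = (-ᶜ (iᶜ *ᶜ fromℝ τ)) ℂM.·ᴹ embed K

evolution-row : ∀ {n} (K : Matrix ℝ n) τ {κ} {v : Fin n → ℂ} → ℂM.LeftEigen (embed K) (fromℝ κ) v →
  ∀ y → (λ N → (v ℂM.◁ expPartial (evolution K τ) N) y) ⇝ᶜ E (-ᴿ (τ *ᴿ κ)) *ᶜ v y
evolution-row K τ {κ} {v} h y = limᶜ-cong
  (λ N → C.trans (C.*-comm (v y) _) (C.trans (C.*-congʳ {v y} (cexp-cong phase N)) (C.sym (◁-expPartial eigen N y))))
  (C.*-comm (v y) (E (-ᴿ (τ *ᴿ κ)))) (limᶜ-* (v y) (E-lim (-ᴿ (τ *ᴿ κ))))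
  where
  μ : ℂ
  μ = (-ᶜ (iᶜ *ᶜ fromℝ τ)) *ᶜ fromℝ κ
  eigen : ℂM.LeftEigen (evolution K τ) μ v
  eigen y = C.trans (ℂM.◁-·ᴹ (-ᶜ (iᶜ *ᶜ fromℝ τ)) v (embed K) y)
    (C.trans (C.*-congˡ { -ᶜ (iᶜ *ᶜ fromℝ τ)} (h y)) (C.sym (C.*-assoc (-ᶜ (iᶜ *ᶜ fromℝ τ)) (fromℝ κ) (v y))))
  phase : iᶜ *ᶜ fromℝ (-ᴿ (τ *ᴿ κ)) ≋ᶜ μ
  phase = C.trans (C.*-congˡ {iᶜ} (C.trans (fromℝ-neg (τ *ᴿ κ)) (C.-‿cong (fromℝ-* τ κ))))
    (C.solve 3 (λ i t k → i C.:* (C.:- (t C.:* k)) C.:= (C.:- (i C.:* t)) C.:* k) C.refl iᶜ (fromℝ τ) (fromℝ κ))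

-- The entry of vU at a is computed twice: as the limit of the scalar exponential series, and by
-- pairing v with the column U e_a = γ e_b.
PSTAt⇒phase : ∀ {n} (K : Matrix ℝ n) {a b τ} (pst : PSTAt K a b τ) → let γ = proj₁ (proj₂ (proj₂ pst)) in
  ∀ {κ v} → ℂM.LeftEigen (embed K) (fromℝ κ) v → E (-ᴿ (τ *ᴿ κ)) *ᶜ v a ≋ᶜ γ *ᶜ v b
PSTAt⇒phase K {a} {b} {τ} (U , isExp , γ , _ , transfer) {κ} {v} h = C.trans
  (limᶜ-unique (evolution-row K τ h a) (limᶜ-sum (λ x → limᶜ-* (v x) (⟶ᶜ⇒⇝ᶜ (isExp x a)))))
  (C.trans (ℂM.sum-cong-≋ (λ x → C.trans (C.*-congˡ {v x} (C.trans (C.sym (ℂM.sum-basis (U x) a)) (≈ᶜ⇒≋ᶜ (transfer x))))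
      (C.solve 3 (λ v g b → v C.:* (g C.:* b) C.:= g C.:* (v C.:* b)) C.refl (v x) γ (ℂM.basis b x))))
    (C.trans (C.sym (ℂM.*-distribˡ-sum γ (λ x → v x *ᶜ ℂM.basis b x))) (C.*-congˡ {γ} (ℂM.sum-basis v b))))

-- U is assembled from a decomposition of each basis row into eigenvectors of K.
PSTAt-from-eigenvectors : ∀ {n r} (K : Matrix ℝ n) {a b τ} (u : Fin r → Fin n → Fin n → ℂ) (κ : Fin r → ℝ) (ε : Fin r → ℂ)
  (γ : ℂ) →
  (∀ x y → ℂM.basis x y ≋ᶜ ℂM.sum (λ j → u j x y)) →
  (∀ j x → ℂM.LeftEigen (embed K) (fromℝ (κ j)) (u j x)) →
  (∀ j → E (-ᴿ (τ *ᴿ κ j)) ≋ᶜ ε j) → UnitModulus γ →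
  (∀ x → ℂM.sum (λ j → ε j *ᶜ u j x a) ≋ᶜ γ *ᶜ ℂM.basis b x) → PSTAt K a b τ
PSTAt-from-eigenvectors {n} {r} K {a} {b} {τ} u κ ε γ decomposition eigen phases unit transfer =
  U , (λ x y → ⇝ᶜ⇒⟶ᶜ (limᶜ-cong (λ N → C.sym (row N x y)) (ℂM.sum-cong-≋ (λ j → C.*-congʳ {u j x y} (phases j)))
        (limᶜ-sum (λ j → evolution-row K τ (eigen j x) y)))) ,
  γ , unit , λ x → ≋ᶜ⇒≈ᶜ (C.trans (ℂM.sum-basis (U x) a) (transfer x))
  where
  U : Matrix ℂ n
  U x y = ℂM.sum (λ j → ε j *ᶜ u j x y)
  row : ∀ N x y → expPartial (evolution K τ) N x y ≋ᶜ ℂM.sum (λ j → (u j x ℂM.◁ expPartial (evolution K τ) N) y)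
  row N x y = C.trans (C.sym (ℂM.basis-◁ (expPartial (evolution K τ) N) x y))
    (C.trans (ℂM.◁-congˡ (expPartial (evolution K τ) N) (decomposition x) y) (ℂM.sum-◁ (λ j → u j x) (expPartial
      (evolution K τ) N) y))

-- Cycles

cycleAdj-edge : ∀ {n} {x y : Fin n} → CycleEdge x y → cycleAdj n x y ≡ 1ᴿ
cycleAdj-edge {x = x} {y} e = cong (λ t → if t then 1ᴿ else 0ᴿ) (dec-true (cycleEdge? x y) e)

cycleAdj-nonedge : ∀ {n} {x y : Fin n} → ¬ CycleEdge x y → cycleAdj n x y ≡ 0ᴿ
cycleAdj-nonedge {x = x} {y} ¬e = cong (λ t → if t then 1ᴿ else 0ᴿ) (dec-false (cycleEdge? x y) ¬e)

next-exists : ∀ {n} (y : Fin n) → ∃[ x ] Next y x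
next-exists {suc n} y with suc (toℕ y) ℕ.<? suc n
... | yes lt = Fin.fromℕ< lt , inj₁ (sym (Fin.toℕ-fromℕ< lt))
... | no ≮   = Fin.zero , inj₂ (ℕ.≤-antisym (Fin.toℕ<n y) (ℕ.≮⇒≥ ≮) , refl)

prev-exists : ∀ {n} (y : Fin n) → ∃[ x ] Next x y
prev-exists {suc n} Fin.zero    = Fin.fromℕ n , inj₂ (cong suc (Fin.toℕ-fromℕ n) , refl)
prev-exists {suc n} (Fin.suc y) = Fin.inject₁ y , inj₁ (cong suc (Fin.toℕ-inject₁ y))

next-unique : ∀ {n} {y x x′ : Fin n} → Next y x → Next y x′ → x ≡ x′
next-unique (inj₁ p) (inj₁ q) = Fin.toℕ-injective (trans (sym p) q)
next-unique {x = x} (inj₁ p) (inj₂ (q , _)) = ⊥-elim (ℕ.<-irrefl (trans (sym p) q) (Fin.toℕ<n x))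
next-unique {x′ = x′} (inj₂ (p , _)) (inj₁ q) = ⊥-elim (ℕ.<-irrefl (trans (sym q) p) (Fin.toℕ<n x′))
next-unique (inj₂ (_ , p)) (inj₂ (_ , q)) = Fin.toℕ-injective (trans p (sym q))

prev-unique : ∀ {n} {y x x′ : Fin n} → Next x y → Next x′ y → x ≡ x′
prev-unique (inj₁ p) (inj₁ q) = Fin.toℕ-injective (ℕ.suc-injective (trans p (sym q)))
prev-unique (inj₁ p) (inj₂ (_ , q)) = ⊥-elim (ℕ.1+n≢0 (trans p q))
prev-unique (inj₂ (_ , p)) (inj₁ q) = ⊥-elim (ℕ.1+n≢0 (trans q p))
prev-unique (inj₂ (p , _)) (inj₂ (q , _)) = Fin.toℕ-injective (ℕ.suc-injective (trans p (sym q)))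

-- Keeps the two neighbours of a vertex distinct, so that a column of A is a sum of two different
-- basis vectors; this is where n ≥ 3 enters the spectrum.
¬next-both : ∀ {n} {x y : Fin n} → 3 ℕ.≤ n → Next x y → ¬ Next y x
¬next-both {x = x} _ (inj₁ p) (inj₁ q) = ℕ.<-irrefl (sym (trans (cong suc p) q)) (ℕ.s≤s (ℕ.n≤1+n (toℕ x)))
¬next-both 3≤n (inj₁ p) (inj₂ (q , r)) = ℕ.<⇒≱ 3≤n (ℕ.≤-reflexive (sym (trans (cong suc (trans (cong suc (sym r)) p)) q)))
¬next-both 3≤n (inj₂ (p , r)) (inj₁ q) = ℕ.<⇒≱ 3≤n (ℕ.≤-reflexive (sym (trans (cong suc (trans (cong suc (sym r)) q)) p)))
¬next-both 3≤n (inj₂ (p , r)) (inj₂ (q , s)) = ℕ.<⇒≱ 3≤n (ℕ.m≤n⇒m≤1+n (ℕ.≤-reflexive (sym (trans (cong suc (sym r)) q))))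

module _ {n} (3≤n : 3 ℕ.≤ n) (ζ ζ̄ : ℂ) (inv : ζ *ᶜ ζ̄ ≋ᶜ fromℝ 1ᴿ) (root : ζ ^ᶜ n ≋ᶜ fromℝ 1ᴿ) where

  private
    v : Fin n → ℂ
    v i = ζ ^ᶜ toℕ i

    next-value : ∀ {x y} → Next x y → v y ≋ᶜ ζ *ᶜ v x
    next-value {x} {y} (inj₁ p)       = C.reflexive (cong (ζ ^ᶜ_) (sym p))
    next-value {x} {y} (inj₂ (p , q)) = C.trans (C.reflexive (cong (ζ ^ᶜ_) q)) (C.trans (C.sym root) (C.reflexive (cong
      (ζ ^ᶜ_) (sym p))))

    prev-value : ∀ {x y} → Next x y → v x ≋ᶜ ζ̄ *ᶜ v y
    prev-value {x} {y} h = C.trans (C.trans (C.sym (C.*-identityˡ (v x))) (C.*-congʳ {v x} (C.sym inv)))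
      (C.trans (C.solve 3 (λ z w a → (z C.:* w) C.:* a C.:= w C.:* (z C.:* a)) C.refl ζ ζ̄ (v x)) (C.*-congˡ {ζ̄} (C.sym
        (next-value h))))

    summand : ∀ {p q y} → Next p y → Next y q → ∀ x →
      v x *ᶜ fromℝ (cycleAdj n x y) ≋ᶜ v x *ᶜ ℂM.basis p x +ᶜ v x *ᶜ ℂM.basis q x
    summand {p} {q} {y} hp hq x = decide (x Fin.≟ p) (x Fin.≟ q)
      where
      values : ∀ {α β δ} → fromℝ (cycleAdj n x y) ≋ᶜ δ → ℂM.basis p x ≋ᶜ α → ℂM.basis q x ≋ᶜ β → δ ≋ᶜ α +ᶜ β →
        v x *ᶜ fromℝ (cycleAdj n x y) ≋ᶜ v x *ᶜ ℂM.basis p x +ᶜ v x *ᶜ ℂM.basis q x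
      values {α} {β} a b c eq = C.trans (C.*-congˡ {v x} (C.trans a (C.trans eq (C.+-cong (C.sym b) (C.sym c)))))
        (C.distribˡ (v x) (ℂM.basis p x) (ℂM.basis q x))
      decide : _ → _ → _
      decide (yes refl) (yes refl) = ⊥-elim (¬next-both 3≤n hp hq)
      decide (yes refl) (no x≢q)   = values (C.reflexive (cong fromℝ (cycleAdj-edge {x = x} {y} (inj₁ hp)))) (ℂM.basis-same x)
        (ℂM.basis-diff (λ eq → x≢q (sym eq))) (C.sym (C.+-identityʳ _))
      decide (no x≢p)   (yes refl) = values (C.reflexive (cong fromℝ (cycleAdj-edge {x = x} {y} (inj₂ hq)))) (ℂM.basis-diff
        (λ eq → x≢p (sym eq))) (ℂM.basis-same x) (C.sym (C.+-identityˡ _))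
      decide (no x≢p)   (no x≢q)   = values (C.reflexive (cong fromℝ (cycleAdj-nonedge {x = x} {y} nonedge)))
          (ℂM.basis-diff (λ eq → x≢p (sym eq))) (ℂM.basis-diff (λ eq → x≢q (sym eq))) (C.sym (C.+-identityˡ _))
        where
        nonedge : ¬ CycleEdge x y
        nonedge (inj₁ h) = x≢p (prev-unique h hp)
        nonedge (inj₂ h) = x≢q (next-unique h hq)

  cycle-eigenvector : ℂM.LeftEigen (embed (cycleAdj n)) (ζ +ᶜ ζ̄) v
  cycle-eigenvector y = C.trans (ℂM.sum-cong-≋ (summand (proj₂ (prev-exists y)) (proj₂ (next-exists y))))
    (C.trans (ℂM.∑-distrib-+ (λ x → v x *ᶜ ℂM.basis p x) (λ x → v x *ᶜ ℂM.basis q x))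
    (C.trans (C.+-cong (C.trans (ℂM.sum-basis v p) (prev-value (proj₂ (prev-exists y)))) (C.trans (ℂM.sum-basis v q)
      (next-value (proj₂ (next-exists y)))))
      (C.solve 3 (λ z w a → w C.:* a C.:+ z C.:* a C.:= (z C.:+ w) C.:* a) C.refl ζ ζ̄ (v y))))
    where
    p = proj₁ (prev-exists y)
    q = proj₁ (next-exists y)

-- The length of the arc that avoids the edge between n - 1 and 0, rather than the graph distance;
-- the other arc has length n - `dist`.
dist : ∀ {n} → Fin n → Fin n → ℕ
dist a b = ℕ.∣ toℕ a - toℕ b ∣

private
  dist-suc : ∀ m b → ℕ.∣ m - b ∣ ℕ.≤ suc ℕ.∣ suc m - b ∣ × ℕ.∣ suc m - b ∣ ℕ.≤ suc ℕ.∣ m - b ∣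
  dist-suc m b = ℕ.≤-trans (ℕ.∣-∣-triangle m (suc m) b) (ℕ.+-monoˡ-≤ _ (ℕ.≤-reflexive (one m)))
               , ℕ.≤-trans (ℕ.∣-∣-triangle (suc m) m b) (ℕ.+-monoˡ-≤ _ (ℕ.≤-reflexive (trans (ℕ.∣-∣-comm (suc m) m) (one m))))
    where
    one : ∀ m → ℕ.∣ m - suc m ∣ ≡ 1
    one zero    = refl
    one (suc m) = one m

  wrap : ∀ {n} {x b : Fin n} → suc (toℕ x) ≡ n → dist x b ℕ.+ suc (toℕ b) ≡ n
  wrap {n} {x} {b} eq = trans (ℕ.+-suc (dist x b) (toℕ b)) (trans (cong suc
    (trans (cong (ℕ._+ toℕ b) (ℕ.m≤n⇒∣n-m∣≡n∸m b≤x)) (ℕ.m∸n+n≡m b≤x))) eq)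
    where
    b≤x : toℕ b ℕ.≤ toℕ x
    b≤x = ℕ.≤-pred (subst (suc (toℕ b) ℕ.≤_) (sym eq) (Fin.toℕ<n b))

-- A walk either does not wrap around the cycle, or makes up the rest of it.
walk-length : ∀ {n ℓ} {a b : Fin n} → CycleWalk ℓ a b → dist a b ℕ.≤ ℓ ⊎ n ℕ.≤ ℓ ℕ.+ dist a b
walk-length {a = a} here = inj₁ (ℕ.≤-reflexive (ℕ.∣n-n∣≡0 (toℕ a)))
walk-length {n} {suc ℓ} {a} {b} (step {b = c} e w) = extend e (walk-length w)
  where
  lipschitz : dist a b ℕ.≤ suc (dist c b) → dist c b ℕ.≤ suc (dist a b) →
    dist c b ℕ.≤ ℓ ⊎ n ℕ.≤ ℓ ℕ.+ dist c b → dist a b ℕ.≤ suc ℓ ⊎ n ℕ.≤ suc ℓ ℕ.+ dist a b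
  lipschitz p q (inj₁ h) = inj₁ (ℕ.≤-trans p (ℕ.s≤s h))
  lipschitz p q (inj₂ h) = inj₂ (ℕ.≤-trans h (ℕ.≤-trans (ℕ.+-monoʳ-≤ ℓ q) (ℕ.≤-reflexive (ℕ.+-suc ℓ (dist a b)))))
  extend : CycleEdge a c → dist c b ℕ.≤ ℓ ⊎ n ℕ.≤ ℓ ℕ.+ dist c b → dist a b ℕ.≤ suc ℓ ⊎ n ℕ.≤ suc ℓ ℕ.+ dist a b
  extend (inj₁ (inj₁ p)) = let l , u = dist-suc (toℕ a) (toℕ b) in
    lipschitz (subst (λ t → dist a b ℕ.≤ suc ℕ.∣ t - toℕ b ∣) p l) (subst (λ t → ℕ.∣ t - toℕ b ∣ ℕ.≤ suc (dist a b)) p u)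
  extend (inj₂ (inj₁ p)) = let l , u = dist-suc (toℕ c) (toℕ b) in
    lipschitz (subst (λ t → ℕ.∣ t - toℕ b ∣ ℕ.≤ suc (dist c b)) p u) (subst (λ t → dist c b ℕ.≤ suc ℕ.∣ t - toℕ b ∣) p l)
  -- An edge between n - 1 and 0 exchanges the two alternatives, because the values of `dist` at its
  -- two ends add up to n - 1.
  extend (inj₁ (inj₂ (p , q))) (inj₁ h) = inj₂ (begin
      n                           ≡⟨ wrap {x = a} {b} p ⟨
      dist a b ℕ.+ suc (toℕ b)    ≤⟨ ℕ.+-monoʳ-≤ (dist a b) (ℕ.s≤s (subst (λ t → ℕ.∣ t - toℕ b ∣ ℕ.≤ ℓ) q h)) ⟩
      dist a b ℕ.+ suc ℓ          ≡⟨ ℕ.+-comm (dist a b) (suc ℓ) ⟩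
      suc ℓ ℕ.+ dist a b          ∎)
    where open ℕ.≤-Reasoning
  extend (inj₁ (inj₂ (p , q))) (inj₂ h) = inj₁ (ℕ.≤-trans (ℕ.n≤1+n _) (ℕ.≤-trans (ℕ.+-cancelʳ-≤ (toℕ b) _ ℓ (begin
      suc (dist a b) ℕ.+ toℕ b    ≡⟨ ℕ.+-suc (dist a b) (toℕ b) ⟨
      dist a b ℕ.+ suc (toℕ b)    ≡⟨ wrap {x = a} {b} p ⟩
      n                           ≤⟨ subst (λ t → n ℕ.≤ ℓ ℕ.+ ℕ.∣ t - toℕ b ∣) q h ⟩
      ℓ ℕ.+ toℕ b                 ∎)) (ℕ.n≤1+n ℓ)))
    where open ℕ.≤-Reasoning
  extend (inj₂ (inj₂ (p , q))) (inj₁ h) = inj₂ (begin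
      n                           ≡⟨ wrap {x = c} {b} p ⟨
      dist c b ℕ.+ suc (toℕ b)    ≤⟨ ℕ.+-monoˡ-≤ (suc (toℕ b)) h ⟩
      ℓ ℕ.+ suc (toℕ b)           ≡⟨ ℕ.+-suc ℓ (toℕ b) ⟩
      suc ℓ ℕ.+ toℕ b             ≡⟨ cong (λ t → suc ℓ ℕ.+ ℕ.∣ t - toℕ b ∣) (sym q) ⟩
      suc ℓ ℕ.+ dist a b          ∎)
    where open ℕ.≤-Reasoning
  extend (inj₂ (inj₂ (p , q))) (inj₂ h) = inj₁ (begin
      dist a b                    ≡⟨ cong (λ t → ℕ.∣ t - toℕ b ∣) q ⟩
      toℕ b                       ≤⟨ ℕ.n≤1+n (toℕ b) ⟩
      suc (toℕ b)                 ≤⟨ ℕ.+-cancelˡ-≤ (dist c b) _ ℓ (ℕ.≤-trans (ℕ.≤-reflexive (wrap {x = c} {b} p)) (ℕ.≤-trans h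
        (ℕ.≤-reflexive (ℕ.+-comm ℓ (dist c b))))) ⟩
      ℓ                           ≤⟨ ℕ.n≤1+n ℓ ⟩
      suc ℓ                       ∎)
    where open ℕ.≤-Reasoning

walk-++ : ∀ {n ℓ ℓ′} {a b c : Fin n} → CycleWalk ℓ a b → CycleWalk ℓ′ b c → CycleWalk (ℓ ℕ.+ ℓ′) a c
walk-++ here        w′ = w′
walk-++ (step e w) w′ = step e (walk-++ w w′)

walk-reverse : ∀ {n ℓ} {a b : Fin n} → CycleWalk ℓ a b → CycleWalk ℓ b a
walk-reverse here = here
walk-reverse {ℓ = suc ℓ} {b = b} (step {a = a} e w) =
  subst (λ k → CycleWalk k b a) (ℕ.+-comm ℓ 1) (walk-++ (walk-reverse w) (step (reverse-edge e) here))
  where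
  reverse-edge : ∀ {n} {x y : Fin n} → CycleEdge x y → CycleEdge y x
  reverse-edge (inj₁ h) = inj₂ h
  reverse-edge (inj₂ h) = inj₁ h

walk-up : ∀ {n} d {a b : Fin n} → toℕ a ℕ.+ d ≡ toℕ b → CycleWalk d a b
walk-up zero {a} {b} eq = subst (CycleWalk 0 a) (Fin.toℕ-injective (trans (sym (ℕ.+-identityʳ (toℕ a))) eq)) here
walk-up {n} (suc d) {a} {b} eq = step (inj₁ (inj₁ (sym (Fin.toℕ-fromℕ< a<n)))) (walk-up d (trans (cong (ℕ._+ d)
  (Fin.toℕ-fromℕ< a<n)) eq′))
  where
  eq′ : suc (toℕ a) ℕ.+ d ≡ toℕ b
  eq′ = trans (sym (ℕ.+-suc (toℕ a) d)) eq
  a<n : suc (toℕ a) ℕ.< n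
  a<n = ℕ.≤-<-trans (ℕ.≤-trans (ℕ.m≤m+n (suc (toℕ a)) d) (ℕ.≤-reflexive eq′)) (Fin.toℕ<n b)

walk-dist : ∀ {n} (a b : Fin n) → CycleWalk (dist a b) a b
walk-dist a b with ℕ.≤-total (toℕ a) (toℕ b)
... | inj₁ a≤b = walk-up (dist a b) (trans (cong (toℕ a ℕ.+_) (ℕ.m≤n⇒∣m-n∣≡n∸m a≤b)) (ℕ.m+[n∸m]≡n a≤b))
... | inj₂ b≤a = walk-reverse (walk-up (dist a b) (trans (cong (toℕ b ℕ.+_) (ℕ.m≤n⇒∣n-m∣≡n∸m b≤a)) (ℕ.m+[n∸m]≡n b≤a)))

private
  -- Down from a to 0, across to the last vertex, and down to b.
  walk-wrap : ∀ {n} {a b : Fin n} → toℕ a ℕ.≤ toℕ b → ∃[ ℓ ] (ℓ ℕ.+ dist a b ≡ n × CycleWalk ℓ a b)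
  walk-wrap {suc n} {a} {b} a≤b = suc ℓ , total
      , subst (λ k → CycleWalk k a b) (ℕ.+-suc (toℕ a) (n ℕ.∸ toℕ b))
          (walk-++ (walk-reverse (walk-up (toℕ a) {Fin.zero} {a} refl))
            (step (inj₂ (inj₂ (cong suc (Fin.toℕ-fromℕ n) , refl)))
              (walk-reverse (walk-up (n ℕ.∸ toℕ b) (trans (ℕ.m+[n∸m]≡n b≤n) (sym (Fin.toℕ-fromℕ n)))))))
    where
    b≤n : toℕ b ℕ.≤ n
    b≤n = ℕ.≤-pred (Fin.toℕ<n b)
    ℓ : ℕ
    ℓ = toℕ a ℕ.+ (n ℕ.∸ toℕ b)
    total : suc ℓ ℕ.+ dist a b ≡ suc n
    total = cong suc (begin
      (toℕ a ℕ.+ (n ℕ.∸ toℕ b)) ℕ.+ dist a b          ≡⟨ cong ((toℕ a ℕ.+ (n ℕ.∸ toℕ b)) ℕ.+_) (ℕ.m≤n⇒∣m-n∣≡n∸m a≤b) ⟩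
      (toℕ a ℕ.+ (n ℕ.∸ toℕ b)) ℕ.+ (toℕ b ℕ.∸ toℕ a) ≡⟨ cong (ℕ._+ (toℕ b ℕ.∸ toℕ a)) (ℕ.+-comm (toℕ a) (n ℕ.∸ toℕ b)) ⟩
      ((n ℕ.∸ toℕ b) ℕ.+ toℕ a) ℕ.+ (toℕ b ℕ.∸ toℕ a) ≡⟨ ℕ.+-assoc (n ℕ.∸ toℕ b) (toℕ a) (toℕ b ℕ.∸ toℕ a) ⟩
      (n ℕ.∸ toℕ b) ℕ.+ (toℕ a ℕ.+ (toℕ b ℕ.∸ toℕ a)) ≡⟨ cong ((n ℕ.∸ toℕ b) ℕ.+_) (ℕ.m+[n∸m]≡n a≤b) ⟩
      (n ℕ.∸ toℕ b) ℕ.+ toℕ b                         ≡⟨ ℕ.m∸n+n≡m b≤n ⟩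
      n ∎)
      where open ≡-Reasoning

walk-around : ∀ {n} (a b : Fin n) → ∃[ ℓ ] (ℓ ℕ.+ dist a b ≡ n × CycleWalk ℓ a b)
walk-around a b with ℕ.≤-total (toℕ a) (toℕ b)
... | inj₁ a≤b = walk-wrap a≤b
... | inj₂ b≤a = let ℓ , eq , w = walk-wrap b≤a in
  ℓ , trans (cong (ℓ ℕ.+_) (ℕ.∣-∣-comm (toℕ a) (toℕ b))) eq , walk-reverse w

2*h≡h+h : ∀ h → 2 ℕ.* h ≡ h ℕ.+ h
2*h≡h+h h = cong (h ℕ.+_) (ℕ.+-identityʳ h)

dist⇒antipodal : ∀ {n h} {a b : Fin n} → n ≡ 2 ℕ.* h → dist a b ≡ h → Antipodal a b
dist⇒antipodal {n} {h} {a} {b} n≡2h eq = h , n≡2h , subst (λ k → CycleWalk k a b) eq (walk-dist a b) , λ ℓ w → minimal ℓ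
  (walk-length w)
  where
  minimal : ∀ ℓ → dist a b ℕ.≤ ℓ ⊎ n ℕ.≤ ℓ ℕ.+ dist a b → h ℕ.≤ ℓ
  minimal ℓ (inj₁ p) = subst (ℕ._≤ ℓ) eq p
  minimal ℓ (inj₂ p) = ℕ.+-cancelʳ-≤ h h ℓ (subst₂ ℕ._≤_ (trans n≡2h (2*h≡h+h h)) (cong (ℓ ℕ.+_) eq) p)

-- The distance h is at most the length of either arc; as the two lengths add up to 2h, both equal
-- h.
antipodal⇒dist : ∀ {n} {a b : Fin n} → Antipodal a b → n ≡ 2 ℕ.* dist a b
antipodal⇒dist {n} {a} {b} (h , n≡2h , _ , minimal) = trans n≡2h (cong (2 ℕ.*_) (ℕ.≤-antisym (minimal (dist a b) (walk-dist a b))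
  (let ℓ , eq , w = walk-around a b in
    ℕ.+-cancelˡ-≤ h (dist a b) h (ℕ.≤-trans (ℕ.+-monoˡ-≤ (dist a b) (minimal ℓ w)) (ℕ.≤-reflexive (trans eq (trans n≡2h
      (2*h≡h+h h))))))))

-- Necessity

UnitC : ℂ → Set
UnitC z = z *ᶜ conj z ≋ᶜ fromℝ 1ᴿ

conj-^ : ∀ z n → conj (z ^ᶜ n) ≋ᶜ conj z ^ᶜ n
conj-^ z zero    = mk≋ᶜ ≋-refl (R.solve 0 (R.:- R.con (+ 0) R.:= R.con (+ 0)) ≋-refl)
conj-^ z (suc n) = C.trans (conj-* z (z ^ᶜ n)) (C.*-congˡ {conj z} (conj-^ z n))

conj-conj : ∀ z → conj (conj z) ≋ᶜ z
conj-conj z = mk≋ᶜ ≋-refl (R.solve 1 (λ x → R.:- (R.:- x) R.:= x) ≋-refl (im z))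

unit-conj : ∀ {z} → UnitC z → UnitC (conj z)
unit-conj {z} h = C.trans (C.*-congˡ {conj z} (conj-conj z)) (C.trans (C.*-comm (conj z) z) h)

unitModulus⇒unit : ∀ {z} → UnitModulus z → UnitC z
unitModulus⇒unit {z} h = mk≋ᶜ
  (R.trans (R.solve 2 (λ a b → a R.:* a R.:- b R.:* (R.:- b) R.:= a R.:* a R.:+ b R.:* b) ≋-refl (re z) (im z)) (mk≋ h))
  (R.solve 2 (λ a b → a R.:* (R.:- b) R.:+ b R.:* a R.:= R.con (+ 0)) ≋-refl (re z) (im z))

2re : ℂ → ℝ
2re z = re z +ᴿ re z

2re-conj : ∀ z → fromℝ (2re z) ≋ᶜ z +ᶜ conj z
2re-conj z = mk≋ᶜ ≋-refl (R.sym (R.-‿inverseʳ (im z)))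

E-^ : ∀ x n → E x ^ᶜ n ≋ᶜ E (ι (+ n) *ᴿ x)
E-^ x zero    = C.trans (C.sym E-0) (E-cong (R.sym (R.zeroˡ x)))
E-^ x (suc n) = C.trans (C.*-congˡ {E x} (E-^ x n)) (C.trans (C.sym (E-+ x (ι (+ n) *ᴿ x))) (E-cong
  (R.trans (R.solve 2 (λ x n → x R.:+ n R.:* x R.:= (R.con (+ 1) R.:+ n) R.:* x) ≋-refl x (ι (+ n))) (R.*-congʳ (R.sym
    (ι-+ (+ 1) (+ n)))))))

^ᴿ-cong : ∀ {x y} → x ≋ y → ∀ k → x ^ᴿ k ≋ y ^ᴿ k
^ᴿ-cong h zero    = ≋-refl
^ᴿ-cong h (suc k) = R.*-cong h (^ᴿ-cong h k)

ι-^ : ∀ z k → ι (z ℤ.^ k) ≋ ι z ^ᴿ k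
ι-^ z zero    = ≋-refl
ι-^ z (suc k) = R.trans (ι-* z (z ℤ.^ k)) (R.*-congˡ (ι-^ z k))

^ᴿ-dbl : ∀ x l → x ^ᴿ dbl l ≋ (x *ᴿ x) ^ᴿ l
^ᴿ-dbl x zero    = ≋-refl
^ᴿ-dbl x (suc l) = R.trans (R.sym (R.*-assoc x x _)) (R.*-congˡ (^ᴿ-dbl x l))

ι-injective : ∀ {z w} → ι z ≋ ι w → z ≡ w
ι-injective {z} {w} (mk≋ h) = ιℚ-injective (decide (ιℚ z ℚ.≟ ιℚ w))
  where
  decide : _ → ιℚ z ≡ ιℚ w
  decide (yes eq) = eq
  decide (no ne) = let N , lt = h ∣ ιℚ z - ιℚ w ∣ (gap-positive ne) in ⊥-elim (ℚ.<-irrefl refl (lt N ℕ.≤-refl))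
    where
    open +-*-Solver
    gap-positive : ιℚ z ≢ ιℚ w → 0ℚ < ∣ ιℚ z - ιℚ w ∣
    gap-positive ne = ℚ.≰⇒> (λ ≤0 → ne (trans (lemma (ιℚ z) (ιℚ w))
      (trans (cong (_+ ιℚ w) (ℚ.∣p∣≡0⇒p≡0 (ιℚ z - ιℚ w) (ℚ.≤-antisym ≤0 (ℚ.0≤∣p∣ (ιℚ z - ιℚ w))))) (ℚ.+-identityˡ (ιℚ w)))))
      where
      lemma : ∀ a b → a ≡ (a - b) + b
      lemma = solve 2 (λ a b → a := (a :- b) :+ b) refl

half : ∀ h → ∃[ g ] (h ≡ dbl g ⊎ h ≡ suc (dbl g))
half zero    = zero , inj₁ refl
half (suc h) with half h
... | g , inj₁ eq = g , inj₂ (cong suc eq)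
... | g , inj₂ eq = suc g , inj₁ (cong suc eq)

dbl≢suc-dbl : ∀ m n → dbl m ≢ suc (dbl n)
dbl≢suc-dbl (suc m) (suc n) eq = dbl≢suc-dbl m n (ℕ.suc-injective (ℕ.suc-injective eq))

-- Descent: 2α² = β² forces β = 2t, and then 2t² = α² with t < α.
√2-irrationalℕ : ∀ α β → 2 ℕ.* (α ℕ.* α) ≡ β ℕ.* β → α ≡ 0
√2-irrationalℕ = <-rec _ descend
  where
  descend : ∀ α → (∀ {γ} → γ ℕ.< α → ∀ β → 2 ℕ.* (γ ℕ.* γ) ≡ β ℕ.* β → γ ≡ 0) → ∀ β → 2 ℕ.* (α ℕ.* α) ≡ β ℕ.* β → α ≡ 0
  descend zero    rec β eq = refl
  descend (suc α) rec β eq = split (half β)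
    where
    A = suc α
    even≢odd : ∀ m n → 2 ℕ.* m ≢ suc (2 ℕ.* n)
    even≢odd m n h = dbl≢suc-dbl m n (trans (dbl≡2* m) (trans h (cong suc (sym (dbl≡2* n)))))
    odd-square : ∀ t → suc (2 ℕ.* t) ℕ.* suc (2 ℕ.* t) ≡ suc (2 ℕ.* (2 ℕ.* (t ℕ.* t) ℕ.+ 2 ℕ.* t))
    odd-square = solve-∀
    even-square : ∀ t → 2 ℕ.* t ℕ.* (2 ℕ.* t) ≡ 2 ℕ.* (2 ℕ.* (t ℕ.* t))
    even-square = solve-∀
    split : ∃[ t ] (β ≡ dbl t ⊎ β ≡ suc (dbl t)) → A ≡ 0
    split (t , inj₂ refl) = ⊥-elim (even≢odd (A ℕ.* A) (2 ℕ.* (t ℕ.* t) ℕ.+ 2 ℕ.* t) (trans eq (trans (cong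
      (λ d → suc d ℕ.* suc d) (dbl≡2* t)) (odd-square t))))
    split (t , inj₁ refl) = contradiction A²≡0 ℕ.1+n≢0
      where
      A²≡2t² : A ℕ.* A ≡ 2 ℕ.* (t ℕ.* t)
      A²≡2t² = ℕ.*-cancelˡ-≡ _ _ 2 (trans eq (trans (cong (λ d → d ℕ.* d) (dbl≡2* t)) (even-square t)))
      t<A : t ℕ.< A
      t<A = ℕ.≰⇒> (λ A≤t → ℕ.<-irrefl A²≡2t² (ℕ.<-≤-trans (ℕ.m<m+n (A ℕ.* A) {A ℕ.* A ℕ.+ 0} (ℕ.s≤s ℕ.z≤n)) (ℕ.*-monoʳ-≤ 2
        (ℕ.*-mono-≤ A≤t A≤t))))
      A²≡0 : A ℕ.* A ≡ 0
      A²≡0 = trans A²≡2t² (cong (λ t → 2 ℕ.* (t ℕ.* t)) (rec t<A A (sym A²≡2t²)))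

√2-irrational : ∀ {θ} a b → θ *ᴿ θ ≋ ι (+ 2) → ι a *ᴿ θ ≋ ι b → a ≡ + 0
√2-irrational {θ} a b θ² h = ℤ.∣i∣≡0⇒i≡0 (√2-irrationalℕ ℤ.∣ a ∣ ℤ.∣ b ∣ (trans (cong (2 ℕ.*_) (sym (ℤ.abs-* a a)))
  (trans (sym (ℤ.abs-* (+ 2) (a ℤ.* a))) (trans (cong ℤ.∣_∣ squares) (ℤ.abs-* b b)))))
  where
  squares : + 2 ℤ.* (a ℤ.* a) ≡ b ℤ.* b
  squares = ι-injective (R.trans (R.trans (ι-* (+ 2) (a ℤ.* a)) (R.*-cong (R.sym θ²) (ι-* a a)))
    (R.trans (R.solve 2 (λ t a → (t R.:* t) R.:* (a R.:* a) R.:= (a R.:* t) R.:* (a R.:* t)) ≋-refl θ (ι a))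
      (R.trans (R.*-cong h h) (R.sym (ι-* b b)))))

-1ᶜ : ℂ
-1ᶜ = ιᶜ (ℤ.- (+ 1))

module ℤ[ℂ] = IntegerSpan ℂ-ring ℤ-coeffsᶜ *-cancel-ιᶜ (λ h → ¬pos-0 (pos-cong (re≋ h) (pos-fromℚ 0<1)))

-1² : -1ᶜ *ᶜ -1ᶜ ≋ᶜ fromℝ 1ᴿ
-1² = C.solve 0 (C.con (ℤ.- (+ 1)) C.:* C.con (ℤ.- (+ 1)) C.:= C.con (+ 1)) C.refl

one-^ᶜ : ∀ n → fromℝ 1ᴿ ^ᶜ n ≋ᶜ fromℝ 1ᴿ
one-^ᶜ zero    = C.refl
one-^ᶜ (suc n) = C.trans (C.*-identityˡ _) (one-^ᶜ n)

-1^dbl : ∀ l → -1ᶜ ^ᶜ dbl l ≋ᶜ fromℝ 1ᴿ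
-1^dbl l = C.trans (C.sym (ℤ[ℂ].sq-^ -1ᶜ l)) (C.trans (C^.^-congˡ l -1²) (one-^ᶜ l))

-1^suc-dbl : ∀ l → -1ᶜ ^ᶜ suc (dbl l) ≋ᶜ -1ᶜ
-1^suc-dbl l = C.trans (C.*-congˡ { -1ᶜ} (-1^dbl l)) (C.*-identityʳ -1ᶜ)

i^dbl : ∀ l → iᶜ ^ᶜ dbl l ≋ᶜ -1ᶜ ^ᶜ l
i^dbl l = C.trans (C.sym (ℤ[ℂ].sq-^ iᶜ l)) (C^.^-congˡ l iᶜ*iᶜ)

-- root m is the primitive (m + 1)-st root of unity e^{2πi/(m+1)}.
angle : ℕ → ℝ
angle m = π *ᴿ fromℚ (ιℕ 2 * recip m)

root : ℕ → ℂ
root m = E (angle m)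

ι-angle : ∀ m → ι (+ suc m) *ᴿ angle m ≋ π +ᴿ π
ι-angle m = ≡⇒≋ (λ i → trans (lemma (ιℕ (suc m)) (recip m) (seq π i)) (trans (cong (_* (ιℕ 2 * seq π i)) (recip-inverse m))
  (lemma₂ (seq π i))))
  where
  open +-*-Solver
  lemma : ∀ n r p → n * (p * (ιℕ 2 * r)) ≡ (n * r) * (ιℕ 2 * p)
  lemma = solve 3 (λ n r p → n :* (p :* (con (ιℕ 2) :* r)) := (n :* r) :* (con (ιℕ 2) :* p)) refl
  lemma₂ : ∀ p → 1ℚ * (ιℕ 2 * p) ≡ p + p
  lemma₂ = solve 1 (λ p → con 1ℚ :* (con (ιℕ 2) :* p) := p :+ p) refl

root-^ : ∀ m → root m ^ᶜ suc m ≋ᶜ fromℝ 1ᴿ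
root-^ m = C.trans (E-^ (angle m) (suc m)) (C.trans (E-cong (ι-angle m)) E-2π)

root-sin-pos : ∀ m → Pos (im (root (suc (suc m))))
root-sin-pos m = sin-pos-π {angle (suc (suc m))}
  (pos-* π-pos (pos-fromℚ (*-pos (ℚ.positive⁻¹ (ιℕ 2)) (recip-pos (suc (suc m))))))
  (pos-cong (≡⇒≋ (λ i → lemma (seq π i) (ιℕ 2 * recip (suc (suc m))))) (pos-* π-pos (pos-fromℚ (p<q⇒0<q-p small))))
  where
  open +-*-Solver
  lemma : ∀ p x → p * (1ℚ - x) ≡ p - p * x
  lemma = solve 2 (λ p x → p :* (con 1ℚ :- x) := p :- p :* x) refl
  small : ιℕ 2 * recip (suc (suc m)) < 1ℚ
  small = subst (ιℕ 2 * recip (suc (suc m)) <_) (recip-inverse (suc (suc m)))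
    (ℚ.*-monoˡ-<-pos (recip (suc (suc m))) {{ℚ.positive (recip-pos (suc (suc m)))}}
      (ιℚ-mono-< {+ 2} {+ suc (suc (suc m))} (ℤ.+<+ (ℕ.s≤s (ℕ.s≤s (ℕ.s≤s ℕ.z≤n))))))

-- For this root of order m + 3 the factor is 2i times a positive sine, so multiplying by it swaps
-- the parts of x up to sign and a positive real, and each part is cancelled separately.
root-cancel : ∀ m x → (root (suc (suc m)) +ᶜ -ᶜ conj (root (suc (suc m)))) *ᶜ x ≋ᶜ fromℝ 0ᴿ → x ≋ᶜ fromℝ 0ᴿ
root-cancel m x (mk≋ᶜ p q) = mk≋ᶜ
  (*-cancel-pos s-pos (*-cancel-pos (ι-pos 1) (R.trans (R.solve 4 (λ c s x y →
      R.con (+ 2) R.:* (s R.:* x) R.:= (c R.:+ R.:- c) R.:* y R.:+ (s R.:+ R.:- (R.:- s)) R.:* x) ≋-refl (re z) (im z) (re x)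
        (im x)) q)))
  (*-cancel-pos s-pos (*-cancel-pos (ι-pos 1) (R.trans (R.solve 4 (λ c s x y →
      R.con (+ 2) R.:* (s R.:* y) R.:= R.:- ((c R.:+ R.:- c) R.:* x R.:- (s R.:+ R.:- (R.:- s)) R.:* y)) ≋-refl (re z) (im z)
        (re x) (im x))
    (R.trans (-‿cong p) (R.solve 0 (R.:- R.con (+ 0) R.:= R.con (+ 0)) ≋-refl)))))
  where
  z = root (suc (suc m))
  s-pos = root-sin-pos m

cycle-power-eigenvector : ∀ {n} → 3 ℕ.≤ n → ∀ k z → UnitC z → z ^ᶜ n ≋ᶜ fromℝ 1ᴿ →
  ℂM.LeftEigen (embed (cycleAdj n ^ᴹ k)) (fromℝ (2re z ^ᴿ k)) (λ i → z ^ᶜ toℕ i)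
cycle-power-eigenvector {n} 3≤n k z u r y =
  C.trans (ℂM.◁-congʳ v (embed-^ᴹ (cycleAdj n) k) y)
    (C.trans (ℂM.eigen-^ᴹ {v = v} (cycle-eigenvector 3≤n z (conj z) u r) k y)
      (C.*-congʳ {v y} (C.trans (C^.^-congˡ k (C.sym (2re-conj z))) (C.sym (fromℝ-^ (2re z) k)))))
  where
  v : Fin n → ℂ
  v i = z ^ᶜ toℕ i

module UnitPowers (R : CommutativeRing 0ℓ 0ℓ) where
  open CommutativeRing R
    using (_≈_; 1#; *-congʳ; *-congˡ; *-assoc; *-comm; *-identityˡ; *-identityʳ; setoid)
    renaming (Carrier to A; _*_ to _⊗_; refl to ≈-refl; sym to ≈-sym; trans to ≈-trans; commutativeSemiring to semiring)
  open Algebra.Properties.CommutativeSemiring.Exp semiring using (_^_; ^-homo-*; ^-distrib-*; ^-congˡ)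
  open Relation.Binary.Reasoning.Setoid setoid

  one-^ : ∀ n → 1# ^ n ≈ 1#
  one-^ zero    = ≈-refl
  one-^ (suc n) = ≈-trans (*-identityˡ (1# ^ n)) (one-^ n)

  inverse-^ : ∀ {z w} → z ⊗ w ≈ 1# → ∀ n → z ^ n ⊗ w ^ n ≈ 1#
  inverse-^ {z} {w} h n = ≈-trans (≈-sym (^-distrib-* z w n)) (≈-trans (^-congˡ n h) (one-^ n))

  cancel : ∀ {x y z w} → z ⊗ w ≈ 1# → x ⊗ z ≈ y ⊗ z → x ≈ y
  cancel {x} {y} {z} {w} h eq = ≈-trans (strip x) (≈-trans (*-congʳ eq) (≈-sym (strip y)))
    where
    strip : ∀ x → x ≈ (x ⊗ z) ⊗ w
    strip x = ≈-trans (≈-sym (*-identityʳ x)) (≈-trans (*-congˡ (≈-sym h)) (≈-sym (*-assoc x z w)))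

  ahead : ∀ {z w e g} → z ⊗ w ≈ 1# → ∀ a d → e ⊗ z ^ a ≈ g ⊗ z ^ (a ℕ.+ d) → e ≈ g ⊗ z ^ d
  ahead {z} {w} {e} {g} h a d eq = cancel (inverse-^ h a) (begin
    e ⊗ z ^ a             ≈⟨ eq ⟩
    g ⊗ z ^ (a ℕ.+ d)     ≈⟨ *-congˡ (≈-trans (^-homo-* z a d) (*-comm (z ^ a) (z ^ d))) ⟩
    g ⊗ (z ^ d ⊗ z ^ a)   ≈⟨ *-assoc g (z ^ d) (z ^ a) ⟨
    (g ⊗ z ^ d) ⊗ z ^ a   ∎)

  behind : ∀ {z w e g} → z ⊗ w ≈ 1# → ∀ b d → e ⊗ z ^ (b ℕ.+ d) ≈ g ⊗ z ^ b → e ≈ g ⊗ w ^ d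
  behind {z} {w} {e} {g} h b d eq = cancel (inverse-^ h d) (begin
    e ⊗ z ^ d             ≈⟨ cancel (inverse-^ h b) (begin
      (e ⊗ z ^ d) ⊗ z ^ b ≈⟨ *-assoc e (z ^ d) (z ^ b) ⟩
      e ⊗ (z ^ d ⊗ z ^ b) ≈⟨ *-congˡ (≈-trans (*-comm (z ^ d) (z ^ b)) (≈-sym (^-homo-* z b d))) ⟩
      e ⊗ z ^ (b ℕ.+ d)   ≈⟨ eq ⟩
      g ⊗ z ^ b           ∎) ⟩
    g                     ≈⟨ *-identityʳ g ⟨
    g ⊗ 1#                ≈⟨ *-congˡ (≈-trans (*-comm (w ^ d) (z ^ d)) (inverse-^ h d)) ⟨
    g ⊗ (w ^ d ⊗ z ^ d)   ≈⟨ *-assoc g (w ^ d) (z ^ d) ⟨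
    (g ⊗ w ^ d) ⊗ z ^ d   ∎)

module U = UnitPowers ℂ-ring

self-conj⇒real : ∀ {z} → z ≋ᶜ conj z → im z ≋ 0ᴿ
self-conj⇒real {z} eq = *-cancel-pos (ι-pos 1) (R.trans
  (R.solve 1 (λ s → R.con (+ 2) R.:* s R.:= s R.:- (R.:- s)) ≋-refl (im z))
  (R.trans (R.+-congʳ (im≋ eq)) (R.-‿inverseʳ (-ᴿ im z))))

multiple-of-π⇒ : ∀ {h m} z → ι (+ h) *ᴿ angle m ≋ π *ᴿ ι z → + 2 ℤ.* + h ≡ + suc m ℤ.* z
multiple-of-π⇒ {h} {m} z eq = ι-injective (R.trans (ι-* (+ 2) (+ h)) (R.trans
    (R.trans (R.solve 2 (λ x y → x R.:= (x R.:- y) R.:+ y) ≋-refl (ι (+ 2) *ᴿ ι (+ h)) (ι (+ suc m) *ᴿ ι z))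
      (R.trans (R.+-congʳ difference) (R.+-identityˡ (ι (+ suc m) *ᴿ ι z))))
    (R.sym (ι-* (+ suc m) z))))
  where
  difference : ι (+ 2) *ᴿ ι (+ h) -ᴿ ι (+ suc m) *ᴿ ι z ≋ 0ᴿ
  difference = *-cancel-pos π-pos (R.trans
    (R.solve 4 (λ p h n z → p R.:* (R.con (+ 2) R.:* h R.:- n R.:* z) R.:= h R.:* (p R.:+ p) R.:- n R.:* (p R.:* z)) ≋-refl π
      (ι (+ h)) (ι (+ suc m)) (ι z))
    (R.trans (R.+-cong (R.*-congˡ (R.sym (ι-angle m))) (-‿cong (R.*-congˡ (R.sym eq))))
      (R.solve 3 (λ h n x → h R.:* (n R.:* x) R.:- n R.:* (h R.:* x) R.:= R.con (+ 0)) ≋-refl (ι (+ h)) (ι (+ suc m)) (angle m))))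

module Necessity {n′} (3≤n : 3 ℕ.≤ suc n′) (k : ℕ) {a b : Fin (suc n′)} (a≢b : a ≢ b)
  {τ} (0<τ : Pos τ) (pst : PSTAt (cycleAdj (suc n′) ^ᴹ k) a b τ) where

  private
    n h : ℕ
    n = suc n′
    h = dist a b
    γ : ℂ
    γ = proj₁ (proj₂ (proj₂ pst))
    γ-unit : UnitC γ
    γ-unit = unitModulus⇒unit (proj₁ (proj₂ (proj₂ (proj₂ pst))))

    power : ℂ → ℝ
    power z = 2re z ^ᴿ k

    E₀ : ℂ → ℂ
    E₀ z = E (-ᴿ (τ *ᴿ power z))

    phase : ∀ z → UnitC z → z ^ᶜ n ≋ᶜ fromℝ 1ᴿ → E₀ z *ᶜ z ^ᶜ toℕ a ≋ᶜ γ *ᶜ z ^ᶜ toℕ b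
    phase z u r = PSTAt⇒phase (cycleAdj n ^ᴹ k) {a} {b} {τ} pst {power z} {λ i → z ^ᶜ toℕ i} (cycle-power-eigenvector 3≤n k z u r)

    conj-root : ∀ {z m} → z ^ᶜ m ≋ᶜ fromℝ 1ᴿ → conj z ^ᶜ m ≋ᶜ fromℝ 1ᴿ
    conj-root {z} {m} r = C.trans (C.sym (conj-^ z m)) (C.trans (conj-cong r) (mk≋ᶜ ≋-refl (R.solve 0
      (R.:- R.con (+ 0) R.:= R.con (+ 0)) ≋-refl)))

    -- The conjugate of z has the same eigenvalue, and `E₀ (conj z)` even reduces to `E₀ z`. Using
    -- the phase equation at both points removes the dependence on which of a and b has the larger
    -- label.
    phase-dist : ∀ z → UnitC z → z ^ᶜ n ≋ᶜ fromℝ 1ᴿ → E₀ z ≋ᶜ γ *ᶜ z ^ᶜ h × E₀ z ≋ᶜ γ *ᶜ conj z ^ᶜ h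
    phase-dist z u r = decide (ℕ.≤-total (toℕ a) (toℕ b))
      where
      up : ∀ z → UnitC z → z ^ᶜ n ≋ᶜ fromℝ 1ᴿ → toℕ b ≡ toℕ a ℕ.+ h → E₀ z ≋ᶜ γ *ᶜ z ^ᶜ h
      up z u r eq = U.ahead {z} {conj z} {E₀ z} {γ} u (toℕ a) h (subst (λ m → E₀ z *ᶜ z ^ᶜ toℕ a ≋ᶜ γ *ᶜ z ^ᶜ m) eq (phase z u r))
      down : ∀ z → UnitC z → z ^ᶜ n ≋ᶜ fromℝ 1ᴿ → toℕ a ≡ toℕ b ℕ.+ h → E₀ z ≋ᶜ γ *ᶜ conj z ^ᶜ h
      down z u r eq = U.behind {z} {conj z} {E₀ z} {γ} u (toℕ b) h (subst (λ m → E₀ z *ᶜ z ^ᶜ m ≋ᶜ γ *ᶜ z ^ᶜ toℕ b) eq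
        (phase z u r))
      conj² : ∀ z → E₀ z ≋ᶜ γ *ᶜ conj (conj z) ^ᶜ h → E₀ z ≋ᶜ γ *ᶜ z ^ᶜ h
      conj² z eq = C.trans eq (C.*-congˡ {γ} (C^.^-congˡ h (conj-conj z)))
      decide : toℕ a ℕ.≤ toℕ b ⊎ toℕ b ℕ.≤ toℕ a → E₀ z ≋ᶜ γ *ᶜ z ^ᶜ h × E₀ z ≋ᶜ γ *ᶜ conj z ^ᶜ h
      decide (inj₁ a≤b) = up z u r eq , up (conj z) (unit-conj u) (conj-root {z} {n} r) eq
        where
        eq : toℕ b ≡ toℕ a ℕ.+ h
        eq = sym (trans (cong (toℕ a ℕ.+_) (ℕ.m≤n⇒∣m-n∣≡n∸m a≤b)) (ℕ.m+[n∸m]≡n a≤b))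
      decide (inj₂ b≤a) = conj² z (down (conj z) (unit-conj u) (conj-root {z} {n} r) eq) , down z u r eq
        where
        eq : toℕ a ≡ toℕ b ℕ.+ h
        eq = sym (trans (cong (toℕ b ℕ.+_) (ℕ.m≤n⇒∣n-m∣≡n∸m b≤a)) (ℕ.m+[n∸m]≡n b≤a))

    γ-cancel : ∀ {x y} → γ *ᶜ x ≋ᶜ γ *ᶜ y → x ≋ᶜ y
    γ-cancel {x} {y} eq = U.cancel {x} {y} {γ} {conj γ} γ-unit (C.trans (C.*-comm x γ) (C.trans eq (C.*-comm γ y)))

    h>0 : h ≢ 0
    h>0 eq = a≢b (Fin.toℕ-injective (ℕ.∣m-n∣≡0⇒m≡n eq))

    h<n : h ℕ.< n
    h<n = ℕ.≤-<-trans (ℕ.∣m-n∣≤m⊔n (toℕ a) (toℕ b)) (ℕ.⊔-lub (Fin.toℕ<n a) (Fin.toℕ<n b))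

  -- For z = e^(2πi/n) the two forms of the phase make z^h real, so 2h is a multiple of n, and 0 <
  -- 2h < 2n leaves only n itself.
  n≡2h : n ≡ 2 ℕ.* h
  n≡2h = from-multiple (sin-zero {ι (+ h) *ᴿ angle n′} (R.trans (im≋ (C.sym (E-^ (angle n′) h))) (self-conj⇒real {z ^ᶜ h} real)))
    where
    z : ℂ
    z = root n′
    real : z ^ᶜ h ≋ᶜ conj (z ^ᶜ h)
    real = let p , q = phase-dist z (E-conj (angle n′)) (root-^ n′) in
      C.trans (γ-cancel {z ^ᶜ h} {conj z ^ᶜ h} (C.trans (C.sym p) q)) (C.sym (conj-^ z h))
    conclude : ∀ z → + 2 ℤ.* + h ≡ + n ℤ.* z → n ≡ 2 ℕ.* h
    conclude (+ zero) eq = contradiction (ℕ.m*n≡0⇒m≡0∨n≡0 2 (ℤ.+-injective (trans (ℤ.pos-* 2 h) (trans eq (ℤ.*-zeroʳ (+ n)))))) λ { (inj₂ h≡0) → h>0 h≡0 }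
    conclude (+ suc zero) eq = sym (ℤ.+-injective (trans (ℤ.pos-* 2 h) (trans eq (ℤ.*-identityʳ (+ n)))))
    conclude (+ suc (suc j)) eq = ⊥-elim (ℕ.<-irrefl (ℤ.+-injective (trans (ℤ.pos-* 2 h) (trans eq (sym (ℤ.pos-* n (suc
      (suc j)))))))
      (ℕ.<-≤-trans (ℕ.*-monoʳ-< 2 h<n) (ℕ.≤-trans (ℕ.≤-reflexive (ℕ.*-comm 2 n)) (ℕ.*-monoʳ-≤ n {2} {suc (suc j)} (ℕ.s≤s
        (ℕ.s≤s ℕ.z≤n))))))
    conclude -[1+ j ] eq = contradiction (trans (ℤ.pos-* 2 h) eq) λ ()
    from-multiple : ∃[ z ] (ι (+ h) *ᴿ angle n′ ≋ π *ᴿ ι z) → n ≡ 2 ℕ.* h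
    from-multiple (z , eq) = conclude z (multiple-of-π⇒ {h} {n′} z eq)

  -- The quotient of the phase equations at z and at 1 eliminates γ. Because n = 2h, the conditions
  -- z^h = ε and ε² = 1 already make z an n-th root of unity.
  phase-difference : ∀ z {ε} → UnitC z → z ^ᶜ h ≋ᶜ ε → ε *ᶜ ε ≋ᶜ fromℝ 1ᴿ → E (τ *ᴿ (ι ((+ 2) ℤ.^ k) -ᴿ power z)) ≋ᶜ ε
  phase-difference z {ε} u zʰ ε² = C.trans (E-cong (R.trans
      (R.*-congˡ (R.+-congʳ (R.sym two^k)))
      (R.solve 3 (λ t x y → t R.:* (x R.:- y) R.:= (R.:- (R.:- (t R.:* x))) R.:+ (R.:- (t R.:* y))) ≋-refl τ (power 1ᶜ)
        (power z))))
    (C.trans (E-+ (-ᴿ (-ᴿ (τ *ᴿ power 1ᶜ))) (-ᴿ (τ *ᴿ power z)))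
    (C.trans (C.*-cong (C.trans (E-neg (-ᴿ (τ *ᴿ power 1ᶜ))) (conj-cong at-1)) at-z)
    (C.trans (C.solve 3 (λ g c e → c C.:* (g C.:* e) C.:= (g C.:* c) C.:* e) C.refl γ (conj γ) ε)
    (C.trans (C.*-congʳ {ε} γ-unit) (C.*-identityˡ ε)))))
    where
    1ᶜ : ℂ
    1ᶜ = fromℝ 1ᴿ
    two^k : power 1ᶜ ≋ ι ((+ 2) ℤ.^ k)
    two^k = R.trans (^ᴿ-cong (≡⇒≋ (λ _ → refl)) k) (R.sym (ι-^ (+ 2) k))
    zⁿ : z ^ᶜ n ≋ᶜ fromℝ 1ᴿ
    zⁿ = subst (λ m → z ^ᶜ m ≋ᶜ fromℝ 1ᴿ) (sym (trans n≡2h (2*h≡h+h h)))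
      (C.trans (C^.^-homo-* z h h) (C.trans (C.*-cong zʰ zʰ) ε²))
    at-z : E₀ z ≋ᶜ γ *ᶜ ε
    at-z = C.trans (proj₁ (phase-dist z u zⁿ)) (C.*-congˡ {γ} zʰ)
    1ᶜ-unit : UnitC 1ᶜ
    1ᶜ-unit = mk≋ᶜ (R.solve 0 (R.con (+ 1) R.:* R.con (+ 1) R.:- R.con (+ 0) R.:* (R.:- R.con (+ 0)) R.:= R.con (+ 1)) ≋-refl)
      (R.solve 0 (R.con (+ 1) R.:* (R.:- R.con (+ 0)) R.:+ R.con (+ 0) R.:* R.con (+ 1) R.:= R.con (+ 0)) ≋-refl)
    at-1 : E₀ 1ᶜ ≋ᶜ γ
    at-1 = C.trans (proj₁ (phase-dist 1ᶜ 1ᶜ-unit (one-^ᶜ n))) (C.trans (C.*-congˡ {γ} (one-^ᶜ h)) (C.*-identityʳ γ))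

-- Cross-multiplication: multiplied by τ, both sides become π m m′, and the positive τ can be
-- cancelled.
ratio : ∀ {τ X Y m m′} → Pos τ → τ *ᴿ X ≋ π *ᴿ ι m → τ *ᴿ Y ≋ π *ᴿ ι m′ → ι m′ *ᴿ X ≋ ι m *ᴿ Y
ratio {τ} {X} {Y} {m} {m′} 0<τ p q = R.trans (R.solve 2 (λ x y → x R.:= (x R.:- y) R.:+ y) ≋-refl (ι m′ *ᴿ X) (ι m *ᴿ Y))
  (R.trans (R.+-congʳ (*-cancel-pos 0<τ (R.trans
      (R.solve 5 (λ t x y m n → t R.:* (n R.:* x R.:- m R.:* y) R.:= n R.:* (t R.:* x) R.:- m R.:* (t R.:* y)) ≋-refl τ X Y
        (ι m) (ι m′))
      (R.trans (R.+-cong (R.*-congˡ p) (-‿cong (R.*-congˡ q)))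
        (R.solve 3 (λ p m n → n R.:* (p R.:* m) R.:- m R.:* (p R.:* n) R.:= R.con (+ 0)) ≋-refl π (ι m) (ι m′))))))
    (R.+-identityˡ (ι m *ᴿ Y)))

-- The double-angle formula (2 cos t)² = 2 cos 2t + 2, which leads from the eigenvalue 0 to √2 and
-- on to √(2 + √2).
sq-2re : ∀ {z w} → UnitC z → z *ᶜ z ≋ᶜ w → 2re z *ᴿ 2re z ≋ 2re w +ᴿ ι (+ 2)
sq-2re {z} {w} u sq = R.trans
  (R.solve 2 (λ c s → (c R.:+ c) R.:* (c R.:+ c) R.:=
    ((c R.:* c R.:- s R.:* s) R.:+ (c R.:* c R.:- s R.:* s)) R.:+ R.con (+ 2) R.:* (c R.:* c R.:- s R.:* (R.:- s))) ≋-refl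
      (re z) (im z))
  (R.+-cong (R.+-cong (re≋ sq) (re≋ sq)) (R.trans (R.*-congˡ (re≋ u)) (R.*-identityʳ (ι (+ 2)))))

ι2^≢0 : ∀ l → (+ 2) ℤ.^ l ≢ + 0
ι2^≢0 zero    ()
ι2^≢0 (suc l) eq with ℤ.i*j≡0⇒i≡0∨j≡0 (+ 2) eq
... | inj₂ p = ι2^≢0 l p

-- With non-negative coefficients throughout, the coefficient of √2 cannot cancel; its positivity is
-- what `irrational-phase` asks for.
surd-power : ∀ {θ} → θ *ᴿ θ ≋ ι (+ 2) → ∀ l → ∃[ A ] ∃[ B ] ((θ +ᴿ ι (+ 2)) ^ᴿ suc l ≋ ι (+ A) +ᴿ ι (+ suc B) *ᴿ θ)
surd-power {θ} θ² zero = 2 , 0 , R.solve 1 (λ t →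
  (t R.:+ R.con (+ 2)) R.:* R.con (+ 1) R.:= R.con (+ 2) R.:+ R.con (+ 1) R.:* t) ≋-refl θ
surd-power {θ} θ² (suc l) = let A , B , eq = surd-power θ² l in next A B eq
  where
  next : ∀ A B → (θ +ᴿ ι (+ 2)) ^ᴿ suc l ≋ ι (+ A) +ᴿ ι (+ suc B) *ᴿ θ → _
  next A B eq = 2 ℕ.* A ℕ.+ 2 ℕ.* suc B , (A ℕ.+ B) ℕ.+ suc B , R.trans (R.*-congˡ eq)
    (R.trans (R.solve 3 (λ t a b → (t R.:+ R.con (+ 2)) R.:* (a R.:+ b R.:* t) R.:=
        (R.con (+ 2) R.:* a R.:+ b R.:* (t R.:* t)) R.:+ (a R.:+ R.con (+ 2) R.:* b) R.:* t) ≋-refl θ (ι (+ A)) (ι (+ suc B)))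
      (R.+-cong (R.trans (R.+-congˡ (R.trans (R.*-congˡ θ²) (R.*-comm (ι (+ suc B)) (ι (+ 2)))))
          (R.sym (R.trans (ι-+ (+ (2 ℕ.* A)) (+ (2 ℕ.* suc B))) (R.+-cong (double A) (double (suc B))))))
        (R.*-congʳ (R.sym (R.trans (R.reflexive (cong (λ m → ι (+ m)) (sym (count A B)))) (R.trans (ι-+ (+ A) (+
          (2 ℕ.* suc B))) (R.+-congˡ (double (suc B)))))))))
    where
    double : ∀ n → ι (+ (2 ℕ.* n)) ≋ ι (+ 2) *ᴿ ι (+ n)
    double n = R.trans (R.reflexive (cong ι (ℤ.pos-* 2 n))) (ι-* (+ 2) (+ n))
    count : ∀ A B → A ℕ.+ 2 ℕ.* suc B ≡ suc ((A ℕ.+ B) ℕ.+ suc B)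
    count = solve-∀

-- Admissible values of the half length h

module Classification {h k′ : ℕ} {τ : ℝ} (0<τ : Pos τ)
  (condition : ∀ z {ε} → UnitC z → z ^ᶜ h ≋ᶜ ε → ε *ᶜ ε ≋ᶜ fromℝ 1ᴿ → E (τ *ᴿ (ι
    ((+ 2) ℤ.^ suc k′) -ᴿ 2re z ^ᴿ suc k′)) ≋ᶜ ε) where

  k : ℕ
  k = suc k′

  T : ℤ
  T = (+ 2) ℤ.^ k

  even-multiple : ∀ z → UnitC z → z ^ᶜ h ≋ᶜ fromℝ 1ᴿ → ∃[ c ] (τ *ᴿ (ι T -ᴿ 2re z ^ᴿ k) ≋ π *ᴿ ι (+ 2 ℤ.* c))
  even-multiple z u eq = E≋1⇒even (condition z u eq (C.*-identityˡ (fromℝ 1ᴿ)))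

  odd-multiple : ∀ z → UnitC z → z ^ᶜ h ≋ᶜ -1ᶜ → ∃[ e ] (τ *ᴿ (ι T -ᴿ 2re z ^ᴿ k) ≋ π *ᴿ ι (+ 2 ℤ.* e ℤ.+ + 1))
  odd-multiple z u eq = E≋-1⇒odd (condition z u eq -1²)

  multiple : ∀ z → UnitC z → ∀ j → z ^ᶜ h ≋ᶜ -1ᶜ ^ᶜ j → ∃[ m ] (τ *ᴿ (ι T -ᴿ 2re z ^ᴿ k) ≋ π *ᴿ ι m)
  multiple z u j eq with half j
  ... | g , inj₁ refl = let c , p = even-multiple z u (C.trans eq (-1^dbl g)) in + 2 ℤ.* c , p
  ... | g , inj₂ refl = let e , p = odd-multiple z u (C.trans eq (-1^suc-dbl g)) in + 2 ℤ.* e ℤ.+ + 1 , p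

  no-odd-divisor : ∀ f q → h ≡ suc (dbl (suc f)) ℕ.* q → ∀ x e → τ *ᴿ ι x ≋ π *ᴿ ι (+ 2 ℤ.* e ℤ.+ + 1) → ⊥
  no-odd-divisor f q h≡mq x e p = contradict (even-multiple ζ (E-conj (angle (dbl (suc f)))) ζʰ)
    where
    ζ : ℂ
    ζ = root (dbl (suc f))
    ζʰ : ζ ^ᶜ h ≋ᶜ fromℝ 1ᴿ
    ζʰ = subst (λ m → ζ ^ᶜ m ≋ᶜ fromℝ 1ᴿ) (sym h≡mq)
      (C.trans (C.sym (C^.^-assocʳ ζ (suc (dbl (suc f))) q)) (C.trans (C^.^-congˡ q (root-^ (dbl (suc f)))) (one-^ᶜ q)))
    θ : ℝ
    θ = 2re ζ
    contradict : ∃[ c ] (τ *ᴿ (ι T -ᴿ θ ^ᴿ k) ≋ π *ᴿ ι (+ 2 ℤ.* c)) → ⊥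
    contradict (c , p′) = ℤ[ℂ].OddRoot.θ^k-not-even (suc f) ζ (conj ζ) (E-conj (angle (dbl (suc f)))) (root-^ (dbl (suc f)))
      (root-cancel (dbl f)) k e w (C.trans (C.*-cong (ℤ[ℂ].φ≈ (odd e)) (C.trans (C^.^-congˡ k (C.sym (2re-conj ζ))) (C.sym
        (fromℝ-^ θ k))))
        (C.trans (C.sym (fromℝ-* (ι (odd e)) (θ ^ᴿ k))) (C.trans (fromℝ-cong even) (C.sym (ℤ[ℂ].φ≈ (+ 2 ℤ.* w))))))
      where
      -- With o = `odd e` and T = 2ᵏ, oθᵏ = oT - o(T - θᵏ), and `ratio` turns the last product into
      -- 2cx. Since k ≥ 1, T is twice 2^k′, so 2 can be taken out of the whole expression.
      w : ℤ
      w = odd e ℤ.* (+ 2) ℤ.^ k′ ℤ.+ ℤ.- (c ℤ.* x)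
      odd-comm : ι (+ 2 ℤ.* e ℤ.+ + 1) ≋ ι (odd e)
      odd-comm = R.reflexive (cong ι (ℤ.+-comm (+ 2 ℤ.* e) (+ 1)))
      even : ι (odd e) *ᴿ θ ^ᴿ k ≋ ι (+ 2 ℤ.* w)
      even = R.trans (R.solve 3 (λ o t y → o R.:* y R.:= o R.:* t R.:- o R.:* (t R.:- y)) ≋-refl (ι (odd e)) (ι T) (θ ^ᴿ k))
        (R.trans (R.+-cong (R.*-congˡ (ι-* (+ 2) ((+ 2) ℤ.^ k′))) (-‿cong (R.trans (R.trans (R.*-congʳ (R.sym odd-comm))
          (R.sym (ratio 0<τ p p′))) (R.*-congʳ (ι-* (+ 2) c)))))
        (R.trans (R.solve 4 (λ o s c x → o R.:* (R.con (+ 2) R.:* s) R.:- (R.con (+ 2) R.:* c) R.:* x R.:= R.con (+ 2) R.:*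
          (o R.:* s R.:+ (R.:- (c R.:* x)))) ≋-refl
            (ι (odd e)) (ι ((+ 2) ℤ.^ k′)) (ι c) (ι x))
          (R.sym (R.trans (ι-* (+ 2) w) (R.*-congˡ (R.trans (ι-+ (odd e ℤ.* (+ 2) ℤ.^ k′) (ℤ.- (c ℤ.* x)))
            (R.+-cong (ι-* (odd e) ((+ 2) ℤ.^ k′)) (R.trans (ι-neg (c ℤ.* x)) (-‿cong (ι-* c x))))))))))

  2re-i^k : ι T -ᴿ 2re iᶜ ^ᴿ k ≋ ι T
  2re-i^k = R.trans (R.+-congˡ (-‿cong (R.trans (R.*-congʳ (R.+-identityˡ 0ᴿ)) (R.zeroˡ (2re iᶜ ^ᴿ k′))))) (R.solve 1
    (λ t → t R.:- R.con (+ 0) R.:= t) ≋-refl (ι T))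

  i-unit : UnitC iᶜ
  i-unit = mk≋ᶜ (R.solve 0 (R.con (+ 0) R.:* R.con (+ 0) R.:- R.con (+ 1) R.:* (R.:- R.con (+ 1)) R.:= R.con (+ 1)) ≋-refl)
    (R.solve 0 (R.con (+ 0) R.:* (R.:- R.con (+ 1)) R.:+ R.con (+ 1) R.:* R.con (+ 0) R.:= R.con (+ 0)) ≋-refl)

  -1-unit : UnitC -1ᶜ
  -1-unit = mk≋ᶜ (R.solve 0 (R.con (ℤ.- (+ 1)) R.:* R.con (ℤ.- (+ 1)) R.:- R.con (+ 0) R.:*
    (R.:- R.con (+ 0)) R.:= R.con (+ 1)) ≋-refl)
    (R.solve 0 (R.con (ℤ.- (+ 1)) R.:* (R.:- R.con (+ 0)) R.:+ R.con (+ 0) R.:* R.con (ℤ.- (+ 1)) R.:= R.con (+ 0)) ≋-refl)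

  half-odd : ∀ f → h ≡ suc (dbl (suc f)) → ⊥
  half-odd f refl = let e , p = odd-multiple -1ᶜ -1-unit (-1^suc-dbl (suc f)) in
    no-odd-divisor f 1 (sym (ℕ.*-identityʳ h)) (T ℤ.+ ℤ.- ((ℤ.- (+ 2)) ℤ.^ k)) e (R.trans (R.*-congˡ (R.trans (ι-+ T (ℤ.-
      ((ℤ.- (+ 2)) ℤ.^ k)))
      (R.+-congˡ (R.trans (ι-neg ((ℤ.- (+ 2)) ℤ.^ k)) (-‿cong (R.trans (ι-^ (ℤ.- (+ 2)) k) (^ᴿ-cong {ι (ℤ.- (+ 2))} {2re -1ᶜ}
        (≡⇒≋ (λ _ → refl)) k))))))) p)

  quarter-odd : ∀ f → h ≡ dbl (suc (dbl (suc f))) → ⊥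
  quarter-odd f refl = let e , p = odd-multiple iᶜ i-unit (C.trans (i^dbl (suc (dbl (suc f)))) (-1^suc-dbl (suc f))) in
    no-odd-divisor f 2 (trans (dbl≡2* (suc (dbl (suc f)))) (ℕ.*-comm 2 (suc (dbl (suc f))))) T e (R.trans (R.*-congˡ
      (R.sym 2re-i^k)) p)

  -- e^(iπ/4) and e^(iπ/8), obtained by halving angles so that repeated squaring leads back to i.
  ζ₈ ζ₁₆ : ℂ
  ζ₈ = E (fromℚ ½ *ᴿ halfπ)
  ζ₁₆ = E (fromℚ ½ *ᴿ (fromℚ ½ *ᴿ halfπ))

  E-half : ∀ x → E (fromℚ ½ *ᴿ x) *ᶜ E (fromℚ ½ *ᴿ x) ≋ᶜ E x
  E-half x = C.trans (C.sym (E-+ (fromℚ ½ *ᴿ x) (fromℚ ½ *ᴿ x))) (E-cong (≡⇒≋ (λ m → ½+½ (seq x m))))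

  ζ₈² : ζ₈ *ᶜ ζ₈ ≋ᶜ iᶜ
  ζ₈² = C.trans (E-half halfπ) E-halfπ

  θ : ℝ
  θ = 2re ζ₈

  θ² : θ *ᴿ θ ≋ ι (+ 2)
  θ² = R.trans (sq-2re {ζ₈} {iᶜ} (E-conj (fromℚ ½ *ᴿ halfπ)) ζ₈²) (R.solve 0
    ((R.con (+ 0) R.:+ R.con (+ 0)) R.:+ R.con (+ 2) R.:= R.con (+ 2)) ≋-refl)

  θ^dbl : ∀ l → θ ^ᴿ dbl l ≋ ι ((+ 2) ℤ.^ l)
  θ^dbl l = R.trans (^ᴿ-dbl θ l) (R.trans (^ᴿ-cong θ² l) (R.sym (ι-^ (+ 2) l)))

  module _ (f : ℕ) (h≡4f : h ≡ dbl (dbl f)) where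

    -- The eigenvalue 0, from z = i, fixes τ as a rational multiple of π; afterwards every other
    -- phase is an integer relation among eigenvalues.
    T-even : ∃[ c ] (τ *ᴿ ι T ≋ π *ᴿ ι (+ 2 ℤ.* c))
    T-even = let c , p = even-multiple iᶜ i-unit (subst (λ m → iᶜ ^ᶜ m ≋ᶜ fromℝ 1ᴿ) (sym h≡4f) (C.trans (i^dbl (dbl f)) (-1^dbl f))) in
      c , R.trans (R.*-congˡ (R.sym 2re-i^k)) p

    2c≢0 : ∀ {c} → τ *ᴿ ι T ≋ π *ᴿ ι (+ 2 ℤ.* c) → + 2 ℤ.* c ≢ + 0
    2c≢0 {c} p eq = ι2^≢0 k (ι-injective (*-cancel-pos 0<τ (R.trans p (R.trans (R.*-congˡ (R.reflexive (cong ι eq)))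
      (R.zeroʳ π)))))

    ζ₈ʰ : ζ₈ ^ᶜ h ≋ᶜ -1ᶜ ^ᶜ f
    ζ₈ʰ = subst (λ m → ζ₈ ^ᶜ m ≋ᶜ -1ᶜ ^ᶜ f) (sym h≡4f) (C.trans (C.sym (ℤ[ℂ].sq-^ ζ₈ (dbl f))) (C.trans (C^.^-congˡ
      (dbl f) ζ₈²) (i^dbl f)))

    -- Here θ = √2, and a phase involving A + Bθ with B ≠ 0 would make it rational.
    irrational-phase : ∀ {A B m} → τ *ᴿ (ι T -ᴿ (ι A +ᴿ ι B *ᴿ θ)) ≋ π *ᴿ ι m → B ≢ + 0 → ⊥
    irrational-phase {A} {B} {m} q B≢0 = let c , p = T-even in contradict c p
      where
      contradict : ∀ c → τ *ᴿ ι T ≋ π *ᴿ ι (+ 2 ℤ.* c) → ⊥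
      contradict c p = decide (ℤ.i*j≡0⇒i≡0∨j≡0 d (√2-irrational {θ} (d ℤ.* B) (d ℤ.* T ℤ.+ ℤ.- (d ℤ.* A ℤ.+ m ℤ.* T)) θ² eq))
        where
        d : ℤ
        d = + 2 ℤ.* c
        decide : d ≡ + 0 ⊎ B ≡ + 0 → ⊥
        decide (inj₁ z) = 2c≢0 p z
        decide (inj₂ z) = B≢0 z
        -- Cross-multiplying with τT = πd gives d(T - A - Bθ) = mT, solved here for θ.
        eq : ι (d ℤ.* B) *ᴿ θ ≋ ι (d ℤ.* T ℤ.+ ℤ.- (d ℤ.* A ℤ.+ m ℤ.* T))
        eq = R.trans (R.*-congʳ (ι-* d B)) (R.trans
          (R.solve 5 (λ d a b t x → (d R.:* b) R.:* x R.:= d R.:* t R.:- (d R.:* a R.:+ d R.:* (t R.:-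
            (a R.:+ b R.:* x)))) ≋-refl (ι d) (ι A) (ι B) (ι T) θ)
          (R.trans (R.+-congˡ (-‿cong (R.+-congˡ (R.sym (ratio {m = d} {m′ = m} 0<τ p q)))))
            (R.sym (R.trans (ι-+ (d ℤ.* T) (ℤ.- (d ℤ.* A ℤ.+ m ℤ.* T))) (R.+-cong (ι-* d T) (R.trans (ι-neg (d ℤ.* A ℤ.+ m ℤ.* T))
              (-‿cong (R.trans (ι-+ (d ℤ.* A) (m ℤ.* T)) (R.+-cong (ι-* d A) (ι-* m T))))))))))

    -- For k = 2l + 1 the power (√2)ᵏ = 2^l √2 would be an irrational phase.
    k-even : ∃[ l ] k ≡ dbl l
    k-even = decide (half k)
      where
      decide : ∃[ l ] (k ≡ dbl l ⊎ k ≡ suc (dbl l)) → ∃[ l ] k ≡ dbl l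
      decide (l , inj₁ eq) = l , eq
      decide (l , inj₂ eq) = let m , q = multiple ζ₈ (E-conj (fromℚ ½ *ᴿ halfπ)) f ζ₈ʰ in
        ⊥-elim (irrational-phase {+ 0} {(+ 2) ℤ.^ l} {m} (R.trans (R.*-congˡ (R.+-congˡ (-‿cong (R.sym θ^k)))) q) (ι2^≢0 l))
        where
        θ^k : θ ^ᴿ k ≋ ι (+ 0) +ᴿ ι ((+ 2) ℤ.^ l) *ᴿ θ
        θ^k = R.trans (R.reflexive (cong (θ ^ᴿ_) eq)) (R.trans (R.*-congˡ (θ^dbl l))
          (R.solve 2 (λ t a → t R.:* a R.:= R.con (+ 0) R.:+ a R.:* t) ≋-refl θ (ι ((+ 2) ℤ.^ l))))

    eighth-odd : ∀ f′ → f ≡ suc (dbl (suc f′)) → ⊥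
    eighth-odd f′ f≡ = let l , k≡ = k-even ; e , p = odd-multiple ζ₈ (E-conj (fromℚ ½ *ᴿ halfπ)) (C.trans ζ₈ʰ (subst (λ m → -1ᶜ ^ᶜ m ≋ᶜ -1ᶜ) (sym f≡) (-1^suc-dbl (suc f′)))) in
      no-odd-divisor f′ 4 (trans h≡4f (trans (4*f f) (cong (ℕ._* 4) f≡))) (T ℤ.+ ℤ.- ((+ 2) ℤ.^ l)) e
        (R.trans (R.*-congˡ (R.trans (ι-+ T (ℤ.- ((+ 2) ℤ.^ l))) (R.+-congˡ (R.trans (ι-neg ((+ 2) ℤ.^ l))
          (-‿cong (R.sym (R.trans (R.reflexive (cong (θ ^ᴿ_) k≡)) (θ^dbl l)))))))) p)
      where
      4*f : ∀ f → dbl (dbl f) ≡ f ℕ.* 4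
      4*f zero    = refl
      4*f (suc f) = cong (4 ℕ.+_) (4*f f)

    -- With k = 2(l + 1) the eigenvalue power is (2 + √2)^(l+1), whose √2 part is positive. Either
    -- sign of ζ₁₆ʰ yields an integer multiple of π, and any such multiple contradicts
    -- irrationality.
    sixteenth : ∀ f′ → f ≡ dbl f′ → ⊥
    sixteenth f′ f≡ = let l , k≡ = k-even in contradict l k≡
      where
      ζ₁₆-unit : UnitC ζ₁₆
      ζ₁₆-unit = E-conj (fromℚ ½ *ᴿ (fromℚ ½ *ᴿ halfπ))
      ζ₁₆² : ζ₁₆ *ᶜ ζ₁₆ ≋ᶜ ζ₈
      ζ₁₆² = E-half (fromℚ ½ *ᴿ halfπ)
      ζ₁₆ʰ : ζ₁₆ ^ᶜ h ≋ᶜ -1ᶜ ^ᶜ f′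
      ζ₁₆ʰ = subst (λ m → ζ₁₆ ^ᶜ m ≋ᶜ -1ᶜ ^ᶜ f′) (sym (trans h≡4f (cong (λ g → dbl (dbl g)) f≡)))
        (C.trans (C.sym (ℤ[ℂ].sq-^ ζ₁₆ (dbl (dbl f′)))) (C.trans (C^.^-congˡ (dbl (dbl f′)) ζ₁₆²)
          (C.trans (C.sym (ℤ[ℂ].sq-^ ζ₈ (dbl f′))) (C.trans (C^.^-congˡ (dbl f′) ζ₈²) (i^dbl f′)))))
      contradict : ∀ l → k ≡ dbl l → ⊥
      contradict (suc l) k≡ = let m , q = multiple ζ₁₆ ζ₁₆-unit f′ ζ₁₆ʰ ; A , B , eq = surd-power {θ} θ² l in
        irrational-phase {+ A} {+ suc B} {m} (R.trans (R.*-congˡ (R.+-congˡ (-‿cong (R.sym (R.trans (R.reflexive (cong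
          (2re ζ₁₆ ^ᴿ_) k≡))
          (R.trans (^ᴿ-dbl (2re ζ₁₆) (suc l)) (R.trans (^ᴿ-cong (sq-2re {ζ₁₆} {ζ₈} ζ₁₆-unit ζ₁₆²) (suc l)) eq))))))) q) λ ()

  classify : 3 ℕ.≤ 2 ℕ.* h → h ≡ 2 ⊎ (h ≡ 4 × 2 ∣ k)
  classify 3≤2h = by-parity (half h)
    where
    by-eighths : ∀ f → h ≡ dbl (dbl f) → ∃[ f′ ] (f ≡ dbl f′ ⊎ f ≡ suc (dbl f′)) → h ≡ 4 × 2 ∣ k
    by-eighths f eq (f′ , inj₁ f≡)          = ⊥-elim (sixteenth f eq f′ f≡)
    by-eighths f eq (suc f′ , inj₂ f≡)      = ⊥-elim (eighth-odd f eq f′ f≡)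
    by-eighths f eq (zero , inj₂ refl)      = let l , k≡ = k-even f eq in eq , divides l (trans k≡ (trans (dbl≡2* l) (ℕ.*-comm 2 l)))
    by-quarters : ∀ g → h ≡ dbl g → ∃[ f ] (g ≡ dbl f ⊎ g ≡ suc (dbl f)) → h ≡ 2 ⊎ (h ≡ 4 × 2 ∣ k)
    by-quarters g eq (f , inj₁ refl)        = inj₂ (by-eighths f eq (half f))
    by-quarters g eq (suc f , inj₂ refl)    = ⊥-elim (quarter-odd f eq)
    by-quarters g eq (zero , inj₂ refl)     = inj₁ eq
    by-parity : ∃[ g ] (h ≡ dbl g ⊎ h ≡ suc (dbl g)) → h ≡ 2 ⊎ (h ≡ 4 × 2 ∣ k)
    by-parity (g , inj₁ eq)                 = by-quarters g eq (half g)
    by-parity (suc g , inj₂ eq)             = ⊥-elim (half-odd g eq)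
    by-parity (zero , inj₂ refl)            = ⊥-elim (ℕ.<⇒≱ 3≤2h ℕ.≤-refl)

-- The cycles of length 4 and 8

module R^ = Algebra.Properties.CommutativeSemiring.Exp R.commutativeSemiring
open R^ using () renaming (_^_ to _^ʳ_)

embed-eigen : ∀ {n} {K : Matrix ℝ n} {κ v} → ℝM.LeftEigen K κ v → ℂM.LeftEigen (embed K) (fromℝ κ) (λ i → fromℝ (v i))
embed-eigen {K = K} {κ} {v} h y = C.trans (ℂM.sum-cong-≋ (λ x → C.sym (fromℝ-* (v x) (K x y))))
  (C.trans (C.sym (fromℝ-sum (λ x → v x *ᴿ K x y))) (C.trans (fromℝ-cong (h y)) (fromℝ-* κ (v y))))

PSTAt-from-real-eigenvectors : ∀ {n r} (K : Matrix ℝ n) {a b τ} (u : Fin r → Fin n → Fin n → ℝ) (κ ε : Fin r → ℝ) (γ : ℝ) →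
  (∀ x y → ℝM.basis x y ≋ ℝM.sum (λ j → u j x y)) →
  (∀ j x → ℝM.LeftEigen K (κ j) (u j x)) →
  (∀ j → E (-ᴿ (τ *ᴿ κ j)) ≋ᶜ fromℝ (ε j)) → γ *ᴿ γ ≋ 1ᴿ →
  (∀ x → ℝM.sum (λ j → ε j *ᴿ u j x a) ≋ γ *ᴿ ℝM.basis b x) → PSTAt K a b τ
PSTAt-from-real-eigenvectors K {a} {b} {τ} u κ ε γ decomposition eigen phases unit transfer =
  PSTAt-from-eigenvectors K {a} {b} {τ} (λ j x y → fromℝ (u j x y)) κ (λ j → fromℝ (ε j)) (fromℝ γ)
    (λ x y → C.trans (embed-basis x y) (C.trans (fromℝ-cong (decomposition x y)) (fromℝ-sum (λ j → u j x y))))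
    (λ j x → embed-eigen (eigen j x)) phases
    (un≋ (R.trans (R.solve 1 (λ g → g R.:* g R.:+ R.con (+ 0) R.:* R.con (+ 0) R.:= g R.:* g) ≋-refl γ) unit))
    (λ x → C.trans (ℂM.sum-cong-≋ (λ j → C.sym (fromℝ-* (ε j) (u j x a)))) (C.trans (C.sym (fromℝ-sum (λ j → ε j *ᴿ u j x a)))
      (C.trans (fromℝ-cong (transfer x)) (C.trans (fromℝ-* γ (ℝM.basis b x)) (C.*-congˡ {fromℝ γ} (C.sym (embed-basis b x)))))))
  where
  embed-basis : ∀ {n} (x y : Fin n) → ℂM.basis x y ≋ᶜ fromℝ (ℝM.basis x y)
  embed-basis x y = C.sym (embed-^ᴹ {_} (λ _ _ → 0ᴿ) 0 x y)

-- The kernel vector w gives w(a) = γ w(b), which eliminates γ from e v(a) = γ v(b). The constant c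
-- normalises the products to 1 and -1, so e = c e v(a) w(b) = c v(b) w(a) = -1.
phase-opposite : ∀ {n} (K : Matrix ℝ n) {a b σ μ ν} {v w : Fin n → ℝ} (c : ℝ) → PSTAt K a b σ →
  ℝM.LeftEigen K μ v → ℝM.LeftEigen K ν w → ν ≋ 0ᴿ →
  c *ᴿ (v a *ᴿ w b) ≋ 1ᴿ → c *ᴿ (v b *ᴿ w a) ≋ ι (ℤ.- (+ 1)) → im (E (σ *ᴿ μ)) ≋ 0ᴿ
phase-opposite K {a} {b} {σ} {μ} {ν} {v} {w} c pst hv hw ν≋0 same opposite = R.trans
  (R.solve 1 (λ s → s R.:= R.:- (R.:- s)) ≋-refl (im (E (σ *ᴿ μ))))
  (R.trans (-‿cong (R.trans (R.sym (im≋ (E-neg (σ *ᴿ μ)))) (im≋ e≋-1))) (R.solve 0 (R.:- R.con (+ 0) R.:= R.con (+ 0)) ≋-refl))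
  where
  e γ : ℂ
  e = E (-ᴿ (σ *ᴿ μ))
  γ = proj₁ (proj₂ (proj₂ pst))
  at-v : e *ᶜ fromℝ (v a) ≋ᶜ γ *ᶜ fromℝ (v b)
  at-v = PSTAt⇒phase K {a} {b} {σ} pst {μ} {λ i → fromℝ (v i)} (embed-eigen hv)
  at-w : fromℝ (w a) ≋ᶜ γ *ᶜ fromℝ (w b)
  at-w = C.trans (C.trans (C.sym (C.*-identityˡ (fromℝ (w a)))) (C.*-congʳ {fromℝ (w a)} (C.sym (C.trans (E-cong
    (R.trans (-‿cong (R.trans (R.*-congˡ ν≋0) (R.zeroʳ σ))) (R.solve 0 (R.:- R.con (+ 0) R.:= R.con (+ 0)) ≋-refl))) E-0))))
    (PSTAt⇒phase K {a} {b} {σ} pst {ν} {λ i → fromℝ (w i)} (embed-eigen hw))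
  product : ∀ x y → fromℝ (c *ᴿ (x *ᴿ y)) ≋ᶜ fromℝ c *ᶜ (fromℝ x *ᶜ fromℝ y)
  product x y = C.trans (fromℝ-* c (x *ᴿ y)) (C.*-congˡ {fromℝ c} (fromℝ-* x y))
  e≋-1 : e ≋ᶜ -1ᶜ
  e≋-1 = C.trans (C.trans (C.sym (C.*-identityʳ e)) (C.*-congˡ {e} (C.trans (fromℝ-cong (R.sym same)) (product (v a) (w b)))))
    (C.trans (C.solve 4 (λ e c x y → e C.:* (c C.:* (x C.:* y)) C.:= c C.:* ((e C.:* x) C.:* y)) C.refl e (fromℝ c) (fromℝ
      (v a)) (fromℝ (w b)))
    (C.trans (C.*-congˡ {fromℝ c} (C.*-congʳ {fromℝ (w b)} at-v))
    (C.trans (C.solve 4 (λ g c x y → c C.:* ((g C.:* x) C.:* y) C.:= c C.:* (x C.:* (g C.:* y))) C.refl γ (fromℝ c) (fromℝ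
      (v b)) (fromℝ (w b)))
    (C.trans (C.*-congˡ {fromℝ c} (C.*-congˡ {fromℝ (v b)} (C.sym at-w)))
    (C.trans (C.sym (product (v b) (w a))) (fromℝ-cong opposite))))))

-- An earlier σ would put σμ strictly between 0 and π, where the sine is positive.
not-before : ∀ {τ σ μ} → Pos μ → τ *ᴿ μ ≋ π → 0ᴿ <ᴿ σ → im (E (σ *ᴿ μ)) ≋ 0ᴿ → τ ≤ᴿ σ
not-before {τ} {σ} {μ} 0<μ τμ≋π 0<σ zero-sin σ<τ = sin≢0 {σ *ᴿ μ} (pos-* (0<⇒pos 0<σ) 0<μ)
  (pos-cong (R.trans (R.solve 3 (λ t s m → (t R.:- s) R.:* m R.:= t R.:* m R.:- s R.:* m) ≋-refl τ σ μ) (R.+-congʳ τμ≋π))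
    (pos-* (<⇒pos σ<τ) 0<μ))
  zero-sin

private
  δ : ∀ {n} → Fin n → Fin n → ℚ
  δ x y = if does (x Fin.≟ y) then 1ℚ else 0ℚ

  even : ℕ → Bool
  even zero          = true
  even (suc zero)    = false
  even (suc (suc n)) = even n

  half-power : ∀ k → fromℚ ½ ^ᴿ k *ᴿ ι (+ 2) ^ʳ k ≋ 1ᴿ
  half-power zero    = R.*-identityˡ 1ᴿ
  half-power (suc k) = R.trans (R.solve 4 (λ a b c d → (a R.:* b) R.:* (c R.:* d) R.:= (a R.:* c) R.:* (b R.:* d)) ≋-refl
    (fromℚ ½) (fromℚ ½ ^ᴿ k) (ι (+ 2)) (ι (+ 2) ^ʳ k))
    (R.trans (R.*-cong (≡⇒≋ {fromℚ ½ *ᴿ ι (+ 2)} {1ᴿ} (λ _ → refl)) (half-power k)) (R.*-identityˡ 1ᴿ))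

  time : ℕ → ℝ
  time k = π *ᴿ fromℚ ½ ^ᴿ k

  time-pos : ∀ k → Pos (time k)
  time-pos k = pos-* π-pos (half^ k)
    where
    half^ : ∀ k → Pos (fromℚ ½ ^ᴿ k)
    half^ zero    = pos-fromℚ 0<1
    half^ (suc k) = pos-* (pos-fromℚ 0<½) (half^ k)

  2^-pos : ∀ k → Pos (ι (+ 2) ^ʳ k)
  2^-pos zero    = pos-fromℚ 0<1
  2^-pos (suc k) = pos-* (ι-pos 1) (2^-pos k)

  time*2^ : ∀ k → time k *ᴿ ι (+ 2) ^ʳ k ≋ π
  time*2^ k = R.trans (R.*-assoc π (fromℚ ½ ^ᴿ k) (ι (+ 2) ^ʳ k)) (R.trans (R.*-congˡ (half-power k)) (R.*-identityʳ π))

  E-neg-π : E (-ᴿ π) ≋ᶜ -1ᶜ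
  E-neg-π = C.trans (E-neg π) (C.trans (conj-cong E-π) (mk≋ᶜ ≋-refl (R.solve 0 (R.:- R.con (+ 0) R.:= R.con (+ 0)) ≋-refl)))

  0^ : ∀ k → 1 ℕ.≤ k → ι (+ 0) ^ʳ k ≋ 0ᴿ
  0^ (suc k) _ = R.zeroˡ (ι (+ 0) ^ʳ k)

  phase-0 : ∀ {τ κ} → κ ≋ 0ᴿ → E (-ᴿ (τ *ᴿ κ)) ≋ᶜ fromℝ 1ᴿ
  phase-0 {τ} κ≋0 = C.trans (E-cong (R.trans (-‿cong (R.*-congˡ κ≋0)) (R.solve 1 (λ t → R.:-
    (t R.:* R.con (+ 0)) R.:= R.con (+ 0)) ≋-refl τ))) E-0

module Cycle4 where
  -- The spectral projections of A for 2, -2 and 0: onto constant vectors, onto alternating vectors,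
  -- and onto the kernel as the remainder.
  part : Fin 3 → Fin 4 → Fin 4 → ℚ
  part 0F                     x y = ¼
  part 1F           x y = if even (toℕ x ℕ.+ toℕ y) then ¼ else - ¼
  part 2F x y = δ x y - (part 0F x y + part 1F x y)

  θ : Fin 3 → ℤ
  θ 0F                     = + 2
  θ 1F           = ℤ.- (+ 2)
  θ 2F = + 0

  -- The phases at τ = π/2ᵏ: the eigenvalues (±2)ᵏ give e^(∓iπ) or e^(±iπ), both -1, and 0 gives 1.
  sgn : Fin 3 → ℚ
  sgn 0F                     = - 1ℚ
  sgn 1F           = - 1ℚ
  sgn 2F = 1ℚ

  u : Fin 3 → Fin 4 → Fin 4 → ℝ
  u j x y = fromℚ (part j x y)

  decomposition : ∀ x y → ℝM.basis x y ≋ ℝM.sum (λ j → u j x y)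
  decomposition x y = ≡⇒≋ (λ m → table m x y)
    where
    -- All sequences involved are constant, so even for a variable m the entries compute to closed
    -- rationals and the finite check evaluates.
    table : ∀ m x y → seq (ℝM.basis x y) m ≡ seq (ℝM.sum (λ j → u j x y)) m
    table m = from-yes (Fin.all? λ x → Fin.all? λ y → seq (ℝM.basis x y) m ℚ.≟ seq (ℝM.sum (λ j → u j x y)) m)

  eigen : ∀ j x → ℝM.LeftEigen (cycleAdj 4) (ι (θ j)) (u j x)
  eigen j x y = ≡⇒≋ (λ m → table m j x y)
    where
    table : ∀ m j x y → seq ((u j x ℝM.◁ cycleAdj 4) y) m ≡ seq (ι (θ j) *ᴿ u j x y) m
    table m = from-yes (Fin.all? λ j → Fin.all? λ x → Fin.all? λ y → seq ((u j x ℝM.◁ cycleAdj 4) y) m ℚ.≟ seq (ι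
      (θ j) *ᴿ u j x y) m)

  transfer : ∀ a b → dist a b ≡ 2 → ∀ x → ℝM.sum (λ j → fromℚ (sgn j) *ᴿ u j x a) ≋ ι (ℤ.- (+ 1)) *ᴿ ℝM.basis b x
  transfer a b d x = ≡⇒≋ (λ m → table m a b d x)
    where
    table : ∀ m a b → dist a b ≡ 2 → ∀ x → seq (ℝM.sum (λ j → fromℚ (sgn j) *ᴿ u j x a)) m ≡ seq (ι (ℤ.- (+ 1)) *ᴿ ℝM.basis b x) m
    table m = from-yes (Fin.all? λ a → Fin.all? λ b → (dist a b ℕ.≟ 2) →-dec Fin.all? λ x →
      seq (ℝM.sum (λ j → fromℚ (sgn j) *ᴿ u j x a)) m ℚ.≟ seq (ι (ℤ.- (+ 1)) *ᴿ ℝM.basis b x) m)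

  phases : ∀ k → 1 ℕ.≤ k → ∀ j → E (-ᴿ (time k *ᴿ ι (θ j) ^ʳ k)) ≋ᶜ fromℝ (fromℚ (sgn j))
  phases k 1≤k 0F = C.trans (E-cong (-‿cong (time*2^ k))) E-neg-π
  phases k 1≤k 1F = decide (sign-power k)
    where
    sign-power : ∀ k → ι (ℤ.- (+ 2)) ^ʳ k ≋ ι (+ 2) ^ʳ k ⊎ ι (ℤ.- (+ 2)) ^ʳ k ≋ -ᴿ (ι (+ 2) ^ʳ k)
    sign-power zero    = inj₁ ≋-refl
    sign-power (suc k) with sign-power k
    ... | inj₁ eq = inj₂ (R.trans (R.*-congˡ eq) (R.solve 1 (λ x → R.con (ℤ.- (+ 2)) R.:* x R.:= R.:-
      (R.con (+ 2) R.:* x)) ≋-refl (ι (+ 2) ^ʳ k)))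
    ... | inj₂ eq = inj₁ (R.trans (R.*-congˡ eq) (R.solve 1 (λ x → R.con (ℤ.- (+ 2)) R.:*
      (R.:- x) R.:= R.con (+ 2) R.:* x) ≋-refl (ι (+ 2) ^ʳ k)))
    decide : _ ⊎ _ → E (-ᴿ (time k *ᴿ ι (ℤ.- (+ 2)) ^ʳ k)) ≋ᶜ -1ᶜ
    decide (inj₁ eq) = C.trans (E-cong (-‿cong (R.trans (R.*-congˡ eq) (time*2^ k)))) E-neg-π
    decide (inj₂ eq) = C.trans (E-cong (R.trans (-‿cong (R.*-congˡ eq)) (R.trans
      (R.solve 2 (λ t x → R.:- (t R.:* (R.:- x)) R.:= t R.:* x) ≋-refl (time k) (ι (+ 2) ^ʳ k)) (time*2^ k)))) E-π
  phases k 1≤k 2F = phase-0 {time k} (0^ k 1≤k)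

  minimum : ∀ k → 1 ℕ.≤ k → ∀ (a b : Fin 4) → dist a b ≡ 2 → IsMinTransferTime (cycleAdj 4 ^ᴹ k) a b (time k)
  minimum k 1≤k a b d = pos⇒0< (time-pos k)
    , PSTAt-from-real-eigenvectors (cycleAdj 4 ^ᴹ k) {a} {b} {time k} u (λ j → ι (θ j) ^ʳ k) (λ j → fromℚ (sgn j)) (ι (ℤ.- (+ 1)))
        decomposition (λ j x → ℝM.eigen-^ᴹ (eigen j x) k) (phases k 1≤k) (≡⇒≋ (λ _ → refl)) (transfer a b d)
    , λ σ 0<σ pst → not-before (2^-pos k) (time*2^ k) 0<σ
        -- v is constant 1/4, while w is 1/2 at a and -1/2 at b; -8 makes the two products 1 and -1.
        (phase-opposite (cycleAdj 4 ^ᴹ k) {a} {b} {σ} {v = u 0F a} {w = u 2F a} (ι (ℤ.- (+ 8))) pst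
          (ℝM.eigen-^ᴹ (eigen 0F a) k) (ℝM.eigen-^ᴹ (eigen 2F a) k) (0^ k 1≤k)
          (≡⇒≋ (λ m → proj₁ (table m a b d))) (≡⇒≋ (λ m → proj₂ (table m a b d))))
    where
    table : ∀ (m : ℕ) a b → dist a b ≡ 2 →
      seq (ι (ℤ.- (+ 8)) *ᴿ (u 0F a a *ᴿ u 2F a b)) m ≡ 1ℚ × seq (ι (ℤ.- (+ 8)) *ᴿ (u 0F a b *ᴿ u 2F a a)) m ≡ - 1ℚ
    table m = from-yes (Fin.all? λ a → Fin.all? λ b → (dist a b ℕ.≟ 2) →-dec
      ((seq (ι (ℤ.- (+ 8)) *ᴿ (u 0F a a *ᴿ u 2F a b)) m ℚ.≟ 1ℚ) ×-dec (seq (ι (ℤ.- (+ 8)) *ᴿ (u 0F a b *ᴿ u 2F a a)) m ℚ.≟ - 1ℚ)))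

-- The eigenvalues of A² on C₈ are 4, 2 and 0.
module Cycle8 where
  -- The spectral projections of A². Squaring merges the eigenvalues √2 and -√2 of A, whose separate
  -- projections are irrational, into one rational projection with entries 1/2 on the diagonal and
  -- -1/2 between antipodal vertices.
  part : Fin 3 → Fin 8 → Fin 8 → ℚ
  part 0F x y = if even (toℕ x ℕ.+ toℕ y) then ¼ else 0ℚ
  part 1F x y = if does (dist x y ℕ.≟ 4) then - ½ else ½ * δ x y
  part 2F x y = δ x y - (part 0F x y + part 1F x y)

  θ : Fin 3 → ℤ
  θ 0F = + 4
  θ 1F = + 2
  θ 2F = + 0

  sgn : Fin 3 → ℚ
  sgn 0F = 1ℚ
  sgn 1F = - 1ℚ
  sgn 2F = 1ℚ

  u : Fin 3 → Fin 8 → Fin 8 → ℝ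
  u j x y = fromℚ (part j x y)

  decomposition : ∀ x y → ℝM.basis x y ≋ ℝM.sum (λ j → u j x y)
  decomposition x y = ≡⇒≋ (λ m → table m x y)
    where
    table : ∀ m x y → seq (ℝM.basis x y) m ≡ seq (ℝM.sum (λ j → u j x y)) m
    table m = from-yes (Fin.all? λ x → Fin.all? λ y → seq (ℝM.basis x y) m ℚ.≟ seq (ℝM.sum (λ j → u j x y)) m)

  -- The rows after one multiplication by A. Tabulating them splits the check for A² into two checks
  -- with single sums.
  neighbours : Fin 3 → Fin 8 → Fin 8 → ℚ
  neighbours 0F x y = if even (toℕ x ℕ.+ toℕ y) then 0ℚ else ½
  neighbours 1F x y = if does (dist x y ℕ.≟ 1) then ½ else if does (dist x y ℕ.≟ 7) then ½
    else if does (dist x y ℕ.≟ 3) then - ½ else if does (dist x y ℕ.≟ 5) then - ½ else 0ℚ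
  neighbours 2F x y = 0ℚ

  eigen : ∀ j x → ℝM.LeftEigen (cycleAdj 8 ℝM.*ᴹ cycleAdj 8) (ι (θ j)) (u j x)
  eigen j x y = R.trans (ℝM.◁-*ᴹ (u j x) (cycleAdj 8) (cycleAdj 8) y)
    (R.trans (ℝM.◁-congˡ {v = u j x ℝM.◁ cycleAdj 8} {w = λ y → fromℚ (neighbours j x y)} (cycleAdj 8) (λ y → ≡⇒≋
      (λ m → table₁ m j x y)) y)
      (≡⇒≋ (λ m → table₂ m j x y)))
    where
    table₁ : ∀ m j x y → seq ((u j x ℝM.◁ cycleAdj 8) y) m ≡ neighbours j x y
    table₁ m = from-yes (Fin.all? λ j → Fin.all? λ x → Fin.all? λ y → seq ((u j x ℝM.◁ cycleAdj 8) y) m ℚ.≟ neighbours j x y)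
    table₂ : ∀ m j x y → seq (((λ y → fromℚ (neighbours j x y)) ℝM.◁ cycleAdj 8) y) m ≡ seq (ι (θ j) *ᴿ u j x y) m
    table₂ m = from-yes (Fin.all? λ j → Fin.all? λ x → Fin.all? λ y →
      seq (((λ y → fromℚ (neighbours j x y)) ℝM.◁ cycleAdj 8) y) m ℚ.≟ seq (ι (θ j) *ᴿ u j x y) m)

  transfer : ∀ a b → dist a b ≡ 4 → ∀ x → ℝM.sum (λ j → fromℚ (sgn j) *ᴿ u j x a) ≋ 1ᴿ *ᴿ ℝM.basis b x
  transfer a b d x = ≡⇒≋ (λ m → table m a b d x)
    where
    table : ∀ m a b → dist a b ≡ 4 → ∀ x → seq (ℝM.sum (λ j → fromℚ (sgn j) *ᴿ u j x a)) m ≡ seq (1ᴿ *ᴿ ℝM.basis b x) m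
    table m = from-yes (Fin.all? λ a → Fin.all? λ b → (dist a b ℕ.≟ 4) →-dec Fin.all? λ x →
      seq (ℝM.sum (λ j → fromℚ (sgn j) *ᴿ u j x a)) m ℚ.≟ seq (1ᴿ *ᴿ ℝM.basis b x) m)

  phases : ∀ q → 1 ℕ.≤ q → ∀ j → E (-ᴿ (time q *ᴿ ι (θ j) ^ʳ q)) ≋ᶜ fromℝ (fromℚ (sgn j))
  -- Here τ times the eigenvalue is π 4^q/2^q = π 2^q with the positive exponent written `suc q`, an
  -- even multiple of π.
  phases (suc q) _ 0F = C.trans (E-cong (R.trans (-‿cong (R.trans (R.*-congˡ (R.trans (R^.^-congˡ (suc q)
    (≡⇒≋ {ι (+ 4)} {ι (+ 2) *ᴿ ι (+ 2)} (λ _ → refl)))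
        (R^.^-distrib-* (ι (+ 2)) (ι (+ 2)) (suc q))))
      (R.trans (R.solve 2 (λ t x → t R.:* (x R.:* x) R.:= (t R.:* x) R.:* x) ≋-refl (time (suc q)) (ι (+ 2) ^ʳ suc q))
        (R.*-congʳ (time*2^ (suc q))))))
      (R.trans (R.solve 2 (λ p x → R.:- (p R.:* (R.con (+ 2) R.:* x)) R.:= p R.:* (R.con (ℤ.- (+ 2)) R.:* x)) ≋-refl π
        (ι (+ 2) ^ʳ q))
        (R.*-congˡ (R.trans (R.trans (R.*-congʳ (ι-neg (+ 2))) (R.solve 1 (λ x →
          (R.:- R.con (+ 2)) R.:* x R.:= R.con (+ 2) R.:* (R.:- x)) ≋-refl (ι (+ 2) ^ʳ q)))
          (R.sym (R.trans (ι-* (+ 2) (ℤ.- ((+ 2) ℤ.^ q))) (R.*-congˡ (R.trans (ι-neg ((+ 2) ℤ.^ q)) (-‿cong (ι-^ʳ q)))))))))))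
            (E-2πz (ℤ.- ((+ 2) ℤ.^ q)))
    where
    ι-^ʳ : ∀ q → ι ((+ 2) ℤ.^ q) ≋ ι (+ 2) ^ʳ q
    ι-^ʳ zero    = ≋-refl
    ι-^ʳ (suc q) = R.trans (ι-* (+ 2) ((+ 2) ℤ.^ q)) (R.*-congˡ (ι-^ʳ q))
  phases q 1≤q 1F = C.trans (E-cong (-‿cong (time*2^ q))) E-neg-π
  phases q 1≤q 2F = phase-0 {time q} (0^ q 1≤q)

  minimum : ∀ q → 1 ℕ.≤ q → ∀ (a b : Fin 8) → dist a b ≡ 4 → IsMinTransferTime (cycleAdj 8 ^ᴹ dbl q) a b (time q)
  minimum q 1≤q a b d = pos⇒0< (time-pos q)
    , PSTAt-from-real-eigenvectors (cycleAdj 8 ^ᴹ dbl q) {a} {b} {time q} u (λ j → ι (θ j) ^ʳ q) (λ j → fromℚ (sgn j)) 1ᴿ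
        decomposition (λ j x → ℝM.eigen-^ᴹ-dbl {M = cycleAdj 8} (eigen j x) q) (phases q 1≤q) (≡⇒≋ (λ _ → refl)) (transfer a b d)
    , λ σ 0<σ pst → not-before (2^-pos q) (time*2^ q) 0<σ
        -- v is 1/2 at a and -1/2 at b, while w is 1/4 at both; 8 makes the two products 1 and -1.
        (phase-opposite (cycleAdj 8 ^ᴹ dbl q) {a} {b} {σ} {v = u 1F a} {w = u 2F a} (ι (+ 8)) pst
          (ℝM.eigen-^ᴹ-dbl {M = cycleAdj 8} (eigen 1F a) q) (ℝM.eigen-^ᴹ-dbl {M = cycleAdj 8} (eigen 2F a) q) (0^ q 1≤q)
          (≡⇒≋ (λ m → proj₁ (table m a b d))) (≡⇒≋ (λ m → proj₂ (table m a b d))))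
    where
    table : ∀ (m : ℕ) a b → dist a b ≡ 4 →
      seq (ι (+ 8) *ᴿ (u 1F a a *ᴿ u 2F a b)) m ≡ 1ℚ × seq (ι (+ 8) *ᴿ (u 1F a b *ᴿ u 2F a a)) m ≡ - 1ℚ
    table m = from-yes (Fin.all? λ a → Fin.all? λ b → (dist a b ℕ.≟ 4) →-dec
      ((seq (ι (+ 8) *ᴿ (u 1F a a *ᴿ u 2F a b)) m ℚ.≟ 1ℚ) ×-dec (seq (ι (+ 8) *ᴿ (u 1F a b *ᴿ u 2F a a)) m ℚ.≟ - 1ℚ)))

-- Minimum times for antipodal vertices and the equivalence

antipodal⇒minimum₄ : ∀ k → 1 ℕ.≤ k → ∀ (a b : Fin 4) → Antipodal a b →
  IsMinTransferTime (cycleAdj 4 ^ᴹ k) a b (π *ᴿ fromℚ ½ ^ᴿ k)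
antipodal⇒minimum₄ k 1≤k a b anti = Cycle4.minimum k 1≤k a b (sym (ℕ.*-cancelˡ-≡ 2 (dist a b) 2 (antipodal⇒dist anti)))

antipodal⇒minimum₈ : ∀ k q → 1 ℕ.≤ k → k ≡ 2 ℕ.* q → ∀ (a b : Fin 8) → Antipodal a b →
  IsMinTransferTime (cycleAdj 8 ^ᴹ k) a b (π *ᴿ fromℚ ½ ^ᴿ q)
antipodal⇒minimum₈ k q 1≤k k≡2q a b anti = subst (λ m → IsMinTransferTime (cycleAdj 8 ^ᴹ m) a b (π *ᴿ fromℚ ½ ^ᴿ q))
  (trans (dbl≡2* q) (sym k≡2q))
  (Cycle8.minimum q (positive q k≡2q) a b (sym (ℕ.*-cancelˡ-≡ 4 (dist a b) 2 (antipodal⇒dist anti))))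
  where
  positive : ∀ q → k ≡ 2 ℕ.* q → 1 ℕ.≤ q
  positive zero    eq = ⊥-elim (ℕ.<⇒≱ 1≤k (ℕ.≤-reflexive eq))
  positive (suc q) _  = ℕ.s≤s ℕ.z≤n

classify : ∀ {h k τ} → 1 ℕ.≤ k → Pos τ →
  (∀ z {ε} → UnitC z → z ^ᶜ h ≋ᶜ ε → ε *ᶜ ε ≋ᶜ fromℝ 1ᴿ → E (τ *ᴿ (ι ((+ 2) ℤ.^ k) -ᴿ 2re z ^ᴿ k)) ≋ᶜ ε) →
  3 ℕ.≤ 2 ℕ.* h → h ≡ 2 ⊎ (h ≡ 4 × 2 ∣ k)
classify {h} {suc k′} {τ} _ 0<τ condition = Classification.classify {h} {k′} {τ} 0<τ condition

PSTAt⇒small : ∀ {n} → 3 ℕ.≤ n → ∀ k → 1 ℕ.≤ k → ∀ {a b : Fin n} → a ≢ b → ∀ {τ} → Pos τ → PSTAt (cycleAdj n ^ᴹ k) a b τ →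
  (n ≡ 4 × Antipodal a b) ⊎ (n ≡ 8 × Antipodal a b × 2 ∣ k)
PSTAt⇒small {suc n′} 3≤n k 1≤k {a} {b} a≢b {τ} 0<τ pst =
  conclude (classify {dist a b} {k} {τ} 1≤k 0<τ phase-difference (subst (3 ℕ.≤_) n≡2h 3≤n))
  where
  open Necessity 3≤n k {a} {b} a≢b {τ} 0<τ pst using (phase-difference; n≡2h)
  conclude : dist a b ≡ 2 ⊎ (dist a b ≡ 4 × 2 ∣ k) → (suc n′ ≡ 4 × Antipodal a b) ⊎ (suc n′ ≡ 8 × Antipodal a b × 2 ∣ k)
  conclude (inj₁ h≡2)         = inj₁ (trans n≡2h (cong (2 ℕ.*_) h≡2) , dist⇒antipodal n≡2h refl)
  conclude (inj₂ (h≡4 , 2∣k)) = inj₂ (trans n≡2h (cong (2 ℕ.*_) h≡4) , dist⇒antipodal n≡2h refl , 2∣k)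

theorem5p7 :
  (∀ (n : ℕ) → 3 ℕ.≤ n → ∀ (k : ℕ) → 1 ℕ.≤ k → ∀ (a b : Fin n) → a ≢ b →
    PST (cycleAdj n ^ᴹ k) a b
      ⇔ ((n ≡ 4 × Antipodal a b) ⊎ (n ≡ 8 × Antipodal a b × 2 ∣ k)))
  × (∃[ π ] (IsPi π
    × (∀ (k : ℕ) → 1 ℕ.≤ k → ∀ (a b : Fin 4) → Antipodal a b →
        IsMinTransferTime (cycleAdj 4 ^ᴹ k) a b (π *ᴿ fromℚ ½ ^ᴿ k))
    × (∀ (k q : ℕ) → 1 ℕ.≤ k → k ≡ 2 ℕ.* q → ∀ (a b : Fin 8) → Antipodal a b →
        IsMinTransferTime (cycleAdj 8 ^ᴹ k) a b (π *ᴿ fromℚ ½ ^ᴿ q))))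
theorem5p7 =
  (λ n 3≤n k 1≤k a b a≢b → mk⇔ (λ (τ , 0<τ , pst) → PSTAt⇒small 3≤n k 1≤k a≢b {τ} (0<⇒pos 0<τ) pst) λ
    { (inj₁ (refl , anti)) → let 0<τ , pst , _ = antipodal⇒minimum₄ k 1≤k a b anti in (π *ᴿ fromℚ ½ ^ᴿ k) , 0<τ , pst
    ; (inj₂ (refl , anti , divides q k≡q*2)) →
        let 0<τ , pst , _ = antipodal⇒minimum₈ k q 1≤k (trans k≡q*2 (ℕ.*-comm q 2)) a b anti in (π *ᴿ fromℚ ½ ^ᴿ q) , 0<τ , pst })
  , π , π-isPi , antipodal⇒minimum₄ , antipodal⇒minimum₈
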